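{- Let $p$ be an odd prime such that $p=x^2+y^2$ with integers $x,y$ satisfying $4\mid x-1$ and $2\mid y$. Then $$\sum_{k=0}^{p-1}\frac{(k+1)\binom{2k}k^2}{8^k}+\sum_{k=0}^{(p-1)/2}\frac{(2k+1)\binom{2k}k^2}{(-16)^k}\equiv2\left(\frac{2}p\right)x\pmod{p^3}.$$
   Context: $\left(\frac{\cdot}{p}\right)$ denotes the Legendre symbol. Congruences between rational numbers whose denominators are prime to $p$ are understood in the ring of $p$-integral rationals. -}

module Defs where

open import Data.Nat as ℕ using (ℕ; zero; suc; _%_)
open import Data.Nat.Combinatorics using (_C_)
open import Data.Nat.Divisibility as ℕD using ()
open import Data.Integer as ℤ using (ℤ; +_; -[1+_])
open import Data.Rational as ℚ using (ℚ; _/_; ↧ₙ_)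
open import Data.Fin using (Fin; toℕ)
open import Data.Fin.Properties using (any?)
open import Data.Product using (∃; _×_)
open import Relation.Nullary using (¬_; yes; no)
open import Relation.Binary.PropositionalEquality using (_≡_)

pow : ℚ → ℕ → ℚ
pow q zero    = ℚ.1ℚ
pow q (suc k) = q ℚ.* pow q k

sumTo : ℕ → (ℕ → ℚ) → ℚ
sumTo zero    f = f zero
sumTo (suc n) f = sumTo n f ℚ.+ f (suc n)

ℕ→ℚ : ℕ → ℚ
ℕ→ℚ n = (+ n) / 1

ℤ→ℚ : ℤ → ℚ
ℤ→ℚ z = z / 1

-- Legendre symbol (a / p) for a prime p (value for p = 0 is junk):
-- 0 if p ∣ a, 1 if a is a nonzero square mod p, -1 otherwise.
legendre : ℕ → ℕ → ℤ
legendre a zero = + 0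
legendre a (suc q) with ℕD._∣?_ (suc q) a
... | yes _ = + 0
... | no _ with any? (λ (i : Fin (suc q)) → (toℕ i ℕ.* toℕ i) % suc q ℕ.≟ a % suc q)
...   | yes _ = + 1
...   | no _  = -[1+ 0 ]

PIntegral : ℕ → ℚ → Set
PIntegral p q = ¬ (p ℕD.∣ (↧ₙ q))

CongModQ : ℕ → ℕ → ℚ → ℚ → Set
CongModQ p m a b = ∃ λ (c : ℚ) → PIntegral p c × (a ℚ.- b ≡ ℕ→ℚ m ℚ.* c)

term1 : ℕ → ℚ
term1 k = ℕ→ℚ ((suc k) ℕ.* (((2 ℕ.* k) C k) ℕ.* ((2 ℕ.* k) C k))) ℚ.* pow ((+ 1) / 8) k

term2 : ℕ → ℚ
term2 k = ℕ→ℚ ((suc (2 ℕ.* k)) ℕ.* (((2 ℕ.* k) C k) ℕ.* ((2 ℕ.* k) C k))) ℚ.* pow (-[1+ 0 ] / 16) k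

-- Write p = 4m + 1, n = 2m and χ for the Legendre symbol. By Jacobsthal, J = −∑ χ(t³ − t)
-- equals 2 (2/p) x. The symbol χ(t) = ±1 is, modulo p³, a fixed polynomial in the n-th power
-- of the Teichmüller representative of t; expanding and summing over t turns J into a
-- combination of binomial coefficients, and this gives J ≡ α + p/α for the explicit product
-- α = (−4)ᵐ ∏_{i≤m} (2i − 1 + D)/(2i + D), where D ≡ −p/2.
--
-- On the other side (2k choose k) ≡ (−4)ᵏ (X choose k) for k < p, where X = n + D ≡ −1/2.
-- With V(x) = ∑_{k<p} (−1)ᵏ (2k choose k)(x choose k)/2ᵏ and T_K(x) = ∑_{k≤K} (−1)ᵏ (x choose k)²,
-- twice the first sum is V(X) + V(X − 1) and twice the second one is
-- T_n(X) + 2 T_{n−1}(X − 1) + p². Both families satisfy recurrences relating x and x + 2 whose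
-- inhomogeneous term is divisible by p² at x = N + D, N < n. Iterating them from x = D shows
-- V(X) + T_n(X) ≡ 2α; telescoping the products of values at consecutive arguments shows
-- α (V(X − 1) + 2 T_{n−1}(X − 1) + p²) ≡ 2p. So the two sums together are α + p/α ≡ J.

module Submission where

open import Defs
open import Data.Nat as ℕ using (ℕ; _∸_; _/_; zero; suc; _≤_; _<_; z≤n; s≤s)
import Data.Nat.Properties as ℕₚ
import Data.Nat.Tactic.RingSolver as ℕRing
open import Data.Nat.Primality using (Prime; euclidsLemma; prime⇒nonTrivial; ¬prime[1])
open import Data.Nat.Divisibility as ℕD using ()
open import Data.Integer as ℤ using (ℤ; +_; -[1+_]; _+_; _-_; -_; ∣_∣)
open import Data.Integer.Divisibility as ℤD using ()
open import Data.Integer.Divisibility.Signed as ℤS using (divides)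
import Data.Integer.Properties as ℤₚ
open import Data.Integer.Tactic.RingSolver using (solve-∀)
open import Data.Rational as ℚ using (ℚ)
open import Data.Empty using (⊥; ⊥-elim)
open import Data.Product using (_×_; _,_; proj₁; proj₂; ∃)
open import Data.Sum using (_⊎_; inj₁; inj₂; [_,_]′)
open import Function using (_∘_; case_of_)
open import Relation.Nullary using (¬_; yes; no; Dec; contradiction)
open import Relation.Binary.PropositionalEquality
  using (_≡_; _≢_; refl; sym; trans; cong; cong₂; subst; subst₂; module ≡-Reasoning)
import Data.Integer.DivMod as ℤDM
open import Data.Nat.Induction using (<-rec)
import Relation.Binary.Reasoning.Setoid as SetoidReasoning
open import Relation.Binary.Bundles using (Setoid)
open import Relation.Binary.Definitions using () renaming (tri< to tri<′; tri≈ to tri≈′; tri> to tri>′)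
open import Data.Rational.Unnormalised using (mkℚᵘ; *≡*)
import Data.Rational.Unnormalised.Properties as ℚᵘₚ
import Data.Rational.Properties as ℚₚ
open import Data.Rational.Solver using () renaming (module +-*-Solver to ℚSolver)
open import Data.Integer.GCD using (gcd)
open import Data.Nat.Combinatorics as ℕC using ()
import Data.Nat.DivMod as ℕDM
open import Data.Fin using (Fin; toℕ; fromℕ<)
open import Data.Fin.Properties using (any?; toℕ-fromℕ<)

-- What has no closed form is made to cancel. The recurrences (2 + x) V(x + 2) = (1 + x) V(x) and (2
-- + x) T(x + 2) = -4 (1 + x) T(x), valid up to the inhomogeneous terms, are solved from x = D by
-- partial products zᵢ of (2i - 1 + D)/(2i + D); this is the origin of α. The corrections of order
-- p² are sums of reciprocals of binomial coefficients; at x = X those of V and of T are the same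
-- sum with opposite signs. In the two products of consecutive values the obstruction is ∑ zᵢ/(2i +
-- 1) for V and a sum over central coefficients for T; a telescoping identity for half rows reduces
-- the second to the first. The starting value V(D) is not summed either: at x = p and at x = D the
-- same quadratic polynomial in x gives V(x) modulo p³. V(p) is known, and modulo p the two
-- coefficients are fixed multiples of H and H² for one harmonic number H, which forces V(D)² V(p) ≡
-- 1. D is represented by the natural number (p³ - p)/2, so that binomial coefficients with upper
-- argument X or D are ordinary integers.

-- Integer multiplication reduces to operations on signs and absolute values, which makes
-- conversion checking of products explode; an opaque copy avoids this.
infixl 7 _*_

opaque
  _*_ : ℤ → ℤ → ℤ
  a * b = a ℤ.* b

opaque
  unfolding _*_

  *≡ℤ* : ∀ a b → a * b ≡ a ℤ.* b
  *≡ℤ* a b = refl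

  *-assoc : ∀ a b c → a * b * c ≡ a * (b * c)
  *-assoc = ℤₚ.*-assoc

  *-comm : ∀ a b → a * b ≡ b * a
  *-comm = ℤₚ.*-comm

  *-identityˡ : ∀ a → + 1 * a ≡ a
  *-identityˡ = ℤₚ.*-identityˡ

  *-identityʳ : ∀ a → a * + 1 ≡ a
  *-identityʳ = ℤₚ.*-identityʳ

  *-zeroˡ : ∀ a → + 0 * a ≡ + 0
  *-zeroˡ = ℤₚ.*-zeroˡ

  *-zeroʳ : ∀ a → a * + 0 ≡ + 0
  *-zeroʳ = ℤₚ.*-zeroʳ

  *-distribˡ-+ : ∀ a b c → a * (b + c) ≡ a * b + a * c
  *-distribˡ-+ = ℤₚ.*-distribˡ-+

  *-distribʳ-+ : ∀ a b c → (b + c) * a ≡ b * a + c * a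
  *-distribʳ-+ = ℤₚ.*-distribʳ-+

  abs-* : ∀ a b → ∣ a * b ∣ ≡ ∣ a ∣ ℕ.* ∣ b ∣
  abs-* = ℤₚ.abs-*

  pos-* : ∀ m n → + (m ℕ.* n) ≡ + m * + n
  pos-* = ℤₚ.pos-*

infixr 8 _^_

_^_ : ℤ → ℕ → ℤ
a ^ zero  = + 1
a ^ suc k = a * a ^ k

^-+ : ∀ a j k → a ^ (j ℕ.+ k) ≡ a ^ j * a ^ k
^-+ a zero    k = sym (*-identityˡ (a ^ k))
^-+ a (suc j) k = trans (cong (a *_) (^-+ a j k)) (sym (*-assoc a (a ^ j) (a ^ k)))

^-^ : ∀ a j k → (a ^ j) ^ k ≡ a ^ (j ℕ.* k)
^-^ a j zero    = cong (a ^_) (sym (ℕₚ.*-zeroʳ j))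
^-^ a j (suc k) = trans (cong (a ^ j *_) (^-^ a j k))
  (trans (sym (^-+ a j (j ℕ.* k))) (cong (a ^_) (sym (ℕₚ.*-suc j k))))

one^ : ∀ k → (+ 1) ^ k ≡ + 1
one^ zero    = refl
one^ (suc k) = trans (*-identityˡ _) (one^ k)

-- Congruences and finite sums

infix 4 _≈_[_]

record _≈_[_] (a b M : ℤ) : Set where
  constructor by
  field
    quot : ℤ
    eq   : a - b ≡ quot * M

open _≈_[_]

-- Congruences are mostly derived by exhibiting the difference of the two sides as an
-- explicit linear combination of the differences of known congruences; the remaining
-- identity is left to the ring solver.
lincomb₁ : ∀ {M a b l r} c → l ≈ r [ M ] → a - b ≡ c * (l - r) → a ≈ b [ M ]
lincomb₁ {M} c (by q e) h = by (c * q) (trans h (trans (cong (c *_) e) (sym (*-assoc c q M))))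

lincomb₂ : ∀ {M a b l r l′ r′} c c′ → l ≈ r [ M ] → l′ ≈ r′ [ M ] →
           a - b ≡ c * (l - r) + c′ * (l′ - r′) → a ≈ b [ M ]
lincomb₂ {M} c c′ (by q e) (by q′ e′) h =
  by (c * q + c′ * q′) (trans h (trans (cong₂ (λ u v → c * u + c′ * v) e e′) (identity c c′ q q′ M)))
  where
  opaque
    unfolding _*_
    identity : ∀ c c′ q q′ M → c * (q * M) + c′ * (q′ * M) ≡ (c * q + c′ * q′) * M
    identity = solve-∀

lincomb₃ : ∀ {M a b l r l′ r′ l″ r″} c c′ c″ → l ≈ r [ M ] → l′ ≈ r′ [ M ] → l″ ≈ r″ [ M ] →
           a - b ≡ c * (l - r) + c′ * (l′ - r′) + c″ * (l″ - r″) → a ≈ b [ M ]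
lincomb₃ {M} {l = l} {r} {l′} {r′} c c′ c″ h h′ h″ e =
  lincomb₂ (+ 1) c″ (lincomb₂ {a = c * (l - r) + c′ * (l′ - r′)} {b = + 0} c c′ h h′ (ℤₚ.+-identityʳ _)) h″
    (trans e (cong (_+ c″ * _) (identity (c * (l - r) + c′ * (l′ - r′)))))
  where
  opaque
    unfolding _*_
    identity : ∀ x → x ≡ + 1 * (x - + 0)
    identity = solve-∀

lincomb₄ : ∀ {M a b l r l′ r′ l″ r″ l‴ r‴} c c′ c″ c‴ →
           l ≈ r [ M ] → l′ ≈ r′ [ M ] → l″ ≈ r″ [ M ] → l‴ ≈ r‴ [ M ] →
           a - b ≡ c * (l - r) + c′ * (l′ - r′) + c″ * (l″ - r″) + c‴ * (l‴ - r‴) → a ≈ b [ M ]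
lincomb₄ {M} {l = l} {r} {l′} {r′} {l″} {r″} c c′ c″ c‴ h h′ h″ h‴ e =
  lincomb₂ (+ 1) c‴
    (lincomb₃ {a = c * (l - r) + c′ * (l′ - r′) + c″ * (l″ - r″)} {b = + 0} c c′ c″ h h′ h″ (ℤₚ.+-identityʳ _)) h‴
    (trans e (cong (_+ c‴ * _) (identity (c * (l - r) + c′ * (l′ - r′) + c″ * (l″ - r″)))))
  where
  opaque
    unfolding _*_
    identity : ∀ x → x ≡ + 1 * (x - + 0)
    identity = solve-∀

linear₁ : ∀ {a b l r : ℤ} c → l ≡ r → a - b ≡ c * (l - r) → a ≡ b
linear₁ {a} {b} {l} c refl h = ℤₚ.i-j≡0⇒i≡j a b
  (trans h (trans (cong (c *_) (ℤₚ.+-inverseʳ l)) (*-zeroʳ c)))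

linear₂ : ∀ {a b l r l′ r′ : ℤ} c c′ → l ≡ r → l′ ≡ r′ → a - b ≡ c * (l - r) + c′ * (l′ - r′) → a ≡ b
linear₂ {l = l} {l′ = l′} c c′ e refl h = linear₁ c e
  (trans h (trans (cong (λ z → c * (l - _) + c′ * z) (ℤₚ.+-inverseʳ l′))
    (trans (cong (λ z → c * (l - _) + z) (*-zeroʳ c′)) (ℤₚ.+-identityʳ _))))

linear₃ : ∀ {a b l r l′ r′ l″ r″ : ℤ} c c′ c″ → l ≡ r → l′ ≡ r′ → l″ ≡ r″ →
          a - b ≡ c * (l - r) + c′ * (l′ - r′) + c″ * (l″ - r″) → a ≡ b
linear₃ {l = l} {r} {l′} {r′} {l″ = l″} c c′ c″ e e′ refl h = linear₂ c c′ e e′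
  (trans h (trans (cong (λ z → c * (l - r) + c′ * (l′ - r′) + c″ * z) (ℤₚ.+-inverseʳ l″))
    (trans (cong (λ z → c * (l - r) + c′ * (l′ - r′) + z) (*-zeroʳ c″)) (ℤₚ.+-identityʳ _))))

linear₄ : ∀ {a b l r l′ r′ l″ r″ l‴ r‴ : ℤ} c c′ c″ c‴ → l ≡ r → l′ ≡ r′ → l″ ≡ r″ → l‴ ≡ r‴ →
          a - b ≡ c * (l - r) + c′ * (l′ - r′) + c″ * (l″ - r″) + c‴ * (l‴ - r‴) → a ≡ b
linear₄ {l = l} {r} {l′} {r′} {l″} {r″} {l‴} c c′ c″ c‴ e e′ e″ refl h = linear₃ c c′ c″ e e′ e″
  (trans h (trans (cong (λ z → c * (l - r) + c′ * (l′ - r′) + c″ * (l″ - r″) + c‴ * z) (ℤₚ.+-inverseʳ l‴))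
    (trans (cong (λ z → c * (l - r) + c′ * (l′ - r′) + c″ * (l″ - r″) + z) (*-zeroʳ c‴)) (ℤₚ.+-identityʳ _))))

≈-reflexive : ∀ {M a b} → a ≡ b → a ≈ b [ M ]
≈-reflexive {M} {a} refl = by (+ 0) (trans (ℤₚ.+-inverseʳ a) (sym (*-zeroˡ M)))

≈-refl : ∀ {M a} → a ≈ a [ M ]
≈-refl = ≈-reflexive refl

≈-sym : ∀ {M a b} → a ≈ b [ M ] → b ≈ a [ M ]
≈-sym {a = a} {b} h = lincomb₁ (- + 1) h (identity a b)
  where
  opaque
    unfolding _*_
    identity : ∀ a b → b - a ≡ - + 1 * (a - b)
    identity = solve-∀

≈-trans : ∀ {M a b c} → a ≈ b [ M ] → b ≈ c [ M ] → a ≈ c [ M ]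
≈-trans {a = a} {b} {c} h k = lincomb₂ (+ 1) (+ 1) h k (identity a b c)
  where
  opaque
    unfolding _*_
    identity : ∀ a b c → a - c ≡ + 1 * (a - b) + + 1 * (b - c)
    identity = solve-∀

≈-setoid : ℤ → Setoid _ _
≈-setoid M = record
  { Carrier = ℤ ; _≈_ = _≈_[ M ]
  ; isEquivalence = record { refl = ≈-refl ; sym = ≈-sym ; trans = ≈-trans } }

module ≈-Reasoning (M : ℤ) = SetoidReasoning (≈-setoid M)

+-cong : ∀ {M a b c d} → a ≈ b [ M ] → c ≈ d [ M ] → a + c ≈ b + d [ M ]
+-cong {a = a} {b} {c} {d} h k = lincomb₂ (+ 1) (+ 1) h k (identity a b c d)
  where
  opaque
    unfolding _*_
    identity : ∀ a b c d → a + c - (b + d) ≡ + 1 * (a - b) + + 1 * (c - d)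
    identity = solve-∀

*-cong : ∀ {M a b c d} → a ≈ b [ M ] → c ≈ d [ M ] → a * c ≈ b * d [ M ]
*-cong {a = a} {b} {c} {d} h k = lincomb₂ c b h k (identity a b c d)
  where
  opaque
    unfolding _*_
    identity : ∀ a b c d → a * c - b * d ≡ c * (a - b) + b * (c - d)
    identity = solve-∀

*-congˡ : ∀ {M c d} a → c ≈ d [ M ] → a * c ≈ a * d [ M ]
*-congˡ {M} {c} {d} a h = *-cong {M} {a} {a} {c} {d} ≈-refl h

*-congʳ : ∀ {M a b} c → a ≈ b [ M ] → a * c ≈ b * c [ M ]
*-congʳ {M} {a} {b} c h = *-cong {M} {a} {b} {c} {c} h ≈-refl

neg-cong : ∀ {M a b} → a ≈ b [ M ] → - a ≈ - b [ M ]
neg-cong {a = a} {b} h = lincomb₁ (- + 1) h (identity a b)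
  where
  opaque
    unfolding _*_
    identity : ∀ a b → - a - - b ≡ - + 1 * (a - b)
    identity = solve-∀

sub-cong : ∀ {M a b c d} → a ≈ b [ M ] → c ≈ d [ M ] → a - c ≈ b - d [ M ]
sub-cong h k = +-cong h (neg-cong k)

^-cong : ∀ {M a b} k → a ≈ b [ M ] → a ^ k ≈ b ^ k [ M ]
^-cong zero    h = ≈-refl
^-cong (suc k) h = *-cong h (^-cong k h)

modulus≈0 : ∀ {M} → M ≈ + 0 [ M ]
modulus≈0 {M} = by (+ 1) (trans (ℤₚ.+-identityʳ M) (sym (*-identityˡ M)))

multiple≈0 : ∀ {M} a → a * M ≈ + 0 [ M ]
multiple≈0 a = by a (ℤₚ.+-identityʳ _)

weaken : ∀ {M a b} c → a ≈ b [ c * M ] → a ≈ b [ M ]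
weaken {M} c (by q e) = by (q * c) (trans e (sym (*-assoc q c M)))

scale : ∀ {M a b} c → a ≈ b [ M ] → c * a ≈ c * b [ c * M ]
scale {M} {a} {b} c (by q e) = by q (trans (identity₁ c a b) (trans (cong (c *_) e) (identity₂ c q M)))
  where
  opaque
    unfolding _*_
    identity₁ : ∀ c a b → c * a - c * b ≡ c * (a - b)
    identity₁ = solve-∀
    identity₂ : ∀ c q M → c * (q * M) ≡ q * (c * M)
    identity₂ = solve-∀

*-≈0 : ∀ {M N a b} → a ≈ + 0 [ M ] → b ≈ + 0 [ N ] → a * b ≈ + 0 [ M * N ]
*-≈0 {M} {N} {a} {b} (by q e) (by r f) = by (q * r)
  (trans (identity₁ a b) (trans (cong₂ _*_ e f) (identity₂ q r M N)))
  where
  opaque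
    unfolding _*_
    identity₁ : ∀ a b → a * b - + 0 ≡ (a - + 0) * (b - + 0)
    identity₁ = solve-∀
    identity₂ : ∀ q r M N → q * M * (r * N) ≡ q * r * (M * N)
    identity₂ = solve-∀

^-distrib-* : ∀ a b k → (a * b) ^ k ≡ a ^ k * b ^ k
^-distrib-* a b zero    = sym (*-identityˡ (+ 1))
^-distrib-* a b (suc k) = trans (cong (a * b *_) (^-distrib-* a b k)) (identity a b (a ^ k) (b ^ k))
  where
  opaque
    unfolding _*_
    identity : ∀ a b x y → a * b * (x * y) ≡ a * x * (b * y)
    identity = solve-∀

pow-comm : ∀ a k → a ^ k * a ≡ a ^ suc k
pow-comm a k = *-comm (a ^ k) a

sq-pow : ∀ a k → (a * a) ^ k ≡ a ^ (k ℕ.+ k)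
sq-pow a k = trans (^-distrib-* a a k) (sym (^-+ a k k))

sgn : ℕ → ℤ
sgn zero    = + 1
sgn (suc k) = - sgn k

sgn² : ∀ k → sgn k * sgn k ≡ + 1
sgn² zero    = *-identityˡ (+ 1)
sgn² (suc k) = trans (identity (sgn k)) (sgn² k)
  where
  opaque
    unfolding _*_
    identity : ∀ x → - x * - x ≡ x * x
    identity = solve-∀

sgn-+ : ∀ j k → sgn (j ℕ.+ k) ≡ sgn j * sgn k
sgn-+ zero    k = sym (*-identityˡ _)
sgn-+ (suc j) k = trans (cong -_ (sgn-+ j k)) (identity (sgn j) (sgn k))
  where
  opaque
    unfolding _*_
    identity : ∀ x y → - (x * y) ≡ - x * y
    identity = solve-∀

sgn-double : ∀ k → sgn (k ℕ.+ k) ≡ + 1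
sgn-double k = trans (sgn-+ k k) (sgn² k)

neg^ : ∀ a k → (- a) ^ k ≡ sgn k * a ^ k
neg^ a zero    = sym (*-identityˡ (+ 1))
neg^ a (suc k) = trans (cong (- a *_) (neg^ a k)) (identity a (sgn k) (a ^ k))
  where
  opaque
    unfolding _*_
    identity : ∀ a s x → - a * (s * x) ≡ - s * (a * x)
    identity = solve-∀

∑ : ℕ → (ℕ → ℤ) → ℤ
∑ zero    f = + 0
∑ (suc n) f = ∑ n f + f n

∏ : ℕ → (ℕ → ℤ) → ℤ
∏ zero    f = + 1
∏ (suc n) f = ∏ n f * f n

∑-cong : ∀ n {f g : ℕ → ℤ} → (∀ i → i < n → f i ≡ g i) → ∑ n f ≡ ∑ n g
∑-cong zero    h = refl
∑-cong (suc n) h = cong₂ _+_ (∑-cong n λ i i<n → h i (ℕₚ.m<n⇒m<1+n i<n)) (h n (ℕₚ.n<1+n n))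

∑-≈ : ∀ {M} n {f g : ℕ → ℤ} → (∀ i → i < n → f i ≈ g i [ M ]) → ∑ n f ≈ ∑ n g [ M ]
∑-≈ zero    h = ≈-refl
∑-≈ (suc n) h = +-cong (∑-≈ n λ i i<n → h i (ℕₚ.m<n⇒m<1+n i<n)) (h n (ℕₚ.n<1+n n))

∏-≈ : ∀ {M} n {f g : ℕ → ℤ} → (∀ i → i < n → f i ≈ g i [ M ]) → ∏ n f ≈ ∏ n g [ M ]
∏-≈ zero    h = ≈-refl
∏-≈ (suc n) h = *-cong (∏-≈ n λ i i<n → h i (ℕₚ.m<n⇒m<1+n i<n)) (h n (ℕₚ.n<1+n n))

∑-+ : ∀ n f g → ∑ n (λ i → f i + g i) ≡ ∑ n f + ∑ n g
∑-+ zero    f g = refl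
∑-+ (suc n) f g = trans (cong (_+ (f n + g n)) (∑-+ n f g)) (identity (∑ n f) (∑ n g) (f n) (g n))
  where
  opaque
    unfolding _*_
    identity : ∀ a b c d → a + b + (c + d) ≡ a + c + (b + d)
    identity = solve-∀

∑-*ˡ : ∀ n c f → ∑ n (λ i → c * f i) ≡ c * ∑ n f
∑-*ˡ zero    c f = sym (*-zeroʳ c)
∑-*ˡ (suc n) c f = trans (cong (_+ c * f n) (∑-*ˡ n c f)) (sym (*-distribˡ-+ c (∑ n f) (f n)))

∑-const : ∀ n c → ∑ n (λ _ → c) ≡ + n * c
∑-const zero    c = sym (*-zeroˡ c)
∑-const (suc n) c = trans (cong (_+ c) (∑-const n c)) (identity (+ n) c)
  where
  opaque
    unfolding _*_
    identity : ∀ n c → n * c + c ≡ (+ 1 + n) * c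
    identity = solve-∀

∑-zero : ∀ n {f : ℕ → ℤ} → (∀ i → i < n → f i ≡ + 0) → ∑ n f ≡ + 0
∑-zero n h = trans (∑-cong n h) (trans (∑-const n (+ 0)) (*-zeroʳ (+ n)))

∑-head : ∀ n f → ∑ (suc n) f ≡ f 0 + ∑ n (λ i → f (suc i))
∑-head zero    f = ℤₚ.+-comm (+ 0) (f 0)
∑-head (suc n) f = trans (cong (_+ f (suc n)) (∑-head n f)) (ℤₚ.+-assoc (f 0) _ _)

∑-concat : ∀ m n f → ∑ (m ℕ.+ n) f ≡ ∑ m f + ∑ n (λ i → f (m ℕ.+ i))
∑-concat m zero    f = trans (cong (λ k → ∑ k f) (ℕₚ.+-identityʳ m)) (sym (ℤₚ.+-identityʳ _))
∑-concat m (suc n) f = trans (cong (λ k → ∑ k f) (ℕₚ.+-suc m n))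
  (trans (cong (_+ f (m ℕ.+ n)) (∑-concat m n f)) (ℤₚ.+-assoc (∑ m f) _ _))

∑-swap : ∀ m n (f : ℕ → ℕ → ℤ) → ∑ m (λ i → ∑ n (f i)) ≡ ∑ n (λ j → ∑ m (λ i → f i j))
∑-swap zero    n f = sym (∑-zero n λ _ _ → refl)
∑-swap (suc m) n f = trans (cong (_+ ∑ n (f m)) (∑-swap m n f))
  (sym (∑-+ n (λ j → ∑ m (λ i → f i j)) (f m)))

∑-reverse : ∀ n f g → (∀ i j → suc (i ℕ.+ j) ≡ n → f i ≡ g j) → ∑ n f ≡ ∑ n g
∑-reverse zero    f g h = refl
∑-reverse (suc n) f g h = trans
  (cong₂ _+_ (∑-reverse n f (λ j → g (suc j)) λ i j e → h i (suc j) (cong suc (trans (ℕₚ.+-suc i j) e)))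
             (h n 0 (cong suc (ℕₚ.+-identityʳ n))))
  (trans (ℤₚ.+-comm _ (g 0)) (sym (∑-head n g)))

∏-cong : ∀ n {f g : ℕ → ℤ} → (∀ i → i < n → f i ≡ g i) → ∏ n f ≡ ∏ n g
∏-cong zero    h = refl
∏-cong (suc n) h = cong₂ _*_ (∏-cong n λ i i<n → h i (ℕₚ.m<n⇒m<1+n i<n)) (h n (ℕₚ.n<1+n n))

∏-* : ∀ n f g → ∏ n (λ i → f i * g i) ≡ ∏ n f * ∏ n g
∏-* zero    f g = sym (*-identityˡ (+ 1))
∏-* (suc n) f g = trans (cong (_* (f n * g n)) (∏-* n f g)) (identity (∏ n f) (∏ n g) (f n) (g n))
  where
  opaque
    unfolding _*_
    identity : ∀ a b c d → a * b * (c * d) ≡ a * c * (b * d)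
    identity = solve-∀

∏-const : ∀ n c → ∏ n (λ _ → c) ≡ c ^ n
∏-const zero    c = refl
∏-const (suc n) c = trans (cong (_* c) (∏-const n c)) (*-comm (c ^ n) c)

∏-head : ∀ n f → ∏ (suc n) f ≡ f 0 * ∏ n (λ i → f (suc i))
∏-head zero    f = *-comm (+ 1) (f 0)
∏-head (suc n) f = trans (cong (_* f (suc n)) (∏-head n f)) (*-assoc (f 0) _ _)

∏-concat : ∀ m n f → ∏ (m ℕ.+ n) f ≡ ∏ m f * ∏ n (λ i → f (m ℕ.+ i))
∏-concat m zero    f = trans (cong (λ k → ∏ k f) (ℕₚ.+-identityʳ m)) (sym (*-identityʳ _))
∏-concat m (suc n) f = trans (cong (λ k → ∏ k f) (ℕₚ.+-suc m n))
  (trans (cong (_* f (m ℕ.+ n)) (∏-concat m n f)) (*-assoc (∏ m f) _ _))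

∏-reverse : ∀ n f g → (∀ i j → suc (i ℕ.+ j) ≡ n → f i ≡ g j) → ∏ n f ≡ ∏ n g
∏-reverse zero    f g h = refl
∏-reverse (suc n) f g h = trans
  (cong₂ _*_ (∏-reverse n f (λ j → g (suc j)) λ i j e → h i (suc j) (cong suc (trans (ℕₚ.+-suc i j) e)))
             (h n 0 (cong suc (ℕₚ.+-identityʳ n))))
  (trans (*-comm _ (g 0)) (sym (∏-head n g)))

-- Binomial coefficients

-- Integer-valued and recursive, so that Pascal's rule holds by computation. `bin-C` identifies it
-- with the coefficient of the theorem.
bin : ℕ → ℕ → ℤ
bin n       zero    = + 1
bin zero    (suc k) = + 0
bin (suc n) (suc k) = bin n k + bin n (suc k)

-- Absorption in multiplied-out form over ℤ: valid also for k ≥ n and ready to enter linear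
-- combinations. It and `bin-lower` are mutually recursive through Pascal's rule.
bin-up : ∀ n k → (+ 1 + + k) * bin (suc n) (suc k) ≡ (+ 1 + + n) * bin n k
bin-lower : ∀ n k → (+ 1 + + k) * bin n (suc k) ≡ (+ n - + k) * bin n k

bin-up n k = trans (*-distribˡ-+ (+ 1 + + k) (bin n k) (bin n (suc k)))
  (trans (cong (λ z → (+ 1 + + k) * bin n k + z) (bin-lower n k)) (identity (+ n) (+ k) (bin n k)))
  where
  opaque
    unfolding _*_
    identity : ∀ n k b → (+ 1 + k) * b + (n - k) * b ≡ (+ 1 + n) * b
    identity = solve-∀

bin-lower zero    zero    = trans (*-zeroʳ (+ 1)) (sym (*-zeroˡ (+ 1)))
bin-lower zero    (suc k) = trans (*-zeroʳ (+ 1 + + suc k)) (sym (*-zeroʳ (+ 0 - + suc k)))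
bin-lower (suc n) zero    = trans (bin-up n 0) (identity (+ n))
  where
  opaque
    unfolding _*_
    identity : ∀ n → (+ 1 + n) * + 1 ≡ (+ 1 + n - + 0) * + 1
    identity = solve-∀
bin-lower (suc n) (suc k) =
  linear₂ (+ 1) (+ 1) (bin-lower n (suc k)) (bin-lower n k)
    (identity (+ n) (+ k) (bin n k) (bin n (suc k)) (bin n (suc (suc k))))
  where
  opaque
    unfolding _*_
    identity : ∀ n k u v w →
      (+ 2 + k) * (v + w) - (+ 1 + n - (+ 1 + k)) * (u + v) ≡
      + 1 * ((+ 2 + k) * w - (n - (+ 1 + k)) * v) + + 1 * ((+ 1 + k) * v - (n - k) * u)
    identity = solve-∀

bin-upper : ∀ n k → (+ 1 + + n - + k) * bin (suc n) k ≡ (+ 1 + + n) * bin n k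
bin-upper n zero    = identity (+ n)
  where
  opaque
    unfolding _*_
    identity : ∀ n → (+ 1 + n - + 0) * + 1 ≡ (+ 1 + n) * + 1
    identity = solve-∀
bin-upper n (suc k) = linear₁ (- + 1) (bin-lower n k) (identity (+ n) (+ k) (bin n k) (bin n (suc k)))
  where
  opaque
    unfolding _*_
    identity : ∀ n k u v → (+ 1 + n - (+ 1 + k)) * (u + v) - (+ 1 + n) * v ≡
                           - + 1 * ((+ 1 + k) * v - (n - k) * u)
    identity = solve-∀

bin-overflow : ∀ {n k} → n < k → bin n k ≡ + 0
bin-overflow {zero}  {suc k} _         = refl
bin-overflow {suc n} {suc k} (s≤s n<k) =
  cong₂ _+_ (bin-overflow n<k) (bin-overflow (ℕₚ.m<n⇒m<1+n n<k))

bin-diag : ∀ n → bin n n ≡ + 1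
bin-diag zero    = refl
bin-diag (suc n) = cong₂ _+_ (bin-diag n) (bin-overflow (ℕₚ.n<1+n n))

bin-1 : ∀ n → bin n 1 ≡ + n
bin-1 zero    = refl
bin-1 (suc n) = cong (λ z → + 1 + z) (bin-1 n)

bin-sym : ∀ j k → bin (j ℕ.+ k) j ≡ bin (j ℕ.+ k) k
bin-sym zero    k       = sym (bin-diag k)
bin-sym (suc j) zero    rewrite ℕₚ.+-identityʳ j = bin-diag (suc j)
bin-sym (suc j) (suc k) = trans (ℤₚ.+-comm (bin (j ℕ.+ suc k) j) _) (cong₂ _+_
  (subst (λ l → bin l (suc j) ≡ bin l k) (sym (ℕₚ.+-suc j k)) (bin-sym (suc j) k)) (bin-sym j (suc k)))

binomial-theorem : ∀ a n → (+ 1 + a) ^ n ≡ ∑ (suc n) (λ k → bin n k * a ^ k)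
binomial-theorem a zero    = sym (trans (ℤₚ.+-identityˡ _) (*-identityˡ (+ 1)))
binomial-theorem a (suc n) = begin
  (+ 1 + a) * (+ 1 + a) ^ n                              ≡⟨ cong ((+ 1 + a) *_) (binomial-theorem a n) ⟩
  (+ 1 + a) * ∑ (suc n) f                                ≡⟨ *-distribʳ-+ (∑ (suc n) f) (+ 1) a ⟩
  + 1 * ∑ (suc n) f + a * ∑ (suc n) f                    ≡⟨ cong₂ _+_ extend (shift (suc n)) ⟩
  ∑ (suc (suc n)) f + ∑ (suc n) g                        ≡⟨ cong (λ z → z + ∑ (suc n) g) (∑-head (suc n) f) ⟩
  f 0 + ∑ (suc n) (λ k → f (suc k)) + ∑ (suc n) g        ≡⟨ ℤₚ.+-assoc (f 0) (∑ (suc n) (λ k → f (suc k))) (∑ (suc n) g) ⟩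
  f 0 + (∑ (suc n) (λ k → f (suc k)) + ∑ (suc n) g)      ≡⟨ cong (λ z → f 0 + z) (sym (∑-+ (suc n) (λ k → f (suc k)) g)) ⟩
  f 0 + ∑ (suc n) (λ k → f (suc k) + g k)                ≡⟨ cong (λ z → f 0 + z) (∑-cong (suc n) λ k _ → pascal k) ⟩
  f 0 + ∑ (suc n) (λ k → h (suc k))                      ≡⟨ ∑-head (suc n) h ⟨
  ∑ (suc (suc n)) h                                      ∎
  where
  open ≡-Reasoning
  f : ℕ → ℤ
  f k = bin n k * a ^ k
  g : ℕ → ℤ
  g k = bin n k * a ^ suc k
  h : ℕ → ℤ
  h k = bin (suc n) k * a ^ k
  extend : + 1 * ∑ (suc n) f ≡ ∑ (suc (suc n)) f
  extend = trans (*-identityˡ _) (sym (trans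
    (cong (λ b → ∑ (suc n) f + b * a ^ suc n) (bin-overflow (ℕₚ.n<1+n n)))
    (trans (cong (λ z → ∑ (suc n) f + z) (*-zeroˡ (a ^ suc n))) (ℤₚ.+-identityʳ (∑ (suc n) f)))))
  opaque
    unfolding _*_
    swapˡ : ∀ a b c → a * (b * c) ≡ b * (a * c)
    swapˡ = solve-∀
  shift : ∀ m → a * ∑ m f ≡ ∑ m (λ k → bin n k * a ^ suc k)
  shift m = trans (sym (∑-*ˡ m a f)) (∑-cong m λ k _ → swapˡ a (bin n k) (a ^ k))
  pascal : ∀ k → f (suc k) + bin n k * a ^ suc k ≡ bin (suc n) (suc k) * a ^ suc k
  pascal k = trans (sym (*-distribʳ-+ (a ^ suc k) (bin n (suc k)) (bin n k)))
    (cong (_* a ^ suc k) (ℤₚ.+-comm (bin n (suc k)) (bin n k)))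

-- Arithmetic modulo powers of p: units, Teichmüller lifts, inverses, permuted sums

module PrimeModulus (q : ℕ) (p-prime : Prime (suc q)) where

  p : ℕ
  p = suc q

  P P² P³ : ℤ
  P  = + p
  P² = P * P
  P³ = P * P²

  P²⇒P : ∀ {a b} → a ≈ b [ P² ] → a ≈ b [ P ]
  P²⇒P = weaken P

  P³⇒P² : ∀ {a b} → a ≈ b [ P³ ] → a ≈ b [ P² ]
  P³⇒P² = weaken P

  P³⇒P : ∀ {a b} → a ≈ b [ P³ ] → a ≈ b [ P ]
  P³⇒P h = P²⇒P (P³⇒P² h)

  Unit : ℤ → Set
  Unit a = ¬ a ≈ + 0 [ P ]

  ∣⇒≈0 : ∀ {a} → p ℕD.∣ ∣ a ∣ → a ≈ + 0 [ P ]
  ∣⇒≈0 {a} d with ℤS.∣ᵤ⇒∣ {P} {a} d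
  ... | divides k e = by k (trans (ℤₚ.+-identityʳ a) (trans e (sym (*≡ℤ* k P))))

  ≈0⇒∣ : ∀ {a} → a ≈ + 0 [ P ] → p ℕD.∣ ∣ a ∣
  ≈0⇒∣ {a} (by k e) = ℤS.∣⇒∣ᵤ (divides k (trans (sym (ℤₚ.+-identityʳ a)) (trans e (*≡ℤ* k P))))

  abstract
    ≈0? : ∀ a → Dec (a ≈ + 0 [ P ])
    ≈0? a with p ℕD.∣? ∣ a ∣
    ... | yes d = yes (∣⇒≈0 d)
    ... | no ¬d = no λ h → ¬d (≈0⇒∣ h)

  difference≈0 : ∀ {M a b} → a ≈ b [ M ] → a - b ≈ + 0 [ M ]
  difference≈0 {M} {a} {b} (by k e) = by k (trans (ℤₚ.+-identityʳ (a - b)) e)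

  ≈-difference : ∀ {M a b} → a - b ≈ + 0 [ M ] → a ≈ b [ M ]
  ≈-difference {M} {a} {b} (by k e) = by k (trans (sym (ℤₚ.+-identityʳ (a - b))) e)

  abstract
    ≈? : ∀ a b → Dec (a ≈ b [ P ])
    ≈? a b with ≈0? (a - b)
    ... | yes h = yes (≈-difference h)
    ... | no ¬h = no λ h → ¬h (difference≈0 h)

  euclid : ∀ a b → a * b ≈ + 0 [ P ] → a ≈ + 0 [ P ] ⊎ b ≈ + 0 [ P ]
  euclid a b h with euclidsLemma ∣ a ∣ ∣ b ∣ p-prime (subst (p ℕD.∣_) (abs-* a b) (≈0⇒∣ h))
  ... | inj₁ d = inj₁ (∣⇒≈0 d)
  ... | inj₂ d = inj₂ (∣⇒≈0 d)

  unit-* : ∀ {a b} → Unit a → Unit b → Unit (a * b)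
  unit-* {a} {b} ua ub h = [ ua , ub ]′ (euclid a b h)

  unit-≈ : ∀ {a b} → a ≈ b [ P ] → Unit b → Unit a
  unit-≈ h ub k = ub (≈-trans (≈-sym h) k)

  unit-neg : ∀ {a} → Unit a → Unit (- a)
  unit-neg {a} ua h = ua (lincomb₁ (- + 1) h (identity a))
    where
    opaque
      unfolding _*_
      identity : ∀ a → a - + 0 ≡ - + 1 * (- a - + 0)
      identity = solve-∀

  unit-small : ∀ {k} → 0 < k → k < p → Unit (+ k)
  unit-small {suc k} _ k<p h = ℕₚ.<⇒≱ k<p (ℕD.∣⇒≤ (≈0⇒∣ h))

  unit-one : Unit (+ 1)
  unit-one = unit-small ℕₚ.≤-refl (ℕ.nonTrivial⇒n>1 p {{prime⇒nonTrivial p-prime}})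

  unit-^ : ∀ {a} k → Unit a → Unit (a ^ k)
  unit-^ zero    ua = unit-one
  unit-^ (suc k) ua = unit-* ua (unit-^ k ua)

  unit-∏ : ∀ k {f : ℕ → ℤ} → (∀ i → i < k → Unit (f i)) → Unit (∏ k f)
  unit-∏ zero    h = unit-one
  unit-∏ (suc k) h = unit-* (unit-∏ k λ i i<k → h i (ℕₚ.m<n⇒m<1+n i<k)) (h k (ℕₚ.n<1+n k))

  bin-p≈0 : ∀ k → k < q → bin p (suc k) ≈ + 0 [ P ]
  bin-p≈0 k k<q = [ (λ h → ⊥-elim (unit-small (s≤s z≤n) (s≤s k<q) h)) , (λ h → h) ]′
    (euclid (+ suc k) (bin p (suc k))
      (lincomb₂ (bin q k) (+ 1) modulus≈0 (≈-reflexive (bin-up q k)) (identity (+ k) (+ q) (bin p (suc k)) (bin q k))))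
    where
    opaque
      unfolding _*_
      identity : ∀ k q u v → (+ 1 + k) * u - + 0 ≡
        v * (+ 1 + q - + 0) + + 1 * ((+ 1 + k) * u - (+ 1 + q) * v)
      identity = solve-∀

  fermat-ℕ : ∀ a → (+ a) ^ p ≈ + a [ P ]
  fermat-ℕ zero    = ≈-reflexive (*-zeroˡ ((+ 0) ^ q))
  fermat-ℕ (suc a) = begin
    (+ 1 + + a) ^ p                                          ≡⟨ binomial-theorem (+ a) p ⟩
    ∑ (suc p) f                                              ≡⟨ cong (λ z → z + f p) (∑-head q f) ⟩
    f 0 + ∑ q (λ k → f (suc k)) + f p                        ≈⟨ +-cong (+-cong (≈-reflexive (*-identityˡ (+ 1))) middle) (≈-trans last (fermat-ℕ a)) ⟩
    + 1 + + 0 + + a                                          ≡⟨⟩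
    + suc a                                                  ∎
    where
    open ≈-Reasoning P
    f : ℕ → ℤ
    f k = bin p k * (+ a) ^ k
    last : f p ≈ (+ a) ^ p [ P ]
    last = ≈-reflexive (trans (cong (_* (+ a) ^ p) (bin-diag p)) (*-identityˡ _))
    middle : ∑ q (λ k → f (suc k)) ≈ + 0 [ P ]
    middle = ≈-trans (∑-≈ q λ k k<q → *-congʳ ((+ a) ^ suc k) (bin-p≈0 k k<q))
                     (≈-reflexive (∑-zero q λ k _ → *-zeroˡ ((+ a) ^ suc k)))

  abstract
    res : ℤ → ℕ
    res a = a ℤDM.%ℕ p

    res<p : ∀ a → res a < p
    res<p a = ℤDM.n%ℕd<d a p

    ≈-res : ∀ a → a ≈ + res a [ P ]
    ≈-res a = by (a ℤDM./ℕ p) (trans (cong (_- + res a) (trans (ℤDM.a≡a%ℕn+[a/ℕn]*n a p)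
      (cong (λ z → + res a + z) (sym (*≡ℤ* (a ℤDM./ℕ p) P))))) (identity (+ res a) (a ℤDM./ℕ p * P)))
      where
      opaque
        unfolding _*_
        identity : ∀ r k → r + k - r ≡ k
        identity = solve-∀

  fermat : ∀ a → a ^ p ≈ a [ P ]
  fermat a = ≈-trans (^-cong p (≈-res a)) (≈-trans (fermat-ℕ (res a)) (≈-sym (≈-res a)))

  cancelᴾ : ∀ {a b} c → Unit c → c * a ≈ c * b [ P ] → a ≈ b [ P ]
  cancelᴾ {a} {b} c uc h = [ (λ c≈0 → ⊥-elim (uc c≈0)) , ≈-difference ]′
    (euclid c (a - b) (lincomb₁ (+ 1) h (identity a b c)))
    where
    opaque
      unfolding _*_
      identity : ∀ a b c → c * (a - b) - + 0 ≡ + 1 * (c * a - c * b)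
      identity = solve-∀

  fermat-unit : ∀ {a} → Unit a → a ^ q ≈ + 1 [ P ]
  fermat-unit {a} ua = cancelᴾ a ua (≈-trans (fermat a) (≈-reflexive (sym (*-identityʳ a))))

  power-expansion : ∀ b u k → ∃ λ w → (b + u) ^ suc k ≡ b ^ suc k + + suc k * u * b ^ k + u * u * w
  power-expansion b u zero = + 0 , identity b u
    where
    opaque
      unfolding _*_
      identity : ∀ b u → (b + u) * + 1 ≡ b * + 1 + + 1 * u * + 1 + u * u * + 0
      identity = solve-∀
  power-expansion b u (suc k) with power-expansion b u k
  ... | w , e = (+ 1 + + k) * b ^ k + (b + u) * w ,
    trans (cong ((b + u) *_) e) (identity b u (+ k) (b ^ k) w)
    where
    opaque
      unfolding _*_
      identity : ∀ b u k x w → (b + u) * (b * x + (+ 1 + k) * u * x + u * u * w) ≡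
        b * (b * x) + (+ 2 + k) * u * (b * x) + u * u * ((+ 1 + k) * x + (b + u) * w)
      identity = solve-∀

  -- In (b + u)^p with u a multiple of pc, the linear term acquires a factor p and the rest contains
  -- u². The free factor `c` allows iteration from modulus p to p³.
  lift : ∀ {a b} c → a ≈ b [ P * c ] → a ^ p ≈ b ^ p [ P * (P * c) ]
  lift {a} {b} c (by k e) with power-expansion b (k * (P * c)) q
  ... | w , e′ = by (k * b ^ q + k * k * c * w) (trans (cong (λ z → z ^ p - b ^ p) a≡)
      (trans (cong (_- b ^ p) e′) (identity (b ^ p) (b ^ q) k P c w)))
    where
    a≡ : a ≡ b + k * (P * c)
    a≡ = linear₁ (+ 1) e (split a b (k * (P * c)))
      where
      opaque
        unfolding _*_
        split : ∀ a b u → a - (b + u) ≡ + 1 * (a - b - u)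
        split = solve-∀
    opaque
      unfolding _*_
      identity : ∀ y x k P c w → y + P * (k * (P * c)) * x + k * (P * c) * (k * (P * c)) * w - y ≡
                                 (k * x + k * k * c * w) * (P * (P * c))
      identity = solve-∀

  -- The value at t of the Teichmüller character modulo p³.
  teich : ℤ → ℤ
  teich t = (t ^ p) ^ p

  -- Each of the two p-th powers raises the modulus by one factor p.
  teich-cong : ∀ {a b} → a ≈ b [ P ] → teich a ≈ teich b [ P³ ]
  teich-cong {a} {b} h = lift P (subst (λ N → a ^ p ≈ b ^ p [ P * N ]) (*-identityʳ P)
    (lift (+ 1) (subst (λ N → a ≈ b [ N ]) (sym (*-identityʳ P)) h)))

  teich≈ : ∀ a → teich a ≈ a [ P ]
  teich≈ a = ≈-trans (fermat (a ^ p)) (fermat a)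

  teich-* : ∀ a b → teich (a * b) ≡ teich a * teich b
  teich-* a b = trans (cong (_^ p) (^-distrib-* a b p)) (^-distrib-* (a ^ p) (b ^ p) p)

  teich-^ : ∀ a k → teich (a ^ k) ≡ teich a ^ k
  teich-^ a zero    = trans (cong (_^ p) (one^ p)) (one^ p)
  teich-^ a (suc k) = trans (teich-* a (a ^ k)) (cong (teich a *_) (teich-^ a k))

  teich-one : teich (+ 1) ≡ + 1
  teich-one = teich-^ (+ 1) 0

  teich-zero : teich (+ 0) ≡ + 0
  teich-zero = trans (cong (_^ p) (*-zeroˡ ((+ 0) ^ q))) (*-zeroˡ ((+ 0) ^ q))

  abstract
    -- An explicit formula rather than a chosen inverse: it is total and exactly multiplicative, so
    -- that `inv-*` is an equality of integers without unit hypotheses. On units, multiplying it by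
    -- a gives the lift of a^q, which is 1 modulo p³.
    inv : ℤ → ℤ
    inv a = teich (a ^ ℕ.pred q) * ((a ^ p * a) ^ q)

    inv-* : ∀ a b → inv (a * b) ≡ inv a * inv b
    inv-* a b = trans (cong₂ _*_
        (trans (cong teich (^-distrib-* a b (ℕ.pred q))) (teich-* (a ^ ℕ.pred q) (b ^ ℕ.pred q)))
        (trans (cong (_^ q) (trans (cong (_* (a * b)) (^-distrib-* a b p)) (swap (a ^ p) (b ^ p) a b)))
               (^-distrib-* (a ^ p * a) (b ^ p * b) q)))
        (swap (teich (a ^ ℕ.pred q)) (teich (b ^ ℕ.pred q)) ((a ^ p * a) ^ q) ((b ^ p * b) ^ q))
      where
      opaque
        unfolding _*_
        swap : ∀ x y z w → x * y * (z * w) ≡ x * z * (y * w)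
        swap = solve-∀

    private
      suc-pred-q : suc (ℕ.pred q) ≡ q
      suc-pred-q = pos q (ℕₚ.≤-pred (ℕ.nonTrivial⇒n>1 p {{prime⇒nonTrivial p-prime}}))
        where
        pos : ∀ k → 0 < k → suc (ℕ.pred k) ≡ k
        pos (suc k) _ = refl

      inv-teich : ∀ a → inv a * a ≡ teich (a ^ q)
      inv-teich a = begin
        teich (a ^ ℕ.pred q) * ((a ^ p * a) ^ q) * a
          ≡⟨ cong (λ z → teich (a ^ ℕ.pred q) * z * a) (^-distrib-* (a ^ p) a q) ⟩
        teich (a ^ ℕ.pred q) * ((a ^ p) ^ q * a ^ q) * a
          ≡⟨ regroup (teich (a ^ ℕ.pred q)) ((a ^ p) ^ q) (a ^ q) a ⟩
        teich (a ^ ℕ.pred q) * (a ^ p * (a ^ p) ^ q)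
          ≡⟨ cong (_* teich a) (teich-^ a (ℕ.pred q)) ⟩
        teich a ^ ℕ.pred q * teich a
          ≡⟨ trans (pow-comm (teich a) (ℕ.pred q)) (cong (teich a ^_) suc-pred-q) ⟩
        teich a ^ q
          ≡⟨ sym (teich-^ a q) ⟩
        teich (a ^ q) ∎
        where
        open ≡-Reasoning
        opaque
          unfolding _*_
          regroup : ∀ t x y a → t * (x * y) * a ≡ t * (a * y * x)
          regroup = solve-∀

    invˡ : ∀ {a} → Unit a → inv a * a ≈ + 1 [ P³ ]
    invˡ {a} ua = ≈-trans (≈-reflexive (inv-teich a))
      (≈-trans (teich-cong (fermat-unit ua)) (≈-reflexive teich-one))

  invˡ′ : ∀ {a} → Unit a → inv a * a ≈ + 1 [ P ]
  invˡ′ ua = P³⇒P (invˡ ua)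

  unit-inv : ∀ {a} → Unit a → Unit (inv a)
  unit-inv {a} ua h = unit-one (≈-trans (≈-sym (invˡ′ ua)) (≈-trans (*-congʳ a h) (≈-reflexive (*-zeroˡ a))))

  cancel-inverse : ∀ {M a b} c d → d * c ≈ + 1 [ M ] → c * a ≈ c * b [ M ] → a ≈ b [ M ]
  cancel-inverse {M} {a} {b} c d dc h = lincomb₃ d (- a) b h dc dc (identity a b c d)
    where
    opaque
      unfolding _*_
      identity : ∀ a b c d → a - b ≡ d * (c * a - c * b) + - a * (d * c - + 1) + b * (d * c - + 1)
      identity = solve-∀

  cancel : ∀ {a b} c → Unit c → c * a ≈ c * b [ P³ ] → a ≈ b [ P³ ]
  cancel c uc = cancel-inverse c (inv c) (invˡ uc)

  cancel² : ∀ {a b} c → Unit c → c * a ≈ c * b [ P² ] → a ≈ b [ P² ]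
  cancel² c uc = cancel-inverse c (inv c) (P³⇒P² (invˡ uc))

  inv-unique : ∀ {a b} → Unit a → b * a ≈ + 1 [ P ] → b ≈ inv a [ P ]
  inv-unique {a} {b} ua h = lincomb₂ (inv a) (- b) h (invˡ′ ua) (identity a b (inv a))
    where
    opaque
      unfolding _*_
      identity : ∀ a b i → b - i ≡ i * (b * a - + 1) + - b * (i * a - + 1)
      identity = solve-∀

  Periodic : ℤ → (ℤ → ℤ) → Set
  Periodic M f = ∀ {a b} → a ≈ b [ P ] → f a ≈ f b [ M ]

  abstract
    δ : ℤ → ℤ → ℤ
    δ a b with ≈? a b
    ... | yes _ = + 1
    ... | no  _ = + 0

    δ-yes : ∀ {a b} → a ≈ b [ P ] → δ a b ≡ + 1
    δ-yes {a} {b} h with ≈? a b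
    ... | yes _ = refl
    ... | no ¬h = contradiction h ¬h

    δ-no : ∀ {a b} → ¬ a ≈ b [ P ] → δ a b ≡ + 0
    δ-no {a} {b} h with ≈? a b
    ... | yes k = contradiction k h
    ... | no _  = refl

  δ-cong : ∀ {a b c d} → (a ≈ b [ P ] → c ≈ d [ P ]) → (c ≈ d [ P ] → a ≈ b [ P ]) → δ a b ≡ δ c d
  δ-cong {a} {b} {c} {d} f g = by-cases (≈? a b)
    where
    by-cases : Dec (a ≈ b [ P ]) → δ a b ≡ δ c d
    by-cases (yes h) = trans (δ-yes h) (sym (δ-yes (f h)))
    by-cases (no ¬h) = trans (δ-no ¬h) (sym (δ-no (¬h ∘ g)))

  ≈⇒≡ : ∀ {i j} → i < p → j < p → + i ≈ + j [ P ] → i ≡ j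
  ≈⇒≡ {i} {j} i<p j<p h with ℕₚ.<-cmp i j
  ... | tri≈′ _ e _ = e
  ... | tri<′ i<j _ _ = ⊥-elim (unit-small (ℕₚ.m<n⇒0<n∸m i<j) (ℕₚ.≤-<-trans (ℕₚ.m∸n≤m j i) j<p)
        (lincomb₁ (- + 1) h (trans (cong (_- + 0) (sym (∸-ℤ (ℕₚ.<⇒≤ i<j)))) (identity (+ i) (+ j)))))
    where
    ∸-ℤ : ∀ {a b} → a ≤ b → + b - + a ≡ + (b ∸ a)
    ∸-ℤ {a} {b} a≤b = trans (ℤₚ.m-n≡m⊖n b a) (ℤₚ.⊖-≥ a≤b)
    opaque
      unfolding _*_
      identity : ∀ i j → j - i - + 0 ≡ - + 1 * (i - j)
      identity = solve-∀
  ... | tri>′ _ _ j<i = ⊥-elim (unit-small (ℕₚ.m<n⇒0<n∸m j<i) (ℕₚ.≤-<-trans (ℕₚ.m∸n≤m i j) i<p)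
        (lincomb₁ (+ 1) h (trans (cong (_- + 0) (sym (∸-ℤ (ℕₚ.<⇒≤ j<i)))) (identity (+ i) (+ j)))))
    where
    ∸-ℤ : ∀ {a b} → a ≤ b → + b - + a ≡ + (b ∸ a)
    ∸-ℤ {a} {b} a≤b = trans (ℤₚ.m-n≡m⊖n b a) (ℤₚ.⊖-≥ a≤b)
    opaque
      unfolding _*_
      identity : ∀ i j → i - j - + 0 ≡ + 1 * (i - j)
      identity = solve-∀

  ∑-single : ∀ k i f → i < k → (∀ j → j < k → j ≢ i → f j ≡ + 0) → ∑ k f ≡ f i
  ∑-single (suc k) i f i<k h with i ℕ.≟ k
  ... | yes refl = trans (cong (_+ f i) (∑-zero k λ j j<k → h j (ℕₚ.m<n⇒m<1+n j<k) (ℕₚ.<⇒≢ j<k))) (ℤₚ.+-identityˡ (f i))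
  ... | no i≢k = trans (cong₂ _+_
      (∑-single k i f (ℕₚ.≤∧≢⇒< (ℕₚ.≤-pred i<k) i≢k) λ j j<k → h j (ℕₚ.m<n⇒m<1+n j<k))
      (h k (ℕₚ.n<1+n k) (i≢k ∘ sym))) (ℤₚ.+-identityʳ (f i))

  ∑-pick : ∀ {M} f → Periodic M f → ∀ a → ∑ p (λ u → δ a (+ u) * f (+ u)) ≈ f a [ M ]
  ∑-pick f per a = ≈-trans (≈-reflexive (trans
      (∑-single p (res a) (λ u → δ a (+ u) * f (+ u)) (res<p a) λ j j<p j≢ →
        trans (cong (_* f (+ j)) (δ-no λ h → j≢ (≈⇒≡ j<p (res<p a) (≈-trans (≈-sym h) (≈-res a))))) (*-zeroˡ (f (+ j))))
      (trans (cong (_* f (+ res a)) (δ-yes (≈-res a))) (*-identityˡ (f (+ res a))))))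
    (per (≈-sym (≈-res a)))

  -- Modulus 0 turns congruence into equality, so `∑-pick` and `∑-permute` serve both for sums
  -- modulo p³ and for exact character sums.
  ≈-zero⇒≡ : ∀ {a b} → a ≈ b [ + 0 ] → a ≡ b
  ≈-zero⇒≡ {a} {b} (by k e) = ℤₚ.i-j≡0⇒i≡j a b (trans e (*-zeroʳ k))

  -- Insert δ and count the pairs (t, u) with gt ≡ u in both orders. For fixed u the condition reads
  -- t ≡ u/g, so `∑-pick` applies again, and no bijection of index sets has to be built.
  ∑-permute : ∀ {M} f → Periodic M f → ∀ {g} → Unit g → ∑ p (λ t → f (g * + t)) ≈ ∑ p (λ t → f (+ t)) [ M ]
  ∑-permute {M} f per {g} ug = begin
    ∑ p (λ t → f (g * + t))                              ≈⟨ ∑-≈ p (λ t _ → ∑-pick f per (g * + t)) ⟨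
    ∑ p (λ t → ∑ p (λ u → δ (g * + t) (+ u) * f (+ u)))  ≡⟨ ∑-swap p p (λ t u → δ (g * + t) (+ u) * f (+ u)) ⟩
    ∑ p (λ u → ∑ p (λ t → δ (g * + t) (+ u) * f (+ u)))  ≡⟨ ∑-cong p (λ u _ → count u) ⟩
    ∑ p (λ t → f (+ t))                                  ∎
    where
    open ≈-Reasoning M
    solve-t : ∀ u t → g * + t ≈ + u [ P ] → inv g * + u ≈ + t [ P ]
    solve-t u t h = lincomb₂ (- inv g) (+ t) h (invˡ′ ug) (identity g (inv g) (+ t) (+ u))
      where
      opaque
        unfolding _*_
        identity : ∀ g i t u → i * u - t ≡ - i * (g * t - u) + t * (i * g - + 1)
        identity = solve-∀
    solve-u : ∀ u t → inv g * + u ≈ + t [ P ] → g * + t ≈ + u [ P ]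
    solve-u u t h = lincomb₂ (- g) (+ u) h (invˡ′ ug) (identity g (inv g) (+ t) (+ u))
      where
      opaque
        unfolding _*_
        identity : ∀ g i t u → g * t - u ≡ - g * (i * u - t) + u * (i * g - + 1)
        identity = solve-∀
    count : ∀ u → ∑ p (λ t → δ (g * + t) (+ u) * f (+ u)) ≡ f (+ u)
    count u = trans (∑-cong p λ t _ → trans (cong (_* f (+ u)) (δ-cong (solve-t u t) (solve-u u t)))
                                            (*-comm (δ (inv g * + u) (+ t)) (f (+ u))))
      (trans (∑-*ˡ p (f (+ u)) (λ t → δ (inv g * + u) (+ t)))
      (trans (cong (f (+ u) *_) (trans (∑-cong p λ t _ → sym (*-identityʳ (δ (inv g * + u) (+ t))))
                                 (≈-zero⇒≡ (∑-pick (λ _ → + 1) (λ _ → ≈-refl) (inv g * + u)))))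
             (*-identityʳ (f (+ u)))))

-- Power sums over the residues, Wilson's theorem

module PowerSums (q : ℕ) (p-prime : Prime (suc q)) where
  open PrimeModulus q p-prime

  0<q : 0 < q
  0<q = ℕₚ.≤-pred (ℕ.nonTrivial⇒n>1 p {{prime⇒nonTrivial p-prime}})

  powerSum : ℕ → ℤ
  powerSum k = ∑ p (λ t → (+ t) ^ k)

  telescoped-power : ∀ N k → ∑ N (λ t → (+ 1 + + t) ^ suc k - (+ t) ^ suc k) ≡ (+ N) ^ suc k
  telescoped-power zero    k = sym (*-zeroˡ ((+ 0) ^ k))
  telescoped-power (suc N) k = linear₁ (+ 1) (telescoped-power N k)
    (identity (∑ N (λ t → (+ 1 + + t) ^ suc k - (+ t) ^ suc k)) ((+ 1 + + N) ^ suc k) ((+ N) ^ suc k))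
    where
    opaque
      unfolding _*_
      identity : ∀ s u v → s + (u - v) - u ≡ + 1 * (s - v)
      identity = solve-∀

  bin-subdiag : ∀ k → bin (suc k) k ≡ + suc k
  bin-subdiag zero    = refl
  bin-subdiag (suc k) = trans (cong₂ _+_ (bin-subdiag k) (bin-diag (suc k))) (ℤₚ.+-comm (+ suc k) (+ 1))

  -- Summing (t + 1)^(k+1) - t^(k+1) over t telescopes to p^(k+1). Expanding the difference leaves
  -- (k + 1) times the k-th power sum plus lower ones, and k + 1 is a unit.
  powerSum-low : ∀ k → k < q → powerSum k ≈ + 0 [ P ]
  powerSum-low = <-rec _ step
    where
    step : ∀ k → (∀ {i} → i < k → i < q → powerSum i ≈ + 0 [ P ]) → k < q → powerSum k ≈ + 0 [ P ]
    step k rec k<q = cancelᴾ (+ suc k) (unit-small (s≤s z≤n) (s≤s k<q)) (begin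
      + suc k * powerSum k
        ≡⟨ cong (_* powerSum k) (bin-subdiag k) ⟨
      bin (suc k) k * powerSum k
        ≡⟨ ℤₚ.+-identityˡ (bin (suc k) k * powerSum k) ⟨
      + 0 + bin (suc k) k * powerSum k
        ≈⟨ +-cong {a = ∑ k (λ i → bin (suc k) i * powerSum i)} (≈-trans (∑-≈ k λ i i<k → *-congˡ (bin (suc k) i) (rec i<k (ℕₚ.<-trans i<k k<q)))
                                (≈-reflexive (∑-zero k λ i _ → *-zeroʳ (bin (suc k) i))))
                  (≈-refl {a = bin (suc k) k * powerSum k}) ⟨
      ∑ (suc k) (λ i → bin (suc k) i * powerSum i)
        ≡⟨ ∑-cong (suc k) (λ i _ → sym (∑-*ˡ p (bin (suc k) i) (λ t → (+ t) ^ i))) ⟩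
      ∑ (suc k) (λ i → ∑ p (λ t → bin (suc k) i * (+ t) ^ i))
        ≡⟨ ∑-swap (suc k) p (λ i t → bin (suc k) i * (+ t) ^ i) ⟩
      ∑ p (λ t → ∑ (suc k) (λ i → bin (suc k) i * (+ t) ^ i))
        ≡⟨ ∑-cong p (λ t _ → difference t) ⟩
      ∑ p (λ t → (+ 1 + + t) ^ suc k - (+ t) ^ suc k)
        ≡⟨ telescoped-power p k ⟩
      P ^ suc k
        ≈⟨ *-congʳ (P ^ k) modulus≈0 ⟩
      + 0 * P ^ k
        ≡⟨ trans (*-zeroˡ (P ^ k)) (sym (*-zeroʳ (+ suc k))) ⟩
      + suc k * + 0 ∎)
      where
      open ≈-Reasoning P
      difference : ∀ t → ∑ (suc k) (λ i → bin (suc k) i * (+ t) ^ i) ≡ (+ 1 + + t) ^ suc k - (+ t) ^ suc k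
      difference t = linear₂ (- + 1) (- (+ t) ^ suc k) (binomial-theorem (+ t) (suc k)) (bin-diag (suc k))
        (identity (∑ (suc k) (λ i → bin (suc k) i * (+ t) ^ i)) ((+ 1 + + t) ^ suc k) ((+ t) ^ suc k) (bin (suc k) (suc k)))
        where
        opaque
          unfolding _*_
          identity : ∀ s u v b → s - (u - v) ≡ - + 1 * (u - (s + b * v)) + - v * (b - + 1)
          identity = solve-∀

  pow-periodic : ∀ a r j → a ^ (suc r ℕ.+ q ℕ.* j) ≈ a ^ suc r [ P ]
  pow-periodic a r zero    = ≈-reflexive (cong (a ^_) (trans (cong (suc r ℕ.+_) (ℕₚ.*-zeroʳ q)) (ℕₚ.+-identityʳ (suc r))))
  pow-periodic a r (suc j) = ≈-trans (≈-reflexive (trans (cong (a ^_) exponent) (^-+ a p (r ℕ.+ q ℕ.* j))))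
    (≈-trans (*-congʳ (a ^ (r ℕ.+ q ℕ.* j)) (fermat a)) (pow-periodic a r j))
    where
    exponent : suc r ℕ.+ q ℕ.* suc j ≡ p ℕ.+ (r ℕ.+ q ℕ.* j)
    exponent = cong suc (trans (cong (r ℕ.+_) (ℕₚ.*-suc q j))
      (trans (sym (ℕₚ.+-assoc r q (q ℕ.* j))) (trans (cong (ℕ._+ q ℕ.* j) (ℕₚ.+-comm r q)) (ℕₚ.+-assoc q r (q ℕ.* j)))))

  zero^ : ∀ k → 0 < k → (+ 0) ^ k ≡ + 0
  zero^ (suc k) _ = *-zeroˡ ((+ 0) ^ k)

  q≈-1 : + q ≈ - + 1 [ P ]
  q≈-1 = lincomb₁ (+ 1) modulus≈0 (identity (+ q))
    where
    opaque
      unfolding _*_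
      identity : ∀ q → q - - + 1 ≡ + 1 * (+ 1 + q - + 0)
      identity = solve-∀

  ∑-units : ∀ {M} f → f 0 ≈ + 0 [ M ] → (∀ t → 0 < t → t < p → f t ≈ + 1 [ M ]) → ∑ p f ≈ + q [ M ]
  ∑-units f f0 f1 = ≈-trans (≈-reflexive (∑-head q f)) (≈-trans
    (+-cong f0 (∑-≈ q λ i i<q → f1 (suc i) (s≤s z≤n) (s≤s i<q)))
    (≈-reflexive (trans (ℤₚ.+-identityˡ _) (trans (∑-const q (+ 1)) (*-identityʳ (+ q))))))

  powerSum-q : powerSum q ≈ - + 1 [ P ]
  powerSum-q = ≈-trans (∑-units (λ t → (+ t) ^ q) (≈-reflexive (zero^ q 0<q))
    λ t 0<t t<p → fermat-unit (unit-small 0<t t<p)) q≈-1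

  1≉-1 : 2 < p → ¬ + 1 ≈ - + 1 [ P ]
  1≉-1 2<p h = unit-small (s≤s z≤n) 2<p (lincomb₁ (+ 1) h (sym (*-identityˡ (+ 2))))

  -- A substitute for a primitive root: if t^(r+1) were 1 for every unit t, the power sum with this
  -- exponent would be q ≡ -1, whereas it vanishes for exponents below q.
  nontrivial-power : ∀ r → suc r < q → ∃ λ g → Unit (+ g) × ¬ (+ g) ^ suc r ≈ + 1 [ P ]
  nontrivial-power r r<q = lemma (ℕₚ.anyUpTo? good? p)
    where
    good? : ∀ t → Dec (Unit (+ t) × ¬ (+ t) ^ suc r ≈ + 1 [ P ])
    good? t with ≈0? (+ t) | ≈? ((+ t) ^ suc r) (+ 1)
    ... | yes h | _     = no λ w → proj₁ w h
    ... | no u  | yes h = no λ w → proj₂ w h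
    ... | no u  | no v  = yes (u , v)
    lemma : Dec (∃ λ t → t < p × Unit (+ t) × ¬ (+ t) ^ suc r ≈ + 1 [ P ]) → ∃ λ g → Unit (+ g) × ¬ (+ g) ^ suc r ≈ + 1 [ P ]
    lemma (yes (g , _ , h)) = g , h
    lemma (no none) = ⊥-elim (unit-neg unit-one (≈-trans (≈-trans (≈-sym q≈-1) (≈-sym all-ones)) (powerSum-low (suc r) r<q)))
      where
      one : ∀ t → 0 < t → t < p → (+ t) ^ suc r ≈ + 1 [ P ]
      one t 0<t t<p with ≈? ((+ t) ^ suc r) (+ 1)
      ... | yes h = h
      ... | no ¬h = ⊥-elim (none (t , t<p , unit-small 0<t t<p , ¬h))
      all-ones : powerSum (suc r) ≈ + q [ P ]
      all-ones = ∑-units (λ t → (+ t) ^ suc r) (≈-reflexive (zero^ (suc r) (s≤s z≤n))) one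

  teichSum : ℕ → ℤ
  teichSum M = ∑ p (λ t → teich (+ t) ^ M)

  -- Replacing t by gt multiplies the sum by a power of the lift of g. That power minus 1 is a unit,
  -- because it is one modulo p by the choice of g.
  teichSum-vanish : ∀ r j → suc r < q → teichSum (suc r ℕ.+ q ℕ.* j) ≈ + 0 [ P³ ]
  teichSum-vanish r j r<q = lemma (nontrivial-power r r<q)
    where
    lemma : (∃ λ g → Unit (+ g) × ¬ (+ g) ^ suc r ≈ + 1 [ P ]) → teichSum (suc r ℕ.+ q ℕ.* j) ≈ + 0 [ P³ ]
    lemma (g , ug , g^≉1) = cancel (teich (+ g) ^ M - + 1) unit (≈-trans
          (lincomb₂ (+ 1) (+ 1) (∑-permute f periodic ug) (≈-reflexive factor)
            (identity (teich (+ g) ^ M) (teichSum M) (∑ p (λ t → f (+ g * + t)))))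
          (≈-reflexive (sym (*-zeroʳ (teich (+ g) ^ M - + 1)))))
      where
      M = suc r ℕ.+ q ℕ.* j
      f : ℤ → ℤ
      f a = teich a ^ M
      periodic : Periodic P³ f
      periodic h = ^-cong M (teich-cong h)
      factor : teich (+ g) ^ M * teichSum M ≡ ∑ p (λ t → f (+ g * + t))
      factor = trans (sym (∑-*ˡ p (teich (+ g) ^ M) (λ t → f (+ t)))) (∑-cong p λ t _ →
        sym (trans (cong (_^ M) (teich-* (+ g) (+ t))) (^-distrib-* (teich (+ g)) (teich (+ t)) M)))
      opaque
        unfolding _*_
        identity : ∀ u s w → (u - + 1) * s - + 0 ≡ + 1 * (w - s) + + 1 * (u * s - w)
        identity = solve-∀
      unit : Unit (teich (+ g) ^ M - + 1)
      unit h = g^≉1 (≈-trans (≈-sym (≈-trans (^-cong M (teich≈ (+ g))) (pow-periodic (+ g) r j))) (≈-difference h))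

  teichSum-full : ∀ j → teichSum (q ℕ.* suc j) ≈ + q [ P³ ]
  teichSum-full j = ∑-units (λ t → teich (+ t) ^ (q ℕ.* suc j))
    (≈-reflexive (trans (cong (_^ (q ℕ.* suc j)) teich-zero) (zero^ (q ℕ.* suc j) (ℕₚ.*-mono-≤ 0<q (s≤s (z≤n {j}))))))
    λ t 0<t t<p → ≈-trans (≈-reflexive (sym (^-^ (teich (+ t)) q (suc j))))
      (≈-trans (^-cong (suc j) (≈-trans (≈-reflexive (sym (teich-^ (+ t) q)))
        (≈-trans (teich-cong (fermat-unit (unit-small 0<t t<p))) (≈-reflexive teich-one))))
        (≈-reflexive (one^ (suc j))))

  -- Only the moments of f of low order matter for summing a polynomial function f over
  -- the residues, so "monic of degree d" is expressed through them.
  record Monic (d : ℕ) (f : ℤ → ℤ) : Set where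
    constructor monic
    field moment : ∀ k → k ℕ.+ d ≤ q → ∑ p (λ t → (+ t) ^ k * f (+ t)) ≈ powerSum (k ℕ.+ d) [ P ]

  open Monic

  monic-one : Monic 0 (λ _ → + 1)
  monic-one = monic λ k _ → ≈-reflexive (trans (∑-cong p λ t _ → *-identityʳ ((+ t) ^ k)) (cong powerSum (sym (ℕₚ.+-identityʳ k))))

  monic-resp : ∀ {d f g} → (∀ x → f x ≡ g x) → Monic d f → Monic d g
  monic-resp f≡g h = monic λ k k≤ → ≈-trans (≈-reflexive (∑-cong p λ t _ → cong ((+ t) ^ k *_) (sym (f≡g (+ t))))) (moment h k k≤)

  monic-linear : ∀ {d f} a → Monic d f → Monic (suc d) (λ x → f x * (x - a))
  monic-linear {d} {f} a (monic h) = monic λ k k≤ → let k+d<q = subst (_≤ q) (ℕₚ.+-suc k d) k≤ in begin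
    ∑ p (λ t → (+ t) ^ k * (f (+ t) * (+ t - a)))
      ≡⟨ ∑-cong p (λ t _ → expand (+ t) ((+ t) ^ k) (f (+ t)) a) ⟩
    ∑ p (λ t → (+ t) ^ suc k * f (+ t) + - a * ((+ t) ^ k * f (+ t)))
      ≡⟨ trans (∑-+ p (λ t → (+ t) ^ suc k * f (+ t)) (λ t → - a * ((+ t) ^ k * f (+ t))))
               (cong (λ z → ∑ p (λ t → (+ t) ^ suc k * f (+ t)) + z) (∑-*ˡ p (- a) (λ t → (+ t) ^ k * f (+ t)))) ⟩
    ∑ p (λ t → (+ t) ^ suc k * f (+ t)) + - a * ∑ p (λ t → (+ t) ^ k * f (+ t))
      ≈⟨ +-cong (h (suc k) k+d<q) (*-congˡ (- a) (≈-trans (h k (ℕₚ.<⇒≤ k+d<q)) (powerSum-low (k ℕ.+ d) k+d<q))) ⟩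
    powerSum (suc k ℕ.+ d) + - a * + 0
      ≡⟨ trans (cong (λ z → powerSum (suc k ℕ.+ d) + z) (*-zeroʳ (- a))) (ℤₚ.+-identityʳ (powerSum (suc k ℕ.+ d))) ⟩
    powerSum (suc k ℕ.+ d)
      ≡⟨ cong powerSum (sym (ℕₚ.+-suc k d)) ⟩
    powerSum (k ℕ.+ suc d) ∎
    where
    open ≈-Reasoning P
    opaque
      unfolding _*_
      expand : ∀ t x f a → x * (f * (t - a)) ≡ t * x * f + - a * (x * f)
      expand = solve-∀

  monic-power : ∀ {d f} a k → Monic d f → Monic (k ℕ.+ d) (λ x → f x * (x - a) ^ k)
  monic-power {d} {f} a zero    h = monic-resp (λ x → sym (*-identityʳ (f x))) h
  monic-power {d} {f} a (suc k) h = monic-resp (λ x → regroup (f x) ((x - a) ^ k) (x - a)) (monic-linear a (monic-power a k h))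
    where
    opaque
      unfolding _*_
      regroup : ∀ f y z → f * y * z ≡ f * (z * y)
      regroup = solve-∀

  monic-∏ : ∀ d → Monic d (λ x → ∏ d (λ i → x - + suc i))
  monic-∏ zero    = monic-one
  monic-∏ (suc d) = monic-linear (+ suc d) (monic-∏ d)

  ∑-monic : ∀ {f} → Monic q f → ∑ p (λ t → f (+ t)) ≈ - + 1 [ P ]
  ∑-monic {f} h = ≈-trans (≈-reflexive (∑-cong p λ t _ → sym (*-identityˡ (f (+ t))))) (≈-trans (moment h 0 ℕₚ.≤-refl) powerSum-q)

  -- Sum the polynomial with roots 1, ..., q over all residues: only x = 0 contributes, while a
  -- monic polynomial of degree q sums to -1.
  wilson : ∏ q (λ i → - + suc i) ≈ - + 1 [ P ]
  wilson = ≈-trans (≈-reflexive (sym (trans (∑-single p 0 (λ t → f (+ t)) (s≤s z≤n) vanish)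
    (∏-cong q λ i _ → ℤₚ.+-identityˡ (- + suc i))))) (∑-monic (monic-∏ q))
    where
    f : ℤ → ℤ
    f x = ∏ q (λ i → x - + suc i)
    ∏-zero : ∀ k {g : ℕ → ℤ} i → i < k → g i ≡ + 0 → ∏ k g ≡ + 0
    ∏-zero (suc k) {g} i i<k e with i ℕ.≟ k
    ... | yes refl = trans (cong (∏ k g *_) e) (*-zeroʳ (∏ k g))
    ... | no i≢k = trans (cong (_* g k) (∏-zero k i (ℕₚ.≤∧≢⇒< (ℕₚ.≤-pred i<k) i≢k) e)) (*-zeroˡ (g k))
    vanish : ∀ j → j < p → j ≢ 0 → f (+ j) ≡ + 0
    vanish zero    _   0≢0 = contradiction refl 0≢0
    vanish (suc j) j<p _   = ∏-zero q j (ℕₚ.≤-pred j<p) (ℤₚ.+-inverseʳ (+ suc j))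

-- Positivity of sums, the quadratic character

∑-nonneg : ∀ k f → (∀ i → i < k → + 0 ℤ.≤ f i) → + 0 ℤ.≤ ∑ k f
∑-nonneg zero    f h = ℤₚ.≤-refl
∑-nonneg (suc k) f h = ℤₚ.+-mono-≤ (∑-nonneg k f λ i i<k → h i (ℕₚ.m<n⇒m<1+n i<k)) (h k (ℕₚ.n<1+n k))

∑-≥-term : ∀ k i f → i < k → (∀ j → j < k → + 0 ℤ.≤ f j) → f i ℤ.≤ ∑ k f
∑-≥-term (suc k) i f i<k h with i ℕ.≟ k
... | yes refl = subst (ℤ._≤ ∑ i f + f i) (ℤₚ.+-identityˡ (f i))
      (ℤₚ.+-monoˡ-≤ (f i) (∑-nonneg i f λ j j<k → h j (ℕₚ.m<n⇒m<1+n j<k)))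
... | no i≢k = subst (ℤ._≤ ∑ k f + f k) (ℤₚ.+-identityʳ (f i))
      (ℤₚ.+-mono-≤ (∑-≥-term k i f (ℕₚ.≤∧≢⇒< (ℕₚ.≤-pred i<k) i≢k) λ j j<k → h j (ℕₚ.m<n⇒m<1+n j<k)) (h k (ℕₚ.n<1+n k)))

square-nonneg : ∀ a → + 0 ℤ.≤ a * a
square-nonneg a = subst (+ 0 ℤ.≤_) (trans (pos-* ∣ a ∣ ∣ a ∣) (abs-square a)) (ℤ.+≤+ z≤n)
  where
  abs-square : ∀ a → + ∣ a ∣ * + ∣ a ∣ ≡ a * a
  abs-square (+ n)    = refl
  abs-square -[1+ n ] = identity (+ suc n)
    where
    opaque
      unfolding _*_
      identity : ∀ x → x * x ≡ - x * - x
      identity = solve-∀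

data Trit : ℤ → Set where
  zero  : Trit (+ 0)
  plus  : Trit (+ 1)
  minus : Trit (- + 1)

module Character (n : ℕ) (p-prime : Prime (suc (n ℕ.+ n))) (2<p : 2 < suc (n ℕ.+ n)) where
  q : ℕ
  q = n ℕ.+ n
  open PrimeModulus q p-prime public
  open PowerSums q p-prime public

  0<n : 0 < n
  0<n = positive n 0<q
    where
    positive : ∀ k → 0 < k ℕ.+ k → 0 < k
    positive (suc k) _ = s≤s z≤n

  n<q : n < q
  n<q = ℕₚ.m<m+n n 0<n

  ^n-sign : ∀ {a} → Unit a → a ^ n ≈ + 1 [ P ] ⊎ a ^ n ≈ - + 1 [ P ]
  ^n-sign {a} ua = [ inj₁ ∘ ≈-difference , inj₂ ∘ ≈-difference ]′ (euclid (a ^ n - + 1) (a ^ n - - + 1)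
      (lincomb₁ (+ 1) (≈-trans (≈-reflexive (sym (^-+ a n n))) (fermat-unit ua)) (identity (a ^ n))))
    where
    opaque
      unfolding _*_
      identity : ∀ x → (x - + 1) * (x - - + 1) - + 0 ≡ + 1 * (x * x - + 1)
      identity = solve-∀

  abstract
    private
      chi : ∀ {a} → Dec (a ≈ + 0 [ P ]) → Dec (a ^ n ≈ + 1 [ P ]) → ℤ
      chi (yes _) _       = + 0
      chi (no _)  (yes _) = + 1
      chi (no _)  (no _)  = - + 1

    -- The quadratic character, defined by Euler's criterion.
    χ : ℤ → ℤ
    χ a = chi (≈0? a) (≈? (a ^ n) (+ 1))

    χ-trit : ∀ a → Trit (χ a)
    χ-trit a with ≈0? a | ≈? (a ^ n) (+ 1)
    ... | yes _ | _     = zero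
    ... | no _  | yes _ = plus
    ... | no _  | no _  = minus

    χ≈ : ∀ a → χ a ≈ a ^ n [ P ]
    χ≈ a with ≈0? a | ≈? (a ^ n) (+ 1)
    ... | yes h | _     = ≈-sym (≈-trans (^-cong n h) (≈-reflexive (zero^ n 0<n)))
    ... | no _  | yes h = ≈-sym h
    ... | no u  | no ¬h = [ (λ h → contradiction h ¬h) , ≈-sym ]′ (^n-sign u)

  trit-unique : ∀ {a b} → Trit a → Trit b → a ≈ b [ P ] → a ≡ b
  trit-unique zero  zero  h = refl
  trit-unique zero  plus  h = ⊥-elim (unit-one (≈-sym h))
  trit-unique zero  minus h = ⊥-elim (unit-neg unit-one (≈-sym h))
  trit-unique plus  zero  h = ⊥-elim (unit-one h)
  trit-unique plus  plus  h = refl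
  trit-unique plus  minus h = ⊥-elim (1≉-1 2<p h)
  trit-unique minus zero  h = ⊥-elim (unit-neg unit-one h)
  trit-unique minus plus  h = ⊥-elim (1≉-1 2<p (≈-sym h))
  trit-unique minus minus h = refl

  trit-* : ∀ {a b} → Trit a → Trit b → Trit (a * b)
  trit-* {b = b} zero  _ = subst Trit (sym (*-zeroˡ b)) zero
  trit-* {b = b} plus  t = subst Trit (sym (*-identityˡ b)) t
  trit-* minus zero  = subst Trit (sym (*-zeroʳ (- + 1))) zero
  trit-* minus plus  = subst Trit (sym (*-identityʳ (- + 1))) minus
  trit-* minus minus = subst Trit identity plus
    where
    identity : + 1 ≡ - + 1 * - + 1
    identity = trans (sym (*-identityˡ (+ 1))) (square-neg (+ 1))
      where
      opaque
        unfolding _*_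
        square-neg : ∀ x → x * x ≡ - x * - x
        square-neg = solve-∀

  χ-unique : ∀ {a b} → Trit b → a ^ n ≈ b [ P ] → χ a ≡ b
  χ-unique {a} t h = trit-unique (χ-trit a) t (≈-trans (χ≈ a) h)

  χ-cong : ∀ {a b} → a ≈ b [ P ] → χ a ≡ χ b
  χ-cong {a} {b} h = χ-unique (χ-trit b) (≈-trans (^-cong n h) (≈-sym (χ≈ b)))

  χ-* : ∀ a b → χ (a * b) ≡ χ a * χ b
  χ-* a b = χ-unique (trit-* (χ-trit a) (χ-trit b))
    (≈-trans (≈-reflexive (^-distrib-* a b n)) (≈-sym (*-cong (χ≈ a) (χ≈ b))))

  χ-zero : ∀ {a} → a ≈ + 0 [ P ] → χ a ≡ + 0
  χ-zero {a} h = χ-unique {a} zero (≈-trans (^-cong n h) (≈-reflexive (zero^ n 0<n)))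

  χ-one : χ (+ 1) ≡ + 1
  χ-one = χ-unique {+ 1} plus (≈-reflexive (one^ n))

  χ-unit² : ∀ {a} → Unit a → χ a * χ a ≡ + 1
  χ-unit² {a} ua = trans (sym (χ-* a a)) (χ-unique {a * a} plus
    (≈-trans (≈-reflexive (trans (^-distrib-* a a n) (sym (^-+ a n n)))) (fermat-unit ua)))

  χ-unit : ∀ {a} → Unit a → χ a ≡ + 1 ⊎ χ a ≡ - + 1
  χ-unit {a} ua = [ inj₁ ∘ χ-unique {a} plus , inj₂ ∘ χ-unique {a} minus ]′ (^n-sign ua)

  χ²-δ : ∀ a → χ a * χ a ≡ + 1 - δ (+ 0) a
  χ²-δ a with ≈0? a
  ... | yes h = trans (cong (λ z → z * z) (χ-zero {a} h)) (trans (*-zeroˡ (+ 0))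
        (cong (λ z → + 1 - z) (sym (δ-yes {+ 0} {a} (≈-sym h)))))
  ... | no u = trans (χ-unit² {a} u) (cong (λ z → + 1 - z) (sym (δ-no {+ 0} {a} λ h → u (≈-sym h))))

  χ-periodic : Periodic (+ 0) χ
  χ-periodic h = ≈-reflexive (χ-cong h)

  nonresidue : ∃ λ g → Unit g × χ g ≡ - + 1
  nonresidue = lemma (nontrivial-power (ℕ.pred n) (subst (_< q) (sym suc-pred-n) n<q))
    where
    suc-pred : ∀ k → 0 < k → suc (ℕ.pred k) ≡ k
    suc-pred (suc k) _ = refl
    suc-pred-n : suc (ℕ.pred n) ≡ n
    suc-pred-n = suc-pred n 0<n
    lemma : (∃ λ g → Unit (+ g) × ¬ (+ g) ^ suc (ℕ.pred n) ≈ + 1 [ P ]) → ∃ λ g → Unit g × χ g ≡ - + 1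
    lemma (g , ug , h) = + g , ug , [ (λ e → ⊥-elim (h (power e))) , (λ e → e) ]′ (χ-unit ug)
      where
      power : χ (+ g) ≡ + 1 → (+ g) ^ suc (ℕ.pred n) ≈ + 1 [ P ]
      power e = ≈-trans (≈-reflexive (cong ((+ g) ^_) suc-pred-n))
        (≈-trans (≈-sym (χ≈ (+ g))) (≈-reflexive e))

  double-zero : ∀ x → x + x ≡ + 0 → x ≡ + 0
  double-zero (+ zero)  _ = refl
  double-zero (+ suc x) ()
  double-zero -[1+ x ]  ()

  ∑χ : ∑ p (λ t → χ (+ t)) ≡ + 0
  ∑χ = lemma nonresidue
    where
    s = ∑ p (λ t → χ (+ t))
    lemma : (∃ λ g → Unit g × χ g ≡ - + 1) → s ≡ + 0
    lemma (g , ug , χg) = double-zero s (linear₂ (- + 1) (+ 1) (≈-zero⇒≡ (∑-permute χ χ-periodic ug)) factor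
          (identity s (∑ p (λ t → χ (g * + t)))))
      where
      factor : ∑ p (λ t → χ (g * + t)) ≡ - + 1 * s
      factor = trans (∑-cong p λ t _ → trans (χ-* g (+ t)) (cong (_* χ (+ t)) χg)) (∑-*ˡ p (- + 1) (λ t → χ (+ t)))
      opaque
        unfolding _*_
        identity : ∀ s u → s + s - + 0 ≡ - + 1 * (u - s) + + 1 * (u - - + 1 * s)
        identity = solve-∀

  ∑χ² : ∀ a → ∑ p (λ k → χ (+ k - a) * χ (+ k - a)) ≡ + q
  ∑χ² a = trans (∑-cong p λ k _ → trans (χ²-δ (+ k - a)) (trans (cong (λ z → + 1 - z) (shift (+ k)))
                   (sym (rewrite-term (δ a (+ k))))))
    (trans (∑-+ p (λ _ → + 1) (λ k → - + 1 * (δ a (+ k) * + 1)))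
    (trans (cong₂ _+_ (∑-const p (+ 1)) (trans (∑-*ˡ p (- + 1) (λ k → δ a (+ k) * + 1))
      (cong (- + 1 *_) (≈-zero⇒≡ (∑-pick (λ _ → + 1) (λ _ → ≈-refl) a)))))
    (identity (+ q))))
    where
    opaque
      unfolding _*_
      rewrite-term : ∀ d → + 1 + - + 1 * (d * + 1) ≡ + 1 - d
      rewrite-term = solve-∀
    shift : ∀ k → δ (+ 0) (k - a) ≡ δ a k
    shift k = δ-cong (λ h → lincomb₁ (+ 1) h (forward a k)) (λ h → lincomb₁ (+ 1) h (backward a k))
      where
      opaque
        unfolding _*_
        forward : ∀ a k → a - k ≡ + 1 * (+ 0 - (k - a))
        forward = solve-∀
        backward : ∀ a k → + 0 - (k - a) ≡ + 1 * (a - k)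
        backward = solve-∀
    opaque
      unfolding _*_
      identity : ∀ q → (+ 1 + q) * + 1 + - + 1 * + 1 ≡ q
      identity = solve-∀

  -- `geo n` is the polynomial (x^n - k^n)/(x - k). If t² never met k, then `geo n` at t² would
  -- vanish for every unit t, since t^(2n) ≡ 1 ≡ k^n, and its sum over t would be the value k^(n-1)
  -- at 0. But its degree in t is below q, so the sum is 0.
  sqrt : ∀ {k} → χ k ≡ + 1 → ∃ λ r → r * r ≈ k [ P ]
  sqrt {k} χk = lemma (ℕₚ.anyUpTo? (λ t → ≈? (+ t * + t) k) p)
    where
    lemma : Dec (∃ λ t → t < p × + t * + t ≈ k [ P ]) → ∃ λ r → r * r ≈ k [ P ]
    lemma (yes (t , _ , h)) = + t , h
    lemma (no none) = ⊥-elim (unit-^ (ℕ.pred n) uk (≈-trans (≈-sym total) (vanish n ℕₚ.≤-refl)))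
     where
     uk : Unit k
     uk h = unit-one (≈-reflexive (trans (sym χk) (χ-zero h)))
     geo : ℕ → ℤ → ℤ
     geo zero    x = + 0
     geo (suc i) x = k * geo i x + x ^ i
     geo-sum : ∀ i x → (x - k) * geo i x ≡ x ^ i - k ^ i
     geo-sum zero    x = *-zeroʳ (x - k)
     geo-sum (suc i) x = linear₁ k (geo-sum i x) (identity x k (geo i x) (x ^ i) (k ^ i))
       where
       opaque
         unfolding _*_
         identity : ∀ x k g u v → (x - k) * (k * g + u) - (x * u - k * v) ≡ k * ((x - k) * g - (u - v))
         identity = solve-∀
     geo-zero : ∀ i → geo (suc i) (+ 0) ≡ k ^ i
     geo-zero zero    = trans (cong (_+ + 1) (*-zeroʳ k)) (ℤₚ.+-identityˡ (+ 1))
     geo-zero (suc i) = trans (cong₂ _+_ (cong (k *_) (geo-zero i)) (*-zeroˡ ((+ 0) ^ i))) (ℤₚ.+-identityʳ (k ^ suc i))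
     vanish : ∀ i → i ≤ n → ∑ p (λ t → geo i (+ t * + t)) ≈ + 0 [ P ]
     vanish zero    _   = ≈-reflexive (∑-zero p λ _ _ → refl)
     vanish (suc i) i<n = ≈-trans (≈-reflexive (trans
         (∑-+ p (λ t → k * geo i (+ t * + t)) (λ t → (+ t * + t) ^ i))
         (cong₂ _+_ (∑-*ˡ p k (λ t → geo i (+ t * + t))) (∑-cong p λ t _ → sq-pow (+ t) i))))
       (≈-trans (+-cong (*-congˡ k (vanish i (ℕₚ.<⇒≤ i<n))) (powerSum-low (i ℕ.+ i) (ℕₚ.+-mono-< i<n i<n)))
                (≈-reflexive (trans (ℤₚ.+-identityʳ (k * + 0)) (*-zeroʳ k))))
     suc-pred : ∀ j → 0 < j → suc (ℕ.pred j) ≡ j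
     suc-pred (suc j) _ = refl
     total : ∑ p (λ t → geo n (+ t * + t)) ≈ k ^ ℕ.pred n [ P ]
     total = ≈-trans (≈-reflexive (∑-head q (λ t → geo n (+ t * + t)))) (≈-trans
       (+-cong (≈-reflexive (trans (cong (geo n) (*-zeroˡ (+ 0))) (trans (cong (λ j → geo j (+ 0)) (sym (suc-pred n 0<n))) (geo-zero (ℕ.pred n)))))
         (≈-trans (∑-≈ q λ i i<q → nonroot (suc i) (s≤s z≤n) (s≤s i<q)) (≈-reflexive (∑-zero q λ _ _ → refl))))
       (≈-reflexive (ℤₚ.+-identityʳ (k ^ ℕ.pred n))))
       where
       nonroot : ∀ t → 0 < t → t < p → geo n (+ t * + t) ≈ + 0 [ P ]
       nonroot t 0<t t<p = [ (λ h → ⊥-elim (none (t , t<p , ≈-difference h))) , (λ h → h) ]′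
         (euclid (+ t * + t - k) (geo n (+ t * + t)) (≈-trans (≈-reflexive (geo-sum n (+ t * + t)))
           (lincomb₃ (+ 1) (+ 1) (- + 1) (≈-trans (≈-reflexive (sq-pow (+ t) n)) (fermat-unit (unit-small 0<t t<p)))
              (χ≈ k) (≈-reflexive χk) (identity ((+ t * + t) ^ n) (k ^ n) (χ k)))))
         where
         opaque
           unfolding _*_
           identity : ∀ u v c → u - v - + 0 ≡ + 1 * (u - + 1) + + 1 * (c - v) + - + 1 * (c - + 1)
           identity = solve-∀

∑-product : ∀ j k f g → ∑ j f * ∑ k g ≡ ∑ j (λ s → ∑ k (λ t → f s * g t))
∑-product zero    k f g = *-zeroˡ (∑ k g)
∑-product (suc j) k f g = trans (*-distribʳ-+ (∑ k g) (∑ j f) (f j))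
  (cong₂ _+_ (∑-product j k f g) (sym (∑-*ˡ k (f j) g)))

-- Signs modulo 4, uniqueness of p = x² + y²

1≉0-mod2 : ¬ + 1 ≈ + 0 [ + 2 ]
1≉0-mod2 (by k e) = impossible ∣ k ∣ (trans (cong ∣_∣ e) (abs-* k (+ 2)))
  where
  impossible : ∀ j → 1 ≢ j ℕ.* 2
  impossible zero    ()
  impossible (suc j) ()

1≉-1-mod4 : ¬ + 1 ≈ - + 1 [ + 4 ]
1≉-1-mod4 (by k e) = impossible ∣ k ∣ (trans (cong ∣_∣ e) (abs-* k (+ 4)))
  where
  impossible : ∀ j → 2 ≢ j ℕ.* 4
  impossible zero    ()
  impossible (suc j) ()

Sign± : ℤ → Set
Sign± ε = ε ≡ + 1 ⊎ ε ≡ - + 1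

sign±-* : ∀ {ε η} → Sign± ε → Sign± η → Sign± (ε * η)
sign±-* {η = η} (inj₁ refl) s = subst Sign± (sym (*-identityˡ η)) s
sign±-* (inj₂ refl) (inj₁ refl) = inj₂ (*-identityʳ (- + 1))
sign±-* (inj₂ refl) (inj₂ refl) = inj₁ (trans (identity (+ 1)) (*-identityˡ (+ 1)))
  where
  opaque
    unfolding _*_
    identity : ∀ x → - x * - x ≡ x * x
    identity = solve-∀

sign±-sgn : ∀ k → Sign± (sgn k)
sign±-sgn zero    = inj₁ refl
sign±-sgn (suc k) = [ (λ e → inj₂ (cong -_ e)) , (λ e → inj₁ (cong -_ e)) ]′ (sign±-sgn k)

complement-product : ∀ {ε η} → Sign± ε → Sign± η → (+ 1 - ε) * (+ 1 - η) ≈ + 0 [ + 4 ]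
complement-product {η = η} (inj₁ refl) _ = ≈-reflexive (*-zeroˡ (+ 1 - η))
complement-product (inj₂ refl) (inj₁ refl) = ≈-reflexive (*-zeroʳ (+ 2))
complement-product (inj₂ refl) (inj₂ refl) = ≈-trans (≈-reflexive (identity (+ 1))) multiplied
  where
  opaque
    unfolding _*_
    identity : ∀ x → (x + x) * (x + x) ≡ x * (+ 4 * x)
    identity = solve-∀
  multiplied : + 1 * (+ 4 * + 1) ≈ + 0 [ + 4 ]
  multiplied = ≈-trans (≈-reflexive (trans (*-identityˡ (+ 4 * + 1)) (*-identityʳ (+ 4)))) modulus≈0

∏-sign± : ∀ N {ε : ℕ → ℤ} → (∀ i → i < N → Sign± (ε i)) → Sign± (∏ N ε)
∏-sign± zero    h = inj₁ refl
∏-sign± (suc N) h = sign±-* (∏-sign± N λ i i<N → h i (ℕₚ.m<n⇒m<1+n i<N)) (h N (ℕₚ.n<1+n N))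

-- For two signs (1 - a)(1 - b) is a multiple of 4, so ab ≡ a + b - 1 and sums of signs can be
-- traded for products.
∑-signs : ∀ N (ε : ℕ → ℤ) → (∀ i → i < N → Sign± (ε i)) → ∑ N ε ≈ + N - + 1 + ∏ N ε [ + 4 ]
∑-signs zero    ε h = ≈-refl
∑-signs (suc N) ε h = lincomb₂ (+ 1) (- + 1) (∑-signs N ε h′) (complement-product (∏-sign± N h′) (h N (ℕₚ.n<1+n N)))
  (identity (∑ N ε) (+ N) (∏ N ε) (ε N))
  where
  h′ : ∀ i → i < N → Sign± (ε i)
  h′ i i<N = h i (ℕₚ.m<n⇒m<1+n i<N)
  opaque
    unfolding _*_
    identity : ∀ s N π e → s + e - (+ 1 + N - + 1 + π * e) ≡
      + 1 * (s - (N - + 1 + π)) + - + 1 * ((+ 1 - π) * (+ 1 - e) - + 0)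
    identity = solve-∀

double-sgn : ∀ m → + m + + m ≈ + 1 - sgn m [ + 4 ]
double-sgn zero    = ≈-refl
double-sgn (suc m) = lincomb₂ (+ 1) (+ 1) (double-sgn m) (complement-product (inj₂ refl) (sign±-sgn m))
  (identity (+ m) (sgn m))
  where
  opaque
    unfolding _*_
    identity : ∀ m s → (+ 1 + m) + (+ 1 + m) - (+ 1 - - s) ≡
      + 1 * (m + m - (+ 1 - s)) + + 1 * ((+ 1 - - + 1) * (+ 1 - s) - + 0)
    identity = solve-∀

module TwoSquares {q : ℕ} (p-prime : Prime (suc q)) where
  open PrimeModulus q p-prime

  private
    product-zero : ∀ a b → a * b ≡ + 0 → a ≡ + 0 ⊎ b ≡ + 0
    product-zero a b e = ℤₚ.i*j≡0⇒i≡0∨j≡0 a (trans (sym (*≡ℤ* a b)) e)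

    cancel-P : ∀ {a b} → P * a ≡ P * b → a ≡ b
    cancel-P {a} {b} e = [ (λ ()) , ℤₚ.i-j≡0⇒i≡j a b ]′ (product-zero P (a - b)
      (linear₁ (+ 1) e (identity P a b)))
      where
      opaque
        unfolding _*_
        identity : ∀ P a b → P * (a - b) - + 0 ≡ + 1 * (P * a - P * b)
        identity = solve-∀

    square-equal : ∀ a b → a * a ≡ b * b → a ≡ b ⊎ a ≡ - b
    square-equal a b e = [ inj₁ ∘ ℤₚ.i-j≡0⇒i≡j a b , inj₂ ∘ ℤₚ.i-j≡0⇒i≡j a (- b) ]′
      (product-zero (a - b) (a - - b) (linear₁ (+ 1) e (identity a b)))
      where
      opaque
        unfolding _*_
        identity : ∀ a b → (a - b) * (a - - b) - + 0 ≡ + 1 * (a * a - b * b)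
        identity = solve-∀

    large-quotient : ∀ k v c → c * c ≡ (+ 2 + + k) * (+ 2 + + k) → v * v ≡ P * P * (+ 1 - c * c) → ⊥
    large-quotient k v c e h = absurd (square-nonneg v) (trans h (trans
        (linear₁ (- (P * P)) e (identity P (c * c) (+ k)))
        (cong -_ (trans (cong₂ (λ z w → P * P * (+ 3 + z + w)) (sym (pos-* 4 k)) (sym (pos-* k k)))
          (trans (cong (_* + (3 ℕ.+ 4 ℕ.* k ℕ.+ k ℕ.* k)) (sym (pos-* p p))) (sym (pos-* (p ℕ.* p) (3 ℕ.+ 4 ℕ.* k ℕ.+ k ℕ.* k))))))))
      where
      absurd : ∀ {a j} → + 0 ℤ.≤ a → a ≡ - (+ suc j) → ⊥
      absurd (ℤ.+≤+ _) ()
      opaque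
        unfolding _*_
        identity : ∀ P C k → P * P * (+ 1 - C) - - (P * P * (+ 3 + + 4 * k + k * k)) ≡
          - (P * P) * (C - (+ 2 + k) * (+ 2 + k))
        identity = solve-∀

  module _ (A x y : ℤ) (xy : P ≡ x * x + y * y) where

    private
      -- Brahmagupta's identity gives p² = u² + v², and u = cp leaves only c = 0, 1, -1. For c = 0
      -- one has v = p or -p, otherwise v = 0; then pA = xu + yv determines A.
      from-divisor : ∀ B → P ≡ A * A + B * B → A * x + B * y ≈ + 0 [ P ] →
                     (A ≡ x ⊎ A ≡ - x) ⊎ (A ≡ y ⊎ A ≡ - y)
      from-divisor B AB (by c e) = by-quotient c e
        where
        u = A * x + B * y
        v = A * y - B * x
        brahmagupta : P * P ≡ u * u + v * v
        brahmagupta = trans (cong₂ _*_ AB xy) (identity A B x y)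
          where
          opaque
            unfolding _*_
            identity : ∀ A B x y → (A * A + B * B) * (x * x + y * y) ≡
              (A * x + B * y) * (A * x + B * y) + (A * y - B * x) * (A * y - B * x)
            identity = solve-∀
        norm : ∀ c → u - + 0 ≡ c * P → v * v ≡ P * P * (+ 1 - c * c)
        norm c e = linear₂ (- + 1) (- (u + c * P)) brahmagupta e (identity P u v c)
          where
          opaque
            unfolding _*_
            identity : ∀ P u v c → v * v - P * P * (+ 1 - c * c) ≡
              - + 1 * (P * P - (u * u + v * v)) + - (u + c * P) * (u - + 0 - c * P)
            identity = solve-∀
        PA : P * A ≡ x * u + y * v
        PA = trans (cong (_* A) xy) (identity A B x y)
          where
          opaque
            unfolding _*_
            identity : ∀ A B x y → (x * x + y * y) * A ≡ x * (A * x + B * y) + y * (A * y - B * x)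
            identity = solve-∀
        solve-A : ∀ c d z → u - + 0 ≡ c * P → v ≡ d * P → (x * c + y * d) ≡ z → A ≡ z
        solve-A c d z eu ev ez = cancel-P (trans PA (trans (linear₂ x y eu ev (identity P x y c d u v)) (cong (P *_) ez)))
          where
          opaque
            unfolding _*_
            identity : ∀ P x y c d u v → x * u + y * v - P * (x * c + y * d) ≡ x * (u - + 0 - c * P) + y * (v - d * P)
            identity = solve-∀
        v-zero : v * v ≡ P * P * + 0 → v ≡ + 0 * P
        v-zero h = [ (λ z → trans z (sym (*-zeroˡ P))) , (λ z → trans z (sym (*-zeroˡ P))) ]′
          (product-zero v v (trans h (*-zeroʳ (P * P))))
        opaque
          unfolding _*_
          combine₁ : ∀ x y → x * + 1 + y * + 0 ≡ x
          combine₁ = solve-∀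
          combine₂ : ∀ x y → x * - + 1 + y * + 0 ≡ - x
          combine₂ = solve-∀
          combine₃ : ∀ x y → x * + 0 + y * + 1 ≡ y
          combine₃ = solve-∀
          combine₄ : ∀ x y → x * + 0 + y * - + 1 ≡ - y
          combine₄ = solve-∀
          minus-P : ∀ P → - P ≡ - + 1 * P
          minus-P = solve-∀
          square-neg : ∀ x → x * x ≡ - x * - x
          square-neg = solve-∀
        by-quotient : ∀ c → u - + 0 ≡ c * P → (A ≡ x ⊎ A ≡ - x) ⊎ (A ≡ y ⊎ A ≡ - y)
        by-quotient (+ 0) e = inj₂ ([ (λ h → inj₁ (solve-A (+ 0) (+ 1) y e (trans h (sym (*-identityˡ P))) (combine₃ x y)))
                                    , (λ h → inj₂ (solve-A (+ 0) (- + 1) (- y) e (trans h (minus-P P)) (combine₄ x y))) ]′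
          (square-equal v P (trans (norm (+ 0) e) (trans (cong (λ z → P * P * (+ 1 - z)) (*-zeroˡ (+ 0))) (*-identityʳ (P * P))))))
        by-quotient (+ 1) e = inj₁ (inj₁ (solve-A (+ 1) (+ 0) x e
          (v-zero (trans (norm (+ 1) e) (cong (λ z → P * P * (+ 1 - z)) (*-identityˡ (+ 1))))) (combine₁ x y)))
        by-quotient (+ suc (suc k)) e = ⊥-elim (large-quotient k v (+ suc (suc k)) refl (norm (+ suc (suc k)) e))
        by-quotient -[1+ 0 ] e = inj₁ (inj₂ (solve-A (- + 1) (+ 0) (- x) e
          (v-zero (trans (norm (- + 1) e) (cong (λ z → P * P * (+ 1 - z)) (trans (sym (square-neg (+ 1))) (*-identityˡ (+ 1)))))) (combine₂ x y)))
        by-quotient -[1+ suc k ] e = ⊥-elim (large-quotient k v -[1+ suc k ] (sym (square-neg (+ suc (suc k)))) (norm -[1+ suc k ] e))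

    -- Since A² ≡ -B² and x² ≡ -y², the number A²x² - B²y² is divisible by p, hence one of Ax + By
    -- and Ax - By is. A change of sign of B exchanges the two cases.
    two-squares-unique : ∀ B → P ≡ A * A + B * B → (A ≡ x ⊎ A ≡ - x) ⊎ (A ≡ y ⊎ A ≡ - y)
    two-squares-unique B AB = [ (λ h → from-divisor (- B) (trans AB (cong (λ z → A * A + z) (square-neg B)))
                                          (≈-trans (≈-reflexive (negate A B x y)) h))
                              , from-divisor B AB ]′ (euclid (A * x - B * y) (A * x + B * y) product≈0)
      where
      opaque
        unfolding _*_
        square-neg : ∀ x → x * x ≡ - x * - x
        square-neg = solve-∀
        negate : ∀ A B x y → A * x + - B * y ≡ A * x - B * y
        negate = solve-∀
      product≈0 : (A * x - B * y) * (A * x + B * y) ≈ + 0 [ P ]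
      product≈0 = lincomb₃ (A * A - y * y) (- (A * A)) (y * y)
        modulus≈0 (≈-reflexive xy) (≈-reflexive AB) (identity P A B x y)
        where
        opaque
          unfolding _*_
          identity : ∀ P A B x y → (A * x - B * y) * (A * x + B * y) - + 0 ≡
            (A * A - y * y) * (P - + 0) + - (A * A) * (P - (x * x + y * y)) + y * y * (P - (A * A + B * B))
          identity = solve-∀

-- Jacobsthal sums

module Jacobsthal (m : ℕ) (p-prime : Prime (suc ((m ℕ.+ m) ℕ.+ (m ℕ.+ m)))) (2<p : 2 < suc ((m ℕ.+ m) ℕ.+ (m ℕ.+ m))) where
  n : ℕ
  n = m ℕ.+ m

  open Character n p-prime 2<p public

  χ-neg-one : χ (- + 1) ≡ + 1
  χ-neg-one = χ-unique { - + 1 } plus (≈-reflexive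
    (trans (neg^ (+ 1) n) (trans (cong₂ _*_ (sgn-double m) (one^ n)) (*-identityˡ (+ 1)))))

  χ-neg : ∀ a → χ (- a) ≡ χ a
  χ-neg a = trans (cong χ (neg-mul a)) (trans (χ-* (- + 1) a) (trans (cong (_* χ a) χ-neg-one) (*-identityˡ (χ a))))
    where
    opaque
      unfolding _*_
      neg-mul : ∀ a → - a ≡ - + 1 * a
      neg-mul = solve-∀

  -- For a unit k this is, up to sign, the trace of Frobenius of the curve s² = kt - t³.
  jacobsthal : ℤ → ℤ
  jacobsthal k = ∑ p (λ t → χ (+ t) * χ (k - + t * + t))

  jacobsthal-cong : ∀ {k l} → k ≈ l [ P ] → jacobsthal k ≡ jacobsthal l
  jacobsthal-cong {k} {l} h = ∑-cong p λ t _ → cong (χ (+ t) *_) (χ-cong (sub-cong h (≈-refl {a = + t * + t})))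

  jacobsthal-scale : ∀ {r} k → Unit r → jacobsthal (r * r * k) ≡ χ r * jacobsthal k
  jacobsthal-scale {r} k ur = trans (sym (≈-zero⇒≡ (∑-permute f periodic ur)))
    (trans (∑-cong p λ t _ → pointwise (+ t)) (∑-*ˡ p (χ r) (λ t → χ (+ t) * χ (k - + t * + t))))
    where
    f : ℤ → ℤ
    f t = χ t * χ (r * r * k - t * t)
    periodic : Periodic (+ 0) f
    periodic {a} {b} h = ≈-reflexive (cong₂ _*_ (χ-cong h) (χ-cong (sub-cong (≈-refl {a = r * r * k}) (*-cong h h))))
    pointwise : ∀ t → f (r * t) ≡ χ r * (χ t * χ (k - t * t))
    pointwise t = trans (cong₂ _*_ (χ-* r t) (trans (cong χ (factor r k t)) (trans (χ-* (r * r) (k - t * t))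
        (trans (cong (_* χ (k - t * t)) (trans (χ-* r r) (χ-unit² ur))) (*-identityˡ (χ (k - t * t)))))))
        (*-assoc (χ r) (χ t) (χ (k - t * t)))
      where
      opaque
        unfolding _*_
        factor : ∀ r k t → r * r * k - r * t * (r * t) ≡ r * r * (k - t * t)
        factor = solve-∀

  correlation : ℤ → ℤ → ℤ
  correlation a b = ∑ p (λ k → χ (+ k - a) * χ (+ k - b))

  correlation-equal : ∀ {a b} → a ≈ b [ P ] → correlation a b ≡ + q
  correlation-equal {a} {b} h = trans
    (∑-cong p λ k _ → cong (χ (+ k - a) *_) (χ-cong (sub-cong (≈-refl {a = + k}) (≈-sym h)))) (∑χ² a)

  correlation-mod : ∀ a b → correlation a b ≈ - + 1 [ P ]
  correlation-mod a b = ≈-trans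
    (∑-≈ p λ k _ → ≈-trans (*-cong (χ≈ (+ k - a)) (χ≈ (+ k - b))) (≈-reflexive (cong (_* (+ k - b) ^ n) (sym (*-identityˡ ((+ k - a) ^ n))))))
    (∑-monic {λ x → + 1 * (x - a) ^ n * (x - b) ^ n}
      (subst (λ d → Monic d (λ x → + 1 * (x - a) ^ n * (x - b) ^ n)) (cong (n ℕ.+_) (ℕₚ.+-identityʳ n))
        (monic-power b n (monic-power a n monic-one))))

  -- The sum Q is -1 modulo p, so bounds suffice. ∑ (f - g)² = 2q - 2Q is at least 1, because its
  -- term at k = a is the square of a nonzero character value, and ∑ (f + g)² = 2q + 2Q is
  -- nonnegative. Hence -q ≤ Q < q.
  correlation-distinct : ∀ {a b} → ¬ a ≈ b [ P ] → correlation a b ≡ - + 1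
  correlation-distinct {a} {b} a≉b = by-quotient (_≈_[_].quot (correlation-mod a b)) (_≈_[_].eq (correlation-mod a b))
    where
    Q = correlation a b
    f g : ℕ → ℤ
    f k = χ (+ k - a)
    g k = χ (+ k - b)
    ∑-sub-square : ∑ p (λ k → (f k - g k) * (f k - g k)) ≡ + q + + q + - + 2 * Q
    ∑-sub-square = trans (∑-cong p λ k _ → expand (f k) (g k)) (trans
      (∑-+ p (λ k → f k * f k + g k * g k) (λ k → - + 2 * (f k * g k)))
      (cong₂ _+_ (trans (∑-+ p (λ k → f k * f k) (λ k → g k * g k)) (cong₂ _+_ (∑χ² a) (∑χ² b))) (∑-*ˡ p (- + 2) (λ k → f k * g k))))
      where
      opaque
        unfolding _*_
        expand : ∀ u v → (u - v) * (u - v) ≡ u * u + v * v + - + 2 * (u * v)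
        expand = solve-∀
    ∑-add-square : ∑ p (λ k → (f k + g k) * (f k + g k)) ≡ + q + + q + + 2 * Q
    ∑-add-square = trans (∑-cong p λ k _ → expand (f k) (g k)) (trans
      (∑-+ p (λ k → f k * f k + g k * g k) (λ k → + 2 * (f k * g k)))
      (cong₂ _+_ (trans (∑-+ p (λ k → f k * f k) (λ k → g k * g k)) (cong₂ _+_ (∑χ² a) (∑χ² b))) (∑-*ˡ p (+ 2) (λ k → f k * g k))))
      where
      opaque
        unfolding _*_
        expand : ∀ u v → (u + v) * (u + v) ≡ u * u + v * v + + 2 * (u * v)
        expand = solve-∀
    1≤sub : + 1 ℤ.≤ + q + + q + - + 2 * Q
    1≤sub = subst (+ 1 ℤ.≤_) ∑-sub-square (subst (ℤ._≤ ∑ p (λ k → (f k - g k) * (f k - g k))) term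
      (∑-≥-term p (res a) (λ k → (f k - g k) * (f k - g k)) (res<p a) λ k _ → square-nonneg (f k - g k)))
      where
      term : (f (res a) - g (res a)) * (f (res a) - g (res a)) ≡ + 1
      term = trans (cong (λ z → (z - g (res a)) * (z - g (res a)))
          (χ-zero {+ res a - a} (difference≈0 (≈-sym (≈-res a)))))
        (trans (drop-zero (g (res a))) (χ-unit² {+ res a - b} λ h → a≉b (≈-trans (≈-res a) (≈-difference h))))
        where
        opaque
          unfolding _*_
          drop-zero : ∀ z → (+ 0 - z) * (+ 0 - z) ≡ z * z
          drop-zero = solve-∀
    0≤add : + 0 ℤ.≤ + q + + q + + 2 * Q
    0≤add = subst (+ 0 ℤ.≤_) ∑-add-square (∑-nonneg p (λ k → (f k + g k) * (f k + g k)) λ k _ → square-nonneg (f k + g k))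
    not-neg : ∀ {z k} → z ℤ.≤ - + k → + 1 ℤ.≤ z → ⊥
    not-neg {k = zero}  h h′ = case ℤₚ.≤-trans h′ h of λ { (ℤ.+≤+ ()) }
    not-neg {k = suc k} h h′ = case ℤₚ.≤-trans h′ h of λ ()
    not-neg₀ : ∀ {z k} → z ≡ - + suc k → + 0 ℤ.≤ z → ⊥
    not-neg₀ refl ()
    by-quotient : ∀ w → Q - - + 1 ≡ w * P → Q ≡ - + 1
    by-quotient (+ zero)  e = ℤₚ.i-j≡0⇒i≡j Q (- + 1) (trans e (*-zeroˡ P))
    by-quotient (+ suc w) e = ⊥-elim (not-neg {k = 2 ℕ.* (w ℕ.* p)} (ℤₚ.≤-reflexive (trans
      (linear₁ (- + 2) e (identity (+ q) (+ w) Q)) (cong -_ (sym (trans (pos-* 2 (w ℕ.* p)) (cong (+ 2 *_) (pos-* w p))))))) 1≤sub)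
      where
      opaque
        unfolding _*_
        identity : ∀ q w Q → q + q + - + 2 * Q - - (+ 2 * (w * (+ 1 + q))) ≡ - + 2 * (Q - - + 1 - (+ 1 + w) * (+ 1 + q))
        identity = solve-∀
    by-quotient -[1+ w ] e = ⊥-elim (not-neg₀ {k = 3 ℕ.+ 2 ℕ.* (w ℕ.* p)} (trans
      (linear₁ (+ 2) e (identity (+ q) (+ w) Q)) (cong (λ z → - (+ 4 + z)) (sym (trans (pos-* 2 (w ℕ.* p)) (cong (+ 2 *_) (pos-* w p)))))) 0≤add)
      where
      opaque
        unfolding _*_
        identity : ∀ q w Q → q + q + + 2 * Q - - (+ 4 + + 2 * (w * (+ 1 + q))) ≡ + 2 * (Q - - + 1 - - (+ 1 + w) * (+ 1 + q))
        identity = solve-∀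

  correlation-δ : ∀ a b → correlation a b ≡ P * δ a b - + 1
  correlation-δ a b with ≈? a b
  ... | yes h = trans (correlation-equal h) (trans (identity (+ q)) (cong (λ z → P * z - + 1) (sym (δ-yes h))))
    where
    opaque
      unfolding _*_
      identity : ∀ q → q ≡ (+ 1 + q) * + 1 - + 1
      identity = solve-∀
  ... | no ¬h = trans (correlation-distinct ¬h) (trans (identity P) (cong (λ z → P * z - + 1) (sym (δ-no ¬h))))
    where
    opaque
      unfolding _*_
      identity : ∀ P → - + 1 ≡ P * + 0 - + 1
      identity = solve-∀

  private
    c : ℕ → ℤ
    c t = χ (+ t)
    sq : ℕ → ℤ
    sq t = + t * + t

  ∑-same-square : ∀ s → c s * ∑ p (λ t → c t * δ (sq s) (sq t)) ≡ + 2 * (c s * c s)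
  ∑-same-square s with ≈0? (+ s)
  ... | yes h = trans (cong (_* ∑ p (λ t → c t * δ (sq s) (sq t))) (χ-zero h))
        (trans (*-zeroˡ _) (trans (sym (trans (cong (+ 2 *_) (*-zeroʳ (c s))) (*-zeroʳ (+ 2)))) (cong (λ z → + 2 * (c s * z)) (sym (χ-zero h)))))
  ... | no us = trans (cong (c s *_) (trans
      (∑-cong p λ t _ → trans (cong (c t *_) (split t)) (distribute (c t) (δ (+ s) (+ t)) (δ (- + s) (+ t))))
      (trans (∑-+ p (λ t → δ (+ s) (+ t) * c t) (λ t → δ (- + s) (+ t) * c t))
        (cong₂ _+_ (≈-zero⇒≡ (∑-pick χ χ-periodic (+ s))) (trans (≈-zero⇒≡ (∑-pick χ χ-periodic (- + s))) (χ-neg (+ s)))))))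
      (identity (c s))
    where
    opaque
      unfolding _*_
      distribute : ∀ c d e → c * (d + e) ≡ d * c + e * c
      distribute = solve-∀
      identity : ∀ c → c * (c + c) ≡ + 2 * (c * c)
      identity = solve-∀
    same-square : ∀ t → sq s ≈ sq t [ P ] → + s ≈ + t [ P ] ⊎ - + s ≈ + t [ P ]
    same-square t h = [ inj₁ ∘ ≈-difference , (λ k → inj₂ (lincomb₁ (- + 1) k (negate (+ s) (+ t)))) ]′
      (euclid (+ s - + t) (+ s + + t) (lincomb₁ (+ 1) h (factor (+ s) (+ t))))
      where
      opaque
        unfolding _*_
        factor : ∀ s t → (s - t) * (s + t) - + 0 ≡ + 1 * (s * s - t * t)
        factor = solve-∀
        negate : ∀ s t → - s - t ≡ - + 1 * (s + t - + 0)
        negate = solve-∀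
    2-unit : Unit (+ 2)
    2-unit = unit-small (s≤s z≤n) 2<p
    not-both : ∀ t → + s ≈ + t [ P ] → - + s ≈ + t [ P ] → ⊥
    not-both t h k = unit-* 2-unit us (lincomb₂ (+ 1) (- + 1) h k (identity′ (+ s) (+ t)))
      where
      opaque
        unfolding _*_
        identity′ : ∀ s t → + 2 * s - + 0 ≡ + 1 * (s - t) + - + 1 * (- s - t)
        identity′ = solve-∀
    opaque
      unfolding _*_
      square-neg : ∀ x → - x * - x ≡ x * x
      square-neg = solve-∀
    split : ∀ t → δ (sq s) (sq t) ≡ δ (+ s) (+ t) + δ (- + s) (+ t)
    split t with ≈? (+ s) (+ t) | ≈? (- + s) (+ t)
    ... | yes h | yes k = ⊥-elim (not-both t h k)
    ... | yes h | no ¬k = trans (δ-yes (*-cong h h)) (sym (cong₂ _+_ (δ-yes h) (δ-no ¬k)))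
    ... | no ¬h | yes k = trans (δ-yes (≈-trans (≈-reflexive (sym (square-neg (+ s)))) (*-cong k k)))
                            (sym (cong₂ _+_ (δ-no ¬h) (δ-yes k)))
    ... | no ¬h | no ¬k = trans (δ-no λ e → [ ¬h , ¬k ]′ (same-square t e)) (sym (cong₂ _+_ (δ-no ¬h) (δ-no ¬k)))

  -- Expand the square and sum over k first: the inner sum is the correlation pδ - 1 of s² and t².
  -- The -1 yields a multiple of ∑ χ = 0, and s² ≡ t² leaves t = s and t = -s.
  jacobsthal-moment : ∑ p (λ k → jacobsthal (+ k) * jacobsthal (+ k)) ≡ P * (+ 2 * + q)
  jacobsthal-moment = begin
    ∑ p (λ k → jacobsthal (+ k) * jacobsthal (+ k))
      ≡⟨ ∑-cong p (λ k _ → ∑-product p p (λ t → c t * u k t) (λ t → c t * u k t)) ⟩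
    ∑ p (λ k → ∑ p (λ s → ∑ p (λ t → (c s * u k s) * (c t * u k t))))
      ≡⟨ ∑-swap p p (λ k s → ∑ p (λ t → (c s * u k s) * (c t * u k t))) ⟩
    ∑ p (λ s → ∑ p (λ k → ∑ p (λ t → (c s * u k s) * (c t * u k t))))
      ≡⟨ ∑-cong p (λ s _ → ∑-swap p p (λ k t → (c s * u k s) * (c t * u k t))) ⟩
    ∑ p (λ s → ∑ p (λ t → ∑ p (λ k → (c s * u k s) * (c t * u k t))))
      ≡⟨ ∑-cong p (λ s _ → ∑-cong p λ t _ → inner s t) ⟩
    ∑ p (λ s → ∑ p (λ t → P * c s * (c t * δ (sq s) (sq t)) + - + 1 * (c s * c t)))
      ≡⟨ ∑-cong p (λ s _ → middle s) ⟩
    ∑ p (λ s → P * + 2 * (c s * c s) + - + 1 * (c s * ∑ p c))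
      ≡⟨ ∑-+ p (λ s → P * + 2 * (c s * c s)) (λ s → - + 1 * (c s * ∑ p c)) ⟩
    ∑ p (λ s → P * + 2 * (c s * c s)) + ∑ p (λ s → - + 1 * (c s * ∑ p c))
      ≡⟨ cong₂ _+_ (trans (∑-*ˡ p (P * + 2) (λ s → c s * c s)) (cong (P * + 2 *_) ∑c²))
           (∑-zero p λ s _ → trans (cong (λ z → - + 1 * (c s * z)) ∑χ) (trans (cong (- + 1 *_) (*-zeroʳ (c s))) (*-zeroʳ (- + 1)))) ⟩
    P * + 2 * + q + + 0
      ≡⟨ trans (ℤₚ.+-identityʳ _) (*-assoc P (+ 2) (+ q)) ⟩
    P * (+ 2 * + q) ∎
    where
    open ≡-Reasoning
    u : ℕ → ℕ → ℤ
    u k t = χ (+ k - sq t)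
    ∑c² : ∑ p (λ s → c s * c s) ≡ + q
    ∑c² = trans (∑-cong p λ s _ → cong (λ z → χ z * χ z) (sym (ℤₚ.+-identityʳ (+ s)))) (∑χ² (+ 0))
    opaque
      unfolding _*_
      regroup : ∀ a b x y → (a * x) * (b * y) ≡ a * b * (x * y)
      regroup = solve-∀
      expand : ∀ P a b d → a * b * (P * d - + 1) ≡ P * a * (b * d) + - + 1 * (a * b)
      expand = solve-∀
    inner : ∀ s t → ∑ p (λ k → (c s * u k s) * (c t * u k t)) ≡ P * c s * (c t * δ (sq s) (sq t)) + - + 1 * (c s * c t)
    inner s t = trans (∑-cong p λ k _ → regroup (c s) (c t) (u k s) (u k t))
      (trans (∑-*ˡ p (c s * c t) (λ k → u k s * u k t))
      (trans (cong (c s * c t *_) (correlation-δ (sq s) (sq t))) (expand P (c s) (c t) (δ (sq s) (sq t)))))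
    middle : ∀ s → ∑ p (λ t → P * c s * (c t * δ (sq s) (sq t)) + - + 1 * (c s * c t)) ≡ P * + 2 * (c s * c s) + - + 1 * (c s * ∑ p c)
    middle s = trans (∑-+ p (λ t → P * c s * (c t * δ (sq s) (sq t))) (λ t → - + 1 * (c s * c t)))
      (cong₂ _+_ (trans (∑-*ˡ p (P * c s) (λ t → c t * δ (sq s) (sq t)))
                   (trans (*-assoc P (c s) _) (trans (cong (P *_) (∑-same-square s)) (sym (*-assoc P (+ 2) (c s * c s))))))
                 (trans (∑-*ˡ p (- + 1) (λ t → c s * c t)) (cong (- + 1 *_) (∑-*ˡ p (c s) c))))

  private
    product-zero : ∀ a b → a * b ≡ + 0 → a ≡ + 0 ⊎ b ≡ + 0
    product-zero a b e = ℤₚ.i*j≡0⇒i≡0∨j≡0 a (trans (sym (*≡ℤ* a b)) e)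

  -- Three cases (0 at k ≡ 0, S² on squares, T² on nonsquares) in one expression linear in 1, χ and
  -- δ, so that it can be summed over k.
  jacobsthal-square : ∀ {ν} → Unit ν → χ ν ≡ - + 1 → ∀ k → let S = jacobsthal (+ 1); T = jacobsthal ν in
    + 2 * (jacobsthal k * jacobsthal k) ≡
    (+ 1 + χ k) * (S * S) + (+ 1 - χ k) * (T * T) + - (S * S + T * T) * (δ (+ 0) k * + 1)
  jacobsthal-square {ν} uν χν k = by-cases (≈0? k)
    where
    S = jacobsthal (+ 1)
    T = jacobsthal ν
    J = jacobsthal k
    zero-case : ∀ A B d χ → d ≡ + 1 → χ ≡ + 0 → + 2 * (+ 0 * + 0) ≡ (+ 1 + χ) * A + (+ 1 - χ) * B + - (A + B) * (d * + 1)
    zero-case A B _ _ refl refl = identity A B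
      where
      opaque
        unfolding _*_
        identity : ∀ A B → + 2 * (+ 0 * + 0) ≡ (+ 1 + + 0) * A + (+ 1 - + 0) * B + - (A + B) * (+ 1 * + 1)
        identity = solve-∀
    unit-case : ∀ A B d χ → d ≡ + 0 → χ ≡ + 1 → + 2 * A ≡ (+ 1 + χ) * A + (+ 1 - χ) * B + - (A + B) * (d * + 1)
    unit-case A B _ _ refl refl = identity A B
      where
      opaque
        unfolding _*_
        identity : ∀ A B → + 2 * A ≡ (+ 1 + + 1) * A + (+ 1 - + 1) * B + - (A + B) * (+ 0 * + 1)
        identity = solve-∀
    nonunit-case : ∀ A B d χ → d ≡ + 0 → χ ≡ - + 1 → + 2 * B ≡ (+ 1 + χ) * A + (+ 1 - χ) * B + - (A + B) * (d * + 1)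
    nonunit-case A B _ _ refl refl = identity A B
      where
      opaque
        unfolding _*_
        identity : ∀ A B → + 2 * B ≡ (+ 1 + - + 1) * A + (+ 1 - - + 1) * B + - (A + B) * (+ 0 * + 1)
        identity = solve-∀
    square-scale : ∀ c x → c * c ≡ + 1 → c * x * (c * x) ≡ x * x
    square-scale c x e = linear₁ (x * x) e (identity c x)
      where
      opaque
        unfolding _*_
        identity : ∀ c x → c * x * (c * x) - x * x ≡ x * x * (c * c - + 1)
        identity = solve-∀
    J-zero : k ≈ + 0 [ P ] → J ≡ + 0
    J-zero h = trans (∑-cong p λ t _ → pointwise t) ∑χ
      where
      pointwise : ∀ t → c t * χ (k - sq t) ≡ c t
      pointwise t with ≈0? (+ t)
      ... | yes e = trans (cong (_* χ (k - sq t)) (χ-zero e)) (trans (*-zeroˡ (χ (k - sq t))) (sym (χ-zero e)))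
      ... | no ut = trans (cong (c t *_) (trans (χ-cong (sub-cong h (≈-refl {a = sq t})))
              (trans (cong χ (ℤₚ.+-identityˡ (- sq t))) (trans (χ-neg (sq t)) (trans (χ-* (+ t) (+ t)) (χ-unit² ut)))))) (*-identityʳ (c t))
    from-root : ∀ {l r} → Unit k → Unit l → r * r ≈ k * l [ P ] → jacobsthal k * jacobsthal k ≡ jacobsthal l * jacobsthal l
    from-root {l} {r} uk ul h = trans (cong (λ z → z * z) (trans (jacobsthal-cong k≈) (jacobsthal-scale l us)))
        (square-scale (χ s) (jacobsthal l) (χ-unit² us))
      where
      s = r * inv l
      k≈ : k ≈ s * s * l [ P ]
      k≈ = lincomb₃ (- (inv l * inv l * l)) (- k) (- (k * l * inv l)) h (invˡ′ ul) (invˡ′ ul) (identity k l r (inv l))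
        where
        opaque
          unfolding _*_
          identity : ∀ k l r i → k - r * i * (r * i) * l ≡
            - (i * i * l) * (r * r - k * l) + - k * (i * l - + 1) + - (k * l * i) * (i * l - + 1)
          identity = solve-∀
      us : Unit s
      us e = uk (≈-trans k≈ (≈-trans (*-congʳ l (*-congʳ s e)) (≈-reflexive (trans (cong (_* l) (*-zeroˡ s)) (*-zeroˡ l)))))
    by-cases : Dec (k ≈ + 0 [ P ]) → + 2 * (J * J) ≡ (+ 1 + χ k) * (S * S) + (+ 1 - χ k) * (T * T) + - (S * S + T * T) * (δ (+ 0) k * + 1)
    by-cases (yes h) = trans (cong (λ z → + 2 * (z * z)) (J-zero h)) (zero-case (S * S) (T * T) (δ (+ 0) k) (χ k) (δ-yes (≈-sym h)) (χ-zero h))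
    by-cases (no uk) = [ square , nonsquare ]′ (χ-unit uk)
      where
      d0 : δ (+ 0) k ≡ + 0
      d0 = δ-no λ h → uk (≈-sym h)
      square : χ k ≡ + 1 → + 2 * (J * J) ≡ (+ 1 + χ k) * (S * S) + (+ 1 - χ k) * (T * T) + - (S * S + T * T) * (δ (+ 0) k * + 1)
      square e = trans (cong (+ 2 *_) (from-root {+ 1} {proj₁ (sqrt e)} uk unit-one (≈-trans (proj₂ (sqrt e)) (≈-reflexive (sym (*-identityʳ k))))))
        (unit-case (S * S) (T * T) (δ (+ 0) k) (χ k) d0 e)
      nonsquare : χ k ≡ - + 1 → + 2 * (J * J) ≡ (+ 1 + χ k) * (S * S) + (+ 1 - χ k) * (T * T) + - (S * S + T * T) * (δ (+ 0) k * + 1)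
      nonsquare e = trans (cong (+ 2 *_) (from-root {ν} {proj₁ root} uk uν (proj₂ root)))
        (nonunit-case (S * S) (T * T) (δ (+ 0) k) (χ k) d0 e)
        where
        neg-square : - + 1 * - + 1 ≡ + 1
        neg-square = trans (identity (+ 1)) (*-identityˡ (+ 1))
          where
          opaque
            unfolding _*_
            identity : ∀ x → - x * - x ≡ x * x
            identity = solve-∀
        root : ∃ λ r → r * r ≈ k * ν [ P ]
        root = sqrt {k * ν} (trans (χ-* k ν) (trans (cong₂ _*_ e χν) neg-square))

  -- Summing `jacobsthal-square` over k gives q (S² + T²) on one side and twice the second moment
  -- 2pq on the other.
  jacobsthal-norm : ∀ {ν} → Unit ν → χ ν ≡ - + 1 →
    jacobsthal (+ 1) * jacobsthal (+ 1) + jacobsthal ν * jacobsthal ν ≡ + 4 * P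
  jacobsthal-norm {ν} uν χν = [ (λ e → ⊥-elim (ℕₚ.<⇒≢ 0<q (sym (ℤₚ.+-injective e)))) , ℤₚ.i-j≡0⇒i≡j _ (+ 4 * P) ]′
    (product-zero (+ q) (S * S + T * T - + 4 * P) (linear₂ (- + 1) (+ 2) doubled jacobsthal-moment
      (identity (+ q) P (S * S) (T * T) (∑ p (λ k → jacobsthal (+ k) * jacobsthal (+ k))))))
    where
    S = jacobsthal (+ 1)
    T = jacobsthal ν
    opaque
      unfolding _*_
      split : ∀ A B χ e → (+ 1 + χ) * A + (+ 1 - χ) * B + e ≡ (A + B) + ((A - B) * χ + e)
      split = solve-∀
      collect : ∀ q A B → (+ 1 + q) * (A + B) + ((A - B) * + 0 + - (A + B) * + 1) ≡ q * (A + B)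
      collect = solve-∀
    doubled : + 2 * ∑ p (λ k → jacobsthal (+ k) * jacobsthal (+ k)) ≡ + q * (S * S + T * T)
    doubled = trans (sym (∑-*ˡ p (+ 2) (λ k → jacobsthal (+ k) * jacobsthal (+ k))))
      (trans (∑-cong p λ k _ → trans (jacobsthal-square uν χν (+ k)) (split (S * S) (T * T) (χ (+ k)) _))
      (trans (∑-+ p (λ _ → S * S + T * T) (λ k → (S * S - T * T) * χ (+ k) + - (S * S + T * T) * (δ (+ 0) (+ k) * + 1)))
      (trans (cong₂ _+_ (∑-const p (S * S + T * T))
        (trans (∑-+ p (λ k → (S * S - T * T) * χ (+ k)) (λ k → - (S * S + T * T) * (δ (+ 0) (+ k) * + 1)))
          (cong₂ _+_ (trans (∑-*ˡ p (S * S - T * T) c) (cong ((S * S - T * T) *_) ∑χ))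
                     (trans (∑-*ˡ p (- (S * S + T * T)) (λ k → δ (+ 0) (+ k) * + 1))
                            (cong (- (S * S + T * T) *_) (≈-zero⇒≡ (∑-pick (λ _ → + 1) (λ _ → ≈-refl) (+ 0))))))))
        (collect (+ q) (S * S) (T * T)))))
    opaque
      unfolding _*_
      identity : ∀ q P A B M → q * (A + B - + 4 * P) - + 0 ≡ - + 1 * (+ 2 * M - q * (A + B)) + + 2 * (M - P * (+ 2 * q))
      identity = solve-∀

-- The exact value of the Jacobsthal sum, including its sign

fac : ℕ → ℤ
fac k = ∏ k (λ i → + suc i)

module JacobsthalSign (m : ℕ) (p-prime : Prime (suc ((m ℕ.+ m) ℕ.+ (m ℕ.+ m)))) (2<p : 2 < suc ((m ℕ.+ m) ℕ.+ (m ℕ.+ m))) where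
  open Jacobsthal m p-prime 2<p public

  half : ℤ → ℤ
  half k = ∑ n (λ i → χ (+ suc i) * χ (k - + suc i * + suc i))

  jacobsthal-half : ∀ k → jacobsthal k ≡ + 2 * half k
  jacobsthal-half k = trans (∑-head q g) (trans (cong₂ _+_ (trans (cong (_* χ (k - + 0 * + 0)) (χ-zero {+ 0} ≈-refl)) (*-zeroˡ _))
      (trans (∑-concat n n (λ i → g (suc i))) (cong (λ z → half k + z) (∑-reverse n (λ i → g (suc (n ℕ.+ i))) (λ j → g (suc j)) reflect))))
    (identity (half k)))
    where
    g : ℕ → ℤ
    g t = χ (+ t) * χ (k - + t * + t)
    opaque
      unfolding _*_
      identity : ∀ h → + 0 + (h + h) ≡ + 2 * h
      identity = solve-∀
    reflect : ∀ i j → suc (i ℕ.+ j) ≡ n → g (suc (n ℕ.+ i)) ≡ g (suc j)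
    reflect i j e = cong₂ _*_ (trans (χ-cong opposite) (χ-neg (+ suc j)))
        (χ-cong (sub-cong (≈-refl {a = k}) (≈-trans (*-cong opposite opposite) (≈-reflexive (square-neg (+ suc j))))))
      where
      opaque
        unfolding _*_
        square-neg : ∀ x → - x * - x ≡ x * x
        square-neg = solve-∀
      total : suc (n ℕ.+ i) ℕ.+ suc j ≡ p
      total = cong suc (trans (ℕₚ.+-assoc n i (suc j)) (cong (n ℕ.+_) (trans (ℕₚ.+-suc i j) e)))
      opposite : + suc (n ℕ.+ i) ≈ - + suc j [ P ]
      opposite = lincomb₁ (+ 1) modulus≈0 (trans (identity′ (+ suc (n ℕ.+ i)) (+ suc j)) (cong (λ z → + 1 * (+ z - + 0)) total))
        where
        opaque
          unfolding _*_
          identity′ : ∀ a b → a - - b ≡ + 1 * (a + b - + 0)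
          identity′ = solve-∀

  half-norm : ∀ {ν} → Unit ν → χ ν ≡ - + 1 → P ≡ half (+ 1) * half (+ 1) + half ν * half ν
  half-norm {ν} uν χν = ℤₚ.*-cancelˡ-≡ (+ 4) P _ (trans (sym (*≡ℤ* (+ 4) P)) (trans
    (linear₁ (- + 1) (trans (sym (cong₂ (λ a b → a * a + b * b) (jacobsthal-half (+ 1)) (jacobsthal-half ν))) (jacobsthal-norm uν χν))
      (identity P (half (+ 1)) (half ν)))
    (*≡ℤ* (+ 4) (half (+ 1) * half (+ 1) + half ν * half ν))))
    where
    opaque
      unfolding _*_
      identity : ∀ P a b → + 4 * P - + 4 * (a * a + b * b) ≡ - + 1 * (+ 2 * a * (+ 2 * a) + + 2 * b * (+ 2 * b) - + 4 * P)
      identity = solve-∀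

  -- Split Wilson's product in the middle. Since n is even, the signs of the first half cancel;
  -- modulo p the factors -(n + i + 1) of the second half are n - i.
  fac² : fac n * fac n ≈ - + 1 [ P ]
  fac² = ≈-trans (≈-sym (≈-trans (≈-reflexive (∏-concat n n (λ i → - + suc i)))
      (*-cong (≈-reflexive first) second))) wilson
    where
    opaque
      unfolding _*_
      neg-mul : ∀ a → - a ≡ - + 1 * a
      neg-mul = solve-∀
    first : ∏ n (λ i → - + suc i) ≡ fac n
    first = trans (∏-cong n λ i _ → neg-mul (+ suc i)) (trans (∏-* n (λ _ → - + 1) (λ i → + suc i))
      (trans (cong (_* fac n) (trans (∏-const n (- + 1)) (trans (neg^ (+ 1) n) (trans (cong₂ _*_ (sgn-double m) (one^ n)) (*-identityˡ (+ 1))))))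
             (*-identityˡ (fac n))))
    second : ∏ n (λ i → - + suc (n ℕ.+ i)) ≈ fac n [ P ]
    second = ≈-trans (∏-≈ n λ i _ → lincomb₁ (- + 1) modulus≈0 (identity (+ n) (+ i)))
      (≈-reflexive (∏-reverse n (λ i → + n - + i) (λ j → + suc j) λ i j e →
        linear₁ (- + 1) (cong +_ e) (identity′ (+ n) (+ i) (+ j))))
      where
      opaque
        unfolding _*_
        identity : ∀ n i → - (+ 1 + (n + i)) - (n - i) ≡ - + 1 * (+ 1 + (n + n) - + 0)
        identity = solve-∀
        identity′ : ∀ n i j → n - i - (+ 1 + j) ≡ - + 1 * (+ 1 + (i + j) - n)
        identity′ = solve-∀

  χ-∏ : ∀ k f → χ (∏ k f) ≡ ∏ k (λ i → χ (f i))
  χ-∏ zero    f = χ-one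
  χ-∏ (suc k) f = trans (χ-* (∏ k f) (f k)) (cong (_* χ (f k)) (χ-∏ k f))

  -- By Euler's criterion this is (n!)^n = ((n!)²)^m, and `fac²` applies.
  χ-fac : ∏ n (λ i → χ (+ suc i)) ≡ sgn m
  χ-fac = trans (sym (χ-∏ n (λ i → + suc i))) (χ-unique {fac n} (trit (sign±-sgn m))
    (≈-trans (≈-reflexive (sym (sq-pow (fac n) m))) (≈-trans (^-cong m fac²)
      (≈-reflexive (trans (neg^ (+ 1) m) (trans (cong (sgn m *_) (one^ m)) (*-identityʳ (sgn m))))))))
    where
    trit : ∀ {ε} → Sign± ε → Trit ε
    trit (inj₁ refl) = plus
    trit (inj₂ refl) = minus

  private
    n′ : ℕ
    n′ = ℕ.pred n
    suc-n′ : suc n′ ≡ n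
    suc-n′ = lemma n 0<n
      where
      lemma : ∀ k → 0 < k → suc (ℕ.pred k) ≡ k
      lemma (suc k) _ = refl
    small : ∀ j → j ≤ suc n → 0 < j → Unit (+ j)
    small j j≤ 0<j = unit-small 0<j (ℕₚ.≤-<-trans j≤ (s≤s n<q))
    F : ℕ → ℤ
    F k = ∏ k (λ i → χ (+ suc i))
    H : ℤ
    H = ∏ n′ (λ i → χ (+ suc (suc (suc i))))
    term : ℕ → ℤ
    term i = χ (+ suc (suc i)) * (χ (+ suc i) * χ (+ suc (suc (suc i))))

  χ-2² : χ (+ 2) * χ (+ 2) ≡ + 1
  χ-2² = χ-unit² (unit-small (s≤s z≤n) 2<p)

  -- 4n(n + 1) = p² - 1 ≡ -1, and both 4 and -1 are squares.
  χ-pred-succ : χ (+ n) * χ (+ suc n) ≡ + 1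
  χ-pred-succ = trans (sym (χ-* (+ n) (+ suc n))) (trans (sym (*-identityˡ _)) (trans (cong (_* χ (+ n * + suc n)) (sym 4-square))
      (trans (sym (χ-* (+ 2 * + 2) (+ n * + suc n))) (trans (χ-cong quarter) χ-neg-one))))
    where
    4-square : χ (+ 2 * + 2) ≡ + 1
    4-square = trans (χ-* (+ 2) (+ 2)) χ-2²
    quarter : + 2 * + 2 * (+ n * + suc n) ≈ - + 1 [ P ]
    quarter = lincomb₁ (+ 1 + + n + + n) modulus≈0 (identity (+ n))
      where
      opaque
        unfolding _*_
        identity : ∀ n → + 2 * + 2 * (n * (+ 1 + n)) - - + 1 ≡ (+ 1 + n + n) * (+ 1 + (n + n) - + 0)
        identity = solve-∀

  -- The three factors multiply to the characters of n!, (n - 1)! and (n + 1)!/2. Squares of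
  -- characters drop out, leaving those of n!, n(n + 1) and 2.
  ∏-term : ∏ n′ term ≡ sgn m * χ (+ 2)
  ∏-term = begin
    ∏ n′ term
      ≡⟨ trans (∏-* n′ (λ i → χ (+ suc (suc i))) _) (cong (G *_) (∏-* n′ (λ i → χ (+ suc i)) (λ i → χ (+ suc (suc (suc i)))))) ⟩
    G * (F n′ * H)
      ≡⟨ linear₁ (- (G * F n′ * H)) χ-2² (identity₁ G (F n′) H (χ (+ 2))) ⟩
    G * F n′ * (χ (+ 2) * H) * χ (+ 2)
      ≡⟨ cong₂ (λ a b → a * F n′ * b * χ (+ 2)) G≡ H≡ ⟩
    F n * F n′ * (F n * χ (+ suc n)) * χ (+ 2)
      ≡⟨ cong (λ z → F n * F n′ * (z * χ (+ suc n)) * χ (+ 2)) F-step ⟩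
    F n * F n′ * (F n′ * χ (+ n) * χ (+ suc n)) * χ (+ 2)
      ≡⟨ linear₂ (F n * χ (+ 2)) (F n * (F n′ * F n′) * χ (+ 2)) (F² n′ (ℕₚ.≤-trans (ℕₚ.n≤1+n n′) (ℕₚ.≤-reflexive suc-n′))) χ-pred-succ
           (identity₂ (F n) (F n′) (χ (+ n)) (χ (+ suc n)) (χ (+ 2))) ⟩
    F n * χ (+ 2)
      ≡⟨ cong (_* χ (+ 2)) χ-fac ⟩
    sgn m * χ (+ 2) ∎
    where
    open ≡-Reasoning
    G : ℤ
    G = ∏ n′ (λ i → χ (+ suc (suc i)))
    G≡ : G ≡ F n
    G≡ = trans (sym (trans (∏-head n′ (λ i → χ (+ suc i))) (trans (cong (_* G) χ-one) (*-identityˡ G)))) (cong F suc-n′)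
    H≡ : χ (+ 2) * H ≡ F n * χ (+ suc n)
    H≡ = trans (sym (trans (∏-head (suc n′) (λ i → χ (+ suc i))) (trans (cong₂ _*_ χ-one (∏-head n′ (λ i → χ (+ suc (suc i))))) (*-identityˡ (χ (+ 2) * H)))))
      (cong (λ k → F (suc k)) suc-n′)
    F-step : F n ≡ F n′ * χ (+ n)
    F-step = trans (cong F (sym suc-n′)) (cong (λ k → F n′ * χ (+ k)) suc-n′)
    F² : ∀ k → k ≤ n → F k * F k ≡ + 1
    F² zero    _   = *-identityˡ (+ 1)
    F² (suc k) k<n = linear₂ (χ (+ suc k) * χ (+ suc k)) (+ 1) (F² k (ℕₚ.<⇒≤ k<n)) (χ-unit² (small (suc k) (ℕₚ.m≤n⇒m≤1+n k<n) (s≤s z≤n)))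
      (identity (F k) (χ (+ suc k)))
      where
      opaque
        unfolding _*_
        identity : ∀ F c → F * c * (F * c) - + 1 ≡ c * c * (F * F - + 1) + + 1 * (c * c - + 1)
        identity = solve-∀
    opaque
      unfolding _*_
      identity₁ : ∀ G F H c → G * (F * H) - G * F * (c * H) * c ≡ - (G * F * H) * (c * c - + 1)
      identity₁ = solve-∀
      identity₂ : ∀ F f a b c → F * f * (f * a * b) * c - F * c ≡ F * c * (f * f - + 1) + F * (f * f) * c * (a * b - + 1)
      identity₂ = solve-∀

  -- The term t = 1 vanishes. In the other n - 1 terms 1 - t² = -(t - 1)(t + 1), so each is a sign,
  -- and modulo 4 their sum is determined by their number and product.
  half-sign : - half (+ 1) ≈ χ (+ 2) [ + 4 ]
  half-sign = lincomb₃ (- + 1) (- + 1) (+ 1) half≈ (double-sgn m) (complement-product (sign±-neg (sign±-sgn m)) (χ-unit (unit-small (s≤s z≤n) 2<p)))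
    (identity (half (+ 1)) (+ m) (sgn m) (χ (+ 2)))
    where
    sign±-neg : ∀ {ε} → Sign± ε → Sign± (- ε)
    sign±-neg (inj₁ refl) = inj₂ refl
    sign±-neg (inj₂ refl) = inj₁ refl
    opaque
      unfolding _*_
      identity : ∀ h m s c → - h - c ≡
        - + 1 * (h - (m + m - + 2 + s * c)) + - + 1 * (m + m - (+ 1 - s)) + + 1 * ((+ 1 - - s) * (+ 1 - c) - + 0)
      identity = solve-∀
    g : ℕ → ℤ
    g i = χ (+ suc i) * χ (+ 1 - + suc i * + suc i)
    g-term : ∀ i → g (suc i) ≡ term i
    g-term i = cong (χ (+ suc (suc i)) *_) (trans (cong χ (factor (+ i))) (trans (χ-neg (+ suc i * + suc (suc (suc i)))) (χ-* (+ suc i) (+ suc (suc (suc i))))))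
      where
      opaque
        unfolding _*_
        factor : ∀ i → + 1 - (+ 2 + i) * (+ 2 + i) ≡ - ((+ 1 + i) * (+ 3 + i))
        factor = solve-∀
    term-sign : ∀ i → i < n′ → Sign± (term i)
    term-sign i i<n′ = sign±-* (unit (suc (suc i)) (ℕₚ.m≤n⇒m≤1+n i<n)) (sign±-* (unit (suc i) (ℕₚ.m≤n⇒m≤1+n (ℕₚ.<⇒≤ i<n))) (unit (suc (suc (suc i))) (s≤s i<n)))
      where
      i<n : suc (suc i) ≤ n
      i<n = subst (suc (suc i) ≤_) suc-n′ (s≤s i<n′)
      unit : ∀ j → j ≤ suc n → {{ℕ.NonZero j}} → Sign± (χ (+ j))
      unit (suc j) j≤ = χ-unit (small (suc j) j≤ (s≤s z≤n))
    head-zero : g 0 ≡ + 0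
    head-zero = trans (cong (χ (+ 1) *_) (χ-zero (≈-reflexive (cong (λ z → + 1 - z) (*-identityˡ (+ 1)))))) (*-zeroʳ (χ (+ 1)))
    half≈ : half (+ 1) ≈ + m + + m - + 2 + sgn m * χ (+ 2) [ + 4 ]
    half≈ = ≈-trans (≈-reflexive (trans (cong (λ k → ∑ k g) (sym suc-n′)) (trans (∑-head n′ g) (trans (cong₂ _+_ head-zero (∑-cong n′ λ i _ → g-term i)) (ℤₚ.+-identityˡ _)))))
      (≈-trans (∑-signs n′ term term-sign) (≈-reflexive (cong₂ _+_ (trans (shift (+ n′)) (cong (λ k → + k - + 2) suc-n′)) ∏-term)))
      where
      opaque
        unfolding _*_
        shift : ∀ k → k - + 1 ≡ + 1 + k - + 2
        shift = solve-∀

  -- Halving the two Jacobsthal sums of `half-norm` represents p as a sum of two squares, so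
  -- `half (+ 1)` is x or y up to sign. It is odd, which excludes y, and `half-sign` together with x
  -- ≡ 1 modulo 4 decides the sign.
  jacobsthal-value : ∀ x y → P ≡ x * x + y * y → x ≈ + 1 [ + 4 ] → y ≈ + 0 [ + 2 ] →
                     - jacobsthal (+ 1) ≡ + 2 * χ (+ 2) * x
  jacobsthal-value x y xy x≈1 y≈0 = trans (cong -_ (jacobsthal-half (+ 1))) (by-value
    (TwoSquares.two-squares-unique p-prime (half (+ 1)) x y xy (half (proj₁ nonresidue))
      (half-norm (proj₁ (proj₂ nonresidue)) (proj₂ (proj₂ nonresidue)))))
    where
    mod2 : ∀ {a b} → a ≈ b [ + 4 ] → a ≈ b [ + 2 ]
    mod2 {a} {b} h = weaken (+ 2) (subst (λ N → a ≈ b [ N ]) (sym (trans (*≡ℤ* (+ 2) (+ 2)) refl)) h)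
    χ2 : Sign± (χ (+ 2))
    χ2 = χ-unit (unit-small (s≤s z≤n) 2<p)
    χ-odd : ¬ χ (+ 2) ≈ + 0 [ + 2 ]
    χ-odd h = [ (λ e → 1≉0-mod2 (≈-trans (≈-reflexive (sym e)) h))
              , (λ e → 1≉0-mod2 (≈-trans (≈-reflexive (cong -_ (sym e))) (neg-cong h))) ]′ χ2
    same : half (+ 1) ≡ - x → - (+ 2 * half (+ 1)) ≡ + 2 * χ (+ 2) * x
    same e = [ (λ f → trans (cong (λ z → - (+ 2 * z)) e) (trans (identity x) (cong (λ z → + 2 * z * x) (sym f))))
             , (λ f → ⊥-elim (1≉-1-mod4 (≈-trans (≈-sym x≈1) (≈-trans (≈-reflexive (trans (sym (ℤₚ.neg-involutive x)) (cong -_ (sym e)))) (≈-trans half-sign (≈-reflexive f)))))) ]′ χ2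
      where
      opaque
        unfolding _*_
        identity : ∀ x → - (+ 2 * - x) ≡ + 2 * + 1 * x
        identity = solve-∀
    opposite : half (+ 1) ≡ x → - (+ 2 * half (+ 1)) ≡ + 2 * χ (+ 2) * x
    opposite e = [ (λ f → ⊥-elim (1≉-1-mod4 (≈-trans (≈-reflexive (sym f)) (≈-trans (≈-sym half-sign) (neg-cong (≈-trans (≈-reflexive e) x≈1))))))
                 , (λ f → trans (cong (λ z → - (+ 2 * z)) e) (trans (identity x) (cong (λ z → + 2 * z * x) (sym f)))) ]′ χ2
      where
      opaque
        unfolding _*_
        identity : ∀ x → - (+ 2 * x) ≡ + 2 * - + 1 * x
        identity = solve-∀
    even : ∀ z → half (+ 1) ≡ z → z ≈ + 0 [ + 2 ] → - (+ 2 * half (+ 1)) ≡ + 2 * χ (+ 2) * x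
    even z e h = ⊥-elim (χ-odd (≈-trans (≈-sym (mod2 half-sign)) (neg-cong (≈-trans (≈-reflexive e) h))))
    by-value : (half (+ 1) ≡ x ⊎ half (+ 1) ≡ - x) ⊎ (half (+ 1) ≡ y ⊎ half (+ 1) ≡ - y) → - (+ 2 * half (+ 1)) ≡ + 2 * χ (+ 2) * x
    by-value (inj₁ (inj₁ e)) = opposite e
    by-value (inj₁ (inj₂ e)) = same e
    by-value (inj₂ (inj₁ e)) = even y e y≈0
    by-value (inj₂ (inj₂ e)) = even (- y) e (neg-cong y≈0)

-- The Jacobsthal sum modulo p³ as a combination of binomial coefficients

∑-blocks : ∀ j n f → ∑ (j ℕ.* n) f ≡ ∑ j (λ b → ∑ n (λ r → f (b ℕ.* n ℕ.+ r)))
∑-blocks zero    n f = refl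
∑-blocks (suc j) n f = trans (cong (λ k → ∑ k f) (ℕₚ.+-comm n (j ℕ.* n)))
  (trans (∑-concat (j ℕ.* n) n f) (cong (_+ ∑ n (λ r → f (j ℕ.* n ℕ.+ r))) (∑-blocks j n f)))

∑-single-≈ : ∀ {M} k i f → i < k → (∀ j → j < k → j ≢ i → f j ≈ + 0 [ M ]) → ∑ k f ≈ f i [ M ]
∑-single-≈ {M} (suc k) i f i<k h = by-cases (i ℕ.≟ k)
  where
  by-cases : Dec (i ≡ k) → ∑ (suc k) f ≈ f i [ M ]
  by-cases (yes refl) = ≈-trans (+-cong (≈-trans (∑-≈ k λ j j<k → h j (ℕₚ.m<n⇒m<1+n j<k) (ℕₚ.<⇒≢ j<k))
      (≈-reflexive (∑-zero k λ _ _ → refl))) ≈-refl) (≈-reflexive (ℤₚ.+-identityˡ (f i)))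
  by-cases (no i≢k) = ≈-trans (+-cong (∑-single-≈ k i f (ℕₚ.≤∧≢⇒< (ℕₚ.≤-pred i<k) i≢k) λ j j<k → h j (ℕₚ.m<n⇒m<1+n j<k))
      (h k (ℕₚ.n<1+n k) (i≢k ∘ sym))) (≈-reflexive (ℤₚ.+-identityʳ (f i)))

-- If u ≡ c = ±1 modulo p, then interpolating the exponent of u from 1, 3, 5 to 0 recovers c modulo p³.
module Trace (m : ℕ) (p-prime : Prime (suc ((m ℕ.+ m) ℕ.+ (m ℕ.+ m)))) (2<p : 2 < suc ((m ℕ.+ m) ℕ.+ (m ℕ.+ m))) where
  open JacobsthalSign m p-prime 2<p public

  -- 15/8, -10/8 and 3/8 are the Lagrange weights at 0 for the nodes 1, 3, 5. The difference from 8c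
  -- is divisible by (u - c)³ for c = 1 and for c = -1.
  interpolate : ℤ → ℤ
  interpolate u = + 15 * u - + 10 * (u * u * u) + + 3 * (u * u * u * u * u)

  interpolate-plus : ∀ {u} → u ≈ + 1 [ P ] → interpolate u ≈ + 8 * + 1 [ P³ ]
  interpolate-plus {u} h = lincomb₁ (+ 3 * u * u + + 9 * u + + 8) (*-≈0 h₀ (*-≈0 h₀ h₀)) (identity u)
    where
    h₀ = difference≈0 h
    opaque
      unfolding _*_
      identity : ∀ u → + 15 * u - + 10 * (u * u * u) + + 3 * (u * u * u * u * u) - + 8 * + 1 ≡
        (+ 3 * u * u + + 9 * u + + 8) * ((u - + 1) * ((u - + 1) * (u - + 1)) - + 0)
      identity = solve-∀

  interpolate-minus : ∀ {u} → u ≈ - + 1 [ P ] → interpolate u ≈ + 8 * - + 1 [ P³ ]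
  interpolate-minus {u} h = lincomb₁ (+ 3 * u * u - + 9 * u + + 8) (*-≈0 h₀ (*-≈0 h₀ h₀)) (identity u)
    where
    h₀ = difference≈0 h
    opaque
      unfolding _*_
      identity : ∀ u → + 15 * u - + 10 * (u * u * u) + + 3 * (u * u * u * u * u) - + 8 * - + 1 ≡
        (+ 3 * u * u - + 9 * u + + 8) * ((u - - + 1) * ((u - - + 1) * (u - - + 1)) - + 0)
      identity = solve-∀

  teich-neg-one : teich (- + 1) ≡ - + 1
  teich-neg-one = trans (cong (_^ p) odd-power) odd-power
    where
    odd-power : (- + 1) ^ p ≡ - + 1
    odd-power = trans (neg^ (+ 1) p) (trans (cong₂ _*_ (cong -_ (sgn-double n)) (one^ p)) (*-identityʳ (- + 1)))

  teich^n : ∀ t → teich t ^ n ≈ χ t [ P³ ]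
  teich^n t = ≈-trans (≈-reflexive (sym (teich-^ t n))) (≈-trans (teich-cong (≈-sym (χ≈ t))) (≈-reflexive (fixed (χ-trit t))))
    where
    fixed : ∀ {c} → Trit c → teich c ≡ c
    fixed zero  = teich-zero
    fixed plus  = teich-one
    fixed minus = teich-neg-one

  -- If 1 - t² is a unit, the n-th power is its character modulo p and interpolation applies. If t²
  -- ≡ 1, divisibility of the base by p alone would not do: it vanishes modulo p³ because the lift
  -- of t² is 1.
  interpolate-χ : ∀ t → + 8 * χ (+ 1 - t * t) ≈ interpolate ((+ 1 - teich t * teich t) ^ n) [ P³ ]
  interpolate-χ t = by-cases (≈0? a)
    where
    a b : ℤ
    a = + 1 - t * t
    b = + 1 - teich t * teich t
    b≈a : b ≈ a [ P ]
    b≈a = sub-cong (≈-refl {a = + 1}) (*-cong (teich≈ t) (teich≈ t))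
    interpolate-zero : + 8 * + 0 ≡ interpolate (+ 0)
    interpolate-zero = identity
      where
      identity : + 8 * + 0 ≡ + 15 * + 0 - + 10 * (+ 0 * + 0 * + 0) + + 3 * (+ 0 * + 0 * + 0 * + 0 * + 0)
      identity = zeros (+ 0) refl
        where
        zeros : ∀ z → z ≡ + 0 → + 8 * z ≡ + 15 * z - + 10 * (z * z * z) + + 3 * (z * z * z * z * z)
        zeros z e = linear₁ (- + 7 + + 10 * (z * z) - + 3 * (z * z * z * z)) e (ring z)
          where
          opaque
            unfolding _*_
            ring : ∀ z → + 8 * z - (+ 15 * z - + 10 * (z * z * z) + + 3 * (z * z * z * z * z)) ≡
              (- + 7 + + 10 * (z * z) - + 3 * (z * z * z * z)) * (z - + 0)
            ring = solve-∀
    interpolate-cong : ∀ {u v} → u ≈ v [ P³ ] → interpolate u ≈ interpolate v [ P³ ]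
    interpolate-cong h = +-cong (sub-cong (*-congˡ (+ 15) h) (*-congˡ (+ 10) (*-cong (*-cong h h) h)))
      (*-congˡ (+ 3) (*-cong (*-cong (*-cong (*-cong h h) h) h) h))
    by-cases : Dec (a ≈ + 0 [ P ]) → + 8 * χ a ≈ interpolate (b ^ n) [ P³ ]
    by-cases (yes a≈0) = ≈-trans (≈-reflexive (trans (cong (+ 8 *_) (χ-zero a≈0)) interpolate-zero))
      (≈-sym (interpolate-cong (≈-trans (^-cong n b≈0) (≈-reflexive (zero^ n 0<n)))))
      where
      b≈0 : b ≈ + 0 [ P³ ]
      b≈0 = lincomb₁ (- + 1) (≈-trans (≈-reflexive (sym (teich-* t t))) (≈-trans (teich-cong (lincomb₁ (- + 1) a≈0 (identity t))) (≈-reflexive teich-one)))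
        (identity′ (teich t))
        where
        opaque
          unfolding _*_
          identity : ∀ t → t * t - + 1 ≡ - + 1 * (+ 1 - t * t - + 0)
          identity = solve-∀
          identity′ : ∀ t → + 1 - t * t - + 0 ≡ - + 1 * (t * t - + 1)
          identity′ = solve-∀
    by-cases (no ua) = [ (λ e → ≈-trans (≈-reflexive (cong (+ 8 *_) e)) (≈-sym (interpolate-plus (≈-trans b^n (≈-reflexive e)))))
                       , (λ e → ≈-trans (≈-reflexive (cong (+ 8 *_) e)) (≈-sym (interpolate-minus (≈-trans b^n (≈-reflexive e))))) ]′ (χ-unit ua)
      where
      b^n : b ^ n ≈ χ a [ P ]
      b^n = ≈-trans (^-cong n b≈a) (≈-sym (χ≈ a))

  W : ℕ → ℤ
  W j = ∑ p (λ t → teich (+ t) ^ n * (+ 1 - teich (+ t) * teich (+ t)) ^ (j ℕ.* n))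

  jacobsthal-W : + 8 * jacobsthal (+ 1) ≈ + 15 * W 1 - + 10 * W 3 + + 3 * W 5 [ P³ ]
  jacobsthal-W = ≈-trans (≈-reflexive (sym (∑-*ˡ p (+ 8) (λ t → χ (+ t) * χ (+ 1 - + t * + t)))))
    (≈-trans (∑-≈ p λ t _ → pointwise (+ t)) (≈-reflexive (trans
      (∑-+ p (λ t → + 15 * w 1 t + - + 10 * w 3 t) (λ t → + 3 * w 5 t))
      (trans (cong₂ _+_ (trans (∑-+ p (λ t → + 15 * w 1 t) (λ t → - + 10 * w 3 t)) (cong₂ _+_ (∑-*ˡ p (+ 15) (w 1)) (∑-*ˡ p (- + 10) (w 3)))) (∑-*ˡ p (+ 3) (w 5)))
        (identity (W 1) (W 3) (W 5))))))
    where
    w : ℕ → ℕ → ℤ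
    w j t = teich (+ t) ^ n * (+ 1 - teich (+ t) * teich (+ t)) ^ (j ℕ.* n)
    opaque
      unfolding _*_
      identity : ∀ a b c → + 15 * a + - + 10 * b + + 3 * c ≡ + 15 * a - + 10 * b + + 3 * c
      identity = solve-∀
    pointwise : ∀ t → let b = + 1 - teich t * teich t in + 8 * (χ t * χ (+ 1 - t * t)) ≈
      + 15 * (teich t ^ n * b ^ (1 ℕ.* n)) + - + 10 * (teich t ^ n * b ^ (3 ℕ.* n)) + + 3 * (teich t ^ n * b ^ (5 ℕ.* n)) [ P³ ]
    pointwise t = ≈-trans (≈-reflexive (regroup (χ t) (χ (+ 1 - t * t)))) (≈-trans (*-cong (≈-sym (teich^n t)) (interpolate-χ t))
      (≈-reflexive (trans (expand (teich t ^ n) u) (cong₂ (λ x y → + 15 * (teich t ^ n * proj₁ x) + - + 10 * (teich t ^ n * proj₂ x) + + 3 * (teich t ^ n * y))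
        (cong₂ _,_ power₁ power₃) power₅))))
      where
      b = + 1 - teich t * teich t
      u = b ^ n
      opaque
        unfolding _*_
        regroup : ∀ x y → + 8 * (x * y) ≡ x * (+ 8 * y)
        regroup = solve-∀
        expand : ∀ x u → x * (+ 15 * u - + 10 * (u * u * u) + + 3 * (u * u * u * u * u)) ≡
          + 15 * (x * (u * + 1)) + - + 10 * (x * (u * (u * (u * + 1)))) + + 3 * (x * (u * (u * (u * (u * (u * + 1))))))
        expand = solve-∀
      power₁ : u ^ 1 ≡ b ^ (1 ℕ.* n)
      power₁ = trans (^-^ b n 1) (cong (b ^_) (ℕₚ.*-comm n 1))
      power₃ : u ^ 3 ≡ b ^ (3 ℕ.* n)
      power₃ = trans (^-^ b n 3) (cong (b ^_) (ℕₚ.*-comm n 3))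
      power₅ : u ^ 5 ≡ b ^ (5 ℕ.* n)
      power₅ = trans (^-^ b n 5) (cong (b ^_) (ℕₚ.*-comm n 5))

  private
    vanish : ∀ e r j → e ≡ r ℕ.+ q ℕ.* j → 0 < r → r < q → teichSum e ≈ + 0 [ P³ ]
    vanish e (suc r) j refl _ r<q = teichSum-vanish r j r<q

    exponent : ∀ b r → n ℕ.+ (b ℕ.* n ℕ.+ r ℕ.+ (b ℕ.* n ℕ.+ r)) ≡ n ℕ.+ (r ℕ.+ r) ℕ.+ q ℕ.* b
    exponent b r = ℤₚ.+-injective (trans (cong (λ z → + n + (z + + r + (z + + r))) (pos-* b n))
      (trans (identity (+ n) (+ b) (+ r)) (cong (λ z → + n + (+ r + + r) + z) (sym (pos-* q b)))))
      where
      opaque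
        unfolding _*_
        identity : ∀ n b r → n + (b * n + r + (b * n + r)) ≡ n + (r + r) + (n + n) * b
        identity = solve-∀

    -- Up to a multiple of q the exponent is n + 2r. For r < m it lies strictly between 0 and q; for
    -- r > m it is q + 2(r - m), again strictly between two multiples of q.
    teichSum-r : ∀ b r → r < n → r ≢ m → teichSum (n ℕ.+ (b ℕ.* n ℕ.+ r ℕ.+ (b ℕ.* n ℕ.+ r))) ≈ + 0 [ P³ ]
    teichSum-r b r r<n r≢m = compare (ℕₚ.<-cmp r m)
      where
      compare : _ → teichSum (n ℕ.+ (b ℕ.* n ℕ.+ r ℕ.+ (b ℕ.* n ℕ.+ r))) ≈ + 0 [ P³ ]
      compare (tri<′ r<m _ _) = vanish _ (n ℕ.+ (r ℕ.+ r)) b (exponent b r) (ℕₚ.≤-trans 0<n (ℕₚ.m≤m+n n (r ℕ.+ r)))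
        (ℕₚ.+-monoʳ-< n (ℕₚ.+-mono-< r<m r<m))
      compare (tri≈′ _ e _) = contradiction e r≢m
      compare (tri>′ _ _ m<r) = vanish _ (d ℕ.+ d) (suc b) (trans (exponent b r) (trans (cong (λ z → n ℕ.+ (z ℕ.+ z) ℕ.+ q ℕ.* b) (sym m+d))
          (ℤₚ.+-injective (trans (cong (λ z → + n + (+ m + + d + (+ m + + d)) + z) (pos-* q b))
            (trans (identity (+ m) (+ d) (+ b)) (cong (λ z → + d + + d + z) (sym (pos-* q (suc b))))))))) (ℕₚ.+-mono-< 0<d 0≤d) (ℕₚ.+-mono-< d<n d<n)
        where
        d = r ∸ m
        m+d : m ℕ.+ d ≡ r
        m+d = ℕₚ.m+[n∸m]≡n (ℕₚ.<⇒≤ m<r)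
        0<d : 0 < d
        0<d = ℕₚ.m<n⇒0<n∸m m<r
        0≤d : 0 < d
        0≤d = 0<d
        d<n : d < n
        d<n = ℕₚ.≤-<-trans (ℕₚ.m∸n≤m r m) r<n
        opaque
          unfolding _*_
          identity : ∀ m d b → m + m + (m + d + (m + d)) + (m + m + (m + m)) * b ≡ d + d + (m + m + (m + m)) * (+ 1 + b)
          identity = solve-∀

    teichSum-m : ∀ b → teichSum (n ℕ.+ (b ℕ.* n ℕ.+ m ℕ.+ (b ℕ.* n ℕ.+ m))) ≈ + q [ P³ ]
    teichSum-m b = ≈-trans (≈-reflexive (cong teichSum (trans (exponent b m) (sym (ℕₚ.*-suc q b))))) (teichSum-full b)

  -- Expand (1 - T²)^(jn). Summing over t kills T^(n+2k) unless n + 2k is a multiple of q, that is k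
  -- = bn + m; for these k the sign (-1)^k is (-1)^m since n is even.
  W-value : ∀ j → W j ≈ + q * (sgn m * ∑ j (λ b → bin (j ℕ.* n) (b ℕ.* n ℕ.+ m))) [ P³ ]
  W-value j = begin
    W j
      ≡⟨ ∑-cong p (λ t _ → expand (teich (+ t))) ⟩
    ∑ p (λ t → ∑ (suc N) (λ k → bin N k * sgn k * teich (+ t) ^ (n ℕ.+ (k ℕ.+ k))))
      ≡⟨ ∑-swap p (suc N) (λ t k → bin N k * sgn k * teich (+ t) ^ (n ℕ.+ (k ℕ.+ k))) ⟩
    ∑ (suc N) (λ k → ∑ p (λ t → bin N k * sgn k * teich (+ t) ^ (n ℕ.+ (k ℕ.+ k))))
      ≡⟨ ∑-cong (suc N) (λ k _ → ∑-*ˡ p (bin N k * sgn k) (λ t → teich (+ t) ^ (n ℕ.+ (k ℕ.+ k)))) ⟩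
    ∑ N f + f N
      ≈⟨ +-cong (≈-reflexive (∑-blocks j n f)) last ⟩
    ∑ j (λ b → ∑ n (λ r → f (b ℕ.* n ℕ.+ r))) + + 0
      ≡⟨ ℤₚ.+-identityʳ _ ⟩
    ∑ j (λ b → ∑ n (λ r → f (b ℕ.* n ℕ.+ r)))
      ≈⟨ ∑-≈ j (λ b _ → ∑-single-≈ n m (λ r → f (b ℕ.* n ℕ.+ r)) (ℕₚ.m<m+n m 0<m) λ r r<n r≢m →
           ≈-trans (*-congˡ (bin N (b ℕ.* n ℕ.+ r) * sgn (b ℕ.* n ℕ.+ r)) (teichSum-r b r r<n r≢m)) (≈-reflexive (*-zeroʳ _))) ⟩
    ∑ j (λ b → f (b ℕ.* n ℕ.+ m))
      ≈⟨ ∑-≈ j (λ b _ → ≈-trans (*-congˡ (bin N (b ℕ.* n ℕ.+ m) * sgn (b ℕ.* n ℕ.+ m)) (teichSum-m b))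
           (≈-reflexive (trans (cong (λ z → bin N (b ℕ.* n ℕ.+ m) * z * + q) (sgn-block b)) (regroup (bin N (b ℕ.* n ℕ.+ m)) (sgn m) (+ q))))) ⟩
    ∑ j (λ b → + q * sgn m * bin N (b ℕ.* n ℕ.+ m))
      ≡⟨ trans (∑-*ˡ j (+ q * sgn m) (λ b → bin N (b ℕ.* n ℕ.+ m))) (*-assoc (+ q) (sgn m) _) ⟩
    + q * (sgn m * ∑ j (λ b → bin N (b ℕ.* n ℕ.+ m))) ∎
    where
    open ≈-Reasoning P³
    N = j ℕ.* n
    f : ℕ → ℤ
    f k = bin N k * sgn k * teichSum (n ℕ.+ (k ℕ.+ k))
    0<m : 0 < m
    0<m = positive m 0<n
      where
      positive : ∀ k → 0 < k ℕ.+ k → 0 < k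
      positive (suc k) _ = s≤s z≤n
    opaque
      unfolding _*_
      regroup : ∀ b s q → b * s * q ≡ q * s * b
      regroup = solve-∀
    sgn-multiple : ∀ b → sgn (b ℕ.* n) ≡ + 1
    sgn-multiple zero    = refl
    sgn-multiple (suc b) = trans (sgn-+ n (b ℕ.* n)) (trans (cong₂ _*_ (sgn-double m) (sgn-multiple b)) (*-identityˡ (+ 1)))
    sgn-block : ∀ b → sgn (b ℕ.* n ℕ.+ m) ≡ sgn m
    sgn-block b = trans (sgn-+ (b ℕ.* n) m) (trans (cong (_* sgn m) (sgn-multiple b)) (*-identityˡ (sgn m)))
    expand : ∀ T → T ^ n * (+ 1 - T * T) ^ N ≡ ∑ (suc N) (λ k → bin N k * sgn k * T ^ (n ℕ.+ (k ℕ.+ k)))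
    expand T = trans (cong (T ^ n *_) (binomial-theorem (- (T * T)) N)) (trans (sym (∑-*ˡ (suc N) (T ^ n) (λ k → bin N k * (- (T * T)) ^ k)))
      (∑-cong (suc N) λ k _ → trans (cong (λ z → T ^ n * (bin N k * z)) (trans (neg^ (T * T) k) (cong (sgn k *_) (sq-pow T k))))
        (trans (regroup′ (T ^ n) (bin N k) (sgn k) (T ^ (k ℕ.+ k))) (cong (bin N k * sgn k *_) (sym (^-+ T n (k ℕ.+ k)))))))
      where
      opaque
        unfolding _*_
        regroup′ : ∀ x b s y → x * (b * (s * y)) ≡ b * s * (x * y)
        regroup′ = solve-∀
    -- The top index jn lies outside the j blocks of length n; its exponent is n modulo q, so it
    -- vanishes too.
    last : f N ≈ + 0 [ P³ ]
    last = ≈-trans (*-congˡ (bin N N * sgn N) (vanish _ n j (trans (cong (λ z → n ℕ.+ (z ℕ.+ z)) (sym (ℕₚ.+-identityʳ N)))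
        (trans (exponent j 0) (cong (ℕ._+ q ℕ.* j) (ℕₚ.+-identityʳ n)))) 0<n n<q)) (≈-reflexive (*-zeroʳ (bin N N * sgn N)))

  trace-formula : + 8 * jacobsthal (+ 1) ≈ + q * (sgn m *
      (+ 15 * ∑ 1 (λ b → bin (1 ℕ.* n) (b ℕ.* n ℕ.+ m)) - + 10 * ∑ 3 (λ b → bin (3 ℕ.* n) (b ℕ.* n ℕ.+ m))
        + + 3 * ∑ 5 (λ b → bin (5 ℕ.* n) (b ℕ.* n ℕ.+ m)))) [ P³ ]
  trace-formula = ≈-trans jacobsthal-W (≈-trans
    (+-cong (sub-cong (*-congˡ (+ 15) (W-value 1)) (*-congˡ (+ 10) (W-value 3))) (*-congˡ (+ 3) (W-value 5)))
    (≈-reflexive (identity (+ q) (sgn m) (∑ 1 (λ b → bin (1 ℕ.* n) (b ℕ.* n ℕ.+ m)))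
      (∑ 3 (λ b → bin (3 ℕ.* n) (b ℕ.* n ℕ.+ m))) (∑ 5 (λ b → bin (5 ℕ.* n) (b ℕ.* n ℕ.+ m))))))
    where
    opaque
      unfolding _*_
      identity : ∀ q s a b c → + 15 * (q * (s * a)) - + 10 * (q * (s * b)) + + 3 * (q * (s * c)) ≡
        q * (s * (+ 15 * a - + 10 * b + + 3 * c))
      identity = solve-∀

-- Products of the form ∏ (c + s) modulo p³, for p ∣ s

module Harmonic (m : ℕ) (p-prime : Prime (suc ((m ℕ.+ m) ℕ.+ (m ℕ.+ m)))) (2<p : 2 < suc ((m ℕ.+ m) ℕ.+ (m ℕ.+ m))) where
  open Trace m p-prime 2<p public

  0<m : 0 < m
  0<m = positive m 0<n
    where
    positive : ∀ k → 0 < k ℕ.+ k → 0 < k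
    positive (suc k) _ = s≤s z≤n

  m<n : m < n
  m<n = ℕₚ.m<m+n m 0<m

  unit-2 : Unit (+ 2)
  unit-2 = unit-small (s≤s z≤n) 2<p

  unit-suc : ∀ {i} → i < q → Unit (+ suc i)
  unit-suc i<q = unit-small (s≤s z≤n) (s≤s i<q)

  unit-fac : ∀ {k} → k ≤ q → Unit (fac k)
  unit-fac {k} k≤q = unit-∏ k λ i i<k → unit-suc (ℕₚ.<-≤-trans i<k k≤q)

  cube≈0 : ∀ {a b c} → a ≈ + 0 [ P ] → b ≈ + 0 [ P ] → c ≈ + 0 [ P ] → a * b * c ≈ + 0 [ P³ ]
  cube≈0 {a} {b} {c} ha hb hc = ≈-trans (≈-reflexive (*-assoc a b c)) (*-≈0 ha (*-≈0 hb hc))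

  -- Twice the second-order truncation of ∏ (1 + s/cᵢ), with σ and ρ the sums of 1/cᵢ and of 1/cᵢ².
  -- Doubling avoids halving σ² - ρ.
  expansion : ℤ → ℤ → ℤ → ℤ
  expansion s σ ρ = + 2 + + 2 * s * σ + s * s * (σ * σ - ρ)

  ∏-expansion : ∀ {s} k (c : ℕ → ℤ) → s ≈ + 0 [ P ] → (∀ i → i < k → Unit (c i)) →
    + 2 * ∏ k (λ i → c i + s) ≈
    ∏ k c * expansion s (∑ k (λ i → inv (c i))) (∑ k (λ i → inv (c i) * inv (c i))) [ P³ ]
  ∏-expansion {s} zero    c hs u = ≈-reflexive (identity s)
    where
    opaque
      unfolding _*_
      identity : ∀ s → + 2 * + 1 ≡ + 1 * (+ 2 + + 2 * s * + 0 + s * s * (+ 0 * + 0 - + 0))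
      identity = solve-∀
  ∏-expansion {s} (suc k) c hs u = lincomb₃ (c k + s) (- (+ 2 * s + + 2 * s * s * σ) * ∏ k c) ((σ * σ - ρ) * ∏ k c)
    (∏-expansion k c hs λ i i<k → u i (ℕₚ.m<n⇒m<1+n i<k)) (invˡ (u k (ℕₚ.n<1+n k))) (cube≈0 hs hs hs)
    (identity s σ ρ (∏ k (λ i → c i + s)) (∏ k c) (c k) (inv (c k)))
    where
    σ = ∑ k (λ i → inv (c i))
    ρ = ∑ k (λ i → inv (c i) * inv (c i))
    opaque
      unfolding _*_
      identity : ∀ s σ ρ X C c r →
        + 2 * (X * (c + s)) - C * c * (+ 2 + + 2 * s * (σ + r) + s * s * ((σ + r) * (σ + r) - (ρ + r * r))) ≡
        (c + s) * (+ 2 * X - C * (+ 2 + + 2 * s * σ + s * s * (σ * σ - ρ)))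
        + - (+ 2 * s + + 2 * s * s * σ) * C * (r * c - + 1) + (σ * σ - ρ) * C * (s * s * s - + 0)
      identity = solve-∀

  H H₂ : ℕ → ℤ
  H  k = ∑ k (λ i → inv (+ suc i))
  H₂ k = ∑ k (λ i → inv (+ suc i) * inv (+ suc i))

  rising : ℤ → ℕ → ℤ
  rising s k = ∏ k (λ i → + suc i + s)

  rising-expansion : ∀ {s} k → k ≤ q → s ≈ + 0 [ P ] → + 2 * rising s k ≈ fac k * expansion s (H k) (H₂ k) [ P³ ]
  rising-expansion k k≤q hs = ∏-expansion k (λ i → + suc i) hs λ i i<k → unit-suc (ℕₚ.<-≤-trans i<k k≤q)

  -- Modulo p, 1/t² is t^(q-2), and 0 < q - 2 < q makes this a vanishing power sum.
  H₂-q : H₂ q ≈ + 0 [ P ]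
  H₂-q = ≈-trans (≈-sym (≈-trans (≈-reflexive (trans (∑-head q (λ t → (+ t) ^ e)) (trans (cong (_+ ∑ q (λ i → (+ suc i) ^ e)) (zero^ e 0<e)) (ℤₚ.+-identityˡ _))))
      (∑-≈ q λ i i<q → power i i<q))) (powerSum-low e e<q)
    where
    e = q ∸ 2
    4≤q : 4 ≤ q
    4≤q = ℕₚ.+-mono-≤ {2} {n} (ℕₚ.+-mono-≤ 0<m 0<m) (ℕₚ.+-mono-≤ 0<m 0<m)
    e+2 : 2 ℕ.+ e ≡ q
    e+2 = ℕₚ.m+[n∸m]≡n (ℕₚ.≤-trans (s≤s (s≤s z≤n)) 4≤q)
    0<e : 0 < e
    0<e = ℕₚ.m<n⇒0<n∸m (ℕₚ.≤-trans (s≤s (s≤s (s≤s z≤n))) 4≤q)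
    e<q : e < q
    e<q = subst (e <_) e+2 (s≤s (ℕₚ.n≤1+n e))
    power : ∀ i → i < q → (+ suc i) ^ e ≈ inv (+ suc i) * inv (+ suc i) [ P ]
    power i i<q = cancelᴾ (x * x) (unit-* ux ux) (lincomb₃ (+ 1) (- (inv x * x)) (- + 1)
        (≈-trans (≈-reflexive (cong (x ^_) e+2)) (fermat-unit ux)) (invˡ′ ux) (invˡ′ ux) (identity x (x ^ e) (inv x)))
      where
      x = + suc i
      ux = unit-suc i<q
      opaque
        unfolding _*_
        identity : ∀ x y i → x * x * y - x * x * (i * i) ≡
          + 1 * (x * (x * y) - + 1) + - (i * x) * (i * x - + 1) + - + 1 * (i * x - + 1)
        identity = solve-∀

  private
    complement : ∀ {i j} → suc (i ℕ.+ j) ≡ q → + suc i ≡ P - + suc j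
    complement {i} {j} e = linear₁ (+ 1) (cong +_ e) (identity (+ i) (+ j) (+ q))
      where
      opaque
        unfolding _*_
        identity : ∀ i j q → + 1 + i - (+ 1 + q - (+ 1 + j)) ≡ + 1 * (+ 1 + (i + j) - q)
        identity = solve-∀

    unit-complement : ∀ {i} → i < q → Unit (P - + suc i)
    unit-complement {i} i<q h = unit-suc i<q (lincomb₂ (+ 1) (- + 1) modulus≈0 h (identity P (+ suc i)))
      where
      opaque
        unfolding _*_
        identity : ∀ P x → x - + 0 ≡ + 1 * (P - + 0) + - + 1 * (P - x - + 0)
        identity = solve-∀

    inv-complement : ∀ {i} → i < q → inv (P - + suc i) ≈ - inv (+ suc i) [ P ]
    inv-complement {i} i<q = ≈-sym (inv-unique (unit-complement i<q)
      (lincomb₂ (- inv (+ suc i)) (+ 1) modulus≈0 (invˡ′ (unit-suc i<q)) (identity P (+ suc i) (inv (+ suc i)))))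
      where
      opaque
        unfolding _*_
        identity : ∀ P x r → - r * (P - x) - + 1 ≡ - r * (P - + 0) + + 1 * (r * x - + 1)
        identity = solve-∀

  -- Wolstenholme: pairing t with p - t gives 2H = p ∑ 1/(t(p - t)), and modulo p the last sum is
  -- -`H₂ q`, hence 0.
  H-q : H q ≈ + 0 [ P² ]
  H-q = cancel² (+ 2) unit-2 (lincomb₂ (+ 1) (+ 1) (P³⇒P² paired) product≈0 (identity (H q) (P * K)))
    where
    K : ℤ
    K = ∑ q (λ i → inv (+ suc i) * inv (P - + suc i))
    opaque
      unfolding _*_
      identity : ∀ h x → + 2 * h - + 2 * + 0 ≡ + 1 * (h + h - x) + + 1 * (x - + 0)
      identity = solve-∀
    reversed : H q ≡ ∑ q (λ j → inv (P - + suc j))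
    reversed = ∑-reverse q (λ i → inv (+ suc i)) (λ j → inv (P - + suc j)) λ i j e → cong inv (complement e)
    paired : H q + H q ≈ P * K [ P³ ]
    paired = ≈-trans (≈-reflexive (trans (cong (λ z → H q + z) reversed) (sym (∑-+ q (λ i → inv (+ suc i)) (λ i → inv (P - + suc i))))))
      (≈-trans (∑-≈ q λ i i<q → lincomb₂ (- inv (P - + suc i)) (- inv (+ suc i)) (invˡ (unit-suc i<q)) (invˡ (unit-complement i<q))
        (identity′ P (+ suc i) (inv (+ suc i)) (inv (P - + suc i)))) (≈-reflexive (∑-*ˡ q P (λ i → inv (+ suc i) * inv (P - + suc i)))))
      where
      opaque
        unfolding _*_
        identity′ : ∀ P x r r′ → r + r′ - P * (r * r′) ≡ - r′ * (r * x - + 1) + - r * (r′ * (P - x) - + 1)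
        identity′ = solve-∀
    K≈0 : K ≈ + 0 [ P ]
    K≈0 = ≈-trans (∑-≈ q λ i i<q → ≈-trans (*-congˡ (inv (+ suc i)) (inv-complement i<q)) (≈-reflexive (neg-square (inv (+ suc i)))))
      (≈-trans (≈-reflexive (∑-*ˡ q (- + 1) (λ i → inv (+ suc i) * inv (+ suc i)))) (≈-trans (*-congˡ (- + 1) H₂-q) (≈-reflexive (*-zeroʳ (- + 1)))))
      where
      opaque
        unfolding _*_
        neg-square : ∀ x → x * - x ≡ - + 1 * (x * x)
        neg-square = solve-∀
    product≈0 : P * K ≈ + 0 [ P² ]
    product≈0 = *-≈0 modulus≈0 K≈0

  -- The residues t and p - t have the same square, so `H₂ q` is twice `H₂ n`.
  H₂-n : H₂ n ≈ + 0 [ P ]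
  H₂-n = cancelᴾ (+ 2) unit-2 (lincomb₂ (+ 1) (- + 1) H₂-q (≈-trans (≈-reflexive (∑-concat n n sq)) (+-cong (≈-refl {a = H₂ n}) upper))
      (identity (H₂ q) (H₂ n)))
    where
    sq : ℕ → ℤ
    sq i = inv (+ suc i) * inv (+ suc i)
    opaque
      unfolding _*_
      identity : ∀ a b → + 2 * b - + 2 * + 0 ≡ + 1 * (a - + 0) + - + 1 * (a - (b + b))
      identity = solve-∀
    upper : ∑ n (λ i → sq (n ℕ.+ i)) ≈ H₂ n [ P ]
    upper = ≈-trans (≈-reflexive (∑-reverse n (λ i → sq (n ℕ.+ i)) (λ j → inv (P - + suc j) * inv (P - + suc j)) λ i j e →
        cong (λ z → inv z * inv z) (complement (trans (cong suc (ℕₚ.+-assoc n i j)) (trans (sym (ℕₚ.+-suc n (i ℕ.+ j))) (cong (n ℕ.+_) e))))))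
      (∑-≈ n λ j j<n → let h = inv-complement (ℕₚ.<-trans j<n n<q) in ≈-trans (*-cong h h) (≈-reflexive (neg-square (inv (+ suc j)))))
      where
      opaque
        unfolding _*_
        neg-square : ∀ x → - x * - x ≡ x * x
        neg-square = solve-∀

  -- Both corrections vanish: s divides by p once and `H q` twice, while s² times `H₂ q` again
  -- contains p³.
  rising-q : ∀ {s} → s ≈ + 0 [ P ] → rising s q ≈ fac q [ P³ ]
  rising-q {s} hs = cancel (+ 2) unit-2 (lincomb₄ (+ 1) (+ 2 * fac q) (fac q * s * H q) (- fac q)
    (rising-expansion q ℕₚ.≤-refl hs) sH≈0 sH≈0 (cube≈0 hs hs H₂-q)
    (identity s (H q) (H₂ q) (rising s q) (fac q)))
    where
    sH≈0 : s * H q ≈ + 0 [ P³ ]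
    sH≈0 = *-≈0 hs H-q
    opaque
      unfolding _*_
      identity : ∀ s h h₂ R F → + 2 * R - + 2 * F ≡ + 1 * (+ 2 * R - F * (+ 2 + + 2 * s * h + s * s * (h * h - h₂)))
        + + 2 * F * (s * h - + 0) + F * s * h * (s * h - + 0) + - F * (s * s * h₂ - + 0)
      identity = solve-∀

  rising-m : ∀ {s} → s ≈ + 0 [ P ] → + 2 * rising s m ≈ fac m * expansion s (H m) (H₂ m) [ P³ ]
  rising-m = rising-expansion m (ℕₚ.≤-trans (ℕₚ.<⇒≤ m<n) (ℕₚ.<⇒≤ n<q))

  rising-n : ∀ {s} → s ≈ + 0 [ P ] → + 2 * rising s n ≈ fac n * expansion s (H n) (+ 0) [ P³ ]
  rising-n {s} hs = lincomb₂ (+ 1) (- fac n) (rising-expansion n (ℕₚ.<⇒≤ n<q) hs) (cube≈0 hs hs H₂-n)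
    (identity s (H n) (H₂ n) (rising s n) (fac n))
    where
    opaque
      unfolding _*_
      identity : ∀ s h h₂ R F → + 2 * R - F * (+ 2 + + 2 * s * h + s * s * (h * h - + 0)) ≡
        + 1 * (+ 2 * R - F * (+ 2 + + 2 * s * h + s * s * (h * h - h₂))) + - F * (s * s * h₂ - + 0)
      identity = solve-∀

-- Factorial quotients around p and 2p

bin-fac : ∀ j k → bin (j ℕ.+ k) j * fac j * fac k ≡ fac (j ℕ.+ k)
bin-fac zero    k = trans (cong (_* fac k) (*-identityˡ (+ 1))) (*-identityˡ (fac k))
bin-fac (suc j) k = linear₂ (fac j * fac k) (+ suc (j ℕ.+ k)) (bin-up (j ℕ.+ k) j) (bin-fac j k)
  (identity (bin (suc (j ℕ.+ k)) (suc j)) (bin (j ℕ.+ k) j) (+ j) (+ (j ℕ.+ k)) (fac j) (fac k) (fac (j ℕ.+ k)))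
  where
  opaque
    unfolding _*_
    identity : ∀ b b′ j N f g h → b * (f * (+ 1 + j)) * g - h * (+ 1 + N) ≡
      f * g * ((+ 1 + j) * b - (+ 1 + N) * b′) + (+ 1 + N) * (b′ * f * g - h)
    identity = solve-∀

odd even : ℕ → ℤ
odd  i = + 1 + (+ i + + i)
even i = + 2 + (+ i + + i)

fac-double : ∀ m → fac (m ℕ.+ m) ≡ ∏ m odd * ∏ m even
fac-double zero    = sym (*-identityˡ (+ 1))
fac-double (suc m) = trans (cong fac (cong suc (ℕₚ.+-suc m m))) (linear₁ (odd m * even m) (fac-double m)
  (identity (fac (m ℕ.+ m)) (∏ m odd) (∏ m even) (+ m)))
  where
  opaque
    unfolding _*_
    identity : ∀ f o e m → f * (+ 1 + (m + m)) * (+ 2 + (m + m)) - o * (+ 1 + (m + m)) * (e * (+ 2 + (m + m))) ≡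
      (+ 1 + (m + m)) * (+ 2 + (m + m)) * (f - o * e)
    identity = solve-∀

∏-even : ∀ m → ∏ m even ≡ (+ 2) ^ m * fac m
∏-even m = trans (∏-cong m λ i _ → identity (+ i)) (trans (∏-* m (λ _ → + 2) (λ i → + suc i)) (cong (_* fac m) (∏-const m (+ 2))))
  where
  opaque
    unfolding _*_
    identity : ∀ i → + 2 + (i + i) ≡ + 2 * (+ 1 + i)
    identity = solve-∀

module Gauss (m : ℕ) (p-prime : Prime (suc ((m ℕ.+ m) ℕ.+ (m ℕ.+ m)))) (2<p : 2 < suc ((m ℕ.+ m) ℕ.+ (m ℕ.+ m))) where
  open Harmonic m p-prime 2<p public

  M N : ℤ
  M = + m
  N = + n

  B : ℤ
  B = bin n m

  fac-p : ∀ k → fac (p ℕ.+ k) ≡ fac q * P * rising P k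
  fac-p k = trans (∏-concat p k (λ i → + suc i)) (cong (fac q * P *_) (∏-cong k λ i _ → identity (+ q) (+ i)))
    where
    opaque
      unfolding _*_
      identity : ∀ q i → + 1 + (+ 1 + q + i) ≡ + 1 + i + (+ 1 + q)
      identity = solve-∀

  fac-2p : ∀ k → fac (p ℕ.+ (p ℕ.+ k)) ≡ fac q * P * (rising P q * (P + P)) * rising (P + P) k
  fac-2p k = trans (fac-p (p ℕ.+ k)) (trans (cong (fac q * P *_) (trans (∏-concat p k (λ i → + suc i + P))
      (cong (rising P q * (P + P) *_) (∏-cong k λ i _ → identity P (+ i))))) (sym (*-assoc (fac q * P) (rising P q * (P + P)) (rising (P + P) k))))
    where
    opaque
      unfolding _*_
      identity : ∀ P i → + 1 + (P + i) + P ≡ + 1 + i + (P + P)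
      identity = solve-∀

  fac-2p′ : ∀ k → fac (q ℕ.+ q ℕ.+ k) * ((P + P + + k - + 1) * (P + P + + k)) ≡ fac (p ℕ.+ (p ℕ.+ k))
  fac-2p′ k = trans (trans (cong (λ z → fac (q ℕ.+ q ℕ.+ k) * z) (cong₂ _*_ (identity₁ (+ q) (+ k)) (identity₂ (+ q) (+ k))))
      (sym (*-assoc (fac (q ℕ.+ q ℕ.+ k)) (+ suc (q ℕ.+ q ℕ.+ k)) (+ suc (suc (q ℕ.+ q ℕ.+ k))))))
      (cong fac (index q k))
    where
    opaque
      unfolding _*_
      identity₁ : ∀ q k → + 1 + q + (+ 1 + q) + k - + 1 ≡ + 1 + (q + q + k)
      identity₁ = solve-∀
      identity₂ : ∀ q k → + 1 + q + (+ 1 + q) + k ≡ + 2 + (q + q + k)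
      identity₂ = solve-∀
    index : ∀ q k → suc (suc (q ℕ.+ q ℕ.+ k)) ≡ suc q ℕ.+ (suc q ℕ.+ k)
    index q k = cong suc (trans (cong suc (ℕₚ.+-assoc q q k)) (sym (ℕₚ.+-suc q (q ℕ.+ k))))

  unit≢0 : ∀ {a} → Unit a → a ≢ + 0
  unit≢0 ua refl = ua ≈-refl

  cancel-exact : ∀ {a b} c → c ≢ + 0 → c * a ≡ c * b → a ≡ b
  cancel-exact {a} {b} c c≢0 e = [ (λ c≡0 → contradiction c≡0 c≢0) , ℤₚ.i-j≡0⇒i≡j a b ]′
    (ℤₚ.i*j≡0⇒i≡0∨j≡0 c (trans (sym (*≡ℤ* c (a - b))) (linear₁ (+ 1) e (identity a b c))))
    where
    opaque
      unfolding _*_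
      identity : ∀ a b c → c * (a - b) - + 0 ≡ + 1 * (c * a - c * b)
      identity = solve-∀

  nonzero-* : ∀ {a b} → a ≢ + 0 → b ≢ + 0 → a * b ≢ + 0
  nonzero-* {a} {b} a≢0 b≢0 e = [ a≢0 , b≢0 ]′ (ℤₚ.i*j≡0⇒i≡0∨j≡0 a (trans (sym (*≡ℤ* a b)) e))

  P≢0 : P ≢ + 0
  P≢0 ()

  P+P≢0 : P + P ≢ + 0
  P+P≢0 ()

  F T Q : ℤ
  F = fac m
  T = fac (n ℕ.+ m)
  Q = fac q

  unit-F : Unit F
  unit-F = unit-fac (ℕₚ.≤-trans (ℕₚ.<⇒≤ m<n) (ℕₚ.<⇒≤ n<q))
  unit-Q : Unit Q
  unit-Q = unit-fac ℕₚ.≤-refl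
  P≈0 : P ≈ + 0 [ P ]
  P≈0 = modulus≈0
  2P≈0 : P + P ≈ + 0 [ P ]
  2P≈0 = +-cong P≈0 P≈0

  -- These are p! and (2p)!. They are divisible by p, so they must be cancelled from exact
  -- identities before anything is reduced modulo p³.
  QP Z : ℤ
  QP = Q * P
  Z = Q * P * (rising P q * (P + P))

  QP≢0 : QP ≢ + 0
  QP≢0 = nonzero-* (unit≢0 unit-Q) P≢0

  unit-rising-q : Unit (rising P q)
  unit-rising-q = unit-≈ (P³⇒P (rising-q P≈0)) unit-Q

  Z≢0 : Z ≢ + 0
  Z≢0 = nonzero-* QP≢0 (nonzero-* (unit≢0 unit-rising-q) P+P≢0)

  -- In the usual notation C(6m, m), C(10m, m), C(10m, 5m), C(6m, 3m), C(10m, 3m). The two Y contain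
  -- the factor p, as adding the lower indices in base p produces a carry. L is (2p + n)!/(10m)!,
  -- because 10m = 2p + n - 2.
  X₁ X₂ X₃ Y₁ Y₂ L : ℤ
  X₁ = bin (m ℕ.+ (q ℕ.+ m)) m
  Y₁ = bin ((n ℕ.+ m) ℕ.+ (n ℕ.+ m)) (n ℕ.+ m)
  X₂ = bin (m ℕ.+ (q ℕ.+ q ℕ.+ m)) m
  X₃ = bin ((q ℕ.+ m) ℕ.+ (q ℕ.+ m)) (q ℕ.+ m)
  Y₂ = bin ((n ℕ.+ m) ℕ.+ (q ℕ.+ (n ℕ.+ m))) (n ℕ.+ m)
  L = (P + P + N - + 1) * (P + P + N)

  B-fac : B * F * F ≡ fac n
  B-fac = bin-fac m m

  fac-6m : fac (q ℕ.+ n) * (P + N) ≡ QP * rising P n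
  fac-6m = fac-p n

  fac-10m : fac (q ℕ.+ q ℕ.+ n) * L ≡ Z * rising (P + P) n
  fac-10m = trans (fac-2p′ n) (fac-2p n)

  index₁ : ∀ m → m ℕ.+ (m ℕ.+ m ℕ.+ (m ℕ.+ m) ℕ.+ m) ≡ m ℕ.+ m ℕ.+ (m ℕ.+ m) ℕ.+ (m ℕ.+ m)
  index₁ = ℕRing.solve-∀
  index₂ : ∀ m → m ℕ.+ m ℕ.+ m ℕ.+ (m ℕ.+ m ℕ.+ m) ≡ m ℕ.+ m ℕ.+ (m ℕ.+ m) ℕ.+ (m ℕ.+ m)
  index₂ = ℕRing.solve-∀
  index₃ : ∀ m → m ℕ.+ (m ℕ.+ m ℕ.+ (m ℕ.+ m) ℕ.+ (m ℕ.+ m ℕ.+ (m ℕ.+ m)) ℕ.+ m) ≡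
                 m ℕ.+ m ℕ.+ (m ℕ.+ m) ℕ.+ (m ℕ.+ m ℕ.+ (m ℕ.+ m)) ℕ.+ (m ℕ.+ m)
  index₃ = ℕRing.solve-∀
  index₄ : ∀ m → m ℕ.+ m ℕ.+ (m ℕ.+ m) ℕ.+ m ℕ.+ (m ℕ.+ m ℕ.+ (m ℕ.+ m) ℕ.+ m) ≡
                 m ℕ.+ m ℕ.+ (m ℕ.+ m) ℕ.+ (m ℕ.+ m ℕ.+ (m ℕ.+ m)) ℕ.+ (m ℕ.+ m)
  index₄ = ℕRing.solve-∀
  index₅ : ∀ m → m ℕ.+ m ℕ.+ m ℕ.+ (m ℕ.+ m ℕ.+ (m ℕ.+ m) ℕ.+ (m ℕ.+ m ℕ.+ m)) ≡
                 m ℕ.+ m ℕ.+ (m ℕ.+ m) ℕ.+ (m ℕ.+ m ℕ.+ (m ℕ.+ m)) ℕ.+ (m ℕ.+ m)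
  index₅ = ℕRing.solve-∀

  fac-X₁ : (P + N) * X₁ * F * rising P m ≡ (P + M) * rising P n
  fac-X₁ = cancel-exact QP QP≢0 (trans (linear₂ (- (P + N) * X₁ * F) ((P + N) * (P + M)) (fac-p m) (trans (bin-fac m (q ℕ.+ m)) (cong fac (index₁ m)))
      (identity₁ (P + N) (P + M) X₁ F (fac (q ℕ.+ m)) QP (rising P m) (fac (q ℕ.+ n))))
    (linear₁ (P + M) fac-6m (identity₂ (P + N) (P + M) (fac (q ℕ.+ n)) QP (rising P n))))
    where
    opaque
      unfolding _*_
      identity₁ : ∀ a b X F f QP R g → QP * (a * X * F * R) - g * a * b ≡
        - a * X * F * (f * b - QP * R) + a * b * (X * F * f - g)
      identity₁ = solve-∀
      identity₂ : ∀ a b g QP R → g * a * b - QP * (b * R) ≡ b * (g * a - QP * R)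
      identity₂ = solve-∀

  fac-Y₁ : (P + N) * Y₁ * (T * T) ≡ P * Q * rising P n
  fac-Y₁ = linear₂ (P + N) (+ 1) (trans (bin-fac (n ℕ.+ m) (n ℕ.+ m)) (cong fac (index₂ m))) fac-6m
    (identity (P + N) Y₁ T (fac (q ℕ.+ n)) P Q (rising P n))
    where
    opaque
      unfolding _*_
      identity : ∀ a Y T g P Q R → a * Y * (T * T) - P * Q * R ≡ a * (Y * T * T - g) + + 1 * (g * a - Q * P * R)
      identity = solve-∀

  fac-X₂ : L * X₂ * F * rising (P + P) m ≡ (P + P + M - + 1) * (P + P + M) * rising (P + P) n
  fac-X₂ = cancel-exact Z Z≢0 (trans (linear₂ (- L * X₂ * F) (L * l) (trans (fac-2p′ m) (fac-2p m)) (trans (bin-fac m (q ℕ.+ q ℕ.+ m)) (cong fac (index₃ m)))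
      (identity₁ L l X₂ F (fac (q ℕ.+ q ℕ.+ m)) Z (rising (P + P) m) (fac (q ℕ.+ q ℕ.+ n))))
    (linear₁ l fac-10m (identity₂ L l (fac (q ℕ.+ q ℕ.+ n)) Z (rising (P + P) n))))
    where
    l = (P + P + M - + 1) * (P + P + M)
    opaque
      unfolding _*_
      identity₁ : ∀ a b X F f QP R g → QP * (a * X * F * R) - g * a * b ≡
        - a * X * F * (f * b - QP * R) + a * b * (X * F * f - g)
      identity₁ = solve-∀
      identity₂ : ∀ a b g QP R → g * a * b - QP * (b * R) ≡ b * (g * a - QP * R)
      identity₂ = solve-∀

  fac-X₃ : L * X₃ * (rising P m * rising P m) * Q ≡ + 2 * ((P + M) * (P + M)) * rising P q * rising (P + P) n
  fac-X₃ = cancel-exact (QP * P) (nonzero-* QP≢0 P≢0) (trans (linear₂ (- (L * X₃) * (f * (P + M) + QP * rising P m)) (L * ((P + M) * (P + M)))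
      (fac-p m) (trans (bin-fac (q ℕ.+ m) (q ℕ.+ m)) (cong fac (index₄ m)))
      (identity₁ L (P + M) X₃ f P Q (rising P m) (fac (q ℕ.+ q ℕ.+ n))))
    (linear₁ ((P + M) * (P + M)) fac-10m (identity₂ L (P + M) (fac (q ℕ.+ q ℕ.+ n)) P Q (rising P q) (rising (P + P) n))))
    where
    f = fac (q ℕ.+ m)
    opaque
      unfolding _*_
      identity₁ : ∀ L b X f P Q R g → Q * P * P * (L * X * (R * R) * Q) - g * L * (b * b) ≡
        - (L * X) * (f * b + Q * P * R) * (f * b - Q * P * R) + L * (b * b) * (X * f * f - g)
      identity₁ = solve-∀
      identity₂ : ∀ L b g P Q R S → g * L * (b * b) - Q * P * P * (+ 2 * (b * b) * R * S) ≡
        b * b * (g * L - Q * P * (R * (P + P)) * S)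
      identity₂ = solve-∀

  fac-Y₂ : L * Y₂ * T * rising P (n ℕ.+ m) ≡ (P + (N + M)) * (P + P) * rising P q * rising (P + P) n
  fac-Y₂ = cancel-exact QP QP≢0 (trans (linear₂ (- (L * Y₂ * T)) (L * (P + (N + M)))
      (fac-p (n ℕ.+ m)) (trans (bin-fac (n ℕ.+ m) (q ℕ.+ (n ℕ.+ m))) (cong fac (index₅ m)))
      (identity₁ L (P + (N + M)) Y₂ T (fac (q ℕ.+ (n ℕ.+ m))) QP (rising P (n ℕ.+ m)) (fac (q ℕ.+ q ℕ.+ n))))
    (linear₁ (P + (N + M)) fac-10m (identity₂ L (P + (N + M)) (fac (q ℕ.+ q ℕ.+ n)) P Q (rising P q) (rising (P + P) n))))
    where
    opaque
      unfolding _*_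
      identity₁ : ∀ L b Y T f QP R g → QP * (L * Y * T * R) - g * L * b ≡ - (L * Y * T) * (f * b - QP * R) + L * b * (Y * T * f - g)
      identity₁ = solve-∀
      identity₂ : ∀ L b g P Q R S → g * L * b - Q * P * (b * (P + P) * R * S) ≡ b * (g * L - Q * P * (R * (P + P)) * S)
      identity₂ = solve-∀

  neg-rising : ∀ s k → ∏ k (λ i → s - + suc i) ≡ sgn k * rising (- s) k
  neg-rising s k = trans (∏-cong k λ i _ → identity s (+ suc i)) (trans (∏-* k (λ _ → - + 1) (λ i → + suc i + - s))
    (cong (_* rising (- s) k) (trans (∏-const k (- + 1)) (trans (neg^ (+ 1) k) (trans (cong (sgn k *_) (one^ k)) (*-identityʳ (sgn k)))))))
    where
    opaque
      unfolding _*_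
      identity : ∀ s x → s - x ≡ - + 1 * (x + - s)
      identity = solve-∀

  fac-q : fac q ≡ fac n * rising (- P) n
  fac-q = trans (∏-concat n n (λ i → + suc i)) (cong (fac n *_) (trans
    (∏-reverse n (λ i → + suc (n ℕ.+ i)) (λ j → P - + suc j) λ i j e → linear₁ (+ 1) (cong +_ e) (identity N (+ i) (+ j)))
    (trans (neg-rising P n) (trans (cong (_* rising (- P) n) (sgn-double m)) (*-identityˡ (rising (- P) n))))))
    where
    opaque
      unfolding _*_
      identity : ∀ n i j → + 1 + (n + i) - (+ 1 + (n + n) - (+ 1 + j)) ≡ + 1 * (+ 1 + (i + j) - n)
      identity = solve-∀

  fac-T : Q ≡ T * (sgn m * rising (- P) m)
  fac-T = trans (cong fac (sym (ℕₚ.+-assoc n m m))) (trans (∏-concat (n ℕ.+ m) m (λ i → + suc i)) (cong (T *_) (trans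
    (∏-reverse m (λ i → + suc (n ℕ.+ m ℕ.+ i)) (λ j → P - + suc j) λ i j e → linear₁ (+ 1) (cong +_ e) (identity M (+ i) (+ j)))
    (neg-rising P m))))
    where
    opaque
      unfolding _*_
      identity : ∀ m i j → + 1 + (m + m + m + i) - (+ 1 + (m + m + (m + m)) - (+ 1 + j)) ≡ + 1 * (+ 1 + (i + j) - m)
      identity = solve-∀

  rising-T : rising P q ≡ rising P (n ℕ.+ m) * (sgn m * rising (- (P + P)) m)
  rising-T = trans (cong (rising P) (sym (ℕₚ.+-assoc n m m))) (trans (∏-concat (n ℕ.+ m) m (λ i → + suc i + P)) (cong (rising P (n ℕ.+ m) *_) (trans
    (∏-reverse m (λ i → + suc (n ℕ.+ m ℕ.+ i) + P) (λ j → P + P - + suc j) λ i j e → linear₁ (+ 1) (cong +_ e) (identity M (+ i) (+ j)))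
    (neg-rising (P + P) m))))
    where
    opaque
      unfolding _*_
      identity : ∀ m i j → let P = + 1 + (m + m + (m + m)) in
        + 1 + (m + m + m + i) + P - (P + P - (+ 1 + j)) ≡ + 1 * (+ 1 + (i + j) - m)
      identity = solve-∀

  h g : ℤ
  h = H n - H m
  g = H₂ m

  -- Twice the expansion of (`rising s n` / n!) divided by (`rising s m` / m!). As `H₂ n` vanishes
  -- modulo p, only `H₂ m` survives at second order, and division gives it a plus sign.
  k : ℤ → ℤ
  k s = + 2 + + 2 * s * h + s * s * (h * h + g)

-- The binomial coefficients of the trace formula modulo p³

module UnitRoot (m : ℕ) (p-prime : Prime (suc ((m ℕ.+ m) ℕ.+ (m ℕ.+ m)))) (2<p : 2 < suc ((m ℕ.+ m) ℕ.+ (m ℕ.+ m))) where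
  open Gauss m p-prime 2<p public

  4<p : 4 < p
  4<p = s≤s (ℕₚ.+-mono-≤ {2} {n} (ℕₚ.+-mono-≤ 0<m 0<m) (ℕₚ.+-mono-≤ 0<m 0<m))

  unit-3 : Unit (+ 3)
  unit-3 = unit-small (s≤s z≤n) (ℕₚ.<-trans (ℕₚ.n<1+n 3) 4<p)

  unit-4 : Unit (+ 4)
  unit-4 = unit-small (s≤s z≤n) 4<p

  private
    unit-product : ∀ {a b c} → a ≡ b * c → Unit b → Unit c → Unit a
    unit-product e ub uc = unit-≈ (≈-reflexive e) (unit-* ub uc)

  unit-16 : Unit (+ 16)
  unit-16 = unit-product (sym (*≡ℤ* (+ 4) (+ 4))) unit-4 unit-4

  unit-216 : Unit (+ 216)
  unit-216 = unit-product (sym (*≡ℤ* (+ 8) (+ 27))) (unit-product (sym (*≡ℤ* (+ 2) (+ 4))) unit-2 unit-4)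
    (unit-product (sym (*≡ℤ* (+ 3) (+ 9))) unit-3 (unit-product (sym (*≡ℤ* (+ 3) (+ 3))) unit-3 unit-3))

  P³≈0 : P³ ≈ + 0 [ P³ ]
  P³≈0 = modulus≈0

  s³≈0 : ∀ {s} → s ≈ + 0 [ P ] → s * s * s ≈ + 0 [ P³ ]
  s³≈0 hs = cube≈0 hs hs hs

  -- Multiply by the inverse expansion, obtained by changing the signs of `H m` and `g`. The long
  -- coefficient gathers all terms of order three in s.
  ratio : ∀ {s} u v → s ≈ + 0 [ P ] → u * expansion s (H m) g ≈ v * expansion s (H n) (+ 0) [ P³ ] → + 2 * u ≈ v * k s [ P³ ]
  ratio {s} u v hs e = cancel (+ 2) unit-2 (lincomb₂ (+ 2 - + 2 * s * H m + s * s * (H m * H m + g))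
      (- u * (+ 4 * H m * g + s * (H m * H m * H m * H m - g * g))
        + v * (+ 2 * H n * (H m * H m + g) - + 2 * H m * H n * H n + s * (H n * H n * (H m * H m + g))))
      e (s³≈0 hs) (identity s u v (H m) (H n) g))
    where
    opaque
      unfolding _*_
      identity : ∀ s u v a b g →
        + 2 * (+ 2 * u) - + 2 * (v * (+ 2 + + 2 * s * (b - a) + s * s * ((b - a) * (b - a) + g))) ≡
        (+ 2 - + 2 * s * a + s * s * (a * a + g)) *
          (u * (+ 2 + + 2 * s * a + s * s * (a * a - g)) - v * (+ 2 + + 2 * s * b + s * s * (b * b - + 0)))
        + (- u * (+ 4 * a * g + s * (a * a * a * a - g * g))
            + v * (+ 2 * b * (a * a + g) - + 2 * a * b * b + s * (b * b * (a * a + g)))) * (s * s * s - + 0)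
      identity = solve-∀

  binomial-ratio : ∀ {s} A X v → s ≈ + 0 [ P ] → A * X * F * rising s m ≡ v * rising s n → + 2 * (A * X) ≈ v * B * k s [ P³ ]
  binomial-ratio {s} A X v hs e = ratio (A * X) (v * B) hs (cancel (F * F) (unit-* unit-F unit-F)
    (≈-trans (lincomb₄ (- (A * X) * F) (+ 2) v (- v * expansion s (H n) (+ 0))
      (rising-m hs) (≈-reflexive e) (rising-n hs) (≈-reflexive B-fac)
      (identity A X v F B (fac n) (rising s m) (rising s n) (expansion s (H m) g) (expansion s (H n) (+ 0)))) ≈-refl))
    where
    opaque
      unfolding _*_
      identity : ∀ A X v F B f R S Ea Eb → F * F * (A * X * Ea) - F * F * (v * B * Eb) ≡
        - (A * X) * F * (+ 2 * R - F * Ea) + + 2 * (A * X * F * R - v * S) + v * (+ 2 * S - f * Eb)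
        + - v * Eb * (B * F * F - f)
      identity = solve-∀

  unit-P+N : Unit (P + N)
  unit-P+N h = unit-small (ℕₚ.≤-trans (s≤s z≤n) 0<n) (ℕₚ.<-trans n<q (ℕₚ.n<1+n q))
    (lincomb₂ (+ 1) (- + 1) h modulus≈0 (identity P N))
    where
    opaque
      unfolding _*_
      identity : ∀ P N → N - + 0 ≡ + 1 * (P + N - + 0) + - + 1 * (P - + 0)
      identity = solve-∀

  -- Rational functions of p are replaced by their expansions modulo p³.
  X₁-value : + 4 * X₁ ≈ (+ 1 - + 2 * P - + 6 * P * P) * B * k P [ P³ ]
  X₁-value = cancel (+ 2 * (P + N)) (unit-* unit-2 unit-P+N) (lincomb₂ (+ 4) (+ 18 * B * k P)
    (binomial-ratio (P + N) X₁ (P + M) P≈0 fac-X₁) P³≈0 (identity M B X₁ (k P)))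
    where
    opaque
      unfolding _*_
      identity : ∀ m B X k → let P = + 1 + (m + m + (m + m)) in
        + 2 * (P + (m + m)) * (+ 4 * X) - + 2 * (P + (m + m)) * ((+ 1 - + 2 * P - + 6 * P * P) * B * k) ≡
        + 4 * (+ 2 * ((P + (m + m)) * X) - (P + m) * B * k) + + 18 * B * k * (P * (P * P) - + 0)
      identity = solve-∀

  unit-L : Unit L
  unit-L h = unit-3 (lincomb₂ (+ 4) (+ 20 - + 25 * P) h modulus≈0 (identity M))
    where
    opaque
      unfolding _*_
      identity : ∀ m → let P = + 1 + (m + m + (m + m)) in
        + 3 - + 0 ≡ + 4 * ((P + P + (m + m) - + 1) * (P + P + (m + m)) - + 0) + (+ 20 - + 25 * P) * (P - + 0)
      identity = solve-∀

  L-value : + 4 * L ≡ (+ 5 * P - + 3) * (+ 5 * P - + 1)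
  L-value = identity M
    where
    opaque
      unfolding _*_
      identity : ∀ m → let P = + 1 + (m + m + (m + m)) in + 4 * ((P + P + (m + m) - + 1) * (P + P + (m + m))) ≡ (+ 5 * P - + 3) * (+ 5 * P - + 1)
      identity = solve-∀

  X₂-value : + 216 * X₂ ≈ (+ 45 - + 186 * P - + 886 * P * P) * B * k (P + P) [ P³ ]
  X₂-value = cancel (+ 4 * L) (unit-* unit-4 unit-L) (lincomb₃ (+ 432) (B * k (P + P)) (B * k (P + P) * r)
    (binomial-ratio L X₂ S 2P≈0 fac-X₂) (≈-reflexive weights) P³≈0 (identity L X₂ S C r P³ B (k (P + P))))
    where
    S C r : ℤ
    S = (P + P + M - + 1) * (P + P + M)
    -- Long division of 432 S = 27 (9P - 5)(9P - 1) by 4 L = (5P - 3)(5P - 1) in ascending powers of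
    -- P: `C` is the quotient up to P², and rP³ is the remainder.
    C = + 45 - + 186 * P - + 886 * P * P
    r = - + 13070 + + 22150 * P
    S-value : + 16 * S ≡ (+ 9 * P - + 5) * (+ 9 * P - + 1)
    S-value = ring M
      where
      opaque
        unfolding _*_
        ring : ∀ m → let P = + 1 + (m + m + (m + m)) in + 16 * ((P + P + m - + 1) * (P + P + m)) ≡ (+ 9 * P - + 5) * (+ 9 * P - + 1)
        ring = solve-∀
    weights : + 432 * S ≡ + 4 * L * C + r * P³
    weights = linear₂ (+ 27) (- C) S-value L-value (ring S L P)
      where
      opaque
        unfolding _*_
        ring : ∀ S L P → let C = + 45 - + 186 * P - + 886 * P * P in + 432 * S - (+ 4 * L * C + (- + 13070 + + 22150 * P) * (P * (P * P))) ≡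
          + 27 * (+ 16 * S - (+ 9 * P - + 5) * (+ 9 * P - + 1)) + - C * (+ 4 * L - (+ 5 * P - + 3) * (+ 5 * P - + 1))
        ring = solve-∀
    opaque
      unfolding _*_
      identity : ∀ L X S C r T B k → + 4 * L * (+ 216 * X) - + 4 * L * (C * B * k) ≡
        + 432 * (+ 2 * (L * X) - S * B * k) + B * k * (+ 432 * S - (+ 4 * L * C + r * T)) + B * k * r * (T - + 0)
      identity = solve-∀

  -- Expansion of (`rising (P + P) n` / n!) divided by the square of (`rising P m` / m!); the square
  -- doubles the contribution of `g`.
  k₃ : ℤ
  k₃ = + 1 + + 2 * P * h + P * P * (+ 2 * h * h + g)

  X₃-ratio : L * X₃ ≈ + 2 * ((P + M) * (P + M) * B) * k₃ [ P³ ]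
  X₃-ratio = cancel (+ 16) unit-16 (lincomb₃ (ē * ē) (- (L * X₃) * (Ea * ē + + 4)) (+ 4 * (c * B)) squared Ea-inverse Eb-ratio
      (identity (L * X₃) (c * B) Ea Eb ē k₃))
    where
    c = (P + M) * (P + M)
    a = H m
    -- The inverse of `Ea` up to the factor 4: the signs of a and g are changed.
    ē = + 2 - + 2 * P * a + P * P * (a * a + g)
    d = + 8 * a * a + + 4 * g
    Ea = expansion P (H m) g
    Eb = expansion (P + P) (H n) (+ 0)
    squared : L * X₃ * (Ea * Ea) ≈ + 4 * (c * B) * Eb [ P³ ]
    squared = cancel (F * F) (unit-* unit-F unit-F) (≈-trans (lincomb₄ (- (L * X₃) * (+ 2 * rising P m + F * Ea)) (+ 4) (+ 4 * c) (- + 4 * c * Eb)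
        (rising-m P≈0) (cancel Q unit-Q reduced) (rising-n 2P≈0) (≈-reflexive B-fac)
        (identity′ (L * X₃) c F B (fac n) (rising P m) (rising (P + P) n) Ea Eb)) ≈-refl)
      where
      reduced : Q * (L * X₃ * (rising P m * rising P m)) ≈ Q * (+ 2 * c * rising (P + P) n) [ P³ ]
      reduced = lincomb₂ (+ 1) (+ 2 * c * rising (P + P) n) (≈-reflexive fac-X₃) (rising-q P≈0)
        (ring Q (L * X₃) (rising P m) c (rising P q) (rising (P + P) n))
        where
        opaque
          unfolding _*_
          ring : ∀ Q X R c r S → Q * (X * (R * R)) - Q * (+ 2 * c * S) ≡ + 1 * (X * (R * R) * Q - + 2 * c * r * S) + + 2 * c * S * (r - Q)
          ring = solve-∀
      opaque
        unfolding _*_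
        identity′ : ∀ X c F B f R S Ea Eb → F * F * (X * (Ea * Ea)) - F * F * (+ 4 * (c * B) * Eb) ≡
          - X * (+ 2 * R + F * Ea) * (+ 2 * R - F * Ea) + + 4 * (X * (R * R) - + 2 * c * S) + + 4 * c * (+ 2 * S - f * Eb)
          + - + 4 * c * Eb * (B * F * F - f)
        identity′ = solve-∀
    Ea-inverse : Ea * ē ≈ + 4 [ P³ ]
    Ea-inverse = lincomb₁ (+ 4 * a * g + P * (a * a * a * a - g * g)) P³≈0 (ring P a g)
      where
      opaque
        unfolding _*_
        ring : ∀ P a g → (+ 2 + + 2 * P * a + P * P * (a * a - g)) * (+ 2 - + 2 * P * a + P * P * (a * a + g)) - + 4 ≡
          (+ 4 * a * g + P * (a * a * a * a - g * g)) * (P * (P * P) - + 0)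
        ring = solve-∀
    ē² : ē * ē ≈ + 4 - + 8 * P * a + P * P * d [ P³ ]
    ē² = lincomb₁ (- + 4 * a * (a * a + g) + P * ((a * a + g) * (a * a + g))) P³≈0 (ring P a g)
      where
      opaque
        unfolding _*_
        ring : ∀ P a g → let e = + 2 - + 2 * P * a + P * P * (a * a + g) in
          e * e - (+ 4 - + 8 * P * a + P * P * (+ 8 * a * a + + 4 * g)) ≡
          (- + 4 * a * (a * a + g) + P * ((a * a + g) * (a * a + g))) * (P * (P * P) - + 0)
        ring = solve-∀
    Eb-ratio : Eb * (ē * ē) ≈ + 8 * k₃ [ P³ ]
    Eb-ratio = lincomb₂ Eb (+ 4 * H n * d - + 32 * a * (H n * H n) + + 4 * P * (H n * H n) * d) ē² P³≈0
      (ring P a (H n) g (ē * ē))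
      where
      opaque
        unfolding _*_
        ring : ∀ P a b g e → let d = + 8 * a * a + + 4 * g ; Eb = + 2 + + 2 * (P + P) * b + (P + P) * (P + P) * (b * b - + 0) in
          Eb * e - + 8 * (+ 1 + + 2 * P * (b - a) + P * P * (+ 2 * (b - a) * (b - a) + g)) ≡
          Eb * (e - (+ 4 - + 8 * P * a + P * P * d)) + (+ 4 * b * d - + 32 * a * (b * b) + + 4 * P * (b * b) * d) * (P * (P * P) - + 0)
        ring = solve-∀
    opaque
      unfolding _*_
      identity : ∀ X C Ea Eb e k → + 16 * X - + 16 * (+ 2 * C * k) ≡
        e * e * (X * (Ea * Ea) - + 4 * C * Eb) + - X * (Ea * e + + 4) * (Ea * e - + 4) + + 4 * C * (Eb * (e * e) - + 8 * k)
      identity = solve-∀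

  X₃-value : + 54 * X₃ ≈ (+ 9 - + 30 * P - + 50 * P * P) * B * k₃ [ P³ ]
  X₃-value = cancel (+ 4 * L) (unit-* unit-4 unit-L) (lincomb₃ (+ 216) (B * k₃) (B * k₃ * r)
    X₃-ratio (≈-reflexive weights) P³≈0 (identity L X₃ S C r P³ B k₃))
    where
    S C r : ℤ
    S = (P + M) * (P + M)
    C = + 9 - + 30 * P - + 50 * P * P
    r = - + 250 + + 1250 * P
    S-value : + 16 * S ≡ (+ 5 * P - + 1) * (+ 5 * P - + 1)
    S-value = ring M
      where
      opaque
        unfolding _*_
        ring : ∀ m → let P = + 1 + (m + m + (m + m)) in + 16 * ((P + m) * (P + m)) ≡ (+ 5 * P - + 1) * (+ 5 * P - + 1)
        ring = solve-∀
    weights : + 432 * S ≡ + 4 * L * C + r * P³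
    weights = linear₂ (+ 27) (- C) S-value L-value (ring S L P)
      where
      opaque
        unfolding _*_
        ring : ∀ S L P → let C = + 9 - + 30 * P - + 50 * P * P in + 432 * S - (+ 4 * L * C + (- + 250 + + 1250 * P) * (P * (P * P))) ≡
          + 27 * (+ 16 * S - (+ 5 * P - + 1) * (+ 5 * P - + 1)) + - C * (+ 4 * L - (+ 5 * P - + 3) * (+ 5 * P - + 1))
        ring = solve-∀
    opaque
      unfolding _*_
      identity : ∀ L X S C r T B k → + 4 * L * (+ 54 * X) - + 4 * L * (C * B * k) ≡
        + 216 * (L * X - + 2 * (S * B) * k) + B * k * (+ 432 * S - (+ 4 * L * C + r * T)) + B * k * r * (T - + 0)
      identity = solve-∀

  -- The right side of the trace formula is sorted by divisibility: `V` collects the multiples of p,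
  -- `U` the rest. They will supply α and p/α. `K` is 16 times the expansion of α relative to B and
  -- the sign (-1)^m.
  U V K : ℤ
  U = + 15 * B - + 20 * X₁ + + 6 * X₂ + + 3 * X₃
  V = - + 10 * Y₁ + + 6 * Y₂
  K = + 16 - + 8 * P * h + P * P * (+ 2 * h * h + g)

  -- With s = -p/2, K/16 is 1 + sh + s² (h²/2 + g/4). The contributions at shifts p and 2p thus
  -- combine into the expansion of a single product at shift -p/2. The factor 216 clears the
  -- denominators of the three X.
  U-value : + 216 * ((+ 1 - P) * U) ≈ + 108 * (B * K) [ P³ ]
  U-value = lincomb₄ (- + 1080 * (+ 1 - P)) (+ 6 * (+ 1 - P)) (+ 12 * (+ 1 - P))
    (B * (- + 1728 + - + 2772 * g + - + 8640 * h + - + 12720 * P * g + + 9504 * P * h + - + 3240 * h * h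
          + - + 12960 * P * h * h + + 15384 * P * P * g + + 15984 * P * P * h * h))
    X₁-value X₂-value X₃-value P³≈0 (identity P B X₁ X₂ X₃ h g)
    where
    opaque
      unfolding _*_
      identity : ∀ P B X₁ X₂ X₃ h g → let
          k₁ = + 2 + + 2 * P * h + P * P * (h * h + g)
          k₂ = + 2 + + 2 * (P + P) * h + (P + P) * (P + P) * (h * h + g)
          k₃ = + 1 + + 2 * P * h + P * P * (+ 2 * h * h + g)
        in + 216 * ((+ 1 - P) * (+ 15 * B - + 20 * X₁ + + 6 * X₂ + + 3 * X₃))
           - + 108 * (B * (+ 16 - + 8 * P * h + P * P * (+ 2 * h * h + g))) ≡
        - + 1080 * (+ 1 - P) * (+ 4 * X₁ - (+ 1 - + 2 * P - + 6 * P * P) * B * k₁)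
        + + 6 * (+ 1 - P) * (+ 216 * X₂ - (+ 45 - + 186 * P - + 886 * P * P) * B * k₂)
        + + 12 * (+ 1 - P) * (+ 54 * X₃ - (+ 9 - + 30 * P - + 50 * P * P) * B * k₃)
        + B * (- + 1728 + - + 2772 * g + - + 8640 * h + - + 12720 * P * g + + 9504 * P * h + - + 3240 * h * h
            + - + 12960 * P * h * h + + 15384 * P * P * g + + 15984 * P * P * h * h) * (P * (P * P) - + 0)
      identity = solve-∀

module TraceValue (m : ℕ) (p-prime : Prime (suc ((m ℕ.+ m) ℕ.+ (m ℕ.+ m)))) (2<p : 2 < suc ((m ℕ.+ m) ℕ.+ (m ℕ.+ m))) where
  open UnitRoot m p-prime 2<p public

  private
    f : ℤ
    f = fac n

    E : ℤ → ℤ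
    E s = expansion s (H n) (+ 0)
    A : ℤ → ℤ
    A s = expansion s (H m) g

    unit-f : Unit f
    unit-f = unit-fac (ℕₚ.<⇒≤ n<q)

    -P≈0 : - P ≈ + 0 [ P ]
    -P≈0 = neg-cong P≈0

    -2P≈0 : - (P + P) ≈ + 0 [ P ]
    -2P≈0 = neg-cong 2P≈0

    E-inverse : E P * E (- P) ≈ + 4 [ P³ ]
    E-inverse = lincomb₁ (P * H n * H n * H n * H n) P³≈0 (identity P (H n))
      where
      opaque
        unfolding _*_
        identity : ∀ P b → (+ 2 + + 2 * P * b + P * P * (b * b - + 0)) * (+ 2 + + 2 * - P * b + - P * - P * (b * b - + 0)) - + 4 ≡
          P * b * b * b * b * (P * (P * P) - + 0)
        identity = solve-∀

    linear-mod : ∀ {s} σ ρ → s ≈ + 0 [ P ] → expansion s σ ρ ≈ + 2 + + 2 * s * σ [ P² ]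
    linear-mod {s} σ ρ hs = lincomb₁ (σ * σ - ρ) (*-≈0 hs hs) (identity s σ ρ)
      where
      opaque
        unfolding _*_
        identity : ∀ s σ ρ → + 2 + + 2 * s * σ + s * s * (σ * σ - ρ) - (+ 2 + + 2 * s * σ) ≡ (σ * σ - ρ) * (s * s - + 0)
        identity = solve-∀

    unit-fFF : Unit (f * F * F)
    unit-fFF = unit-* (unit-* unit-f unit-F) unit-F

    normalise : ∀ a → f * F * F * (+ 4 * (a * B) * E (- P)) ≈ + 8 * (a * Q) [ P³ ]
    normalise a = lincomb₃ (+ 4 * a * f * E (- P)) (- + 4 * a * f) (- + 8 * a)
      (≈-reflexive B-fac) (rising-n -P≈0) (≈-reflexive fac-q) (ring a f F B Q (rising (- P) n) (E (- P)))
      where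
      opaque
        unfolding _*_
        ring : ∀ a f F B Q C E → f * F * F * (+ 4 * (a * B) * E) - + 8 * (a * Q) ≡
          + 4 * a * f * E * (B * F * F - f) + - + 4 * a * f * (+ 2 * C - f * E) + - + 8 * a * (Q - f * C)
        ring = solve-∀

  -- The factors (3m)! and (4m)! are eliminated by means of (4m)! = (2m)! ∏ (p − i) = ± (3m)! ∏ (p − i).
  Y₁-ratio : (P + N) * Y₁ * B ≈ P * (+ 1 + + 2 * P * h) [ P³ ]
  Y₁-ratio = cancel (+ 16) unit-16 (≈-trans (lincomb₂ (- + 4 * ((P + N) * Y₁ * B)) (E P) E-inverse reduced
      (identity ((P + N) * Y₁ * B) (E P) (E (- P)) (A (- P)) P)) (≈-trans (scale P expanded) (≈-reflexive (regroup P (H n - H m)))))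
    where
    opaque
      unfolding _*_
      regroup : ∀ P h → P * (+ 16 + + 32 * P * h) ≡ + 16 * (P * (+ 1 + + 2 * P * h))
      regroup = solve-∀
      identity : ∀ y E E′ A P → + 16 * y - P * (E * E * (A * A)) ≡ - + 4 * y * (E * E′ - + 4) + E * (+ 4 * y * E′ - P * E * (A * A))
      identity = solve-∀
    expanded : E P * E P * (A (- P) * A (- P)) ≈ + 16 + + 32 * P * h [ P² ]
    expanded = ≈-trans (*-cong (*-cong hE hE) (*-cong hA hA)) (lincomb₁
        (+ 16 * a * a + - + 64 * a * b + + 16 * b * b + + 32 * P * a * a * b + - + 32 * P * a * b * b + + 16 * P * P * a * a * b * b)
        (*-≈0 P≈0 P≈0) (ring P a b))
      where
      a = H m
      b = H n
      hE = linear-mod {P} (H n) (+ 0) P≈0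
      hA = linear-mod { - P} (H m) g -P≈0
      opaque
        unfolding _*_
        ring : ∀ P a b → (+ 2 + + 2 * P * b) * (+ 2 + + 2 * P * b) * ((+ 2 + + 2 * - P * a) * (+ 2 + + 2 * - P * a)) - (+ 16 + + 32 * P * (b - a)) ≡
          (+ 16 * a * a + - + 64 * a * b + + 16 * b * b + + 32 * P * a * a * b + - + 32 * P * a * b * b + + 16 * P * P * a * a * b * b) * (P * P - + 0)
        ring = solve-∀
    R S : ℤ
    R = rising (- P) m
    S = rising P n
    eliminated : (P + N) * Y₁ * Q ≈ P * S * (R * R) [ P³ ]
    eliminated = cancel Q unit-Q (lincomb₃ ((P + N) * Y₁ * (Q + T * (sgn m * R))) (R * R * (sgn m * sgn m)) (P * Q * S * R * R)
      (≈-reflexive fac-T) (≈-reflexive fac-Y₁) (≈-reflexive (sgn² m)) (ring (P + N) Y₁ Q P S R T (sgn m)))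
      where
      opaque
        unfolding _*_
        ring : ∀ a Y Q P S R T s → Q * (a * Y * Q) - Q * (P * S * (R * R)) ≡
          a * Y * (Q + T * (s * R)) * (Q - T * (s * R)) + R * R * (s * s) * (a * Y * (T * T) - P * Q * S) + P * Q * S * R * R * (s * s - + 1)
        ring = solve-∀
    reduced : + 4 * ((P + N) * Y₁ * B) * E (- P) ≈ P * E P * (A (- P) * A (- P)) [ P³ ]
    reduced = cancel (f * F * F) unit-fFF (≈-trans (normalise ((P + N) * Y₁)) (≈-trans (*-congˡ (+ 8) eliminated)
      (lincomb₂ (+ 4 * P * R * R) (P * f * E P * (+ 2 * R + F * A (- P))) (rising-n P≈0) (rising-m -P≈0)
        (ring P f F S R (E P) (A (- P))))))
      where
      opaque
        unfolding _*_
        ring : ∀ P f F S R E A → + 8 * (P * S * (R * R)) - f * F * F * (P * E * (A * A)) ≡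
          + 4 * P * R * R * (+ 2 * S - f * E) + P * f * E * (+ 2 * R + F * A) * (+ 2 * R - F * A)
        ring = solve-∀

  Y₂-ratio : L * Y₂ * B ≈ + 2 * (P + (N + M)) * (P * (+ 1 + + 3 * P * h)) [ P³ ]
  Y₂-ratio = cancel (+ 16) unit-16 (≈-trans (lincomb₂ (- + 4 * (L * Y₂ * B)) (E P) E-inverse reduced
      (identity (L * Y₂ * B) (E P) (E (- P)) (E (P + P)) (A (- P)) (A (- (P + P))) P c))
      (≈-trans (*-congˡ (+ 2 * c) (scale P expanded)) (≈-reflexive (regroup P (H n - H m) c))))
    where
    c = P + (N + M)
    opaque
      unfolding _*_
      regroup : ∀ P h c → + 2 * c * (P * (+ 16 + + 48 * P * h)) ≡ + 16 * (+ 2 * c * (P * (+ 1 + + 3 * P * h)))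
      regroup = solve-∀
      identity : ∀ z E E′ E₂ A A₂ P c → + 16 * z - + 2 * c * (P * (E * E₂ * (A * A₂))) ≡
        - + 4 * z * (E * E′ - + 4) + E * (+ 4 * z * E′ - c * (P + P) * E₂ * A₂ * A)
      identity = solve-∀
    expanded : E P * E (P + P) * (A (- P) * A (- (P + P))) ≈ + 16 + + 48 * P * h [ P² ]
    expanded = ≈-trans (*-cong (*-cong (linear-mod {P} b (+ 0) P≈0) (linear-mod {P + P} b (+ 0) 2P≈0))
                               (*-cong (linear-mod { - P} a g -P≈0) (linear-mod { - (P + P)} a g -2P≈0)))
      (lincomb₁ (+ 32 * a * a + - + 144 * a * b + + 32 * b * b + + 96 * P * a * a * b + - + 96 * P * a * b * b + + 64 * P * P * a * a * b * b)
        (*-≈0 P≈0 P≈0) (ring P a b))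
      where
      a = H m
      b = H n
      opaque
        unfolding _*_
        ring : ∀ P a b → (+ 2 + + 2 * P * b) * (+ 2 + + 2 * (P + P) * b) * ((+ 2 + + 2 * - P * a) * (+ 2 + + 2 * - (P + P) * a)) - (+ 16 + + 48 * P * (b - a)) ≡
          (+ 32 * a * a + - + 144 * a * b + + 32 * b * b + + 96 * P * a * a * b + - + 96 * P * a * b * b + + 64 * P * P * a * a * b * b) * (P * P - + 0)
        ring = solve-∀
    R R₂ S : ℤ
    R  = rising (- P) m
    R₂ = rising (- (P + P)) m
    S  = rising (P + P) n
    eliminated : L * Y₂ * Q ≈ c * (P + P) * S * R₂ * R [ P³ ]
    eliminated = cancel (rising P q) unit-rising-q (lincomb₄ (L * Y₂ * rising P q) (L * Y₂ * (T * (sgn m * R))) (sgn m * sgn m * R * R₂) (c * (P + P) * rising P q * S * R * R₂)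
      (≈-reflexive fac-T) (≈-reflexive rising-T) (≈-reflexive fac-Y₂) (≈-reflexive (sgn² m))
      (ring (L * Y₂) Q c (P + P) (rising P q) (rising P (n ℕ.+ m)) S R R₂ T (sgn m)))
      where
      opaque
        unfolding _*_
        ring : ∀ Y Q c 2P r r₃ S R R₂ T s → r * (Y * Q) - r * (c * 2P * S * R₂ * R) ≡
          Y * r * (Q - T * (s * R)) + Y * (T * (s * R)) * (r - r₃ * (s * R₂)) + s * s * R * R₂ * (Y * T * r₃ - c * 2P * r * S)
          + c * 2P * r * S * R * R₂ * (s * s - + 1)
        ring = solve-∀
    reduced : + 4 * (L * Y₂ * B) * E (- P) ≈ c * (P + P) * E (P + P) * A (- (P + P)) * A (- P) [ P³ ]
    reduced = cancel (f * F * F) unit-fFF (≈-trans (normalise (L * Y₂)) (≈-trans (*-congˡ (+ 8) eliminated)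
      (lincomb₃ (c * (P + P) * (+ 4 * R₂ * R)) (c * (P + P) * (+ 2 * R * f * E (P + P))) (c * (P + P) * (f * E (P + P) * F * A (- (P + P))))
        (rising-n 2P≈0) (rising-m -2P≈0) (rising-m -P≈0)
        (ring (c * (P + P)) f F S R R₂ (E (P + P)) (A (- P)) (A (- (P + P)))))))
      where
      opaque
        unfolding _*_
        ring : ∀ c f F S R R₂ E A A₂ → + 8 * (c * S * R₂ * R) - f * F * F * (c * E * A₂ * A) ≡
          c * (+ 4 * R₂ * R) * (+ 2 * S - f * E) + c * (+ 2 * R * f * E) * (+ 2 * R₂ - F * A₂) + c * (f * E * F * A₂) * (+ 2 * R - F * A)
        ring = solve-∀

  Y₁-value : Y₁ * B ≈ - + 2 * P * (+ 1 + + 3 * P) * (+ 1 + + 2 * P * h) [ P³ ]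
  Y₁-value = cancel (+ 2 * (P + N)) (unit-* unit-2 unit-P+N) (lincomb₂ (+ 2) (+ 18 * (+ 1 + + 2 * P * h)) Y₁-ratio P³≈0 (identity M (Y₁ * B) Y₁ B h refl))
    where
    identity : ∀ m y Y B h → y ≡ Y * B → let P = + 1 + (m + m + (m + m)) in
      + 2 * (P + (m + m)) * y - + 2 * (P + (m + m)) * (- + 2 * P * (+ 1 + + 3 * P) * (+ 1 + + 2 * P * h)) ≡
      + 2 * ((P + (m + m)) * Y * B - P * (+ 1 + + 2 * P * h)) + + 18 * (+ 1 + + 2 * P * h) * (P * (P * P) - + 0)
    identity m _ Y B h refl = ring m Y B h
      where
      opaque
        unfolding _*_
        ring : ∀ m Y B h → let P = + 1 + (m + m + (m + m)) in
          + 2 * (P + (m + m)) * (Y * B) - + 2 * (P + (m + m)) * (- + 2 * P * (+ 1 + + 3 * P) * (+ 1 + + 2 * P * h)) ≡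
          + 2 * ((P + (m + m)) * Y * B - P * (+ 1 + + 2 * P * h)) + + 18 * (+ 1 + + 2 * P * h) * (P * (P * P) - + 0)
        ring = solve-∀

  Y₂-value : + 3 * (Y₂ * B) ≈ - + 2 * P * (+ 3 + + 13 * P) * (+ 1 + + 3 * P * h) [ P³ ]
  Y₂-value = cancel (+ 4 * L) (unit-* unit-4 unit-L) (lincomb₂ (+ 12) ((- + 370 + + 650 * P) * (+ 1 + + 3 * P * h)) Y₂-ratio P³≈0 (ring M Y₂ B h))
    where
    opaque
      unfolding _*_
      ring : ∀ m Y B h → let P = + 1 + (m + m + (m + m)) ; L = (P + P + (m + m) - + 1) * (P + P + (m + m)) in
        + 4 * L * (+ 3 * (Y * B)) - + 4 * L * (- + 2 * P * (+ 3 + + 13 * P) * (+ 1 + + 3 * P * h)) ≡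
        + 12 * (L * Y * B - + 2 * (P + (m + m + m)) * (P * (+ 1 + + 3 * P * h))) + (- + 370 + + 650 * P) * (+ 1 + + 3 * P * h) * (P * (P * P) - + 0)
      ring = solve-∀

  -- Both Y contain a factor p, so the remaining factors are needed only to first order in p.
  -- Multiplying by B removes the quotient by B in `Y₁-ratio` and `Y₂-ratio`.
  V-value : (+ 1 - P) * (V * B) ≈ P * (+ 8 + + 4 * P * h) [ P³ ]
  V-value = lincomb₃ (- + 10 * (+ 1 - P)) (+ 2 * (+ 1 - P)) (- + 8 + - + 40 * h + + 36 * P * h) Y₁-value Y₂-value P³≈0 (ring P B Y₁ Y₂ h)
    where
    opaque
      unfolding _*_
      ring : ∀ P B Y₁ Y₂ h → (+ 1 - P) * ((- + 10 * Y₁ + + 6 * Y₂) * B) - P * (+ 8 + + 4 * P * h) ≡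
        - + 10 * (+ 1 - P) * (Y₁ * B - - + 2 * P * (+ 1 + + 3 * P) * (+ 1 + + 2 * P * h))
        + + 2 * (+ 1 - P) * (+ 3 * (Y₂ * B) - - + 2 * P * (+ 3 + + 13 * P) * (+ 1 + + 3 * P * h))
        + (- + 8 + - + 40 * h + + 36 * P * h) * (P * (P * P) - + 0)
      ring = solve-∀

-- The product α and its quadratic equation

∑-odd-even : ∀ (f : ℤ → ℤ) m → ∑ (m ℕ.+ m) (λ i → f (+ suc i)) ≡ ∑ m (λ i → f (odd i)) + ∑ m (λ i → f (even i))
∑-odd-even f zero    = refl
∑-odd-even f (suc m) = trans (cong (λ k → ∑ k (λ i → f (+ suc i))) (cong suc (ℕₚ.+-suc m m)))
  (trans (cong (λ z → z + f (odd m) + f (even m)) (∑-odd-even f m))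
    (identity (∑ m (λ i → f (odd i))) (∑ m (λ i → f (even i))) (f (odd m)) (f (even m))))
  where
  opaque
    unfolding _*_
    identity : ∀ a b c d → a + b + c + d ≡ a + c + (b + d)
    identity = solve-∀

module Alpha (m : ℕ) (p-prime : Prime (suc ((m ℕ.+ m) ℕ.+ (m ℕ.+ m)))) (2<p : 2 < suc ((m ℕ.+ m) ℕ.+ (m ℕ.+ m))) where
  open TraceValue m p-prime 2<p public

  -- A natural number playing the role of −p/2 modulo p³, namely (p³ − p)/2.
  abstract
    d : ℕ
    d = p ℕ.* (2 ℕ.* (n ℕ.* suc n))

    private
      d-value : + d ≡ P * (+ 2 * (N * (+ 1 + N)))
      d-value = trans (pos-* p (2 ℕ.* (n ℕ.* suc n))) (cong (P *_) (trans (pos-* 2 (n ℕ.* suc n)) (cong (+ 2 *_) (pos-* n (suc n)))))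

    0<d : 0 < d
    0<d = ℕₚ.*-mono-≤ {1} {p} (s≤s z≤n) (ℕₚ.*-mono-≤ {1} {2} (s≤s z≤n) (ℕₚ.*-mono-≤ 0<n (s≤s (z≤n {n}))))

    d≈0 : + d ≈ + 0 [ P ]
    d≈0 = ≈-trans (≈-reflexive (trans d-value (*-comm P (+ 2 * (N * (+ 1 + N)))))) (multiple≈0 (+ 2 * (N * (+ 1 + N))))

    2d≈ : + d + + d ≈ - P [ P³ ]
    2d≈ = lincomb₂ (+ 2) (+ 1) (≈-reflexive d-value) P³≈0 (identity N (+ d))
      where
      opaque
        unfolding _*_
        identity : ∀ n d → let P = + 1 + (n + n) in d + d - - P ≡ + 2 * (d - P * (+ 2 * (n * (+ 1 + n)))) + + 1 * (P * (P * P) - + 0)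
        identity = solve-∀

  D : ℤ
  D = + d

  κ oddProduct evenProduct α : ℤ
  κ = (- + 4) ^ m
  oddProduct  = ∏ m (λ i → odd i + D)
  evenProduct = ∏ m (λ i → even i + D)
  α = κ * oddProduct * inv evenProduct

  unit-odd : ∀ {i} → i < m → Unit (odd i)
  unit-odd {i} i<m = unit-suc (ℕₚ.<-trans (ℕₚ.+-mono-< i<m i<m) n<q)

  unit-even : ∀ {i} → i < m → Unit (even i)
  unit-even {i} i<m = unit-suc (ℕₚ.≤-trans (subst (_≤ n) (cong suc (ℕₚ.+-suc i i)) (ℕₚ.+-mono-≤ i<m i<m)) (ℕₚ.<⇒≤ n<q))

  shift-unit : ∀ {a} → Unit a → Unit (a + D)
  shift-unit {a} ua = unit-≈ (≈-trans (+-cong (≈-refl {a = a}) d≈0) (≈-reflexive (ℤₚ.+-identityʳ a))) ua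

  unit-evenProduct : Unit evenProduct
  unit-evenProduct = unit-∏ m λ i i<m → shift-unit (unit-even i<m)

  unit-oddProduct : Unit oddProduct
  unit-oddProduct = unit-∏ m λ i i<m → shift-unit (unit-odd i<m)

  unit-κ : Unit κ
  unit-κ = unit-^ m (unit-neg unit-4)

  unit-α : Unit α
  unit-α = unit-* (unit-* unit-κ unit-oddProduct) (unit-inv unit-evenProduct)

  α-evenProduct : α * evenProduct ≈ κ * oddProduct [ P³ ]
  α-evenProduct = lincomb₁ (κ * oddProduct) (invˡ unit-evenProduct) (identity (κ * oddProduct) (inv evenProduct) evenProduct)
    where
    opaque
      unfolding _*_
      identity : ∀ a i e → a * i * e - a ≡ a * (i * e - + 1)
      identity = solve-∀

  private
    s a₂ r o t : ℤ
    s  = sgn m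
    a₂ = ∑ m (λ i → inv (even i))
    r  = ∑ m (λ i → inv (even i) * inv (even i))
    o  = ∑ m (λ i → inv (odd i))
    t  = ∑ m (λ i → inv (odd i) * inv (odd i))

    o+a₂ : H n ≡ o + a₂
    o+a₂ = ∑-odd-even inv m

    t+r : t + r ≈ + 0 [ P ]
    t+r = ≈-trans (≈-reflexive (sym (∑-odd-even (λ x → inv x * inv x) m))) H₂-n

    even-double : ∀ i → even i ≡ + 2 * + suc i
    even-double i = ring (+ i)
      where
      opaque
        unfolding _*_
        ring : ∀ i → + 2 + (i + i) ≡ + 2 * (+ 1 + i)
        ring = solve-∀

    2a₂ : + 2 * a₂ ≈ H m [ P³ ]
    2a₂ = lincomb₂ (+ 2) (H m) (≈-reflexive (trans (∑-cong m λ i _ → trans (cong inv (even-double i)) (inv-* (+ 2) (+ suc i)))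
      (∑-*ˡ m (inv (+ 2)) (λ i → inv (+ suc i))))) (invˡ unit-2) (ring a₂ (inv (+ 2)) (H m))
      where
      opaque
        unfolding _*_
        ring : ∀ a i h → + 2 * a - h ≡ + 2 * (a - i * h) + h * (i * + 2 - + 1)
        ring = solve-∀

    4r : + 4 * r ≈ g [ P³ ]
    4r = lincomb₂ (+ 4) (g * (inv (+ 2) * + 2 + + 1)) (≈-reflexive (trans (∑-cong m λ i _ → trans (cong (λ z → z * z) (trans (cong inv (even-double i)) (inv-* (+ 2) (+ suc i))))
        (regroup (inv (+ 2)) (inv (+ suc i)))) (∑-*ˡ m (inv (+ 2) * inv (+ 2)) (λ i → inv (+ suc i) * inv (+ suc i))))) (invˡ unit-2) (ring r (inv (+ 2)) g)
      where
      opaque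
        unfolding _*_
        regroup : ∀ i x → i * x * (i * x) ≡ i * i * (x * x)
        regroup = solve-∀
        ring : ∀ r i g → + 4 * r - g ≡ + 4 * (r - i * i * g) + g * (i * + 2 + + 1) * (i * + 2 - + 1)
        ring = solve-∀

    Ev Od Ee Eo : ℤ
    Ev = ∏ m even
    Od = ∏ m odd
    Ee = expansion D a₂ r
    Eo = expansion D o t

    unit-Ev : Unit Ev
    unit-Ev = unit-∏ m λ i i<m → unit-even i<m

    -- The zeroth-order value of α: (-4)^m times the odd product over the even product is (-1)^m
    -- C(2m, m), by splitting (2m)! into odd and even factors.
    κ-Od : Ev * (s * B) ≈ κ * Od [ P³ ]
    κ-Od = cancel Ev unit-Ev (lincomb₄ ((Ev + (+ 2) ^ m * F) * (s * B)) (s * ((+ 2) ^ m * (+ 2) ^ m)) (s * ((+ 2) ^ m * (+ 2) ^ m)) (- (Od * Ev))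
      (≈-reflexive (∏-even m)) (≈-reflexive B-fac) (≈-reflexive (fac-double m)) (≈-reflexive κ≡)
      (ring Ev Od s B F (fac n) ((+ 2) ^ m) κ))
      where
      κ≡ : κ ≡ s * ((+ 2) ^ m * (+ 2) ^ m)
      κ≡ = trans (neg^ (+ 4) m) (cong (s *_) (trans (cong (_^ m) (sym (*≡ℤ* (+ 2) (+ 2)))) (^-distrib-* (+ 2) (+ 2) m)))
      opaque
        unfolding _*_
        ring : ∀ Ev Od s B F f c κ → Ev * (Ev * (s * B)) - Ev * (κ * Od) ≡
          (Ev + c * F) * (s * B) * (Ev - c * F) + s * (c * c) * (B * F * F - f) + s * (c * c) * (f - Od * Ev) + - (Od * Ev) * (κ - s * (c * c))
        ring = solve-∀

    α-ratio : α * Ee ≈ s * B * Eo [ P³ ]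
    α-ratio = cancel Ev unit-Ev (lincomb₄ (- α) (+ 2) κ (- Eo)
      (∏-expansion m even d≈0 λ i i<m → unit-even i<m) α-evenProduct (∏-expansion m odd d≈0 λ i i<m → unit-odd i<m) κ-Od
      (ring Ev α Ee s B Eo evenProduct κ oddProduct Od))
      where
      opaque
        unfolding _*_
        ring : ∀ Ev α Ee s B Eo pe κ po Od → Ev * (α * Ee) - Ev * (s * B * Eo) ≡
          - α * (+ 2 * pe - Ev * Ee) + + 2 * (α * pe - κ * po) + κ * (+ 2 * po - Od * Eo) + - Eo * (Ev * (s * B) - κ * Od)
        ring = solve-∀

    α-ratio′ : + 4 * α ≈ s * B * (+ 4 + + 4 * D * (o - a₂) + D * D * (+ 2 * (o - a₂) * (o - a₂) + + 4 * r)) [ P³ ]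
    α-ratio′ = lincomb₃ (+ 2 - + 2 * D * a₂ + D * D * (a₂ * a₂ + r))
      (- α * (+ 4 * a₂ * r + D * (a₂ * a₂ * a₂ * a₂ - r * r)) + s * B * w) (- + 2 * (s * B)) α-ratio (s³≈0 d≈0) (cube≈0 d≈0 d≈0 t+r)
      (ring D α (s * B) a₂ r o t)
      where
      w = + 2 * a₂ * t + + 2 * o * r + - + 2 * a₂ * o * o + + 2 * a₂ * a₂ * o + D * (o * o - t) * (a₂ * a₂ + r)
      opaque
        unfolding _*_
        ring : ∀ D α C a r o t → + 4 * α - C * (+ 4 + + 4 * D * (o - a) + D * D * (+ 2 * (o - a) * (o - a) + + 4 * r)) ≡
          (+ 2 - + 2 * D * a + D * D * (a * a + r)) * (α * (+ 2 + + 2 * D * a + D * D * (a * a - r)) - C * (+ 2 + + 2 * D * o + D * D * (o * o - t)))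
          + (- α * (+ 4 * a * r + D * (a * a * a * a - r * r))
             + C * (+ 2 * a * t + + 2 * o * r + - + 2 * a * o * o + + 2 * a * a * o + D * (o * o - t) * (a * a + r))) * (D * D * D - + 0)
          + - + 2 * C * (D * D * (t + r) - + 0)
        ring = solve-∀

  -- Odd and even reciprocals add up to `H n`, and the even ones alone to half of `H m`; hence their
  -- difference is h. Then 2D ≡ -p converts the expansion in D into `K`.
  α-value : + 16 * α ≈ s * B * K [ P³ ]
  α-value = ≈-trans (≈-trans (≈-reflexive (*-assoc′ α)) (*-congˡ (+ 4) α-ratio′)) (≈-trans (≈-reflexive (ring s B D (o - a₂) r))
      (≈-trans (*-congˡ (s * B) (+-cong (+-cong (≈-refl {a = + 16}) (*-congˡ (+ 8) (*-cong 2d≈ e≈)))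
        (*-cong (*-cong 2d≈ 2d≈) (+-cong (*-cong (*-congˡ (+ 2) e≈) e≈) 4r))))
      (≈-reflexive (ring′ (s * B) P h g))))
    where
    opaque
      unfolding _*_
      *-assoc′ : ∀ a → + 16 * a ≡ + 4 * (+ 4 * a)
      *-assoc′ = solve-∀
    e≈ : o - a₂ ≈ h [ P³ ]
    e≈ = lincomb₂ (- + 1) (- + 1) (≈-reflexive o+a₂) 2a₂ (ring″ o a₂ (H n) (H m))
      where
      opaque
        unfolding _*_
        ring″ : ∀ o a b c → o - a - (b - c) ≡ - + 1 * (b - (o + a)) + - + 1 * (+ 2 * a - c)
        ring″ = solve-∀
    opaque
      unfolding _*_
      ring : ∀ s B D e r → + 4 * (s * B * (+ 4 + + 4 * D * e + D * D * (+ 2 * e * e + + 4 * r))) ≡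
        s * B * (+ 16 + + 8 * ((D + D) * e) + (D + D) * (D + D) * (+ 2 * e * e + + 4 * r))
      ring = solve-∀
      ring′ : ∀ C P h g → C * (+ 16 + + 8 * (- P * h) + - P * - P * (+ 2 * h * h + g)) ≡ C * (+ 16 - + 8 * P * h + P * P * (+ 2 * h * h + g))
      ring′ = solve-∀

  U-part : α * ((+ 1 - P) * (s * U)) ≈ + 8 * (α * α) [ P³ ]
  U-part = cancel (+ 216) unit-216 (lincomb₂ (α * s) (- + 108 * α) U-value α-value (ring α P s U B K))
    where
    opaque
      unfolding _*_
      ring : ∀ α P s U B K → + 216 * (α * ((+ 1 - P) * (s * U))) - + 216 * (+ 8 * (α * α)) ≡
        α * s * (+ 216 * ((+ 1 - P) * U) - + 108 * (B * K)) + - + 108 * α * (+ 16 * α - s * B * K)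
      ring = solve-∀

  V-part : α * ((+ 1 - P) * (s * V)) ≈ + 8 * P [ P³ ]
  V-part = cancel (+ 16) unit-16 (lincomb₄ ((+ 1 - P) * (s * V)) (s * s * K) (+ 8 * g + - + 16 * h * h + + 4 * P * g * h + + 8 * P * h * h * h) (P * K * (+ 8 + + 4 * P * h))
    α-value V-value P³≈0 (≈-reflexive (sgn² m)) (ring α P s V B h g))
    where
    opaque
      unfolding _*_
      ring : ∀ α P s V B h g → let K = + 16 - + 8 * P * h + P * P * (+ 2 * h * h + g) in
        + 16 * (α * ((+ 1 - P) * (s * V))) - + 16 * (+ 8 * P) ≡
        (+ 1 - P) * (s * V) * (+ 16 * α - s * B * K) + s * s * K * ((+ 1 - P) * (V * B) - P * (+ 8 + + 4 * P * h))
        + (+ 8 * g + - + 16 * h * h + + 4 * P * g * h + + 8 * P * h * h * h) * (P * (P * P) - + 0) + P * K * (+ 8 + + 4 * P * h) * (s * s - + 1)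
      ring = solve-∀

  private
    -- The lower indices bn + m and (j - 1 - b)n + m add up to jn, so the blocks b and j - 1 - b
    -- give equal coefficients.
    collect : + 15 * ∑ 1 (λ b → bin (1 ℕ.* n) (b ℕ.* n ℕ.+ m)) - + 10 * ∑ 3 (λ b → bin (3 ℕ.* n) (b ℕ.* n ℕ.+ m))
        + + 3 * ∑ 5 (λ b → bin (5 ℕ.* n) (b ℕ.* n ℕ.+ m)) ≡ U + V
    collect = trans (cong₂ _+_ (cong₂ (λ x y → + 15 * (+ 0 + x) - + 10 * y) e₁₀
        (cong₂ _+_ (cong₂ (λ x y → + 0 + x + y) e₃₀ e₃₁) e₃₂))
        (cong (+ 3 *_) (cong₂ _+_ (cong₂ _+_ (cong₂ _+_ (cong₂ (λ x y → + 0 + x + y) e₅₀ e₅₁) e₅₂) e₅₃) e₅₄)))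
      (ring B X₁ X₂ X₃ Y₁ Y₂)
      where
      opaque
        unfolding _*_
        ring : ∀ B X₁ X₂ X₃ Y₁ Y₂ → + 15 * (+ 0 + B) - + 10 * (+ 0 + X₁ + Y₁ + X₁) + + 3 * (+ 0 + X₂ + Y₂ + X₃ + Y₂ + X₂) ≡
          + 15 * B - + 20 * X₁ + + 6 * X₂ + + 3 * X₃ + (- + 10 * Y₁ + + 6 * Y₂)
        ring = solve-∀
      e₁₀ : bin (1 ℕ.* n) (0 ℕ.* n ℕ.+ m) ≡ B
      e₁₀ = cong (λ k → bin k m) (ℕₚ.+-identityʳ n)
      i₁ : ∀ m → 3 ℕ.* (m ℕ.+ m) ≡ m ℕ.+ (m ℕ.+ m ℕ.+ (m ℕ.+ m) ℕ.+ m)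
      i₁ = ℕRing.solve-∀
      i₂ : ∀ m → 3 ℕ.* (m ℕ.+ m) ≡ m ℕ.+ m ℕ.+ m ℕ.+ (m ℕ.+ m ℕ.+ m)
      i₂ = ℕRing.solve-∀
      i₃ : ∀ m → m ℕ.+ m ℕ.+ 0 ℕ.+ m ≡ m ℕ.+ m ℕ.+ m
      i₃ = ℕRing.solve-∀
      i₄ : ∀ m → 2 ℕ.* (m ℕ.+ m) ℕ.+ m ≡ m ℕ.+ m ℕ.+ (m ℕ.+ m) ℕ.+ m
      i₄ = ℕRing.solve-∀
      i₅ : ∀ m → 5 ℕ.* (m ℕ.+ m) ≡ m ℕ.+ (m ℕ.+ m ℕ.+ (m ℕ.+ m) ℕ.+ (m ℕ.+ m ℕ.+ (m ℕ.+ m)) ℕ.+ m)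
      i₅ = ℕRing.solve-∀
      i₆ : ∀ m → 5 ℕ.* (m ℕ.+ m) ≡ m ℕ.+ m ℕ.+ m ℕ.+ (m ℕ.+ m ℕ.+ (m ℕ.+ m) ℕ.+ (m ℕ.+ m ℕ.+ m))
      i₆ = ℕRing.solve-∀
      i₇ : ∀ m → 5 ℕ.* (m ℕ.+ m) ≡ m ℕ.+ m ℕ.+ (m ℕ.+ m) ℕ.+ m ℕ.+ (m ℕ.+ m ℕ.+ (m ℕ.+ m) ℕ.+ m)
      i₇ = ℕRing.solve-∀
      i₈ : ∀ m → 3 ℕ.* (m ℕ.+ m) ℕ.+ m ≡ m ℕ.+ m ℕ.+ (m ℕ.+ m) ℕ.+ (m ℕ.+ m ℕ.+ m)
      i₈ = ℕRing.solve-∀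
      i₉ : ∀ m → 4 ℕ.* (m ℕ.+ m) ℕ.+ m ≡ m ℕ.+ m ℕ.+ (m ℕ.+ m) ℕ.+ (m ℕ.+ m ℕ.+ (m ℕ.+ m)) ℕ.+ m
      i₉ = ℕRing.solve-∀
      e₃₀ : bin (3 ℕ.* n) (0 ℕ.* n ℕ.+ m) ≡ X₁
      e₃₀ = cong (λ k → bin k m) (i₁ m)
      e₃₁ : bin (3 ℕ.* n) (1 ℕ.* n ℕ.+ m) ≡ Y₁
      e₃₁ = cong₂ bin (i₂ m) (i₃ m)
      e₃₂ : bin (3 ℕ.* n) (2 ℕ.* n ℕ.+ m) ≡ X₁
      e₃₂ = trans (cong₂ bin (i₁ m) (i₄ m)) (sym (bin-sym m (q ℕ.+ m)))
      e₅₀ : bin (5 ℕ.* n) (0 ℕ.* n ℕ.+ m) ≡ X₂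
      e₅₀ = cong (λ k → bin k m) (i₅ m)
      e₅₁ : bin (5 ℕ.* n) (1 ℕ.* n ℕ.+ m) ≡ Y₂
      e₅₁ = cong₂ bin (i₆ m) (i₃ m)
      e₅₂ : bin (5 ℕ.* n) (2 ℕ.* n ℕ.+ m) ≡ X₃
      e₅₂ = cong₂ bin (i₇ m) (i₄ m)
      e₅₃ : bin (5 ℕ.* n) (3 ℕ.* n ℕ.+ m) ≡ Y₂
      e₅₃ = trans (cong₂ bin (i₆ m) (i₈ m)) (sym (bin-sym (n ℕ.+ m) (q ℕ.+ (n ℕ.+ m))))
      e₅₄ : bin (5 ℕ.* n) (4 ℕ.* n ℕ.+ m) ≡ X₂
      e₅₄ = trans (cong₂ bin (i₅ m) (i₉ m)) (sym (bin-sym m (q ℕ.+ q ℕ.+ m)))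

  -- α is the unit root of T² + jacobsthal 1 · T + p modulo p³.
  α-root : α * - jacobsthal (+ 1) ≈ α * α + P [ P³ ]
  α-root = cancel (+ 8) unit-8 (lincomb₄ (- α) (- (α * + q * s)) (+ 1) (+ 1)
    trace-formula (≈-reflexive collect) U-part V-part
    (ring α (jacobsthal (+ 1)) (+ q) s U V _))
    where
    unit-8 : Unit (+ 8)
    unit-8 = unit-≈ (≈-reflexive (sym (*≡ℤ* (+ 2) (+ 4)))) (unit-* unit-2 unit-4)
    opaque
      unfolding _*_
      ring : ∀ α J q s U V C → let P = + 1 + q in + 8 * (α * - J) - + 8 * (α * α + P) ≡
        - α * (+ 8 * J - q * (s * C)) + - (α * q * s) * (C - (U + V)) + + 1 * (α * ((+ 1 - P) * (s * U)) - + 8 * (α * α))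
        + + 1 * (α * ((+ 1 - P) * (s * V)) - + 8 * P)
      ring = solve-∀

-- Truncated hypergeometric sums

-- A truncation of the hypergeometric series 2F1(-x, -x; 1; -1), which Kummer's theorem evaluates
-- when it is complete.
kummer : ℕ → ℕ → ℤ
kummer K x = ∑ (suc K) (λ k → sgn k * (bin x k * bin x k))

kummer-poly : ℤ → ℤ → ℤ
kummer-poly x K = + 5 * x * x + + 11 * x + + 6 - + 6 * K * x - + 6 * K + + 2 * K * K

-- A recurrence of Zeilberger type. The complete sum satisfies the homogeneous equation; the right
-- side is the telescoping certificate at the truncation point, and induction on K verifies it.
kummer-rec : ∀ K x → (+ 1 + + x) * ((+ 2 + + x) * kummer K (suc (suc x)) + + 4 * (+ 1 + + x) * kummer K x) ≡
             sgn K * (bin (suc x) K * bin (suc x) K) * kummer-poly (+ x) (+ K)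
kummer-rec zero x = identity (+ x)
  where
  opaque
    unfolding _*_
    identity : ∀ x → (+ 1 + x) * ((+ 2 + x) * (+ 0 + + 1 * (+ 1 * + 1)) + + 4 * (+ 1 + x) * (+ 0 + + 1 * (+ 1 * + 1))) ≡
      + 1 * (+ 1 * + 1) * (+ 5 * x * x + + 11 * x + + 6 - + 6 * + 0 * x - + 6 * + 0 + + 2 * + 0 * + 0)
    identity = solve-∀
kummer-rec (suc K) x = linear₃ (+ 1)
  (- + 4 * sgn K * ((+ 1 + + x) * bin x (suc K) + (+ x - + K) * v))
  (- sgn K * ((+ 4 * + x + + 4 - + 2 * + K) * u + + 2 * (+ K - + x) * v))
  (kummer-rec K x) (sym (bin-upper x (suc K))) (bin-lower (suc x) K)
  (identity (+ x) (+ K) (sgn K) (kummer K (suc (suc x))) (kummer K x) u v (bin x (suc K)))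
  where
  u = bin (suc x) K
  v = bin (suc x) (suc K)
  opaque
    unfolding _*_
    identity : ∀ x K s T T′ u v w → let k = + 1 + K in
      (+ 1 + x) * ((+ 2 + x) * (T + - s * ((u + v) * (u + v))) + + 4 * (+ 1 + x) * (T′ + - s * (w * w)))
        - - s * (v * v) * (+ 5 * x * x + + 11 * x + + 6 - + 6 * k * x - + 6 * k + + 2 * k * k) ≡
      + 1 * ((+ 1 + x) * ((+ 2 + x) * T + + 4 * (+ 1 + x) * T′) - s * (u * u) * (+ 5 * x * x + + 11 * x + + 6 - + 6 * K * x - + 6 * K + + 2 * K * K))
      + - + 4 * s * ((+ 1 + x) * w + (x - K) * v) * ((+ 1 + x) * w - (+ 1 + x - (+ 1 + K)) * v)
      + - s * ((+ 4 * x + + 4 - + 2 * K) * u + + 2 * (K - x) * v) * ((+ 1 + K) * v - (+ 1 + x - K) * u)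
    identity = solve-∀

-- (2k - x - 1) C(x + 1, k) is (x + 1) times C(x, k - 1) - C(x, k). Multiplying by C(x + 1, k) gives
-- a difference of squares, whose alternating sum is two copies of `kummer K x` up to the last term.
kummer-weighted : ∀ K x → ∑ (suc K) (λ k → sgn k * (+ 2 * + k - + suc x) * (bin (suc x) k * bin (suc x) k)) ≡
  - + 2 * + suc x * kummer K x + + suc x * (sgn K * (bin x K * bin x K))
kummer-weighted zero x = identity (+ x)
  where
  opaque
    unfolding _*_
    identity : ∀ x → + 0 + + 1 * (+ 2 * + 0 - (+ 1 + x)) * (+ 1 * + 1) ≡ - + 2 * (+ 1 + x) * (+ 0 + + 1 * (+ 1 * + 1)) + (+ 1 + x) * (+ 1 * (+ 1 * + 1))
    identity = solve-∀
kummer-weighted (suc K) x = linear₂ (+ 1) (- sgn K * (u + v)) (kummer-weighted K x) (sym bin-difference)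
  (identity (+ x) (+ K) (sgn K) (∑ (suc K) (λ k → sgn k * (+ 2 * + k - + suc x) * (bin (suc x) k * bin (suc x) k))) (kummer K x) u v)
  where
  u = bin x K
  v = bin x (suc K)
  bin-difference : (+ 1 + + x) * (u - v) ≡ (+ 2 * (+ 1 + + K) - (+ 1 + + x)) * (u + v)
  bin-difference = linear₂ (- + 1) (- + 1) (bin-up x K) (bin-lower x K) (ring (+ x) (+ K) u v)
    where
    opaque
      unfolding _*_
      ring : ∀ x K u v → (+ 1 + x) * (u - v) - (+ 2 * (+ 1 + K) - (+ 1 + x)) * (u + v) ≡
        - + 1 * ((+ 1 + K) * (u + v) - (+ 1 + x) * u) + - + 1 * ((+ 1 + K) * v - (x - K) * u)
      ring = solve-∀
  opaque
    unfolding _*_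
    identity : ∀ x K s S T u v → S + - s * (+ 2 * (+ 1 + K) - (+ 1 + x)) * ((u + v) * (u + v))
        - (- + 2 * (+ 1 + x) * (T + - s * (v * v)) + (+ 1 + x) * (- s * (v * v))) ≡
      + 1 * (S - (- + 2 * (+ 1 + x) * T + (+ 1 + x) * (s * (u * u))))
      + - s * (u + v) * ((+ 2 * (+ 1 + K) - (+ 1 + x)) * (u + v) - (+ 1 + x) * (u - v))
    identity = solve-∀

central : ℕ → ℤ
central k = bin (k ℕ.+ k) k

central-rec : ∀ k → (+ 1 + + k) * central (suc k) ≡ + 2 * (+ 1 + (+ k + + k)) * central k
central-rec k = trans (cong (λ j → (+ 1 + + k) * bin (suc j) (suc k)) (ℕₚ.+-suc k k))
  (linear₂ (+ 2) (- (+ 1 + + k)) (bin-up (k ℕ.+ k) k) (subst (λ j → bin j (suc k) ≡ bin j k) (ℕₚ.+-suc k k) (sym (bin-sym k (suc k))))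
    (ring (+ k) (bin (suc (k ℕ.+ k)) k) (bin (suc (k ℕ.+ k)) (suc k)) (central k)))
  where
  opaque
    unfolding _*_
    ring : ∀ k a b c → (+ 1 + k) * (a + b) - + 2 * (+ 1 + (k + k)) * c ≡
      + 2 * ((+ 1 + k) * b - (+ 1 + (k + k)) * c) + - (+ 1 + k) * (b - a)
    ring = solve-∀

-- legendreV K x = ∑_{k ≤ K} (−1)ᵏ (2k choose k) (x choose k) 2ᴷ⁻ᵏ
legendreV : ℕ → ℕ → ℤ
legendreV zero    x = + 1
legendreV (suc K) x = + 2 * legendreV K x + sgn (suc K) * central (suc K) * bin x (suc K)

-- As in `kummer-rec`, the right side is the certificate at the truncation point; it vanishes once K
-- exceeds x + 1.
legendreV-rec : ∀ K x → (+ 2 + + x) * legendreV K (suc (suc x)) - (+ 1 + + x) * legendreV K x ≡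
                (+ 1 + (+ K + + K)) * (sgn K * central K * bin (suc x) K)
legendreV-rec zero x = identity (+ x)
  where
  opaque
    unfolding _*_
    identity : ∀ x → (+ 2 + x) * + 1 - (+ 1 + x) * + 1 ≡ (+ 1 + (+ 0 + + 0)) * (+ 1 * + 1 * + 1)
    identity = solve-∀
legendreV-rec (suc K) x = linear₄ (+ 2) (- sgn K * u) (sgn K * c′) (sgn K * c′)
  (legendreV-rec K x) (central-rec K) (sym (bin-upper x (suc K))) (bin-lower (suc x) K)
  (identity (+ x) (+ K) (sgn K) (legendreV K (suc (suc x))) (legendreV K x) (central K) c′ u (bin (suc x) (suc K)) (bin x (suc K)))
  where
  u = bin (suc x) K
  c′ = central (suc K)
  opaque
    unfolding _*_
    identity : ∀ x K s V V′ c c′ u v w →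
      (+ 2 + x) * (+ 2 * V + - s * c′ * (u + v)) - (+ 1 + x) * (+ 2 * V′ + - s * c′ * w) - (+ 1 + ((+ 1 + K) + (+ 1 + K))) * (- s * c′ * v) ≡
      + 2 * ((+ 2 + x) * V - (+ 1 + x) * V′ - (+ 1 + (K + K)) * (s * c * u))
      + - s * u * ((+ 1 + K) * c′ - + 2 * (+ 1 + (K + K)) * c)
      + s * c′ * ((+ 1 + x) * w - (+ 1 + x - (+ 1 + K)) * v)
      + s * c′ * ((+ 1 + K) * v - (+ 1 + x - K) * u)
    identity = solve-∀

legendreV-1 : ∀ K → legendreV (suc K) 1 ≡ + 0
legendreV-1 zero    = trans (cong₂ _+_ (*-identityʳ (+ 2)) (trans (*-identityʳ (- + 1 * + 2)) (trans (*≡ℤ* (- + 1) (+ 2)) refl))) refl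
legendreV-1 (suc K) = trans (cong (λ z → + 2 * z + sgn (suc (suc K)) * central (suc (suc K)) * + 0) (legendreV-1 K))
  (ring (sgn (suc (suc K)) * central (suc (suc K))))
  where
  opaque
    unfolding _*_
    ring : ∀ a → + 2 * + 0 + a * + 0 ≡ + 0
    ring = solve-∀

-- C(2k, k) is the constant term of (z + 2 + 1/z)^k, so the complete sum is 2^K times the constant
-- term of (-(z + 1/z)/2)^x, which is 0 for odd x. The proof iterates the recurrence from x = 1.
legendreV-odd : ∀ i K → suc (i ℕ.+ i) ≤ K → legendreV K (suc (i ℕ.+ i)) ≡ + 0
legendreV-odd zero    (suc K) _  = legendreV-1 K
legendreV-odd (suc i) K       i≤ = trans (cong (legendreV K) (cong (suc ∘ suc) (ℕₚ.+-suc i i))) (from-multiple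
  (linear₃ (+ 1) (+ 1 + + x) ((+ 1 + (+ K + + K)) * (sgn K * central K))
    (legendreV-rec K x) (legendreV-odd i K (ℕₚ.≤-trans (ℕₚ.≤-trans (ℕₚ.n≤1+n x) (ℕₚ.n≤1+n (suc x))) i≤′)) (bin-overflow i≤′)
    (ring (+ x) (legendreV K (suc (suc x))) (legendreV K x) (+ 1 + (+ K + + K)) (sgn K * central K) (bin (suc x) K))))
  where
  x = suc (i ℕ.+ i)
  i≤′ : suc (suc x) ≤ K
  i≤′ = subst (_≤ K) (cong (suc ∘ suc) (ℕₚ.+-suc i i)) i≤
  from-multiple : ∀ {a} → (+ 2 + + x) * a ≡ + 0 → a ≡ + 0
  from-multiple {a} e = [ (λ ()) , (λ h → h) ]′ (ℤₚ.i*j≡0⇒i≡0∨j≡0 (+ 2 + + x) (trans (sym (*≡ℤ* (+ 2 + + x) a)) e))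
  opaque
    unfolding _*_
    ring : ∀ x V V′ c d b → (+ 2 + x) * V - + 0 ≡
      + 1 * ((+ 2 + x) * V - (+ 1 + x) * V′ - c * (d * b)) + (+ 1 + x) * (V′ - + 0) + c * d * (b - + 0)
    ring = solve-∀

alternating : ℕ → ℕ → ℕ → ℤ
alternating K j x = ∑ (suc K) (λ k → sgn k * bin x k * bin k j)

-- C(x, k) C(k, j) = C(x, j) C(x - j, k - j), and alternating partial sums along a row have a closed
-- form. The denominator x - j is multiplied out.
alternating-sum : ∀ K j x → (+ x - + j) * alternating K j x ≡ sgn K * ((+ 1 + + K) * bin K j * bin x (suc K))
alternating-sum zero j x = linear₂ (bin 0 j) (- + 1) (sym (bin-1 x)) (vanish j) (ring (+ x) (+ j) (bin 0 j) (bin x 1))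
  where
  vanish : ∀ j → + j * bin 0 j ≡ + 0
  vanish zero    = *-zeroˡ (+ 1)
  vanish (suc j) = *-zeroʳ (+ suc j)
  opaque
    unfolding _*_
    ring : ∀ x j b y → (x - j) * (+ 0 + + 1 * + 1 * b) - + 1 * ((+ 1 + + 0) * b * y) ≡ b * (x - y) + - + 1 * (j * b - + 0)
    ring = solve-∀
alternating-sum (suc K) j x = linear₃ (+ 1) (- sgn K * bin x (suc K)) (sgn K * bin (suc K) j)
  (alternating-sum K j x) (bin-upper K j) (bin-lower x (suc K))
  (ring (+ x) (+ j) (+ K) (sgn K) (alternating K j x) (bin K j) (bin (suc K) j) (bin x (suc K)) (bin x (suc (suc K))))
  where
  opaque
    unfolding _*_
    ring : ∀ x j K s T b c X Y → (x - j) * (T + - s * X * c) - - s * ((+ 1 + (+ 1 + K)) * c * Y) ≡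
      + 1 * ((x - j) * T - s * ((+ 1 + K) * b * X)) + - s * X * ((+ 1 + K - j) * c - (+ 1 + K) * b)
      + s * c * ((+ 1 + (+ 1 + K)) * Y - (x - (+ 1 + K)) * X)
    ring = solve-∀

-- The recurrences at arguments N + D

module ShiftedBinomials (m : ℕ) (p-prime : Prime (suc ((m ℕ.+ m) ℕ.+ (m ℕ.+ m)))) (2<p : 2 < suc ((m ℕ.+ m) ℕ.+ (m ℕ.+ m))) where
  open Alpha m p-prime 2<p public

  d′ : ℕ
  d′ = ℕ.pred d

  suc-d′ : suc d′ ≡ d
  suc-d′ = lemma d 0<d
    where
    lemma : ∀ k → 0 < k → suc (ℕ.pred k) ≡ k
    lemma (suc k) _ = refl

  +d′ : + 1 + + d′ ≡ D
  +d′ = cong +_ suc-d′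

  m≤q : m ≤ q
  m≤q = ℕₚ.≤-trans (ℕₚ.<⇒≤ m<n) (ℕₚ.<⇒≤ n<q)

  bin-d≈0 : ∀ k → k < q → bin d (suc k) ≈ + 0 [ P ]
  bin-d≈0 k k<q = subst (λ j → bin j (suc k) ≈ + 0 [ P ]) suc-d′ (cancelᴾ (+ suc k) (unit-suc k<q)
    (lincomb₃ (+ 1) (bin d′ k) (bin d′ k) (≈-reflexive (bin-up d′ k)) (≈-reflexive +d′) d≈0
      (identity (+ k) (bin (suc d′) (suc k)) (+ d′) (bin d′ k) D)))
    where
    opaque
      unfolding _*_
      identity : ∀ k b e c D → (+ 1 + k) * b - (+ 1 + k) * + 0 ≡
        + 1 * ((+ 1 + k) * b - (+ 1 + e) * c) + c * (+ 1 + e - D) + c * (D - + 0)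
      identity = solve-∀

  bin-shift : ∀ r k → k ≤ q → bin (r ℕ.+ d) k ≈ bin r k [ P ]
  bin-shift zero    zero    _   = ≈-refl
  bin-shift zero    (suc k) k<q = bin-d≈0 k k<q
  bin-shift (suc r) zero    _   = ≈-refl
  bin-shift (suc r) (suc k) k<q = +-cong (bin-shift r k (ℕₚ.<⇒≤ k<q)) (bin-shift r (suc k) k<q)

  bin-d′ : ∀ k → k ≤ q → bin d′ k ≈ sgn k [ P ]
  bin-d′ zero    _   = ≈-refl
  bin-d′ (suc k) k<q = lincomb₂ (+ 1) (- + 1) (subst (λ j → bin j (suc k) ≈ + 0 [ P ]) (sym suc-d′) (bin-d≈0 k k<q)) (bin-d′ k (ℕₚ.<⇒≤ k<q))
    (identity (bin d′ k) (bin d′ (suc k)) (sgn k))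
    where
    opaque
      unfolding _*_
      identity : ∀ a b s → b - - s ≡ + 1 * (a + b - + 0) + - + 1 * (a - s)
      identity = solve-∀

  sgn-q : sgn q ≡ + 1
  sgn-q = sgn-double n

  bin-shift-p : ∀ r → r ≤ q → bin (r ℕ.+ d) p ≈ bin d p [ P ]
  bin-shift-p zero    _   = ≈-refl
  bin-shift-p (suc r) r<q = ≈-trans (+-cong (≈-trans (bin-shift r q ℕₚ.≤-refl) (≈-reflexive (bin-overflow r<q)))
      (bin-shift-p r (ℕₚ.<⇒≤ r<q))) (≈-reflexive (ℤₚ.+-identityˡ (bin d p)))

  P*bin-d-p : P * bin d p ≡ D * bin d′ q
  P*bin-d-p = subst (λ j → P * bin j p ≡ + j * bin d′ q) suc-d′ (bin-up d′ q)

  -- Start from p C(r + d, p) = (r + D - q) C(r + d, q). Modulo p² the left side is p C(d, p) = D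
  -- C(d - 1, q) ≡ D; on the right the coefficient is divisible by p, so r + D - q may be replaced
  -- by r + 1.
  bin-top : ∀ r → r < q → (+ 1 + + r) * bin (r ℕ.+ d) q ≈ D [ P² ]
  bin-top r r<q = lincomb₄ (+ 1) (+ 1) (+ 1) (+ 1)
    (≈-reflexive (sym (bin-lower (r ℕ.+ d) q))) (*-≈0 (sub-cong P≈0 d≈0) b≈0) (≈-trans (scale P (bin-shift-p r (ℕₚ.<⇒≤ r<q))) (≈-reflexive P*bin-d-p))
    (*-≈0 d≈0 (difference≈0 (≈-trans (bin-d′ q ℕₚ.≤-refl) (≈-reflexive sgn-q))))
    (identity (+ r) (+ q) D (bin (r ℕ.+ d) q) (bin (r ℕ.+ d) p) (bin d′ q))
    where
    b≈0 : bin (r ℕ.+ d) q ≈ + 0 [ P ]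
    b≈0 = ≈-trans (bin-shift r q ℕₚ.≤-refl) (≈-reflexive (bin-overflow r<q))
    opaque
      unfolding _*_
      identity : ∀ r q D b b′ c → let P = + 1 + q in (+ 1 + r) * b - D ≡
        + 1 * ((r + D - q) * b - P * b′) + + 1 * ((P - D) * b - + 0) + + 1 * (P * b′ - D * c) + + 1 * (D * (c - + 1) - + 0)
      identity = solve-∀

  -- The coefficient is `rising P q` divided by q!, so `rising-q` applies.
  wolstenholme : bin (p ℕ.+ q) p ≈ + 1 [ P³ ]
  wolstenholme = cancel Q unit-Q (lincomb₂ (+ 1) (+ 1) (≈-reflexive (cancel-exact QP QP≢0
      (trans (regroup (bin (p ℕ.+ q) p) Q P) (trans (bin-fac p q) (fac-p q))))) (rising-q P≈0) (identity Q (bin (p ℕ.+ q) p) (rising P q)))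
    where
    opaque
      unfolding _*_
      regroup : ∀ w Q P → Q * P * (w * Q) ≡ w * (Q * P) * Q
      regroup = solve-∀
      identity : ∀ Q w R → Q * w - Q * + 1 ≡ + 1 * (w * Q - R) + + 1 * (R - Q)
      identity = solve-∀

  -- For ξ the truncation point moves with the argument, and at N = n it is the upper limit of the
  -- second sum of the theorem; for v it stays at q.
  ξ v : ℕ → ℤ
  ξ N = kummer N (N ℕ.+ d)
  v N = legendreV q (N ℕ.+ d)

  unit-shift : ∀ {k} → k < q → Unit (+ 1 + (+ k + D))
  unit-shift {k} k<q = unit-≈ (+-cong (≈-refl {a = + 1}) (≈-trans (+-cong (≈-refl {a = + k}) d≈0) (≈-reflexive (ℤₚ.+-identityʳ (+ k))))) (unit-suc k<q)

  bin-next : ∀ N → N ≤ q → (+ 1 + + N) * bin (N ℕ.+ d) (suc N) ≈ D [ P² ]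
  bin-next N N≤q = lincomb₂ (+ 1) (+ 1) (≈-reflexive (bin-lower (N ℕ.+ d) N))
    (*-≈0 d≈0 (difference≈0 (≈-trans (bin-shift N N N≤q) (≈-reflexive (bin-diag N)))))
    (identity (+ N) D (bin (N ℕ.+ d) (suc N)) (bin (N ℕ.+ d) N))
    where
    opaque
      unfolding _*_
      identity : ∀ N D b c → (+ 1 + N) * b - D ≡ + 1 * ((+ 1 + N) * b - (N + D - N) * c) + + 1 * (D * (c - + 1) - + 0)
      identity = solve-∀

  bin-next≈0 : ∀ N → suc N ≤ q → bin (N ℕ.+ d) (suc N) ≈ + 0 [ P ]
  bin-next≈0 N N<q = ≈-trans (bin-shift N (suc N) N<q) (≈-reflexive (bin-overflow (ℕₚ.n<1+n N)))

  bin-next² : ∀ N → suc N ≤ q → (+ 1 + + N) * (+ 1 + + N) * (bin (N ℕ.+ d) (suc N) * bin (N ℕ.+ d) (suc N)) ≈ D * D [ P³ ]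
  bin-next² N N<q = lincomb₁ (+ 1) (*-≈0 sum≈0 (difference≈0 (bin-next N (ℕₚ.<⇒≤ N<q)))) (identity (+ 1 + + N) (bin (N ℕ.+ d) (suc N)) D)
    where
    sum≈0 : (+ 1 + + N) * bin (N ℕ.+ d) (suc N) + D ≈ + 0 [ P ]
    sum≈0 = ≈-trans (+-cong (*-congˡ (+ 1 + + N) (bin-next≈0 N N<q)) d≈0) (≈-reflexive (trans (ℤₚ.+-identityʳ _) (*-zeroʳ (+ 1 + + N))))
    opaque
      unfolding _*_
      identity : ∀ a e D → a * a * (e * e) - D * D ≡ + 1 * ((a * e + D) * (a * e - D) - + 0)
      identity = solve-∀

  -- `kummer-rec` with K = N + 2, after splitting off the last two terms at the argument N + d. All
  -- that remains is a multiple of e², where e = C(N + d, N + 1), and (N + 1)² e² ≡ D² modulo p³.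
  ξ-step : ∀ N → suc (suc N) ≤ q →
    (+ 1 + + N) * (+ 2 + + N) * ((+ 2 + (+ N + D)) * ξ (suc (suc N)) + + 4 * (+ 1 + (+ N + D)) * ξ N) ≈
    sgn N * (D * D) * (+ 5 * + N + + 7) [ P³ ]
  ξ-step N N<q = cancel ((+ 1 + (+ N + D)) * (+ 2 + + N)) (unit-* (unit-shift (ℕₚ.<-trans (ℕₚ.n<1+n N) N<q)) (unit-suc N<q))
    (≈-trans eliminate collect)
    where
    e e′ x : ℤ
    e  = bin (N ℕ.+ d) (suc N)
    e′ = bin (N ℕ.+ d) (suc (suc N))
    x  = + N + D
    s  = sgn N
    e≈0 = bin-next≈0 N (ℕₚ.<⇒≤ N<q)
    -- The part of the boundary terms with one more factor D; next to e² it vanishes modulo p³.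
    weight : ℤ → ℤ → ℤ
    weight N D = + 35 + + 29 * D + + 80 * N + + 41 * D * N + + 9 * D * D + + 59 * N * N + + 14 * D * N * N + + 6 * D * D * N + + 1 * D * D * D + + 14 * N * N * N
    f f₀ poly : ℤ
    f  = (+ 2 + + N) * e′
    f₀ = (x - (+ 1 + + N)) * e
    poly = kummer-poly x (+ 2 + + N)
    eliminate : (+ 1 + (+ N + D)) * (+ 2 + + N) * ((+ 1 + + N) * (+ 2 + + N) * ((+ 2 + x) * ξ (suc (suc N)) + + 4 * (+ 1 + x) * ξ N)) ≈
      s * (+ 1 + + N) * ((+ 1 + + N) * (+ 1 + + N) * (e * e)) * (+ 2 + + N) * (+ 5 * + N + + 7) [ P³ ]
    eliminate = lincomb₃ ((+ 1 + + N) * (+ 2 + + N) * (+ 2 + + N))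
      (s * (+ 1 + + N) * (poly * (+ 2 * (+ 2 + + N) * e + f + f₀) - + 4 * (+ 1 + x) * (+ 1 + x) * (f + f₀)))
      (s * (+ 1 + + N) * weight (+ N) D)
      (≈-reflexive (kummer-rec (suc (suc N)) (N ℕ.+ d))) (≈-reflexive (bin-lower (N ℕ.+ d) (suc N))) (cube≈0 d≈0 e≈0 e≈0)
      (identity (+ N) D s e e′ (ξ (suc (suc N))) (ξ N))
      where
      opaque
        unfolding _*_
        identity : ∀ N D s e e′ X Y → let
            x = N + D ; f = (+ 2 + N) * e′ ; f₀ = (x - (+ 1 + N)) * e ; K = + 2 + N
            poly = + 5 * x * x + + 11 * x + + 6 - + 6 * K * x - + 6 * K + + 2 * K * K
          in (+ 1 + x) * (+ 2 + N) * ((+ 1 + N) * (+ 2 + N) * ((+ 2 + x) * X + + 4 * (+ 1 + x) * Y))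
             - s * (+ 1 + N) * ((+ 1 + N) * (+ 1 + N) * (e * e)) * (+ 2 + N) * (+ 5 * N + + 7) ≡
          (+ 1 + N) * (+ 2 + N) * (+ 2 + N) *
            ((+ 1 + x) * ((+ 2 + x) * X + + 4 * (+ 1 + x) * (Y + - s * (e * e) + - - s * (e′ * e′))) - - - s * ((e + e′) * (e + e′)) * poly)
          + s * (+ 1 + N) * (poly * (+ 2 * (+ 2 + N) * e + f + f₀) - + 4 * (+ 1 + x) * (+ 1 + x) * (f + f₀)) * (f - f₀)
          + s * (+ 1 + N) * (+ 35 + + 29 * D + + 80 * N + + 41 * D * N + + 9 * D * D + + 59 * N * N + + 14 * D * N * N + + 6 * D * D * N + + 1 * D * D * D + + 14 * N * N * N) * (D * e * e - + 0)
        identity = solve-∀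
    collect : s * (+ 1 + + N) * ((+ 1 + + N) * (+ 1 + + N) * (e * e)) * (+ 2 + + N) * (+ 5 * + N + + 7) ≈
      (+ 1 + (+ N + D)) * (+ 2 + + N) * (s * (D * D) * (+ 5 * + N + + 7)) [ P³ ]
    collect = lincomb₂ (s * (+ 1 + + N) * (+ 2 + + N) * (+ 5 * + N + + 7)) (- s * (+ 2 + + N) * (+ 5 * + N + + 7))
      (bin-next² N (ℕₚ.<⇒≤ N<q)) (s³≈0 d≈0) (identity (+ N) D s (e * e))
      where
      opaque
        unfolding _*_
        identity : ∀ N D s E → s * (+ 1 + N) * ((+ 1 + N) * (+ 1 + N) * E) * (+ 2 + N) * (+ 5 * N + + 7)
            - (+ 1 + (N + D)) * (+ 2 + N) * (s * (D * D) * (+ 5 * N + + 7)) ≡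
          s * (+ 1 + N) * (+ 2 + N) * (+ 5 * N + + 7) * ((+ 1 + N) * (+ 1 + N) * E - D * D) + - s * (+ 2 + N) * (+ 5 * N + + 7) * (D * D * D - + 0)
        identity = solve-∀

  -- At x = N + D the inhomogeneous term of legendreV-rec has a factor p on top of the factor D.
  v-bound : ∀ r → r < q → (+ 1 + + r) * ((+ 1 + (+ q + + q)) * (sgn q * central q * bin (r ℕ.+ d) q)) ≈ P * D [ P³ ]
  v-bound r r<q = ≈-trans (≈-reflexive (linear₂ ((+ 1 + + r) * b * (+ 1 + (+ q + + q)) * central q) ((+ 1 + + r) * b * - + 1) sgn-q (bin-up (q ℕ.+ q) q)
      (identity (+ r) (+ q) (sgn q) (central q) b w))) (scale P (lincomb₂ w (+ 1) (bin-top r r<q)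
        (*-≈0 d≈0 (difference≈0 (P³⇒P wolstenholme))) (identity′ (+ r) w b D)))
    where
    b w : ℤ
    b = bin (r ℕ.+ d) q
    w = bin (p ℕ.+ q) p
    opaque
      unfolding _*_
      identity : ∀ r q s c b w → (+ 1 + r) * ((+ 1 + (q + q)) * (s * c * b)) - (+ 1 + q) * (w * ((+ 1 + r) * b)) ≡
        (+ 1 + r) * b * (+ 1 + (q + q)) * c * (s - + 1) + (+ 1 + r) * b * - + 1 * ((+ 1 + q) * w - (+ 1 + (q + q)) * c)
      identity = solve-∀
      identity′ : ∀ r w b D → w * ((+ 1 + r) * b) - D ≡ w * ((+ 1 + r) * b - D) + + 1 * (D * (w - + 1) - + 0)
      identity′ = solve-∀

  v-step : ∀ N → suc N < q → (+ 2 + + N) * ((+ 2 + (+ N + D)) * v (suc (suc N)) - (+ 1 + (+ N + D)) * v N) ≈ P * D [ P³ ]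
  v-step N N<q = ≈-trans (≈-reflexive (cong ((+ 2 + + N) *_) (legendreV-rec q (N ℕ.+ d)))) (v-bound (suc N) N<q)

  -- Solutions, along the even arguments, of the homogeneous recurrences: z of the one for v, y of
  -- the one for ξ. In particular `y m` is α.
  z y : ℕ → ℤ
  z i = ∏ i (λ j → odd j + D) * inv (∏ i (λ j → even j + D))
  y i = (- + 4) ^ i * z i

  z-step : ∀ i → i < m → (even i + D) * z (suc i) ≈ (odd i + D) * z i [ P³ ]
  z-step i i<m = ≈-trans (≈-reflexive (cong (λ w → (even i + D) * (O * (odd i + D) * w)) (inv-* E (even i + D))))
    (lincomb₁ (O * (odd i + D) * inv E) (invˡ (shift-unit (unit-even i<m))) (identity (even i + D) (odd i + D) O (inv E) (inv (even i + D))))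
    where
    O E : ℤ
    O = ∏ i (λ j → odd j + D)
    E = ∏ i (λ j → even j + D)
    opaque
      unfolding _*_
      identity : ∀ e o O I i → e * (O * o * (I * i)) - o * (O * I) ≡ O * o * I * (i * e - + 1)
      identity = solve-∀

  y-step : ∀ i → i < m → (even i + D) * y (suc i) ≈ - + 4 * (odd i + D) * y i [ P³ ]
  y-step i i<m = lincomb₁ (- + 4 * (- + 4) ^ i) (z-step i i<m) (identity (even i + D) (odd i + D) ((- + 4) ^ i) (z (suc i)) (z i))
    where
    opaque
      unfolding _*_
      identity : ∀ e o c z z′ → e * (- + 4 * c * z) - - + 4 * o * (c * z′) ≡ - + 4 * c * (e * z - o * z′)
      identity = solve-∀

  inv-one : inv (+ 1) ≈ + 1 [ P³ ]
  inv-one = ≈-trans (≈-reflexive (sym (*-identityʳ (inv (+ 1))))) (invˡ unit-one)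

  z-0 : z 0 ≈ + 1 [ P³ ]
  z-0 = ≈-trans (≈-reflexive (*-identityˡ (inv (+ 1)))) inv-one

  y-0 : y 0 ≈ + 1 [ P³ ]
  y-0 = ≈-trans (≈-reflexive (*-identityˡ (z 0))) z-0

  y-m : y m ≡ α
  y-m = sym (*-assoc κ oddProduct (inv evenProduct))

  drop-D : ∀ a → a + D ≈ a [ P ]
  drop-D a = ≈-trans (+-cong (≈-refl {a = a}) d≈0) (≈-reflexive (ℤₚ.+-identityʳ a))

  -- Modulo p the shift D disappears and n is -1/2, so the ratios of consecutive terms on the two
  -- sides agree.
  z-mod : ∀ i → i ≤ m → z i ≈ sgn i * bin n i [ P ]
  z-mod zero    _   = ≈-trans (P³⇒P z-0) (≈-reflexive (sym (*-identityˡ (+ 1))))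
  z-mod (suc i) i<m = cancelᴾ (even i + D) (shift-unit (unit-even i<m)) (lincomb₄ (+ 1) (odd i + D) (+ 2 * sgn i) (+ 1)
    (P³⇒P (z-step i i<m)) (z-mod i (ℕₚ.<⇒≤ i<m)) (≈-reflexive (bin-lower n i)) remainder
    (identity (+ i) N D (z (suc i)) (z i) (sgn i) (bin n i) (bin n (suc i))))
    where
    remainder : sgn i * bin n i * P + sgn i * (bin n i + bin n (suc i)) * D ≈ + 0 [ P ]
    remainder = lincomb₂ (sgn i * bin n i) (sgn i * (bin n i + bin n (suc i))) P≈0 d≈0
      (ring (sgn i * bin n i) (sgn i * (bin n i + bin n (suc i))) P D)
      where
      opaque
        unfolding _*_
        ring : ∀ a b P D → a * P + b * D - + 0 ≡ a * (P - + 0) + b * (D - + 0)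
        ring = solve-∀
    opaque
      unfolding _*_
      identity : ∀ i n D z z′ s b b′ → let e = + 2 + (i + i) ; o = + 1 + (i + i) in
        (e + D) * z - (e + D) * (- s * b′) ≡
        + 1 * ((e + D) * z - (o + D) * z′) + (o + D) * (z′ - s * b) + + 2 * s * ((+ 1 + i) * b′ - (n - i) * b)
        + + 1 * (s * b * (+ 1 + (n + n)) + s * (b + b′) * D - + 0)
      identity = solve-∀

  y-mod : ∀ i → i ≤ m → y i ≈ sgn i * central i [ P ]
  y-mod zero    _   = ≈-trans (P³⇒P y-0) (≈-reflexive (sym (*-identityˡ (+ 1))))
  y-mod (suc i) i<m = cancelᴾ (even i + D) (shift-unit (unit-even i<m)) (lincomb₄ (+ 1) (- + 4 * (odd i + D)) (+ 2 * sgn i)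
    (- + 4 * sgn i * central i + sgn i * central (suc i))
    (P³⇒P (y-step i i<m)) (y-mod i (ℕₚ.<⇒≤ i<m)) (≈-reflexive (central-rec i)) d≈0
    (identity (+ i) D (y (suc i)) (y i) (sgn i) (central i) (central (suc i))))
    where
    opaque
      unfolding _*_
      identity : ∀ i D y y′ s c c′ → let e = + 2 + (i + i) ; o = + 1 + (i + i) in
        (e + D) * y - (e + D) * (- s * c′) ≡
        + 1 * ((e + D) * y - - + 4 * (o + D) * y′) + - + 4 * (o + D) * (y′ - s * c)
        + + 2 * s * ((+ 1 + i) * c′ - + 2 * (+ 1 + (i + i)) * c) + (- + 4 * s * c + s * c′) * (D - + 0)
      identity = solve-∀

-- Solving the recurrences to second order

module TSums (m : ℕ) (p-prime : Prime (suc ((m ℕ.+ m) ℕ.+ (m ℕ.+ m)))) (2<p : 2 < suc ((m ℕ.+ m) ℕ.+ (m ℕ.+ m))) where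
  open ShiftedBinomials m p-prime 2<p public

  unit-bin : ∀ {a k} → k ≤ a → a ≤ q → Unit (bin a k)
  unit-bin {a} {k} k≤a a≤q h = unit-fac a≤q (≈-trans (≈-reflexive (sym (subst (λ j → bin j k * fac k * fac (a ∸ k) ≡ fac j) (ℕₚ.m+[n∸m]≡n k≤a) (bin-fac k (a ∸ k)))))
    (≈-trans (*-congʳ (fac (a ∸ k)) (*-congʳ (fac k) h)) (≈-reflexive (trans (cong (_* fac (a ∸ k)) (*-zeroˡ (fac k))) (*-zeroˡ (fac (a ∸ k)))))))

  -- (-1)^j / (j² C(a, j)) with j = l + 1, the building block of the corrections of order D² in both
  -- families.
  term : ℕ → ℕ → ℤ
  term a l = sgn (suc l) * inv (+ suc l * + suc l * bin a (suc l))

  -- 1/(j² (a+1 choose j)) − 1/(j² (a choose j)) is, up to the factor 1/(a+1)², a sum of two adjacent reciprocals.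
  term-step : ∀ a l → suc l ≤ a → suc a ≤ q →
    term (suc a) l - term a l ≈ inv (+ suc a) * inv (+ suc a) * (sgn l * (inv (bin a (suc l)) + inv (bin a l))) [ P ]
  term-step a l l<a a<q = ≈-trans (≈-reflexive (trans (cong₂ (λ X Y → - s * X - - s * Y) (expand (bin (suc a) (suc l))) (expand b)) (identity₀ s ι û u)))
      (≈-trans (*-congˡ s (≈-trans left (≈-sym right))) (≈-reflexive (identity₁ s ν u u₁)))
    where
    s j b b₁ ι ν u u₁ û : ℤ
    s  = sgn l
    j  = + suc l
    b  = bin a (suc l)
    b₁ = bin a l
    ι  = inv j
    ν  = inv (+ suc a)
    u  = inv b
    u₁ = inv b₁
    û  = inv (bin (suc a) (suc l))
    expand : ∀ x → inv (j * j * x) ≡ ι * ι * inv x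
    expand x = trans (inv-* (j * j) x) (cong (_* inv x) (inv-* j j))
    opaque
      unfolding _*_
      identity₀ : ∀ s ι û u → - s * (ι * ι * û) - - s * (ι * ι * u) ≡ s * (ι * ι * (u - û))
      identity₀ = solve-∀
      identity₁ : ∀ s ν u u₁ → s * (ν * ν * (u + u₁)) ≡ ν * ν * (s * (u + u₁))
      identity₁ = solve-∀
    ub : u * b ≈ + 1 [ P ]
    ub = invˡ′ (unit-bin l<a (ℕₚ.<⇒≤ a<q))
    ub₁ : u₁ * b₁ ≈ + 1 [ P ]
    ub₁ = invˡ′ (unit-bin (ℕₚ.<⇒≤ l<a) (ℕₚ.<⇒≤ a<q))
    UB : û * (b₁ + b) ≈ + 1 [ P ]
    UB = invˡ′ (unit-bin (s≤s (ℕₚ.<⇒≤ l<a)) a<q)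
    adjacent : ι * û ≈ ν * u₁ [ P ]
    adjacent = ≈-reflexive (trans (sym (inv-* j (bin (suc a) (suc l)))) (trans (cong inv (bin-up a l)) (inv-* (+ suc a) b₁)))
    left : ι * ι * (u - û) ≈ ι * u * ν [ P ]
    left = lincomb₄ (- (ι * ι * u)) (ι * ι * û) (ι * u * b₁) (ι * u * ν) UB ub adjacent ub₁ (identity ι û u u₁ b b₁ ν)
      where
      opaque
        unfolding _*_
        identity : ∀ ι û u u₁ b b₁ ν → ι * ι * (u - û) - ι * u * ν ≡
          - (ι * ι * u) * (û * (b₁ + b) - + 1) + ι * ι * û * (u * b - + 1) + ι * u * b₁ * (ι * û - ν * u₁) + ι * u * ν * (u₁ * b₁ - + 1)
        identity = solve-∀
    right : ν * ν * (u + u₁) ≈ ι * u * ν [ P ]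
    right = lincomb₄ (- (ν * ν * u)) (- (ν * ν * u₁)) (- (ν * u * (b₁ + b))) (ν * u * ι) ub₁ ub adjacent UB (identity ι û u u₁ b b₁ ν)
      where
      opaque
        unfolding _*_
        identity : ∀ ι û u u₁ b b₁ ν → ν * ν * (u + u₁) - ι * u * ν ≡
          - (ν * ν * u) * (u₁ * b₁ - + 1) + - (ν * ν * u₁) * (u * b - + 1) + - (ν * u * (b₁ + b)) * (ι * û - ν * u₁) + ν * u * ι * (û * (b₁ + b) - + 1)
        identity = solve-∀

  -- In `term-step` the reciprocal shared by neighbouring values of l occurs with opposite signs, so
  -- the sum over l telescopes to its two ends.
  partial-step : ∀ a J → J ≤ a → suc a ≤ q →
    ∑ J (term (suc a)) - ∑ J (term a) ≈ - (inv (+ suc a) * inv (+ suc a)) * (sgn J * inv (bin a J) - + 1) [ P ]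
  partial-step a zero    _   a<q = lincomb₁ (inv (+ suc a) * inv (+ suc a)) (P³⇒P inv-one) (identity (inv (+ suc a)) (inv (+ 1)))
    where
    opaque
      unfolding _*_
      identity : ∀ ν u → + 0 - + 0 - - (ν * ν) * (+ 1 * u - + 1) ≡ ν * ν * (u - + 1)
      identity = solve-∀
  partial-step a (suc J) J<a a<q = lincomb₂ (+ 1) (+ 1) (partial-step a J (ℕₚ.<⇒≤ J<a) a<q) (term-step a J J<a a<q)
    (identity (∑ J (term (suc a))) (∑ J (term a)) (term (suc a) J) (term a J) (inv (+ suc a)) (sgn J) (inv (bin a (suc J))) (inv (bin a J)))
    where
    opaque
      unfolding _*_
      identity : ∀ S S′ t t′ ν s u u₁ → S + t - (S′ + t′) - - (ν * ν) * (- s * u - + 1) ≡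
        + 1 * (S - S′ - - (ν * ν) * (s * u₁ - + 1)) + + 1 * (t - t′ - ν * ν * (s * (u + u₁)))
      identity = solve-∀

  c : ℕ → ℤ
  c i = ∑ i (term (i ℕ.+ i))

  private
    index : ∀ i → suc i ℕ.+ suc i ≡ suc (suc (i ℕ.+ i))
    index i = cong suc (ℕₚ.+-suc i i)

    2i+2≤n : ∀ {i} → i < m → suc (suc (i ℕ.+ i)) ≤ n
    2i+2≤n {i} i<m = subst (_≤ n) (index i) (ℕₚ.+-mono-≤ i<m i<m)

    2i+2≤q : ∀ {i} → i < m → suc (suc (i ℕ.+ i)) ≤ q
    2i+2≤q i<m = ℕₚ.≤-trans (2i+2≤n i<m) (ℕₚ.<⇒≤ n<q)

  -- D² w/2 is the relative correction of ξ at 2i. Unlike that of v, it is not a partial sum of a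
  -- fixed sequence: the upper index 2i moves along.
  w : ℕ → ℤ
  w i = c i - H₂ (i ℕ.+ i)

  module CStep (i : ℕ) (i<m : i < m) where
    s o e J b b₁ b₀ β τ ω ι : ℤ
    s  = sgn i
    o  = odd i
    e  = even i
    J  = + suc i
    b  = central (suc i)
    b₁ = bin (suc (i ℕ.+ i)) i
    b₀ = central i
    β  = inv b
    τ  = inv e
    ω  = inv o
    ι  = inv J

    unit-b : Unit b
    unit-b = unit-bin {suc i ℕ.+ suc i} {suc i} (ℕₚ.m≤m+n (suc i) (suc i)) (subst (_≤ q) (sym (index i)) (2i+2≤q i<m))

    b≡2b₁ : b ≡ + 2 * b₁
    b≡2b₁ = trans (cong (λ z → bin (i ℕ.+ suc i) i + z) (sym (bin-sym i (suc i))))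
      (trans (cong (λ j → bin j i + bin j i) (ℕₚ.+-suc i i)) (ring b₁))
      where
      opaque
        unfolding _*_
        ring : ∀ x → x + x ≡ + 2 * x
        ring = solve-∀

    Jb₁≡ob₀ : J * b₁ ≡ o * b₀
    Jb₁≡ob₀ = trans (cong (J *_) (subst (λ j → bin j i ≡ bin j (suc i)) (ℕₚ.+-suc i i) (bin-sym i (suc i)))) (bin-up (i ℕ.+ i) i)

    ι≈2τ : ι ≈ + 2 * τ [ P ]
    ι≈2τ = ≈-sym (inv-unique (unit-suc (ℕₚ.<-≤-trans i<m m≤q)) (lincomb₁ (+ 1) (invˡ′ (unit-even i<m)) (ring τ (+ i))))
      where
      opaque
        unfolding _*_
        ring : ∀ τ i → + 2 * τ * (+ 1 + i) - + 1 ≡ + 1 * (τ * (+ 2 + (i + i)) - + 1)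
        ring = solve-∀

    2βb₁ : + 2 * β * b₁ ≈ + 1 [ P ]
    2βb₁ = lincomb₂ (+ 1) (- β) (invˡ′ unit-b) (≈-reflexive b≡2b₁) (ring β b b₁)
      where
      opaque
        unfolding _*_
        ring : ∀ β b b₁ → + 2 * β * b₁ - + 1 ≡ + 1 * (β * b - + 1) + - β * (b - + 2 * b₁)
        ring = solve-∀

    β₁≈ : inv b₁ ≈ + 2 * β [ P ]
    β₁≈ = ≈-sym (inv-unique (unit-bin (ℕₚ.≤-trans (ℕₚ.m≤m+n i i) (ℕₚ.n≤1+n (i ℕ.+ i))) (ℕₚ.≤-trans (ℕₚ.n≤1+n _) (2i+2≤q i<m))) 2βb₁)

    β₀≈ : inv b₀ ≈ + 2 * o * β * ι [ P ]
    β₀≈ = ≈-sym (inv-unique (unit-bin (ℕₚ.m≤m+n i i) (ℕₚ.≤-trans (ℕₚ.n≤1+n _) (ℕₚ.≤-trans (ℕₚ.n≤1+n _) (2i+2≤q i<m))))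
      (lincomb₃ (+ 2 * β * b₁) (+ 1) (- + 2 * β * ι) (invˡ′ (unit-suc (ℕₚ.<-≤-trans i<m m≤q))) 2βb₁ (≈-reflexive Jb₁≡ob₀) (ring o β ι J b₀ b₁)))
      where
      opaque
        unfolding _*_
        ring : ∀ o β ι J b₀ b₁ → + 2 * o * β * ι * b₀ - + 1 ≡ + 2 * β * b₁ * (ι * J - + 1) + + 1 * (+ 2 * β * b₁ - + 1) + - + 2 * β * ι * (J * b₁ - o * b₀)
        ring = solve-∀

    -- The sum c gains one term, and its upper index moves from 2i to 2i + 2 by two `partial-step`s.
    -- The constants -1 in these are what the subtraction of `H₂` removes.
    difference : w (suc i) - w i ≈ - s * (ι * ι * β + ω * ω * inv b₀ + τ * τ * inv b₁) [ P ]
    difference = ≈-trans (≈-reflexive (cong (λ z → z - w i) w-suc)) (lincomb₂ (+ 1) (+ 1)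
      (partial-step (suc (i ℕ.+ i)) i (ℕₚ.≤-trans (ℕₚ.m≤m+n i i) (ℕₚ.n≤1+n _)) (2i+2≤q i<m))
      (partial-step (i ℕ.+ i) i (ℕₚ.m≤m+n i i) (ℕₚ.≤-trans (ℕₚ.n≤1+n _) (2i+2≤q i<m)))
      (ring s ι β ω τ (inv b₀) (inv b₁) (∑ i (term (suc (suc (i ℕ.+ i))))) (∑ i (term (suc (i ℕ.+ i)))) (c i) (H₂ (i ℕ.+ i))))
      where
      w-suc : w (suc i) ≡ ∑ i (term (suc (suc (i ℕ.+ i)))) + - s * (ι * ι * β) - (H₂ (i ℕ.+ i) + ω * ω + τ * τ)
      w-suc = cong₂ _-_ (cong₂ _+_ (cong (λ a → ∑ i (term a)) (index i))
          (cong (- s *_) (trans (inv-* (J * J) b) (cong (_* β) (inv-* J J))))) (cong H₂ (index i))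
      opaque
        unfolding _*_
        ring : ∀ s ι β ω τ β₀ β₁ S₂ S₁ c H → S₂ + - s * (ι * ι * β) - (H + ω * ω + τ * τ) - (c - H) - - s * (ι * ι * β + ω * ω * β₀ + τ * τ * β₁) ≡
          + 1 * (S₂ - S₁ - - (τ * τ) * (s * β₁ - + 1)) + + 1 * (S₁ - c - - (ω * ω) * (s * β₀ - + 1))
        ring = solve-∀

    -- Twice the coefficient ψ of `ξ-increment`: precisely the equation that makes `w` the
    -- correction of ξ.
    c-step : (e + D) * y (suc i) * (w (suc i) - w i) ≈ + 2 * ((+ 5 * + (i ℕ.+ i) + + 7) * ω * τ) [ P ]
    c-step = ≈-trans (*-cong (*-cong (drop-D e) (y-mod (suc i) i<m)) (≈-trans difference
        (*-congˡ (- s) (+-cong (+-cong (*-congʳ β (*-cong ι≈2τ ι≈2τ)) (*-congˡ (ω * ω) (≈-trans β₀≈ (*-congˡ (+ 2 * o * β) ι≈2τ)))) (*-congˡ (τ * τ) β₁≈)))))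
      (lincomb₄ (e * b * β * (+ 6 * τ * τ + + 4 * ω * ω * o * τ)) (e * (+ 6 * τ * τ + + 4 * ω * ω * o * τ)) (+ 6 * τ + + 4 * ω * ω * o - + 4 * ω) (+ 4 * ω - + 6 * τ)
        (≈-reflexive (sgn² i)) (invˡ′ unit-b) (invˡ′ (unit-even i<m)) (invˡ′ (unit-odd i<m)) (ring s (+ i) b β τ ω))
      where
      opaque
        unfolding _*_
        ring : ∀ s i b β τ ω → let e = + 2 + (i + i) ; o = + 1 + (i + i) in
          e * (- s * b) * (- s * (+ 2 * τ * (+ 2 * τ) * β + ω * ω * (+ 2 * o * β * (+ 2 * τ)) + τ * τ * (+ 2 * β))) - + 2 * ((+ 5 * (i + i) + + 7) * ω * τ) ≡
          e * b * β * (+ 6 * τ * τ + + 4 * ω * ω * o * τ) * (s * s - + 1) + e * (+ 6 * τ * τ + + 4 * ω * ω * o * τ) * (β * b - + 1)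
          + (+ 6 * τ + + 4 * ω * ω * o - + 4 * ω) * (τ * e - + 1) + (+ 4 * ω - + 6 * τ) * (ω * o - + 1)
        ring = solve-∀

    E O Nᵢ ψ : ℤ
    Nᵢ = + (i ℕ.+ i)
    E = + 2 + (Nᵢ + D)
    O = + 1 + (Nᵢ + D)
    ψ = (+ 5 * Nᵢ + + 7) * ω * τ

    E≡ : e + D ≡ E
    E≡ = ℤₚ.+-assoc (+ 2) Nᵢ D

    O≡ : o + D ≡ O
    O≡ = ℤₚ.+-assoc (+ 1) Nᵢ D

    ξ-increment : E * ξ (suc (suc (i ℕ.+ i))) + + 4 * O * ξ (i ℕ.+ i) ≈ D * D * ψ [ P³ ]
    ξ-increment = lincomb₄ (ω * τ) (- X * τ * e) (- X) (D * D * ψ)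
      (ξ-step (i ℕ.+ i) (2i+2≤q i<m)) (invˡ (unit-odd i<m)) (invˡ (unit-even i<m)) (≈-reflexive (sgn-double i))
      (ring X Nᵢ D ω τ (sgn (i ℕ.+ i)))
      where
      X = E * ξ (suc (suc (i ℕ.+ i))) + + 4 * O * ξ (i ℕ.+ i)
      opaque
        unfolding _*_
        ring : ∀ X N D ω τ s → let e = + 2 + N ; o = + 1 + N ; ψ = (+ 5 * N + + 7) * ω * τ in
          X - D * D * ψ ≡ ω * τ * (o * e * X - s * (D * D) * (+ 5 * N + + 7)) + - X * τ * e * (ω * o - + 1) + - X * (τ * e - + 1) + D * D * ψ * (s - + 1)
        ring = solve-∀

    v-increment : E * v (suc (suc (i ℕ.+ i))) - O * v (i ℕ.+ i) ≈ - + 2 * (D * D * τ) [ P³ ]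
    v-increment = lincomb₃ τ (- X) (D * τ) (v-step (i ℕ.+ i) (2i+2≤q i<m)) (invˡ (unit-even i<m)) 2d≈ (ring X Nᵢ D τ P)
      where
      X = E * v (suc (suc (i ℕ.+ i))) - O * v (i ℕ.+ i)
      opaque
        unfolding _*_
        ring : ∀ X N D τ P → let e = + 2 + N in X - - + 2 * (D * D * τ) ≡ τ * (e * X - P * D) + - X * (τ * e - + 1) + D * τ * (D + D - - P)
        ring = solve-∀

    term-value : (e + D) * z (suc i) * term n i ≈ + 4 * τ [ P ]
    term-value = ≈-trans (*-cong (*-cong (drop-D e) (z-mod (suc i) i<m)) (≈-trans (≈-reflexive (cong (- s *_)
        (trans (inv-* (J * J) bn) (cong (_* inv bn) (inv-* J J))))) (*-congˡ (- s) (*-congʳ (inv bn) (*-cong ι≈2τ ι≈2τ)))))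
      (lincomb₃ (+ 4 * e * τ * τ * bn * inv bn) (+ 4 * e * τ * τ) (+ 4 * τ)
        (≈-reflexive (sgn² i)) (invˡ′ (unit-bin (ℕₚ.<-trans i<m m<n) (ℕₚ.<⇒≤ n<q))) (invˡ′ (unit-even i<m)) (ring s e τ bn (inv bn)))
      where
      bn : ℤ
      bn = bin n (suc i)
      opaque
        unfolding _*_
        ring : ∀ s e τ b u → e * (- s * b) * (- s * (+ 2 * τ * (+ 2 * τ) * u)) - + 4 * τ ≡
          + 4 * e * τ * τ * b * u * (s * s - + 1) + + 4 * e * τ * τ * (u * b - + 1) + + 4 * τ * (τ * e - + 1)
        ring = solve-∀

  -- Divide the recurrence by its homogeneous solution y: what remains is an increment of order D²,
  -- so `w` has to be right only modulo p.
  ξ-value : ∀ i → i ≤ m → + 2 * ξ (i ℕ.+ i) ≈ y i * (+ 2 + D * D * w i) [ P³ ]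
  ξ-value zero    _   = lincomb₁ (- + 2) y-0 (ring (y 0) D)
    where
    opaque
      unfolding _*_
      ring : ∀ y D → + 2 * (+ 0 + + 1 * (+ 1 * + 1)) - y * (+ 2 + D * D * (+ 0 - + 0)) ≡ - + 2 * (y - + 1)
      ring = solve-∀
  ξ-value (suc i) i<m = cancel E (unit-≈ (≈-reflexive (sym E≡)) (shift-unit (unit-even i<m))) (≈-trans (≈-reflexive (cong (λ a → E * (+ 2 * ξ a)) (index i)))
    (lincomb₄ (+ 2) (- + 4 * O) (- (+ 2 + D * D * w i)) (- + 1)
      ξ-increment (ξ-value i (ℕₚ.<⇒≤ i<m)) (subst₂ (λ a b → a * y (suc i) ≈ - + 4 * b * y i [ P³ ]) E≡ O≡ (y-step i i<m))
      (cube≈0 d≈0 d≈0 (difference≈0 (subst (λ a → a * y (suc i) * (w (suc i) - w i) ≈ + 2 * ψ [ P ]) E≡ c-step)))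
      (ring E O D ψ (ξ (suc (suc (i ℕ.+ i)))) (ξ (i ℕ.+ i)) (y (suc i)) (y i) (w (suc i)) (w i))))
    where
    open CStep i i<m
    opaque
      unfolding _*_
      ring : ∀ E O D ψ X X′ y y′ w w′ → E * (+ 2 * X) - E * (y * (+ 2 + D * D * w)) ≡
        + 2 * (E * X + + 4 * O * X′ - D * D * ψ) + - + 4 * O * (+ 2 * X′ - y′ * (+ 2 + D * D * w′)) + - (+ 2 + D * D * w′) * (E * y - - + 4 * O * y′)
        + - + 1 * (D * D * (E * y * (w - w′) - + 2 * ψ) - + 0)
      ring = solve-∀

  -- Dividing by z leaves increments -2D²/e over the value of the homogeneous solution. Modulo p
  -- that value is a signed C(n, i + 1), which is why the upper index here is n at every i.
  v-value : ∀ i → i ≤ m → + 2 * v (i ℕ.+ i) ≈ z i * (+ 2 * v 0 - D * D * ∑ i (term n)) [ P³ ]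
  v-value zero    _   = lincomb₁ (- + 2 * v 0) z-0 (ring (z 0) (v 0) D)
    where
    opaque
      unfolding _*_
      ring : ∀ z v D → + 2 * v - z * (+ 2 * v - D * D * + 0) ≡ - + 2 * v * (z - + 1)
      ring = solve-∀
  v-value (suc i) i<m = cancel E (unit-≈ (≈-reflexive (sym E≡)) (shift-unit (unit-even i<m))) (≈-trans (≈-reflexive (cong (λ a → E * (+ 2 * v a)) (index i)))
    (lincomb₄ (+ 2) O (- (+ 2 * v 0 - D * D * ∑ i (term n))) (+ 1)
      v-increment (v-value i (ℕₚ.<⇒≤ i<m)) (subst₂ (λ a b → a * z (suc i) ≈ b * z i [ P³ ]) E≡ O≡ (z-step i i<m))
      (cube≈0 d≈0 d≈0 (difference≈0 (subst (λ a → a * z (suc i) * term n i ≈ + 4 * τ [ P ]) E≡ term-value)))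
      (ring E O D τ (v (suc (suc (i ℕ.+ i)))) (v (i ℕ.+ i)) (v 0) (z (suc i)) (z i) (∑ i (term n)) (term n i))))
    where
    open CStep i i<m
    opaque
      unfolding _*_
      ring : ∀ E O D τ X X′ V z z′ f t → E * (+ 2 * X) - E * (z * (+ 2 * V - D * D * (f + t))) ≡
        + 2 * (E * X - O * X′ - - + 2 * (D * D * τ)) + O * (+ 2 * X′ - z′ * (+ 2 * V - D * D * f)) + - (+ 2 * V - D * D * f) * (E * z - O * z′)
        + + 1 * (D * D * (E * z * t - + 4 * τ) - + 0)
      ring = solve-∀

  w₂ : ℤ
  w₂ = (+ 2) ^ q

  κ² : κ * κ ≡ w₂
  κ² = trans (cong (λ a → a * a) κ≡) (linear₂ (T₂ * T₂ * (T₂ * T₂)) (- + 1) (sgn² m) (trans (^-+ (+ 2) n n) (cong (λ a → a * a) (^-+ (+ 2) m m))) (ring (sgn m) T₂ w₂))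
    where
    T₂ : ℤ
    T₂ = (+ 2) ^ m
    κ≡ : κ ≡ sgn m * (T₂ * T₂)
    κ≡ = trans (neg^ (+ 4) m) (cong (sgn m *_) (trans (cong (_^ m) (sym (*≡ℤ* (+ 2) (+ 2)))) (^-distrib-* (+ 2) (+ 2) m)))
    opaque
      unfolding _*_
      ring : ∀ s t w → s * (t * t) * (s * (t * t)) - w ≡ t * t * (t * t) * (s * s - + 1) + - + 1 * (w - t * t * (t * t))
      ring = solve-∀

  unit-w₂ : Unit w₂
  unit-w₂ = unit-^ q unit-2

  -- (1 + i)⁴ = −4 for a square root i of −1.
  κ≈1 : κ ≈ + 1 [ P ]
  κ≈1 = ≈-trans (≈-sym (^-cong m fourth)) (≈-trans (≈-reflexive (trans (sq-pow (X * X) m) (sq-pow X n))) (fermat-unit unit-X))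
    where
    X : ℤ
    X = + 1 + fac n
    fourth : X * X * (X * X) ≈ - + 4 [ P ]
    fourth = lincomb₁ (+ 4 * (fac n + + 1) + (fac n * fac n + + 1)) fac² (ring (fac n))
      where
      opaque
        unfolding _*_
        ring : ∀ a → (+ 1 + a) * (+ 1 + a) * ((+ 1 + a) * (+ 1 + a)) - - + 4 ≡ (+ 4 * (a + + 1) + (a * a + + 1)) * (a * a - - + 1)
        ring = solve-∀
    unit-X : Unit X
    unit-X h = unit-neg unit-4 (≈-trans (≈-sym fourth) (≈-trans (*-congʳ (X * X) (*-congʳ X h)) (≈-reflexive (trans (cong (_* (X * X)) (*-zeroˡ X)) (*-zeroˡ (X * X))))))

  w₂≈1 : w₂ ≈ + 1 [ P ]
  w₂≈1 = ≈-trans (≈-reflexive (sym κ²)) (≈-trans (*-cong κ≈1 κ≈1) (≈-reflexive (*-identityˡ (+ 1))))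

  private
    C : ℤ
    C = c m

  ξ-n : + 2 * ξ n ≈ α * (+ 2 + D * D * C) [ P³ ]
  ξ-n = lincomb₂ (+ 1) (- α) (subst (λ a → + 2 * ξ n ≈ a * (+ 2 + D * D * w m) [ P³ ]) y-m (ξ-value m ℕₚ.≤-refl)) (cube≈0 d≈0 d≈0 H₂-n)
    (ring (ξ n) α D C (H₂ n))
    where
    opaque
      unfolding _*_
      ring : ∀ X α D C H → + 2 * X - α * (+ 2 + D * D * C) ≡ + 1 * (+ 2 * X - α * (+ 2 + D * D * (C - H))) + - α * (D * D * H - + 0)
      ring = solve-∀

  v-n : v 0 ≈ w₂ * κ [ P³ ] → + 2 * v n ≈ w₂ * (α * (+ 2 - D * D * C)) [ P³ ]
  v-n v₀ = cancel κ unit-κ (lincomb₄ κ (+ 2 * α) (α * C) (+ 2 * v 0 - D * D * C)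
    (v-value m ℕₚ.≤-refl) v₀ (cube≈0 d≈0 d≈0 (difference≈0 (≈-trans (*-cong w₂≈1 κ≈1) (≈-reflexive (*-identityˡ (+ 1)))))) (≈-reflexive y-m)
    (ring κ (v n) w₂ α D C (v 0) (z m)))
    where
    opaque
      unfolding _*_
      ring : ∀ κ V w α D C v z → κ * (+ 2 * V) - κ * (w * (α * (+ 2 - D * D * C))) ≡
        κ * (+ 2 * V - z * (+ 2 * v - D * D * C)) + + 2 * α * (v - w * κ) + α * C * (D * D * (w * κ - + 1) - + 0) + (+ 2 * v - D * D * C) * (κ * z - α)
      ring = solve-∀

  -- At i = m the two corrections are one and the same sum `c m`, with upper index 2m = n, and enter
  -- with opposite signs. The remaining term `H₂ n` vanishes modulo p.
  T-part : v 0 ≈ w₂ * κ [ P³ ] → v n + w₂ * ξ n ≈ + 2 * (w₂ * α) [ P³ ]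
  T-part v₀ = cancel (+ 2) unit-2 (lincomb₂ (+ 1) w₂ (v-n v₀) ξ-n (ring (v n) w₂ (ξ n) α D C))
    where
    opaque
      unfolding _*_
      ring : ∀ V w X α D C → + 2 * (V + w * X) - + 2 * (+ 2 * (w * α)) ≡ + 1 * (+ 2 * V - w * (α * (+ 2 - D * D * C))) + w * (+ 2 * X - α * (+ 2 + D * D * C))
      ring = solve-∀

-- The starting value of V at D

∑-telescope : ∀ N (g : ℕ → ℤ) → ∑ N (λ i → g (suc i) - g i) ≡ g N - g 0
∑-telescope zero    g = sym (ℤₚ.+-inverseʳ (g 0))
∑-telescope (suc N) g = trans (cong (_+ (g (suc N) - g N)) (∑-telescope N g)) (ring (g (suc N)) (g N) (g 0))
  where
  opaque
    unfolding _*_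
    ring : ∀ a b c → b - c + (a - b) ≡ a - c
    ring = solve-∀

∑-alternating-bin : ∀ N → ∑ (suc N) (λ l → sgn (suc l) * bin (suc N) (suc l)) ≡ - + 1
∑-alternating-bin N = linear₂ (- + 1) (+ 1) (binomial-theorem (- + 1) (suc N)) vanish
  (trans (ring S ((+ 1 + - + 1) ^ suc N)) (cong (λ z → - + 1 * ((+ 1 + - + 1) ^ suc N - z) + + 1 * ((+ 1 + - + 1) ^ suc N - + 0)) (sym split)))
  where
  S : ℤ
  S = ∑ (suc N) (λ l → sgn (suc l) * bin (suc N) (suc l))
  vanish : (+ 1 + - + 1) ^ suc N ≡ + 0
  vanish = *-zeroˡ ((+ 1 + - + 1) ^ N)
  sign-power : ∀ k → bin (suc N) k * (- + 1) ^ k ≡ sgn k * bin (suc N) k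
  sign-power k = trans (cong (bin (suc N) k *_) (trans (neg^ (+ 1) k) (trans (cong (sgn k *_) (one^ k)) (*-identityʳ (sgn k))))) (*-comm (bin (suc N) k) (sgn k))
  split : ∑ (suc (suc N)) (λ k → bin (suc N) k * (- + 1) ^ k) ≡ + 1 + S
  split = trans (∑-cong (suc (suc N)) λ k _ → sign-power k) (trans (∑-head (suc N) (λ k → sgn k * bin (suc N) k)) (cong (λ z → z + S) (*-identityˡ (+ 1))))
  opaque
    unfolding _*_
    ring : ∀ S x → S - - + 1 ≡ - + 1 * (x - (+ 1 + S)) + + 1 * (x - + 0)
    ring = solve-∀

falling : ∀ x k → bin x k * fac k ≡ ∏ k (λ i → + x - + i)
falling x zero    = *-identityˡ (+ 1)
falling x (suc k) = linear₂ (fac k) (+ x - + k) (bin-lower x k) (falling x k) (ring (+ x) (+ k) (bin x (suc k)) (bin x k) (fac k) (∏ k (λ i → + x - + i)))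
  where
  opaque
    unfolding _*_
    ring : ∀ x k b b′ f g → b * (f * (+ 1 + k)) - g * (x - k) ≡ f * ((+ 1 + k) * b - (x - k) * b′) + (x - k) * (b′ * f - g)
    ring = solve-∀

module Bases (m : ℕ) (p-prime : Prime (suc ((m ℕ.+ m) ℕ.+ (m ℕ.+ m)))) (2<p : 2 < suc ((m ℕ.+ m) ℕ.+ (m ℕ.+ m))) where
  open TSums m p-prime 2<p public

  half₂ : ℤ
  half₂ = inv (+ 2)

  half-2 : half₂ * + 2 ≈ + 1 [ P³ ]
  half-2 = invˡ unit-2

  half-pow : ∀ k → (+ 2) ^ k * half₂ ^ k ≈ + 1 [ P³ ]
  half-pow k = ≈-trans (≈-reflexive (sym (^-distrib-* (+ 2) half₂ k))) (≈-trans (^-cong k (≈-trans (≈-reflexive (*-comm (+ 2) half₂)) half-2)) (≈-reflexive (one^ k)))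

  ĉ β : ℕ → ℤ
  ĉ k = central k * half₂ ^ k
  β i = central i * (half₂ * half₂) ^ i

  legendreV-ĉ : ∀ K x → legendreV K x ≈ (+ 2) ^ K * ∑ (suc K) (λ k → sgn k * ĉ k * bin x k) [ P³ ]
  legendreV-ĉ zero    x = ≈-reflexive (ring (+ 1))
    where
    opaque
      unfolding _*_
      ring : ∀ (x : ℤ) → + 1 ≡ + 1 * (+ 0 + + 1 * (+ 1 * + 1) * + 1)
      ring = solve-∀
  legendreV-ĉ (suc K) x = lincomb₂ (+ 2) (- (sgn (suc K) * central (suc K) * bin x (suc K))) (legendreV-ĉ K x) (half-pow (suc K))
    (ring (legendreV K x) (sgn (suc K)) (central (suc K)) (bin x (suc K)) ((+ 2) ^ K) (half₂ ^ K) half₂ (∑ (suc K) (λ k → sgn k * ĉ k * bin x k)))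
    where
    opaque
      unfolding _*_
      ring : ∀ V s c b t h i S → + 2 * V + s * c * b - + 2 * t * (S + s * (c * (i * h)) * b) ≡
        + 2 * (V - t * S) + - (s * c * b) * (+ 2 * t * (i * h) - + 1)
      ring = solve-∀

  ĉ-rec : ∀ k → (+ 1 + + k) * ĉ (suc k) ≈ (+ 1 + (+ k + + k)) * ĉ k [ P³ ]
  ĉ-rec k = lincomb₂ (half₂ * half₂ ^ k) ((+ 1 + (+ k + + k)) * central k * half₂ ^ k) (≈-reflexive (central-rec k)) half-2
    (ring (+ k) (central (suc k)) (central k) half₂ (half₂ ^ k))
    where
    opaque
      unfolding _*_
      ring : ∀ k c c′ i h → (+ 1 + k) * (c * (i * h)) - (+ 1 + (k + k)) * (c′ * h) ≡
        i * h * ((+ 1 + k) * c - + 2 * (+ 1 + (k + k)) * c′) + (+ 1 + (k + k)) * c′ * h * (i * + 2 - + 1)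
      ring = solve-∀

  β-rec : ∀ i → (+ 2 + (+ i + + i)) * β (suc i) ≈ (+ 1 + (+ i + + i)) * β i [ P³ ]
  β-rec i = lincomb₂ (+ 2 * half₂ * half₂ * (half₂ * half₂) ^ i) ((+ 1 + (+ i + + i)) * central i * (half₂ * half₂) ^ i * (half₂ * + 2 + + 1))
    (≈-reflexive (central-rec i)) half-2 (ring (+ i) (central (suc i)) (central i) half₂ ((half₂ * half₂) ^ i))
    where
    opaque
      unfolding _*_
      ring : ∀ k c c′ i h → (+ 2 + (k + k)) * (c * (i * i * h)) - (+ 1 + (k + k)) * (c′ * h) ≡
        + 2 * i * i * h * ((+ 1 + k) * c - + 2 * (+ 1 + (k + k)) * c′) + (+ 1 + (k + k)) * c′ * h * (i * + 2 + + 1) * (i * + 2 - + 1)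
      ring = solve-∀

  -- C(2k, k)/2^k is the constant term of (1 + (z + 1/z)/2)^k; expand by the binomial theorem. The
  -- proof checks the recurrence `ĉ-rec` for the right side, with `G` as telescoping certificate.
  ĉ-β : ∀ k → k ≤ q → ĉ k ≈ ∑ (suc n) (λ i → bin k (i ℕ.+ i) * β i) [ P³ ]
  ĉ-β zero _ = ≈-reflexive (sym (trans (∑-head n (λ i → bin 0 (i ℕ.+ i) * β i)) (trans (cong (λ z → + 1 * β 0 + z) (∑-zero n λ i _ → *-zeroˡ (β (suc i))))
    (trans (ℤₚ.+-identityʳ (+ 1 * β 0)) (*-identityˡ (β 0))))))
  ĉ-β (suc k) k<q = cancel (+ 1 + + k) (unit-suc k<q) (≈-trans (ĉ-rec k) (≈-trans (*-congˡ (+ 1 + (+ k + + k)) (ĉ-β k (ℕₚ.<⇒≤ k<q)))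
      (≈-sym (lincomb₂ (+ 1) (+ 1) summed (≈-reflexive last) (ring₀ ((+ 1 + + k) * ∑ (suc n) (λ i → bin (suc k) (i ℕ.+ i) * β i)) ((+ 1 + (+ k + + k)) * ∑ (suc n) (λ i → bin k (i ℕ.+ i) * β i)) (G (suc n)))))))
    where
    opaque
      unfolding _*_
      ring₀ : ∀ a b g → a - b ≡ + 1 * (a - b - (g - + 0)) + + 1 * (g - + 0)
      ring₀ = solve-∀
    G : ℕ → ℤ
    G zero    = + 0
    G (suc i) = - (+ 1 + (+ i + + i)) * bin k (suc (i ℕ.+ i)) * β i
    last : G (suc n) ≡ + 0
    last = trans (cong (λ z → - (+ 1 + (+ n + + n)) * z * β n) (bin-overflow (ℕₚ.<-trans k<q (ℕₚ.n<1+n q))))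
      (trans (cong (_* β n) (*-zeroʳ (- (+ 1 + (+ n + + n))))) (*-zeroˡ (β n)))
    pointwise : ∀ i → (+ 1 + + k) * (bin (suc k) (i ℕ.+ i) * β i) - (+ 1 + (+ k + + k)) * (bin k (i ℕ.+ i) * β i) ≈ G (suc i) - G i [ P³ ]
    pointwise zero = ≈-reflexive (linear₁ (β 0) (bin-1 k) (ring (+ k) (bin k 1) (β 0)))
      where
      opaque
        unfolding _*_
        ring : ∀ k b β → (+ 1 + k) * (+ 1 * β) - (+ 1 + (k + k)) * (+ 1 * β) - (- (+ 1 + (+ 0 + + 0)) * b * β - + 0) ≡ β * (b - k)
        ring = solve-∀
    pointwise (suc i) = subst (λ a → (+ 1 + + k) * (bin (suc k) a * β (suc i)) - (+ 1 + (+ k + + k)) * (bin k a * β (suc i)) ≈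
        - (+ 1 + (+ suc i + + suc i)) * bin k (suc a) * β (suc i) - G (suc i) [ P³ ]) (sym (cong suc (ℕₚ.+-suc i i)))
      (lincomb₃ (β (suc i)) (- β (suc i)) (bin k j) (≈-reflexive (bin-lower k (suc j))) (≈-reflexive (bin-lower k j)) (β-rec i)
        (ring (+ k) (+ i) (bin k j) (bin k (suc j)) (bin k (suc (suc j))) (β (suc i)) (β i)))
      where
      j : ℕ
      j = suc (i ℕ.+ i)
      opaque
        unfolding _*_
        ring : ∀ k i u v w β β′ → let j = + 1 + (i + i) in
          (+ 1 + k) * ((u + v) * β) - (+ 1 + (k + k)) * (v * β) - (- (+ 1 + ((+ 1 + i) + (+ 1 + i))) * w * β - - (+ 1 + (i + i)) * u * β′) ≡
          β * ((+ 1 + (+ 1 + j)) * w - (k - (+ 1 + j)) * v) + - β * ((+ 1 + j) * v - (k - j) * u) + u * ((+ 2 + (i + i)) * β - (+ 1 + (i + i)) * β′)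
        ring = solve-∀
    summed : (+ 1 + + k) * ∑ (suc n) (λ i → bin (suc k) (i ℕ.+ i) * β i) - (+ 1 + (+ k + + k)) * ∑ (suc n) (λ i → bin k (i ℕ.+ i) * β i) ≈ G (suc n) - + 0 [ P³ ]
    summed = ≈-trans (≈-reflexive (trans (cong₂ _-_ (sym (∑-*ˡ (suc n) (+ 1 + + k) (λ i → bin (suc k) (i ℕ.+ i) * β i)))
          (sym (∑-*ˡ (suc n) (+ 1 + (+ k + + k)) (λ i → bin k (i ℕ.+ i) * β i)))) (sub-∑ (suc n))))
        (≈-trans (∑-≈ (suc n) λ i _ → pointwise i) (≈-reflexive (∑-telescope (suc n) G)))
      where
      sub-∑ : ∀ N {f g : ℕ → ℤ} → ∑ N f - ∑ N g ≡ ∑ N (λ i → f i - g i)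
      sub-∑ zero    = refl
      sub-∑ (suc N) {f} {g} = trans (ring (∑ N f) (∑ N g) (f N) (g N)) (cong (_+ (f N - g N)) (sub-∑ N))
        where
        opaque
          unfolding _*_
          ring : ∀ a b c d → a + c - (b + d) ≡ a - b + (c - d)
          ring = solve-∀

  -- In the basis C(k, 2i) the sum over k becomes `alternating`, for which a closed form is
  -- available.
  legendreV-alternating : ∀ x → legendreV q x ≈ w₂ * ∑ (suc n) (λ i → β i * alternating q (i ℕ.+ i) x) [ P³ ]
  legendreV-alternating x = ≈-trans (legendreV-ĉ q x) (*-congˡ w₂ (≈-trans
    (∑-≈ p λ k k<p → *-congʳ (bin x k) (*-congˡ (sgn k) (ĉ-β k (ℕₚ.≤-pred k<p))))
    (≈-reflexive (trans (∑-cong p λ k _ → distribute k) (trans (∑-swap p (suc n) (λ k i → β i * (sgn k * bin x k * bin k (i ℕ.+ i))))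
      (∑-cong (suc n) λ i _ → ∑-*ˡ p (β i) (λ k → sgn k * bin x k * bin k (i ℕ.+ i))))))))
    where
    distribute : ∀ k → sgn k * ∑ (suc n) (λ i → bin k (i ℕ.+ i) * β i) * bin x k ≡ ∑ (suc n) (λ i → β i * (sgn k * bin x k * bin k (i ℕ.+ i)))
    distribute k = trans (regroup (sgn k) (∑ (suc n) (λ i → bin k (i ℕ.+ i) * β i)) (bin x k)) (trans (sym (∑-*ˡ (suc n) (sgn k * bin x k) (λ i → bin k (i ℕ.+ i) * β i)))
      (∑-cong (suc n) λ i _ → regroup′ (sgn k * bin x k) (bin k (i ℕ.+ i)) (β i)))
      where
      opaque
        unfolding _*_
        regroup : ∀ s S b → s * S * b ≡ s * b * S
        regroup = solve-∀
        regroup′ : ∀ a b c → a * (b * c) ≡ c * (a * b)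
        regroup′ = solve-∀

  alternating-p : ∀ x j → (+ x - + j) * alternating q j x ≡ bin q j * (P * bin x p)
  alternating-p x j = trans (alternating-sum q j x) (trans (cong (_* (P * bin q j * bin x p)) sgn-q) (ring P (bin q j) (bin x p)))
    where
    opaque
      unfolding _*_
      ring : ∀ P b c → + 1 * (P * b * c) ≡ b * (P * c)
      ring = solve-∀

  -- Times q! it is ∏ (D - i) over i = 1, ..., q, that is `rising (- D) q` up to the sign (-1)^q =
  -- 1.
  bin-d′-q : bin d′ q ≈ + 1 [ P³ ]
  bin-d′-q = cancel Q unit-Q (≈-trans (≈-reflexive (trans (*-comm Q (bin d′ q)) (trans (falling d′ q)
    (trans (∏-cong q λ i _ → linear₁ (+ 1) +d′ (ring D (+ d′) (+ i))) (trans (neg-rising D q) (trans (cong (_* rising (- D) q) sgn-q) (*-identityˡ (rising (- D) q))))))))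
    (≈-trans (rising-q (neg-cong d≈0)) (≈-reflexive (sym (*-identityʳ Q)))))
    where
    opaque
      unfolding _*_
      ring : ∀ D e i → e - i - (D - (+ 1 + i)) ≡ + 1 * (+ 1 + e - D)
      ring = solve-∀

  D≢0 : D ≢ + 0
  D≢0 e = ℕₚ.<⇒≢ 0<d (sym (ℤₚ.+-injective e))

  private
    2l+2≤q : ∀ {l} → l < n → suc l ℕ.+ suc l ≤ q
    2l+2≤q l<n = ℕₚ.+-mono-≤ l<n l<n

    J a bq : ℕ → ℤ
    J l = + (suc l ℕ.+ suc l)
    a l = inv (J l)
    bq l = bin q (suc l ℕ.+ suc l)

    unit-J : ∀ {l} → l < n → Unit (J l)
    unit-J {l} l<n = unit-suc (2l+2≤q l<n)

  -- Both shifts s = p and s = D are multiples of p for which the alternating sums are explicit.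
  alternating-shift : ∀ {s c} x → + x ≡ s → s ≈ + 0 [ P ] → P * bin x p ≡ s * c → c ≈ + 1 [ P³ ] → ∀ l → l < n →
    alternating q (suc l ℕ.+ suc l) x ≈ - s * bq l * (a l + s * a l * a l) [ P³ ]
  alternating-shift {s} {c} x refl hs e hc l l<n = cancel (s - J l) unit (lincomb₄ (+ 1) (s * bq l) (- s * bq l * (+ 1 + s * a l)) (bq l * a l * a l)
    (≈-reflexive (trans (alternating-p x (suc l ℕ.+ suc l)) (cong (bq l *_) e))) hc (invˡ (unit-J l<n)) (s³≈0 hs)
    (ring s (J l) (alternating q (suc l ℕ.+ suc l) x) (bq l) (a l) c))
    where
    unit : Unit (s - J l)
    unit h = unit-J l<n (lincomb₂ (- + 1) (+ 1) h hs (ring₁ s (J l)))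
      where
      opaque
        unfolding _*_
        ring₁ : ∀ s j → j - + 0 ≡ - + 1 * (s - j - + 0) + + 1 * (s - + 0)
        ring₁ = solve-∀
    opaque
      unfolding _*_
      ring : ∀ s j T b a c → (s - j) * T - (s - j) * (- s * b * (a + s * a * a)) ≡
        + 1 * ((s - j) * T - b * (s * c)) + s * b * (c - + 1) + - s * b * (+ 1 + s * a) * (a * j - + 1) + b * a * a * (s * s * s - + 0)
      ring = solve-∀

  S₁ S₂ : ℤ
  S₁ = ∑ n (λ l → β (suc l) * bq l * a l)
  S₂ = ∑ n (λ l → β (suc l) * bq l * a l * a l)

  -- The term i = 0 gives 1. Every other alternating sum is divisible by s, with expansion
  -- coefficients that do not depend on s; hence the same S₁ and S₂ serve at x = p and at x = D.
  legendreV-shift : ∀ {s c} x → + x ≡ s → s ≈ + 0 [ P ] → P * bin x p ≡ s * c → c ≈ + 1 [ P³ ] → alternating q 0 x ≈ + 1 [ P³ ] →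
    legendreV q x ≈ w₂ * (+ 1 - s * S₁ - s * s * S₂) [ P³ ]
  legendreV-shift {s} {c} x ex hs e hc h₀ = ≈-trans (legendreV-alternating x) (*-congˡ w₂ (≈-trans (≈-reflexive (∑-head n (λ i → β i * alternating q (i ℕ.+ i) x)))
    (≈-trans (+-cong (≈-trans (*-congˡ (β 0) h₀) (≈-reflexive (trans (*-identityʳ (β 0)) (*-identityˡ (+ 1)))))
      (≈-trans (∑-≈ n λ l l<n → ≈-trans (*-congˡ (β (suc l)) (alternating-shift x ex hs e hc l l<n)) (≈-reflexive (expand s (β (suc l)) (bq l) (a l))))
        (≈-reflexive (trans (∑-+ n (λ l → - s * (β (suc l) * bq l * a l)) (λ l → - (s * s) * (β (suc l) * bq l * a l * a l)))
          (cong₂ _+_ (∑-*ˡ n (- s) (λ l → β (suc l) * bq l * a l)) (∑-*ˡ n (- (s * s)) (λ l → β (suc l) * bq l * a l * a l)))))))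
      (≈-reflexive (ring s S₁ S₂)))))
    where
    opaque
      unfolding _*_
      expand : ∀ s β b a → β * (- s * b * (a + s * a * a)) ≡ - s * (β * b * a) + - (s * s) * (β * b * a * a)
      expand = solve-∀
      ring : ∀ s x y → + 1 + (- s * x + - (s * s) * y) ≡ + 1 - s * x - s * s * y
      ring = solve-∀

  private
    u₀ : ℤ
    u₀ = + 1 - P * S₁ - P * P * S₂

  -- Extended by its term k = p, the sum vanishes because p is odd. So the sum up to q is determined
  -- by that single term, half a central coefficient.
  legendreV-p : legendreV q p ≡ bin (p ℕ.+ q) p
  legendreV-p = ℤₚ.*-cancelˡ-≡ (+ 2) (legendreV q p) (bin (p ℕ.+ q) p) (trans (sym (*≡ℤ* (+ 2) (legendreV q p))) (trans
    (linear₄ (+ 1) (central p * bin p p) (central p) (+ 1) (legendreV-odd n p ℕₚ.≤-refl) sgn-q (bin-diag p) central-p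
      (ring (legendreV q p) (sgn q) (central p) (bin p p) (bin (p ℕ.+ q) p)))
    (*≡ℤ* (+ 2) (bin (p ℕ.+ q) p))))
    where
    central-p : central p ≡ + 2 * bin (p ℕ.+ q) p
    central-p = trans (cong (_+ bin (q ℕ.+ p) p) (bin-sym q p)) (trans (cong (λ j → bin j p + bin j p) (ℕₚ.+-comm q p)) (ring₁ (bin (p ℕ.+ q) p)))
      where
      opaque
        unfolding _*_
        ring₁ : ∀ x → x + x ≡ + 2 * x
        ring₁ = solve-∀
    opaque
      unfolding _*_
      ring : ∀ V s c b x → + 2 * V - + 2 * x ≡ + 1 * (+ 2 * V + - s * c * b - + 0) + c * b * (s - + 1) + c * (b - + 1) + + 1 * (c - + 2 * x)
      ring = solve-∀

  w₂-inverse : w₂ * u₀ ≈ + 1 [ P³ ]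
  w₂-inverse = ≈-trans (≈-sym (legendreV-shift p refl P≈0 (cong (P *_) (bin-diag p)) ≈-refl
    (≈-reflexive (cancel-exact P P≢0 (trans (cong (_* alternating q 0 p) (sym (ℤₚ.+-identityʳ P))) (trans (alternating-p p 0)
      (trans (cong (λ z → + 1 * (P * z)) (bin-diag p)) (*-identityˡ (P * + 1)))))))))
    (≈-trans (≈-reflexive legendreV-p) wolstenholme)

  v₀-value : v 0 ≈ w₂ * (+ 1 - D * S₁ - D * D * S₂) [ P³ ]
  v₀-value = legendreV-shift d refl d≈0 P*bin-d-p bin-d′-q (≈-trans (≈-reflexive (cancel-exact D D≢0
    (trans (cong (_* alternating q 0 d) (sym (ℤₚ.+-identityʳ D))) (trans (alternating-p d 0) (trans (*-identityˡ (P * bin d p)) P*bin-d-p))))) bin-d′-q)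

  harmonicSum harmonicSum₂ : ℕ → ℤ
  harmonicSum  N = ∑ N (λ l → sgn (suc l) * bin N (suc l) * inv (+ suc l))
  harmonicSum₂ N = ∑ N (λ l → sgn (suc l) * bin N (suc l) * inv (+ suc l) * inv (+ suc l))

  private
    absorb : ∀ N l → l ≤ N → N < q → bin N l * inv (+ suc l) ≈ inv (+ suc N) * bin (suc N) (suc l) [ P ]
    absorb N l l≤N N<q = lincomb₃ (inv (+ suc N) * bin (suc N) (suc l)) (- (bin N l * inv (+ suc l))) (- inv (+ suc l) * inv (+ suc N))
      (invˡ′ (unit-suc (ℕₚ.≤-<-trans l≤N N<q))) (invˡ′ (unit-suc N<q)) (≈-reflexive (bin-up N l))
      (ring (inv (+ suc l)) (inv (+ suc N)) (bin N l) (bin (suc N) (suc l)) (+ l) (+ N))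
      where
      opaque
        unfolding _*_
        ring : ∀ i ν b b′ l N → b * i - ν * b′ ≡
          ν * b′ * (i * (+ 1 + l) - + 1) + - (b * i) * (ν * (+ 1 + N) - + 1) + - i * ν * ((+ 1 + l) * b′ - (+ 1 + N) * b)
        ring = solve-∀

  -- By Pascal's rule and C(N, l)/(l + 1) = C(N + 1, l + 1)/(N + 1), the increment in N is 1/(N + 1)
  -- times an alternating row sum, which is -1.
  harmonicSum-value : ∀ N → N ≤ q → harmonicSum N ≈ - H N [ P ]
  harmonicSum-value zero    _   = ≈-refl
  harmonicSum-value (suc N) N<q = begin
    harmonicSum (suc N)
      ≡⟨ trans (∑-cong (suc N) λ l _ → expand (sgn l) (bin N l) (bin N (suc l)) (inv (+ suc l)))
           (∑-+ (suc N) (λ l → sgn (suc l) * bin N (suc l) * inv (+ suc l)) (λ l → sgn (suc l) * (bin N l * inv (+ suc l)))) ⟩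
    harmonicSum N + sgn (suc N) * bin N (suc N) * inv (+ suc N) + ∑ (suc N) (λ l → sgn (suc l) * (bin N l * inv (+ suc l)))
      ≈⟨ +-cong (≈-trans (+-cong (harmonicSum-value N (ℕₚ.<⇒≤ N<q)) (≈-reflexive last)) (≈-reflexive (ℤₚ.+-identityʳ (- H N))))
           (≈-trans (∑-≈ (suc N) λ l l<N → ≈-trans (*-congˡ (sgn (suc l)) (absorb N l (ℕₚ.≤-pred l<N) N<q)) (≈-reflexive (regroup (sgn (suc l)) (inv (+ suc N)) (bin (suc N) (suc l)))))
             (≈-reflexive (trans (∑-*ˡ (suc N) (inv (+ suc N)) (λ l → sgn (suc l) * bin (suc N) (suc l))) (cong (inv (+ suc N) *_) (∑-alternating-bin N))))) ⟩
    - H N + inv (+ suc N) * - + 1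
      ≡⟨ ring (H N) (inv (+ suc N)) ⟩
    - H (suc N) ∎
    where
    open ≈-Reasoning P
    opaque
      unfolding _*_
      expand : ∀ s b b′ i → - s * (b + b′) * i ≡ - s * b′ * i + - s * (b * i)
      expand = solve-∀
      regroup : ∀ s ν b → s * (ν * b) ≡ ν * (s * b)
      regroup = solve-∀
      ring : ∀ H ν → - H + ν * - + 1 ≡ - (H + ν)
      ring = solve-∀
    last : sgn (suc N) * bin N (suc N) * inv (+ suc N) ≡ + 0
    last = trans (cong (λ b → sgn (suc N) * b * inv (+ suc N)) (bin-overflow (ℕₚ.n<1+n N)))
      (trans (cong (_* inv (+ suc N)) (*-zeroʳ (sgn (suc N)))) (*-zeroˡ (inv (+ suc N))))

  -- The same absorption makes the increment 1/(N + 1) times `harmonicSum (suc N)`, already known.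
  harmonicSum₂-value : ∀ N → N ≤ q → + 2 * harmonicSum₂ N ≈ - (H N * H N + H₂ N) [ P ]
  harmonicSum₂-value zero    _   = ≈-reflexive (ring (+ 0))
    where
    opaque
      unfolding _*_
      ring : ∀ (x : ℤ) → + 2 * + 0 ≡ - (+ 0 * + 0 + + 0)
      ring = solve-∀
  harmonicSum₂-value (suc N) N<q = ≈-trans (*-congˡ (+ 2) step) (lincomb₂ (+ 1) (+ 2 * inv (+ suc N)) (harmonicSum₂-value N (ℕₚ.<⇒≤ N<q)) (harmonicSum-value (suc N) N<q)
      (ring (harmonicSum₂ N) (harmonicSum (suc N)) (inv (+ suc N)) (H N) (H₂ N)))
    where
    opaque
      unfolding _*_
      expand : ∀ s b b′ i → - s * (b + b′) * i * i ≡ - s * b′ * i * i + - s * (b * i) * i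
      expand = solve-∀
      regroup : ∀ s ν b i → s * (ν * b) * i ≡ ν * (s * b * i)
      regroup = solve-∀
      ring : ∀ B A ν h h₂ → + 2 * (B + ν * A) - - ((h + ν) * (h + ν) + (h₂ + ν * ν)) ≡ + 1 * (+ 2 * B - - (h * h + h₂)) + + 2 * ν * (A - - (h + ν))
      ring = solve-∀
    last : sgn (suc N) * bin N (suc N) * inv (+ suc N) * inv (+ suc N) ≡ + 0
    last = trans (cong (λ b → sgn (suc N) * b * inv (+ suc N) * inv (+ suc N)) (bin-overflow (ℕₚ.n<1+n N)))
      (trans (cong (λ z → z * inv (+ suc N) * inv (+ suc N)) (*-zeroʳ (sgn (suc N)))) (trans (cong (_* inv (+ suc N)) (*-zeroˡ (inv (+ suc N)))) (*-zeroˡ (inv (+ suc N)))))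
    step : harmonicSum₂ (suc N) ≈ harmonicSum₂ N + inv (+ suc N) * harmonicSum (suc N) [ P ]
    step = ≈-trans (≈-reflexive (trans (∑-cong (suc N) λ l _ → expand (sgn l) (bin N l) (bin N (suc l)) (inv (+ suc l)))
           (∑-+ (suc N) (λ l → sgn (suc l) * bin N (suc l) * inv (+ suc l) * inv (+ suc l)) (λ l → sgn (suc l) * (bin N l * inv (+ suc l)) * inv (+ suc l)))))
      (+-cong (≈-reflexive (trans (cong (λ z → harmonicSum₂ N + z) last) (ℤₚ.+-identityʳ (harmonicSum₂ N))))
        (≈-trans (∑-≈ (suc N) λ l l<N → ≈-trans (*-congʳ (inv (+ suc l)) (*-congˡ (sgn (suc l)) (absorb N l (ℕₚ.≤-pred l<N) N<q)))
            (≈-reflexive (regroup (sgn (suc l)) (inv (+ suc N)) (bin (suc N) (suc l)) (inv (+ suc l)))))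
          (≈-reflexive (∑-*ˡ (suc N) (inv (+ suc N)) (λ l → sgn (suc l) * bin (suc N) (suc l) * inv (+ suc l))))))

  bin-q : ∀ k → k ≤ q → bin q k ≈ sgn k [ P ]
  bin-q zero    _   = ≈-refl
  bin-q (suc k) k<q = lincomb₂ (+ 1) (- + 1) (bin-p≈0 k k<q) (bin-q k (ℕₚ.<⇒≤ k<q)) (ring (bin q k) (bin q (suc k)) (sgn k))
    where
    opaque
      unfolding _*_
      ring : ∀ a b s → b - - s ≡ + 1 * (a + b - + 0) + - + 1 * (a - s)
      ring = solve-∀

  β-mod : ∀ i → i ≤ n → β i ≈ sgn i * bin n i [ P ]
  β-mod zero    _   = ≈-refl
  β-mod (suc i) i<n = cancelᴾ (+ 2 + (+ i + + i)) unit (lincomb₄ (+ 1) (+ 1 + (+ i + + i)) (+ 2 * sgn i) (sgn i * bin n i)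
    (P³⇒P (β-rec i)) (β-mod i (ℕₚ.<⇒≤ i<n)) (≈-reflexive (bin-lower n i)) P≈0
    (ring (+ i) N (β (suc i)) (β i) (sgn i) (bin n i) (bin n (suc i))))
    where
    unit : Unit (+ 2 + (+ i + + i))
    unit = subst (λ j → Unit (+ j)) (cong suc (ℕₚ.+-suc i i)) (unit-J i<n)
    opaque
      unfolding _*_
      ring : ∀ i n β β′ s b b′ → let e = + 2 + (i + i) ; o = + 1 + (i + i) in e * β - e * (- s * b′) ≡
        + 1 * (e * β - o * β′) + o * (β′ - s * b) + + 2 * s * ((+ 1 + i) * b′ - (n - i) * b) + s * b * (+ 1 + (n + n) - + 0)
      ring = solve-∀

  private
    a-half : ∀ l → a l ≡ half₂ * inv (+ suc l)
    a-half l = trans (cong inv (ring (+ suc l))) (inv-* (+ 2) (+ suc l))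
      where
      opaque
        unfolding _*_
        ring : ∀ x → x + x ≡ + 2 * x
        ring = solve-∀

    bq≈1 : ∀ l → l < n → bq l ≈ + 1 [ P ]
    bq≈1 l l<n = ≈-trans (bin-q (suc l ℕ.+ suc l) (2l+2≤q l<n)) (≈-reflexive (sgn-double (suc l)))

  -- Modulo p, β at l is (-1)^l C(n, l) and C(q, 2l) is 1; with 1/(2l) in place of 1/l, S₁ is half
  -- of `harmonicSum n`.
  S₁-mod : + 2 * S₁ ≈ - H n [ P ]
  S₁-mod = ≈-trans (≈-trans (≈-reflexive (sym (∑-*ˡ n (+ 2) (λ l → β (suc l) * bq l * a l))))
      (∑-≈ n λ l l<n → ≈-trans (*-congˡ (+ 2) (*-cong (*-cong (β-mod (suc l) l<n) (bq≈1 l l<n)) (≈-reflexive (a-half l))))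
        (lincomb₁ (sgn (suc l) * bin n (suc l) * inv (+ suc l)) (P³⇒P half-2) (ring (sgn (suc l)) (bin n (suc l)) half₂ (inv (+ suc l))))))
    (harmonicSum-value n (ℕₚ.<⇒≤ n<q))
    where
    opaque
      unfolding _*_
      ring : ∀ s b h i → + 2 * (s * b * + 1 * (h * i)) - s * b * i ≡ s * b * i * (h * + 2 - + 1)
      ring = solve-∀

  S₂-mod : + 8 * S₂ ≈ - (H n * H n) [ P ]
  S₂-mod = lincomb₃ (+ 2) (+ 1) (- + 1) quadruple (harmonicSum₂-value n (ℕₚ.<⇒≤ n<q)) H₂-n (ring′ S₂ (harmonicSum₂ n) (H n) (H₂ n))
    where
    opaque
      unfolding _*_
      ring : ∀ s b h i → + 4 * (s * b * + 1 * (h * i) * (h * i)) - s * b * i * i ≡ s * b * i * i * (h * + 2 + + 1) * (h * + 2 - + 1)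
      ring = solve-∀
    quadruple : + 4 * S₂ ≈ harmonicSum₂ n [ P ]
    quadruple = ≈-trans (≈-reflexive (sym (∑-*ˡ n (+ 4) (λ l → β (suc l) * bq l * a l * a l))))
      (∑-≈ n λ l l<n → ≈-trans (*-congˡ (+ 4) (*-cong (*-cong (*-cong (β-mod (suc l) l<n) (bq≈1 l l<n)) (≈-reflexive (a-half l))) (≈-reflexive (a-half l))))
        (lincomb₁ (sgn (suc l) * bin n (suc l) * inv (+ suc l) * inv (+ suc l) * (half₂ * + 2 + + 1)) (P³⇒P half-2) (ring (sgn (suc l)) (bin n (suc l)) half₂ (inv (+ suc l)))))
    opaque
      unfolding _*_
      ring′ : ∀ S B h h₂ → + 8 * S - - (h * h) ≡ + 2 * (+ 4 * S - B) + + 1 * (+ 2 * B - - (h * h + h₂)) + - + 1 * (h₂ - + 0)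
      ring′ = solve-∀

  private
    T₄ : ℤ
    T₄ = + 4 + + 2 * P * S₁ - P * P * S₂

  -- The term of order P² is 12 S₁² + 24 S₂, and it vanishes modulo p because S₁ ≡ -H/2 and S₂ ≡
  -- -H²/8 with H = `H n`.
  T₄² : T₄ * T₄ * u₀ ≈ + 16 [ P³ ]
  T₄² = lincomb₂ (- + 1) (- + 12 * S₁ * S₂ + + 9 * P * S₂ * S₂ + - + 4 * S₁ * S₁ * S₁ + + 3 * P * P * S₁ * S₂ * S₂ + - + 1 * P * P * P * S₂ * S₂ * S₂) small P³≈0 (ring P S₁ S₂)
    where
    small : P * P * (+ 12 * S₁ * S₁ + + 24 * S₂) ≈ + 0 [ P³ ]
    small = cube≈0 P≈0 P≈0 (lincomb₂ (+ 3 * (+ 2 * S₁ - H n)) (+ 3) S₁-mod S₂-mod (ring′ S₁ S₂ (H n)))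
      where
      opaque
        unfolding _*_
        ring′ : ∀ s t h → + 12 * s * s + + 24 * t - + 0 ≡ + 3 * (+ 2 * s - h) * (+ 2 * s - - h) + + 3 * (+ 8 * t - - (h * h))
        ring′ = solve-∀
    opaque
      unfolding _*_
      ring : ∀ P s t → (+ 4 + + 2 * P * s - P * P * t) * (+ 4 + + 2 * P * s - P * P * t) * (+ 1 - P * s - P * P * t) - + 16 ≡
        - + 1 * (P * P * (+ 12 * s * s + + 24 * t) - + 0) + (- + 12 * s * t + + 9 * P * t * t + - + 4 * s * s * s + + 3 * P * P * s * t * t + - + 1 * P * P * P * t * t * t) * (P * (P * P) - + 0)
      ring = solve-∀

  -- Both T₄/4 and κ are square roots of 1/u₀ that are 1 modulo p.
  T₄≈4κ : T₄ ≈ + 4 * κ [ P³ ]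
  T₄≈4κ = cancel (T₄ + + 4 * κ) unit (cancel u₀ unit-u₀ (lincomb₃ (+ 1) (- + 16) (- + 16 * u₀) T₄² w₂-inverse (≈-reflexive κ²) (ring T₄ κ u₀ w₂)))
    where
    unit-u₀ : Unit u₀
    unit-u₀ h = unit-one (≈-trans (≈-sym (P³⇒P w₂-inverse)) (≈-trans (*-congˡ w₂ h) (≈-reflexive (*-zeroʳ w₂))))
    unit : Unit (T₄ + + 4 * κ)
    unit = unit-≈ (lincomb₂ (+ 2 * S₁ - P * S₂) (+ 4) P≈0 κ≈1 (ring′ P S₁ S₂ κ)) (unit-≈ (≈-reflexive (sym (*≡ℤ* (+ 2) (+ 4)))) (unit-* unit-2 unit-4))
      where
      opaque
        unfolding _*_
        ring′ : ∀ P s t κ → + 4 + + 2 * P * s - P * P * t + + 4 * κ - + 8 ≡ (+ 2 * s - P * t) * (P - + 0) + + 4 * (κ - + 1)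
        ring′ = solve-∀
    opaque
      unfolding _*_
      ring : ∀ T κ u w → u * ((T + + 4 * κ) * T) - u * ((T + + 4 * κ) * (+ 4 * κ)) ≡ + 1 * (T * T * u - + 16) + - + 16 * (w * u - + 1) + - + 16 * u * (κ * κ - w)
      ring = solve-∀

  v₀ : v 0 ≈ w₂ * κ [ P³ ]
  v₀ = cancel (+ 4) unit-4 (lincomb₃ (+ 4) w₂ (w₂ * (- + 2 * S₁ - (D + D - P) * S₂)) v₀-value T₄≈4κ 2d≈ (ring (v 0) w₂ κ D P S₁ S₂))
    where
    opaque
      unfolding _*_
      ring : ∀ v w κ D P s t → + 4 * v - + 4 * (w * κ) ≡ + 4 * (v - w * (+ 1 - D * s - D * D * t)) + w * (+ 4 + + 2 * P * s - P * P * t - + 4 * κ)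
        + w * (- + 2 * s - (D + D - P) * t) * (D + D - - P)
      ring = solve-∀

  κ-mod² : + 4 * κ ≈ + 4 - P * H n [ P² ]
  κ-mod² = lincomb₃ (- + 1) (- S₂) (+ 1) (P³⇒P² T₄≈4κ) modulus≈0 (scale P S₁-mod) (ring P S₁ S₂ κ (H n))
    where
    opaque
      unfolding _*_
      ring : ∀ P s t κ h → + 4 * κ - (+ 4 - P * h) ≡ - + 1 * (+ 4 + + 2 * P * s - P * P * t - + 4 * κ) + - t * (P * P - + 0) + + 1 * (P * (+ 2 * s) - P * - h)
      ring = solve-∀

  -- Eisenstein's congruence for 2^(p-1), obtained by squaring `κ-mod²`.
  w₂-mod² : + 2 * w₂ ≈ + 2 - P * H n [ P² ]
  w₂-mod² = cancel² (+ 8) (unit-≈ (≈-reflexive (sym (*≡ℤ* (+ 2) (+ 4)))) (unit-* unit-2 unit-4))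
    (lincomb₃ (+ 4 * κ + + 4 - P * H n) (- + 16) (H n * H n) κ-mod² (≈-reflexive κ²) modulus≈0 (ring P κ w₂ (H n)))
    where
    opaque
      unfolding _*_
      ring : ∀ P κ w h → + 8 * (+ 2 * w) - + 8 * (+ 2 - P * h) ≡ (+ 4 * κ + + 4 - P * h) * (+ 4 * κ - (+ 4 - P * h)) + - + 16 * (κ * κ - w) + h * h * (P * P - + 0)
      ring = solve-∀

-- The value of V at D - 1

module Predecessor (m : ℕ) (p-prime : Prime (suc ((m ℕ.+ m) ℕ.+ (m ℕ.+ m)))) (2<p : 2 < suc ((m ℕ.+ m) ℕ.+ (m ℕ.+ m))) where
  open Bases m p-prime 2<p public

  unit-odd′ : ∀ {i} → i < n → Unit (odd i)
  unit-odd′ i<n = unit-suc (ℕₚ.+-mono-< i<n i<n)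

  sgn-n : sgn n ≡ + 1
  sgn-n = sgn-double m

  sgn-reflect : ∀ i j → suc (i ℕ.+ j) ≡ n → sgn i ≡ sgn (suc j)
  sgn-reflect i j e = linear₂ (sgn (suc j)) (- sgn i) (trans (sym (sgn-+ i (suc j))) (trans (cong sgn (trans (ℕₚ.+-suc i j) e)) sgn-n)) (sgn² (suc j))
    (ring (sgn i) (sgn (suc j)))
    where
    opaque
      unfolding _*_
      ring : ∀ s t → s - t ≡ t * (s * t - + 1) + - s * (t * t - + 1)
      ring = solve-∀

  bin-reflect : ∀ i j → suc (i ℕ.+ j) ≡ n → bin n i ≡ bin n (suc j)
  bin-reflect i j e = subst (λ a → bin a i ≡ bin a (suc j)) (trans (ℕₚ.+-suc i j) e) (bin-sym i (suc j))

  oddSum : ℤ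
  oddSum = ∑ n (λ i → β i * inv (odd i))

  -- The reflection i ↦ n - 1 - i turns 2i + 1 into p - 2(j + 1), so the odd reciprocals become
  -- those of `harmonicSum n`.
  oddSum-value : + 2 * oddSum ≈ H n [ P ]
  oddSum-value = ≈-trans (*-congˡ (+ 2) (≈-trans (∑-≈ n λ i i<n → *-congʳ (inv (odd i)) (β-mod i (ℕₚ.<⇒≤ i<n)))
      (≈-trans (≈-reflexive (∑-reverse n (λ i → sgn i * bin n i * inv (odd i)) (λ j → sgn (suc j) * bin n (suc j) * inv (P - even j)) reflect))
        (≈-trans (∑-≈ n λ j j<n → ≈-trans (*-congˡ (sgn (suc j) * bin n (suc j)) (inv-reflect j j<n)) (≈-reflexive (regroup (sgn (suc j) * bin n (suc j)) half₂ (inv (+ suc j)))))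
          (≈-reflexive (∑-*ˡ n (- half₂) (λ j → sgn (suc j) * bin n (suc j) * inv (+ suc j))))))))
    (lincomb₂ (- + 2 * half₂) (H n) (harmonicSum-value n (ℕₚ.<⇒≤ n<q)) (P³⇒P half-2) (ring (harmonicSum n) half₂ (H n)))
    where
    reflect : ∀ i j → suc (i ℕ.+ j) ≡ n → sgn i * bin n i * inv (odd i) ≡ sgn (suc j) * bin n (suc j) * inv (P - even j)
    reflect i j e = cong₂ (λ a b → a * inv b) (cong₂ _*_ (sgn-reflect i j e) (bin-reflect i j e)) (linear₁ (+ 2) (cong +_ e) (ring₁ (+ i) (+ j) N))
      where
      opaque
        unfolding _*_
        ring₁ : ∀ i j n → + 1 + (i + i) - (+ 1 + (n + n) - (+ 2 + (j + j))) ≡ + 2 * (+ 1 + (i + j) - n)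
        ring₁ = solve-∀
    inv-reflect : ∀ j → j < n → inv (P - even j) ≈ - (half₂ * inv (+ suc j)) [ P ]
    inv-reflect j j<n = ≈-sym (inv-unique unit (lincomb₃ (- (half₂ * ι)) (half₂ * + 2) (+ 1) P≈0 (invˡ′ (unit-suc (ℕₚ.<-trans j<n n<q))) (P³⇒P half-2)
        (ring₂ half₂ ι P (+ j))))
      where
      ι = inv (+ suc j)
      unit : Unit (P - even j)
      unit h′ = unit-suc (ℕₚ.+-mono-≤ j<n j<n) (lincomb₂ (- + 1) (+ 1) h′ P≈0 (trans (cong (λ a → + (suc a) - + 0) (ℕₚ.+-suc j j)) (ring₃ P (+ j))))
        where
        opaque
          unfolding _*_
          ring₃ : ∀ P j → + 2 + (j + j) - + 0 ≡ - + 1 * (P - (+ 2 + (j + j)) - + 0) + + 1 * (P - + 0)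
          ring₃ = solve-∀
      opaque
        unfolding _*_
        ring₂ : ∀ h i P j → - (h * i) * (P - (+ 2 + (j + j))) - + 1 ≡ - (h * i) * (P - + 0) + h * + 2 * (i * (+ 1 + j) - + 1) + + 1 * (h * + 2 - + 1)
        ring₂ = solve-∀
    opaque
      unfolding _*_
      regroup : ∀ b h i → b * - (h * i) ≡ - h * (b * i)
      regroup = solve-∀
      ring : ∀ S h H → + 2 * (- h * S) - H ≡ - + 2 * h * (S - - H) + H * (h * + 2 - + 1)
      ring = solve-∀

  -- At x = D - 1 the factor x - 2i is D - (2i + 1), and p C(d - 1, p) = (D - p) C(d - 1, q), where
  -- the last coefficient is 1 modulo p³.
  alternating-d′ : ∀ i → i < n → alternating q (i ℕ.+ i) d′ ≈ - (D - P) * inv (odd i) [ P² ]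
  alternating-d′ i i<n = cancel² (D - odd i) unit (lincomb₄ (+ 1) (bin d′ q) (- (D - P)) (+ 1)
      (≈-reflexive exact) (*-≈0 (difference≈0 (bin-q (i ℕ.+ i) 2i≤q)) D-P≈0)
      (P³⇒P² (invˡ (unit-odd′ i<n))) rest
      (ring D (odd i) P (alternating q (i ℕ.+ i) d′) (bin q (i ℕ.+ i)) (bin d′ q) (inv (odd i)) (sgn (i ℕ.+ i)) ))
    where
    2i≤q : i ℕ.+ i ≤ q
    2i≤q = ℕₚ.+-mono-≤ (ℕₚ.<⇒≤ i<n) (ℕₚ.<⇒≤ i<n)
    D-P≈0 : D - P ≈ + 0 [ P ]
    D-P≈0 = sub-cong d≈0 P≈0
    unit : Unit (D - odd i)
    unit h′ = unit-odd′ i<n (lincomb₂ (- + 1) (+ 1) h′ d≈0 (ring₁ D (odd i)))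
      where
      opaque
        unfolding _*_
        ring₁ : ∀ D o → o - + 0 ≡ - + 1 * (D - o - + 0) + + 1 * (D - + 0)
        ring₁ = solve-∀
    exact : (D - odd i) * alternating q (i ℕ.+ i) d′ ≡ bin q (i ℕ.+ i) * ((D - P) * bin d′ q)
    exact = trans (cong (_* alternating q (i ℕ.+ i) d′) (linear₁ (- + 1) +d′ (ring₁ D (+ d′) (+ i)))) (trans (alternating-p d′ (i ℕ.+ i))
      (cong (bin q (i ℕ.+ i) *_) (trans (bin-lower d′ q) (cong (_* bin d′ q) (linear₁ (+ 1) +d′ (ring₂ D (+ d′) (+ q)))))))
      where
      opaque
        unfolding _*_
        ring₁ : ∀ D e i → D - (+ 1 + (i + i)) - (e - (i + i)) ≡ - + 1 * (+ 1 + e - D)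
        ring₁ = solve-∀
        ring₂ : ∀ D e q → e - q - (D - (+ 1 + q)) ≡ + 1 * (+ 1 + e - D)
        ring₂ = solve-∀
    rest : (D - P) * (sgn (i ℕ.+ i) * bin d′ q - + 1) + (D - P) * (D * inv (odd i)) ≈ + 0 [ P² ]
    rest = +-cong (*-≈0 D-P≈0 (difference≈0 (≈-trans (*-cong (≈-reflexive (sgn-double i)) (P³⇒P bin-d′-q)) (≈-reflexive (*-identityˡ (+ 1))))))
      (*-≈0 D-P≈0 (≈-trans (*-congʳ (inv (odd i)) d≈0) (≈-reflexive (*-zeroˡ (inv (odd i))))))
    opaque
      unfolding _*_
      ring : ∀ D o P A b c ω s → (D - o) * A - (D - o) * (- (D - P) * ω) ≡
        + 1 * ((D - o) * A - b * ((D - P) * c)) + c * ((b - s) * (D - P) - + 0) + - (D - P) * (ω * o - + 1) + + 1 * ((D - P) * (s * c - + 1) + (D - P) * (D * ω) - + 0)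
      ring = solve-∀

  -- The index j = q is separate, because there x - j = D - p is not a unit. But C(k, q) leaves only
  -- the term k = q.
  alternating-q : alternating q q d′ ≈ + 1 [ P³ ]
  alternating-q = ≈-trans (≈-reflexive (trans (cong (_+ sgn q * bin d′ q * bin q q) (∑-zero q λ k k<q → trans (cong (sgn k * bin d′ k *_) (bin-overflow k<q)) (*-zeroʳ (sgn k * bin d′ k))))
      (trans (ℤₚ.+-identityˡ (sgn q * bin d′ q * bin q q)) (trans (cong₂ (λ a b → a * bin d′ q * b) sgn-q (bin-diag q)) (ring (bin d′ q)))))) bin-d′-q
    where
    opaque
      unfolding _*_
      ring : ∀ x → + 1 * x * + 1 ≡ x
      ring = solve-∀

  -- The powers of 2 cancel and leave C(2n, n), which is ∏ (p - i)/n! over i = 1, ..., n.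
  w₂β-n : w₂ * β n ≈ + 1 - P * H n [ P² ]
  w₂β-n = ≈-trans (lincomb₁ (central n) (P³⇒P² (half-pow q)) (trans (cong (λ a → w₂ * (central n * a) - central n) (sq-pow half₂ n)) (ring w₂ (central n) (half₂ ^ q))))
      (cancel² (+ 2 * fac n) (unit-* unit-2 (unit-fac (ℕₚ.<⇒≤ n<q))) (lincomb₃ (+ 2) (+ 1) (fac n * (H n * H n)) (≈-reflexive product) (P³⇒P² (rising-n (neg-cong P≈0))) modulus≈0
        (ring′ (central n) (fac n) (rising (- P) n) P (H n))))
    where
    opaque
      unfolding _*_
      ring : ∀ w c h → w * (c * h) - c ≡ c * (w * h - + 1)
      ring = solve-∀
    product : central n * fac n ≡ rising (- P) n
    product = trans (falling q n) (trans (∏-cong n λ i _ → ring₁ (+ q) (+ i)) (trans (neg-rising P n) (trans (cong (_* rising (- P) n) sgn-n) (*-identityˡ (rising (- P) n)))))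
      where
      opaque
        unfolding _*_
        ring₁ : ∀ q i → q - i ≡ + 1 + q - (+ 1 + i)
        ring₁ = solve-∀
    opaque
      unfolding _*_
      ring′ : ∀ c f R P H → + 2 * f * c - + 2 * f * (+ 1 - P * H) ≡
        + 2 * (c * f - R) + + 1 * (+ 2 * R - f * (+ 2 + + 2 * - P * H + - P * - P * (H * H - + 0))) + f * (H * H) * (P * P - + 0)
      ring′ = solve-∀

  v₋ : ℤ
  v₋ = legendreV q d′

  -- Precision p² suffices, since this value will be multiplied by D. The odd reciprocals contribute
  -- 3/4 and the top index -1 to the coefficient of p `H n`, together the -1/4 of `κ-mod²`.
  v₋≈κ : v₋ ≈ κ [ P² ]
  v₋≈κ = cancel² (+ 4) unit-4 (lincomb₄ (+ 1) (- + 1) (+ 1) (+ 4) quadruple κ-mod² 3P-part w₂β-n (ring v₋ κ w₂ (β n) D P oddSum (H n)))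
    where
    value : v₋ ≈ w₂ * (- (D - P) * oddSum + β n) [ P² ]
    value = ≈-trans (P³⇒P² (legendreV-alternating d′)) (*-congˡ w₂ (+-cong
      (≈-trans (∑-≈ n λ i i<n → ≈-trans (*-congˡ (β i) (alternating-d′ i i<n)) (≈-reflexive (ring₁ (β i) (- (D - P)) (inv (odd i)))))
        (≈-reflexive (∑-*ˡ n (- (D - P)) (λ i → β i * inv (odd i)))))
      (≈-trans (*-congˡ (β n) (P³⇒P² alternating-q)) (≈-reflexive (*-identityʳ (β n))))))
      where
      opaque
        unfolding _*_
        ring₁ : ∀ b d i → b * (d * i) ≡ d * (b * i)
        ring₁ = solve-∀
    quadruple : + 4 * v₋ ≈ - (+ 4 * (D - P)) * oddSum + + 4 * (w₂ * β n) [ P² ]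
    quadruple = lincomb₂ (+ 4) (- + 4 * oddSum) value (*-≈0 (difference≈0 w₂≈1) (sub-cong d≈0 P≈0)) (ring₂ v₋ w₂ (β n) D P oddSum)
      where
      opaque
        unfolding _*_
        ring₂ : ∀ v w b D P S → + 4 * v - (- (+ 4 * (D - P)) * S + + 4 * (w * b)) ≡ + 4 * (v - w * (- (D - P) * S + b)) + - + 4 * S * ((w - + 1) * (D - P) - + 0)
        ring₂ = solve-∀
    3P-part : - (+ 4 * (D - P)) * oddSum ≈ + 3 * P * H n [ P² ]
    3P-part = lincomb₂ (- + 2 * oddSum) (+ 3) (P³⇒P² 2d≈) (scale P oddSum-value) (ring₃ D P oddSum (H n))
      where
      opaque
        unfolding _*_
        ring₃ : ∀ D P S h → - (+ 4 * (D - P)) * S - + 3 * P * h ≡ - + 2 * S * (D + D - - P) + + 3 * (P * (+ 2 * S) - P * h)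
        ring₃ = solve-∀
    opaque
      unfolding _*_
      ring : ∀ v κ w b D P S h → + 4 * v - + 4 * κ ≡ + 1 * (+ 4 * v - (- (+ 4 * (D - P)) * S + + 4 * (w * b))) + - + 1 * (+ 4 * κ - (+ 4 - P * h))
        + + 1 * (- (+ 4 * (D - P)) * S - + 3 * P * h) + + 4 * (w * b - (+ 1 - P * h))
      ring = solve-∀

-- The product of consecutive values of V

∑-pairs : ∀ k f → ∑ (k ℕ.+ k) f ≡ ∑ k (λ i → f (i ℕ.+ i) + f (suc (i ℕ.+ i)))
∑-pairs zero    f = refl
∑-pairs (suc k) f = trans (cong (λ a → ∑ a f) (cong suc (ℕₚ.+-suc k k))) (trans (ℤₚ.+-assoc (∑ (k ℕ.+ k) f) (f (k ℕ.+ k)) (f (suc (k ℕ.+ k))))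
  (cong (_+ (f (k ℕ.+ k) + f (suc (k ℕ.+ k)))) (∑-pairs k f)))

legendreV-≈ : ∀ {M} K x x′ → (∀ k → k ≤ K → bin x k ≈ bin x′ k [ M ]) → legendreV K x ≈ legendreV K x′ [ M ]
legendreV-≈ zero    x x′ h = ≈-refl
legendreV-≈ (suc K) x x′ h = +-cong (*-congˡ (+ 2) (legendreV-≈ K x x′ λ k k≤K → h k (ℕₚ.m≤n⇒m≤1+n k≤K)))
  (*-congˡ (sgn (suc K) * central (suc K)) (h (suc K) ℕₚ.≤-refl))

kummer-diagonal-odd : ∀ i → let N = suc (i ℕ.+ i) in kummer N N ≡ + 0
kummer-diagonal-odd i = [ (λ ()) , (λ h → h) ]′ (ℤₚ.i*j≡0⇒i≡0∨j≡0 (+ 2) (trans (sym (*≡ℤ* (+ 2) (kummer N N))) (linear₁ (+ 1) antisymmetric (ring (kummer N N)))))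
  where
  N : ℕ
  N = suc (i ℕ.+ i)
  sgn-N : sgn N ≡ - + 1
  sgn-N = cong (λ s → - s) (sgn-double i)
  reflect : ∀ j k → suc (j ℕ.+ k) ≡ suc N → sgn j * (bin N j * bin N j) ≡ - + 1 * (sgn k * (bin N k * bin N k))
  reflect j k e = subst (λ a → sgn j * (bin a j * bin a j) ≡ - + 1 * (sgn k * (bin a k * bin a k))) (ℕₚ.suc-injective e)
    (trans (cong (λ b → sgn j * (b * b)) (bin-sym j k)) (linear₂ (sgn k * B²) (- (sgn j * B²)) (trans (sym (sgn-+ j k)) (trans (cong sgn (ℕₚ.suc-injective e)) sgn-N)) (sgn² k)
      (ring₁ (sgn j) (sgn k) B²)))
    where
    B² : ℤ
    B² = bin (j ℕ.+ k) k * bin (j ℕ.+ k) k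
    opaque
      unfolding _*_
      ring₁ : ∀ s t b → s * b - - + 1 * (t * b) ≡ t * b * (s * t - - + 1) + - (s * b) * (t * t - + 1)
      ring₁ = solve-∀
  antisymmetric : kummer N N ≡ - + 1 * kummer N N
  antisymmetric = trans (∑-reverse (suc N) (λ k → sgn k * (bin N k * bin N k)) (λ k → - + 1 * (sgn k * (bin N k * bin N k))) reflect)
    (∑-*ˡ (suc N) (- + 1) (λ k → sgn k * (bin N k * bin N k)))
  opaque
    unfolding _*_
    ring : ∀ x → + 2 * x - + 0 ≡ + 1 * (x - - + 1 * x)
    ring = solve-∀

module ProductV (m : ℕ) (p-prime : Prime (suc ((m ℕ.+ m) ℕ.+ (m ℕ.+ m)))) (2<p : 2 < suc ((m ℕ.+ m) ℕ.+ (m ℕ.+ m))) where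
  open Predecessor m p-prime 2<p public

  v-odd : ∀ i → i < n → v (suc (i ℕ.+ i)) ≈ + 0 [ P ]
  v-odd i i<n = ≈-trans (legendreV-≈ q (suc (i ℕ.+ i) ℕ.+ d) (suc (i ℕ.+ i)) (bin-shift (suc (i ℕ.+ i))))
    (≈-reflexive (legendreV-odd i q (ℕₚ.+-mono-< i<n i<n)))

  v-even : ∀ i → i ≤ m → v (i ℕ.+ i) ≈ z i [ P ]
  v-even i i≤m = cancelᴾ (+ 2) unit-2 (lincomb₃ (+ 1) (+ 2 * z i) (- (z i * D * ∑ i (term n))) (P³⇒P (v-value i i≤m))
    (≈-trans (P³⇒P v₀) (≈-trans (*-cong w₂≈1 κ≈1) (≈-reflexive (*-identityˡ (+ 1))))) d≈0 (ring (v (i ℕ.+ i)) (z i) (v 0) D (∑ i (term n))))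
    where
    opaque
      unfolding _*_
      ring : ∀ V z v D S → + 2 * V - + 2 * z ≡ + 1 * (+ 2 * V - z * (+ 2 * v - D * D * S)) + + 2 * z * (v - + 1) + - (z * D * S) * (D - + 0)
      ring = solve-∀

  ξ-odd : ∀ i → i < n → ξ (suc (i ℕ.+ i)) ≈ + 0 [ P ]
  ξ-odd i i<n = ≈-trans (∑-≈ (suc N′) λ k k≤N → *-congˡ (sgn k) (let h′ = bin-shift N′ k (ℕₚ.≤-trans (ℕₚ.≤-pred k≤N) (ℕₚ.+-mono-< i<n i<n)) in *-cong h′ h′))
    (≈-reflexive (kummer-diagonal-odd i))
    where
    N′ : ℕ
    N′ = suc (i ℕ.+ i)

  ξ-even : ∀ i → i ≤ m → ξ (i ℕ.+ i) ≈ y i [ P ]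
  ξ-even i i≤m = cancelᴾ (+ 2) unit-2 (lincomb₂ (+ 1) (y i * D * w i) (P³⇒P (ξ-value i i≤m)) d≈0 (ring (ξ (i ℕ.+ i)) (y i) D (w i)))
    where
    opaque
      unfolding _*_
      ring : ∀ V z D S → + 2 * V - + 2 * z ≡ + 1 * (+ 2 * V - z * (+ 2 + D * D * S)) + z * D * S * (D - + 0)
      ring = solve-∀

  F₀ : ℤ
  F₀ = ∑ m (λ i → z i * inv (odd i))

  private
    inhomogeneity : ℕ → ℤ
    inhomogeneity i = (+ 1 + (+ q + + q)) * (sgn q * central q * bin (suc (i ℕ.+ d′)) q)

    flux : ℕ → ℤ
    flux i = (+ 1 + + (i ℕ.+ d′)) * (legendreV q (suc (i ℕ.+ d′)) * legendreV q (i ℕ.+ d′))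

    index-d′ : ∀ i → suc (i ℕ.+ d′) ≡ i ℕ.+ d
    index-d′ i = trans (sym (ℕₚ.+-suc i d′)) (cong (i ℕ.+_) suc-d′)

    -- Multiply `legendreV-rec` by the middle value V(x + 1): its two terms become the products of
    -- consecutive values, so the recurrence of order two telescopes.
    flux-step : ∀ i → i < q → flux (suc i) - flux i ≈ P * D * (v i * inv (+ suc i)) [ P³ ]
    flux-step i i<q = lincomb₄ (V₁ * inv (+ suc i) * (+ 1 + + i)) (V₁ * inv (+ suc i)) (- (flux (suc i) - flux i)) (P * D * inv (+ suc i))
      (≈-reflexive (legendreV-rec q (i ℕ.+ d′)))
      (subst (λ a → (+ 1 + + i) * ((+ 1 + (+ q + + q)) * (sgn q * central q * bin a q)) ≈ P * D [ P³ ]) (sym (index-d′ i)) (v-bound i i<q)) (invˡ (unit-suc i<q))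
      (≈-reflexive (cong (legendreV q) (index-d′ i)))
      (ring (+ (i ℕ.+ d′)) V₂ V₁ V₀ (inhomogeneity i) (inv (+ suc i)) (+ i) P D (v i))
      where
      V₀ V₁ V₂ : ℤ
      V₀ = legendreV q (i ℕ.+ d′)
      V₁ = legendreV q (suc (i ℕ.+ d′))
      V₂ = legendreV q (suc (suc (i ℕ.+ d′)))
      opaque
        unfolding _*_
        ring : ∀ x V₂ V₁ V₀ R ι i P D v → let δ = (+ 1 + (+ 1 + x)) * (V₂ * V₁) - (+ 1 + x) * (V₁ * V₀) in
          δ - P * D * (v * ι) ≡
          V₁ * ι * (+ 1 + i) * ((+ 2 + x) * V₂ - (+ 1 + x) * V₀ - R) + V₁ * ι * ((+ 1 + i) * R - P * D) + - δ * (ι * (+ 1 + i) - + 1) + P * D * ι * (V₁ - v)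
        ring = solve-∀

  v-pred : ℤ
  v-pred = legendreV q (n ℕ.+ d′)

  -- At the start the flux is D V(D) V(D - 1) in scaled form, at the end its factor N + D is -1/2.
  -- The source already contains pD, so the values v in it are needed modulo p only, and those at
  -- odd arguments vanish.
  v-product : v n * v-pred ≈ P * (w₂ * w₂) + P * P * F₀ [ P³ ]
  v-product = lincomb₄ (- + 2) (v n * v-pred) (- + 1) (- + 1) (≈-trans (≈-reflexive (cong (_- flux 0) (sym flux-n))) total) 2d≈ boundary source
      (ring (flux 0) S N (v n * v-pred) D (w₂ * w₂) F₀)
    where
    S : ℤ
    S = ∑ n (λ i → P * D * (v i * inv (+ suc i)))
    flux-n : flux n ≡ (N + D) * (v n * v-pred)
    flux-n = cong (λ a → + a * (legendreV q a * v-pred)) (index-d′ n)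
    total : flux n - flux 0 ≈ S [ P³ ]
    total = ≈-trans (≈-reflexive (sym (∑-telescope n flux))) (∑-≈ n λ i i<n → flux-step i (ℕₚ.<-trans i<n n<q))
    boundary : + 2 * flux 0 ≈ - P * (w₂ * w₂) [ P³ ]
    boundary = ≈-trans (≈-reflexive (cong (λ a → + 2 * (+ a * (legendreV q a * v₋))) suc-d′)) (lincomb₄ (v 0 * v₋) (- P * v₋) (- (w₂ * κ)) (- P * w₂)
      2d≈ v₀ (scale P v₋≈κ) (≈-reflexive κ²) (ring₁ D (v 0) v₋ P w₂ κ))
      where
      opaque
        unfolding _*_
        ring₁ : ∀ D v u P w κ → + 2 * (D * (v * u)) - - P * (w * w) ≡ v * u * (D + D - - P) + - P * u * (v - w * κ) + - (w * κ) * (P * u - P * κ) + - P * w * (κ * κ - w)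
        ring₁ = solve-∀
    oddParts : ∑ n (λ i → v i * inv (+ suc i)) ≈ F₀ [ P ]
    oddParts = ≈-trans (≈-reflexive (∑-pairs m (λ i → v i * inv (+ suc i)))) (∑-≈ m λ i i<m →
      ≈-trans (+-cong (*-congʳ (inv (odd i)) (v-even i (ℕₚ.<⇒≤ i<m))) (*-congʳ (inv (+ suc (suc (i ℕ.+ i)))) (v-odd i (ℕₚ.<-trans i<m m<n))))
        (≈-reflexive (ring₂ (z i * inv (odd i)) (inv (+ suc (suc (i ℕ.+ i)))))))
      where
      opaque
        unfolding _*_
        ring₂ : ∀ a b → a + + 0 * b ≡ a
        ring₂ = solve-∀
    source : + 2 * S ≈ - P * P * F₀ [ P³ ]
    source = ≈-trans (≈-reflexive (cong (+ 2 *_) (∑-*ˡ n (P * D) (λ i → v i * inv (+ suc i))))) (lincomb₂ (P * σ) (- + 1) 2d≈ (scale P (scale P oddParts)) (ring₃ P D σ F₀))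
      where
      σ : ℤ
      σ = ∑ n (λ i → v i * inv (+ suc i))
      opaque
        unfolding _*_
        ring₃ : ∀ P D S F → + 2 * (P * D * S) - - P * P * F ≡ P * S * (D + D - - P) + - + 1 * (P * (P * S) - P * (P * F))
        ring₃ = solve-∀
    opaque
      unfolding _*_
      ring : ∀ f S n V D W F → let P = + 1 + (n + n) in
        V - (P * W + P * P * F) ≡ - + 2 * ((n + D) * V - f - S) + V * (D + D - - P) + - + 1 * (+ 2 * f - - P * W) + - + 1 * (+ 2 * S - - P * P * F)
      ring = solve-∀

-- A sum over central coefficients transformed into a half row

module CentralSums (m : ℕ) (p-prime : Prime (suc ((m ℕ.+ m) ℕ.+ (m ℕ.+ m)))) (2<p : 2 < suc ((m ℕ.+ m) ℕ.+ (m ℕ.+ m))) where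
  open ProductV m p-prime 2<p public

  -- γ k = (1/2)ₖ/k! and Ω r i = (1/2)ᵢ(1/2)ᵣ₋ᵢ/r!, for i ≤ r.
  γ : ℕ → ℤ
  γ k = ∏ k odd * inv (∏ k even)

  Ω θ : ℕ → ℕ → ℤ
  Ω r i = ∏ i odd * ∏ (r ∸ i) odd * inv (∏ r even)
  θ r i = sgn i * Ω r i * inv (odd i)

  unit-even′ : ∀ {i} → i < n → Unit (even i)
  unit-even′ {i} i<n = subst (λ a → Unit (+ suc a)) (ℕₚ.+-suc i i) (unit-suc (ℕₚ.+-mono-≤ i<n i<n))

  Ω-suc : ∀ r i → Ω (suc r) (suc i) ≡ odd i * inv (even r) * Ω r i
  Ω-suc r i = trans (cong (λ a → ∏ i odd * odd i * ∏ (r ∸ i) odd * a) (inv-* (∏ r even) (even r)))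
    (ring (∏ i odd) (odd i) (∏ (r ∸ i) odd) (inv (∏ r even)) (inv (even r)))
    where
    opaque
      unfolding _*_
      ring : ∀ a o b e f → a * o * b * (e * f) ≡ o * f * (a * b * e)
      ring = solve-∀

  suc-∸ : ∀ {r i} → i ≤ r → suc r ∸ i ≡ suc (r ∸ i)
  suc-∸ i≤r = ℕₚ.+-∸-assoc 1 i≤r

  Ω-same : ∀ r i → i ≤ r → Ω (suc r) i ≡ odd (r ∸ i) * inv (even r) * Ω r i
  Ω-same r i i≤r = trans (cong₂ (λ a b → ∏ i odd * ∏ a odd * b) (suc-∸ i≤r) (inv-* (∏ r even) (even r)))
    (ring (∏ i odd) (odd (r ∸ i)) (∏ (r ∸ i) odd) (inv (∏ r even)) (inv (even r)))
    where
    opaque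
      unfolding _*_
      ring : ∀ a o b e f → a * (b * o) * (e * f) ≡ o * f * (a * b * e)
      ring = solve-∀

  odd-split : ∀ {r i} → i ≤ r → odd i + odd (r ∸ i) ≡ even r
  odd-split {r} {i} i≤r = linear₁ (+ 2) (cong +_ (ℕₚ.m+[n∸m]≡n i≤r)) (ring (+ i) (+ (r ∸ i)) (+ r))
    where
    opaque
      unfolding _*_
      ring : ∀ i j r → + 1 + (i + i) + (+ 1 + (j + j)) - (+ 2 + (r + r)) ≡ + 2 * (i + j - r)
      ring = solve-∀

  -- The two new factors are 2i + 1 and 2(r - i) + 1, and they add up to 2r + 2.
  Ω-pascal : ∀ r i → r < n → i ≤ r → Ω (suc r) i + Ω (suc r) (suc i) ≈ Ω r i [ P ]
  Ω-pascal r i r<n i≤r = ≈-trans (≈-reflexive (cong₂ _+_ (Ω-same r i i≤r) (Ω-suc r i))) (lincomb₂ (Ω r i) (inv (even r) * Ω r i)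
      (invˡ′ (unit-even′ r<n)) (≈-reflexive (odd-split i≤r)) (ring (odd i) (odd (r ∸ i)) (even r) (inv (even r)) (Ω r i)))
    where
    opaque
      unfolding _*_
      ring : ∀ o o′ e f w → o′ * f * w + o * f * w - w ≡ w * (f * e - + 1) + f * w * (o + o′ - e)
      ring = solve-∀

  Ω-zero : ∀ r → Ω r 0 ≡ γ r
  Ω-zero r = cong (_* inv (∏ r even)) (*-identityˡ (∏ r odd))

  θ-step : ∀ r i → r < n → i ≤ r → θ (suc r) i - θ r i ≈ - inv (even r) * (sgn i * Ω r i) [ P ]
  θ-step r i r<n i≤r = lincomb₃ (sgn i * inv (odd i)) (- (sgn i * inv (odd i))) (- (sgn i * inv (even r) * Ω r i)) (Ω-pascal r i r<n i≤r) (≈-reflexive (Ω-suc r i))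
    (invˡ′ (unit-odd′ (ℕₚ.≤-<-trans i≤r r<n)))
    (ring (sgn i) (Ω r i) (Ω (suc r) i) (Ω (suc r) (suc i)) (inv (even r)) (inv (odd i)) (odd i))
    where
    opaque
      unfolding _*_
      ring : ∀ s w w′ w″ e ω o → s * w′ * ω - s * w * ω - - e * (s * w) ≡
        s * ω * (w′ + w″ - w) + - (s * ω) * (w″ - o * e * w) + - (s * e * w) * (ω * o - + 1)
      ring = solve-∀

  -- By `θ-step`, passing to the next row removes the denominators 2i + 1. What is left is an
  -- alternating sum of a row of Ω, and `Ω-pascal` telescopes it.
  θ-sum-step : ∀ r I → r < n → I ≤ suc r → ∑ I (θ (suc r)) - ∑ I (θ r) ≈ - inv (even r) * (γ (suc r) - sgn I * Ω (suc r) I) [ P ]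
  θ-sum-step r zero    r<n _   = lincomb₁ (- inv (even r)) (≈-reflexive (Ω-zero (suc r))) (ring (inv (even r)) (γ (suc r)) (Ω (suc r) 0))
    where
    opaque
      unfolding _*_
      ring : ∀ e g w → + 0 - + 0 - - e * (g - + 1 * w) ≡ - e * (w - g)
      ring = solve-∀
  θ-sum-step r (suc I) r<n I<r = lincomb₃ (+ 1) (+ 1) (inv (even r) * sgn I) (θ-sum-step r I r<n (ℕₚ.<⇒≤ I<r)) (θ-step r I r<n (ℕₚ.≤-pred I<r)) (Ω-pascal r I r<n (ℕₚ.≤-pred I<r))
    (ring (∑ I (θ (suc r))) (∑ I (θ r)) (θ (suc r) I) (θ r I) (inv (even r)) (γ (suc r)) (sgn I) (Ω (suc r) I) (Ω (suc r) (suc I)) (Ω r I))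
    where
    opaque
      unfolding _*_
      ring : ∀ S S′ t t′ e g s w w′ u → S + t - (S′ + t′) - - e * (g - - s * w′) ≡
        + 1 * (S - S′ - - e * (g - s * w)) + + 1 * (t - t′ - - e * (s * u)) + e * s * (w + w′ - u)
      ring = solve-∀

  u : ℕ → ℤ
  u J = Ω (J ℕ.+ J) J

  -- The first half of the row 2I + 1. Passing to I + 1 crosses two rows and adds one entry; the
  -- boundary terms are central entries of Ω.
  ϑ : ℕ → ℤ
  ϑ I = ∑ (suc I) (θ (suc (I ℕ.+ I)))

  -- The source term of the recurrence for ρ at J = i + 1, freed of 16^J: 5k + 7 and (k + 1)(k + 2)
  -- at k = 2J - 1 are 2(5J + 1) and 2J(2J + 1).
  summand : ℕ → ℤ
  summand i = (+ 5 * + suc i + + 1) * (sgn (suc i) * u (suc i)) * inv (+ suc i) * inv (odd (suc i))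

  γ-suc : ∀ k → γ (suc k) ≡ odd k * inv (even k) * γ k
  γ-suc k = trans (cong (λ a → ∏ k odd * odd k * a) (inv-* (∏ k even) (even k))) (ring (∏ k odd) (odd k) (inv (∏ k even)) (inv (even k)))
    where
    opaque
      unfolding _*_
      ring : ∀ a o e f → a * o * (e * f) ≡ o * f * (a * e)
      ring = solve-∀

  inv-double : ∀ a → inv (a + a) ≡ half₂ * inv a
  inv-double a = trans (cong inv (ring a)) (inv-* (+ 2) a)
    where
    opaque
      unfolding _*_
      ring : ∀ x → x + x ≡ + 2 * x
      ring = solve-∀

  inv-even : ∀ k → inv (even k) ≡ half₂ * inv (+ suc k)
  inv-even k = trans (cong inv (ring (+ k))) (inv-double (+ suc k))
    where
    opaque
      unfolding _*_
      ring : ∀ k → + 2 + (k + k) ≡ + 1 + k + (+ 1 + k)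
      ring = solve-∀

  reciprocalSum : ℕ → ℤ
  reciprocalSum k = ∑ k (λ l → γ (suc l) * inv (+ suc l))

  module SummationStep (I : ℕ) (J<m : suc I < m) where
    r J : ℕ
    r = suc (I ℕ.+ I)
    J = suc I

    s w₁ w₂′ ι ω g₁ g₂ : ℤ
    s   = sgn J
    w₁  = Ω (suc r) J
    w₂′ = Ω (suc (suc r)) J
    ι   = inv (+ J)
    ω   = inv (odd J)
    g₁  = γ (suc r)
    g₂  = γ (suc (suc r))

    J+J : J ℕ.+ J ≡ suc r
    J+J = cong suc (ℕₚ.+-suc I I)

    inv-r : inv (+ suc r) ≡ half₂ * ι
    inv-r = trans (cong (inv ∘ +_) (sym J+J)) (inv-double (+ J))

    inv-suc-r : inv (+ suc (suc r)) ≡ ω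
    inv-suc-r = cong (inv ∘ +_ ∘ suc) (sym J+J)

    suc-r<n : suc r < n
    suc-r<n = subst (_< n) J+J (ℕₚ.+-mono-< J<m J<m)

    J≤suc-r : J ≤ suc r
    J≤suc-r = subst (J ≤_) J+J (ℕₚ.m≤m+n J J)

    ϑ-suc : ϑ J ≡ ∑ J (θ (suc (suc r))) + s * w₂′ * ω
    ϑ-suc = cong (λ a → ∑ (suc J) (θ (suc a))) J+J

    reciprocalSum-suc : reciprocalSum (suc (J ℕ.+ J)) ≡ reciprocalSum r + g₁ * (half₂ * ι) + g₂ * ω
    reciprocalSum-suc = trans (cong (reciprocalSum ∘ suc) J+J) (cong₂ (λ a b → reciprocalSum r + g₁ * a + g₂ * b) inv-r inv-suc-r)

    first : ∑ J (θ (suc r)) - ϑ I ≈ - (half₂ * (half₂ * ι)) * (g₁ - s * w₁) [ P ]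
    first = subst (λ a → ∑ J (θ (suc r)) - ϑ I ≈ - a * (g₁ - s * w₁) [ P ]) (trans (inv-even r) (cong (half₂ *_) inv-r))
      (θ-sum-step r J (ℕₚ.<-trans (ℕₚ.n<1+n r) suc-r<n) J≤suc-r)

    second : ∑ J (θ (suc (suc r))) - ∑ J (θ (suc r)) ≈ - (half₂ * ω) * (g₂ - s * w₂′) [ P ]
    second = subst (λ a → ∑ J (θ (suc (suc r))) - ∑ J (θ (suc r)) ≈ - a * (g₂ - s * w₂′) [ P ]) (trans (inv-even (suc r)) (cong (half₂ *_) inv-suc-r))
      (θ-sum-step (suc r) J suc-r<n (ℕₚ.m≤n⇒m≤1+n J≤suc-r))

    w₂′≈ : w₂′ ≈ half₂ * w₁ [ P ]
    w₂′≈ = ≈-trans (≈-reflexive (trans (Ω-same (suc r) J J≤suc-r) (cong₂ (λ a b → odd a * b * w₁) (trans (cong (_∸ J) (sym J+J)) (ℕₚ.m+n∸n≡m J J))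
        (trans (inv-even (suc r)) (cong (half₂ *_) inv-suc-r)))))
      (lincomb₁ (half₂ * w₁) (invˡ′ (unit-odd′ (ℕₚ.<-trans J<m m<n))) (ring (odd J) half₂ ω w₁))
      where
      opaque
        unfolding _*_
        ring : ∀ o h ω w → o * (h * ω) * w - h * w ≡ h * w * (ω * o - + 1)
        ring = solve-∀

    increment : + 4 * (ϑ J - ϑ I) + + 2 * (g₁ * (half₂ * ι) + g₂ * ω) ≈ s * w₁ * (ι + + 3 * ω) [ P ]
    increment = ≈-trans (≈-reflexive (cong (λ a → + 4 * (a - ϑ I) + + 2 * (g₁ * (half₂ * ι) + g₂ * ω)) ϑ-suc)) (lincomb₄ (+ 4) (+ 4) (+ 4 * s * ω * (half₂ + + 1))
      (s * w₁ * (ι * (half₂ * + 2 + + 1) + ω * (half₂ * + 2 + + 3)) - + 2 * half₂ * ι * g₁ - + 2 * ω * g₂) first second w₂′≈ (P³⇒P half-2)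
      (ring half₂ s w₁ w₂′ ι ω g₁ g₂ (∑ J (θ (suc (suc r)))) (∑ J (θ (suc r))) (ϑ I)))
      where
      opaque
        unfolding _*_
        ring : ∀ h s w w′ ι ω g g′ A″ A′ A → + 4 * (A″ + s * w′ * ω - A) + + 2 * (g * (h * ι) + g′ * ω) - s * w * (ι + + 3 * ω) ≡
          + 4 * (A′ - A - - (h * (h * ι)) * (g - s * w)) + + 4 * (A″ - A′ - - (h * ω) * (g′ - s * w′)) + + 4 * s * ω * (h + + 1) * (w′ - h * w)
          + (s * w * (ι * (h * + 2 + + 1) + ω * (h * + 2 + + 3)) - + 2 * h * ι * g - + 2 * ω * g′) * (h * + 2 - + 1)
        ring = solve-∀

    summand-value : summand I ≈ s * w₁ * (ι + + 3 * ω) [ P ]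
    summand-value = ≈-trans (≈-reflexive (cong (λ a → (+ 5 * + J + + 1) * (s * Ω a J) * ι * ω) J+J))
      (lincomb₂ (s * w₁ * ω * + 3) (s * w₁ * ι) (invˡ′ (unit-suc (ℕₚ.<-trans (ℕₚ.n<1+n I) (ℕₚ.<-trans (ℕₚ.<-trans J<m m<n) n<q)))) (invˡ′ (unit-odd′ (ℕₚ.<-trans J<m m<n))) (ring (+ J) s w₁ ι ω))
      where
      opaque
        unfolding _*_
        ring : ∀ J s w ι ω → (+ 5 * J + + 1) * (s * w) * ι * ω - s * w * (ι + + 3 * ω) ≡ s * w * ω * + 3 * (ι * J - + 1) + s * w * ι * (ω * (+ 1 + (J + J)) - + 1)
        ring = solve-∀

  -- Both sides have equal increments, by `increment` and `summand-value`. At I = 0 the left side is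
  -- empty and the right side is 4/2 + 2/2 - 3.
  summation : ∀ I → I < m → ∑ I summand ≈ + 4 * ϑ I + + 2 * reciprocalSum (suc (I ℕ.+ I)) - + 3 [ P ]
  summation zero    _   = lincomb₃ (- (+ 6 * inv (+ 1))) (- (+ 3 * (inv (+ 1) + + 1))) (- (+ 3 * (inv (+ 1) * inv (+ 1))))
      (≈-reflexive (γ-suc 0)) (P³⇒P inv-one) (P³⇒P half-2)
      (trans (cong (λ a → + 0 - (+ 4 * (+ 0 + + 1 * a * inv (+ 1)) + + 2 * (+ 0 + γ 1 * inv (+ 1)) - + 3)) (Ω-zero 1)) (ring (γ 1) (inv (+ 1)) half₂))
    where
    opaque
      unfolding _*_
      ring : ∀ g i h → + 0 - (+ 4 * (+ 0 + + 1 * g * i) + + 2 * (+ 0 + g * i) - + 3) ≡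
        - (+ 6 * i) * (g - + 1 * h * (+ 1 * i)) + - (+ 3 * (i + + 1)) * (i - + 1) + - (+ 3 * (i * i)) * (h * + 2 - + 1)
      ring = solve-∀
  summation (suc I) J<m = ≈-trans (+-cong (summation I (ℕₚ.<-trans (ℕₚ.n<1+n I) J<m)) summand-value) (lincomb₂ (- + 1) (- + 2) increment (≈-reflexive reciprocalSum-suc)
      (ring (ϑ I) (ϑ J) (reciprocalSum r) (reciprocalSum (suc (J ℕ.+ J))) (s * w₁ * (ι + + 3 * ω)) (g₁ * (half₂ * ι)) (g₂ * ω)))
    where
    open SummationStep I J<m
    opaque
      unfolding _*_
      ring : ∀ A A′ T T′ X a b → + 4 * A + + 2 * T - + 3 + X - (+ 4 * A′ + + 2 * T′ - + 3) ≡
        - + 1 * (+ 4 * (A′ - A) + + 2 * (a + b) - X) + - + 2 * (T′ - (T + a + b))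
      ring = solve-∀

  γ-mod : ∀ k → k ≤ n → γ k ≈ sgn k * bin n k [ P ]
  γ-mod zero    _   = ≈-trans (≈-reflexive (*-identityˡ (inv (+ 1)))) (≈-trans (P³⇒P inv-one) (≈-reflexive (sym (*-identityˡ (+ 1)))))
  γ-mod (suc k) k<n = cancelᴾ (even k) (unit-even′ k<n) (≈-trans (≈-reflexive (cong (even k *_) (γ-suc k))) (lincomb₄ (odd k * γ k) (odd k) (+ 2 * sgn k) (sgn k * bin n k)
      (invˡ′ (unit-even′ k<n)) (γ-mod k (ℕₚ.<⇒≤ k<n)) (≈-reflexive (bin-lower n k)) P≈0 (ring (+ k) N (inv (even k)) (γ k) (sgn k) (bin n k) (bin n (suc k)))))
    where
    opaque
      unfolding _*_
      ring : ∀ k n f g s b b′ → let e = + 2 + (k + k) ; o = + 1 + (k + k) in e * (o * f * g) - e * (- s * b′) ≡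
        o * g * (f * e - + 1) + o * (g - s * b) + + 2 * s * ((+ 1 + k) * b′ - (n - k) * b) + s * b * (+ 1 + (n + n) - + 0)
      ring = solve-∀

  n₋ : ℕ
  n₋ = suc (ℕ.pred m ℕ.+ ℕ.pred m)

  suc-pred-m : suc (ℕ.pred m) ≡ m
  suc-pred-m = ℕₚ.suc-pred m {{ℕ.>-nonZero 0<m}}

  suc-n₋ : suc n₋ ≡ n
  suc-n₋ = trans (cong suc (sym (ℕₚ.+-suc (ℕ.pred m) (ℕ.pred m)))) (cong₂ ℕ._+_ suc-pred-m suc-pred-m)

  -- Compare ratios of consecutive entries: (2i + 1)/(p - 2(i + 2)) on the left, (n - i)/(i + 2) on
  -- the right. They agree modulo p because 2n ≡ -1.
  Ω-mod : ∀ i → i ≤ n₋ → Ω n₋ i ≈ bin (suc n) (suc i) [ P ]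
  Ω-mod zero    _    = ≈-trans (≈-reflexive (Ω-zero n₋)) (≈-trans (γ-mod n₋ (subst (n₋ ≤_) suc-n₋ (ℕₚ.n≤1+n n₋))) (lincomb₁ (- + 1) P≈0
      (trans (cong₂ (λ a b → a - b) sgn-bin (bin-1 (suc n))) (ring N))))
    where
    opaque
      unfolding _*_
      ring : ∀ n → - n - (+ 1 + n) ≡ - + 1 * (+ 1 + (n + n) - + 0)
      ring = solve-∀
    sgn-bin : sgn n₋ * bin n n₋ ≡ - N
    sgn-bin = trans (cong₂ _*_ (trans (neg-neg (sgn n₋)) (cong (λ a → - a) (trans (cong sgn suc-n₋) sgn-n))) (subst (λ a → bin a n₋ ≡ + a) suc-n₋ (bin-subdiag n₋)))
      (ring₁ N)
      where
      opaque
        unfolding _*_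
        neg-neg : ∀ x → x ≡ - - x
        neg-neg = solve-∀
        ring₁ : ∀ x → - + 1 * x ≡ - x
        ring₁ = solve-∀
  Ω-mod (suc i) i<n₋ = cancelᴾ (odd j) (unit-odd′ j<n) (≈-trans (≈-reflexive swap) (lincomb₃ (odd i) (+ 2) (b₁ - b₂)
      (Ω-mod i (ℕₚ.<⇒≤ i<n₋)) (≈-reflexive (bin-lower (suc n) (suc i))) P≈0
      (trans (cong (λ a → odd i * Ω n₋ i - a * b₂) odd-j) (ring (+ i) N (Ω n₋ i) b₁ b₂))))
    where
    j : ℕ
    j = n₋ ∸ suc i
    b₁ b₂ : ℤ
    b₁ = bin (suc n) (suc i)
    b₂ = bin (suc n) (suc (suc i))
    j<n : j < n
    j<n = ℕₚ.≤-<-trans (ℕₚ.m∸n≤m n₋ (suc i)) (subst (n₋ <_) suc-n₋ (ℕₚ.n<1+n n₋))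
    swap : odd j * Ω n₋ (suc i) ≡ odd i * Ω n₋ i
    swap = trans (ring₁ (∏ i odd) (odd i) (∏ j odd) (odd j) (inv (∏ n₋ even))) (cong (λ a → odd i * (∏ i odd * ∏ a odd * inv (∏ n₋ even))) (sym (suc-∸ {n₋} {suc i} i<n₋)))
      where
      opaque
        unfolding _*_
        ring₁ : ∀ a o b o′ e → o′ * (a * o * b * e) ≡ o * (a * (b * o′) * e)
        ring₁ = solve-∀
    odd-j : odd j ≡ P - + 2 * (+ 2 + + i)
    odd-j = linear₁ (+ 2) (cong +_ (trans (cong suc (ℕₚ.m+[n∸m]≡n i<n₋)) suc-n₋)) (ring₂ (+ i) (+ j) N)
      where
      opaque
        unfolding _*_
        ring₂ : ∀ i j n → + 1 + (j + j) - (+ 1 + (n + n) - + 2 * (+ 2 + i)) ≡ + 2 * (+ 1 + (+ 1 + i + j) - n)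
        ring₂ = solve-∀
    opaque
      unfolding _*_
      ring : ∀ i n w b b′ → let P = + 1 + (n + n) in (+ 1 + (i + i)) * w - (P - + 2 * (+ 2 + i)) * b′ ≡
        (+ 1 + (i + i)) * (w - b) + + 2 * ((+ 1 + (+ 1 + i)) * b′ - (+ 1 + n - (+ 1 + i)) * b) + (b - b′) * (P - + 0)
      ring = solve-∀

  γSum : ℤ
  γSum = ∑ m (λ i → γ i * inv (odd i))

  -- By γ-mod the summand is (γᵢ − γᵢ₊₁)/(2i + 1), and γᵢ₊₁/(2i + 1) = γᵢ − γᵢ₊₁.
  ϑ-last : ϑ (ℕ.pred m) ≈ γSum - + 1 + γ m [ P ]
  ϑ-last = begin
    ∑ (suc (ℕ.pred m)) (θ n₋)                          ≡⟨ cong (λ k → ∑ k (θ n₋)) suc-pred-m ⟩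
    ∑ m (θ n₋)                                         ≈⟨ ∑-≈ m pointwise ⟩
    ∑ m (λ i → γ i * inv (odd i) + (γ (suc i) - γ i))  ≡⟨ ∑-+ m (λ i → γ i * inv (odd i)) (λ i → γ (suc i) - γ i) ⟩
    γSum + ∑ m (λ i → γ (suc i) - γ i)                 ≡⟨ cong (λ a → γSum + a) (∑-telescope m γ) ⟩
    γSum + (γ m - γ 0)                                 ≈⟨ lincomb₁ (- + 1) (γ-mod 0 z≤n) (ring γSum (γ m) (γ 0)) ⟩
    γSum - + 1 + γ m                                   ∎
    where
    open ≈-Reasoning P
    opaque
      unfolding _*_
      ring : ∀ S a b → S + (a - b) - (S - + 1 + a) ≡ - + 1 * (b - + 1 * + 1)
      ring = solve-∀
    pointwise : ∀ i → i < m → θ n₋ i ≈ γ i * inv (odd i) + (γ (suc i) - γ i) [ P ]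
    pointwise i i<m = ≈-trans (lincomb₃ (sgn i * ω) (- ω) ω (Ω-mod i i≤n₋) (γ-mod i (ℕₚ.<⇒≤ i<n)) (γ-mod (suc i) i<n)
        (ring₁ (sgn i) (Ω n₋ i) ω (bin n i) (bin n (suc i)) (γ i) (γ (suc i))))
      (lincomb₃ (- (ω + + 1)) (- (ε * γ i)) (- γ i) (≈-reflexive (γ-suc i)) (invˡ′ (unit-odd′ i<n)) (invˡ′ (unit-even′ i<n))
        (ring₂ (+ i) ω ε (γ i) (γ (suc i))))
      where
      i<n : i < n
      i<n = ℕₚ.<-trans i<m m<n
      i≤n₋ : i ≤ n₋
      i≤n₋ = ℕₚ.≤-pred (subst (suc i ≤_) (sym suc-n₋) i<n)
      ω ε : ℤ
      ω = inv (odd i)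
      ε = inv (even i)
      opaque
        unfolding _*_
        ring₁ : ∀ s w ω b b′ g g′ → s * w * ω - (g * ω - g′ * ω) ≡ s * ω * (w - (b + b′)) + - ω * (g - s * b) + ω * (g′ - - s * b′)
        ring₁ = solve-∀
        ring₂ : ∀ i ω ε g g′ → let o = + 1 + (i + i) ; e = + 2 + (i + i) in
          g * ω - g′ * ω - (g * ω + (g′ - g)) ≡ - (ω + + 1) * (g′ - o * ε * g) + - (ε * g) * (ω * o - + 1) + - g * (ε * e - + 1)
        ring₂ = solve-∀

  -- It is `harmonicSum n` without its last term 1/n, and 1/n ≡ -2.
  reciprocalSum-last : reciprocalSum n₋ ≈ - H n + + 2 [ P ]
  reciprocalSum-last = ≈-trans (∑-≈ n₋ λ l l<n₋ → *-congʳ (inv (+ suc l)) (γ-mod (suc l) (ℕₚ.<⇒≤ (subst (suc l <_) suc-n₋ (s≤s l<n₋)))))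
    (lincomb₄ (+ 1) (- + 1) (- inv N) (+ 2) (harmonicSum-value n (ℕₚ.<⇒≤ n<q)) (≈-reflexive split) P≈0 (invˡ′ unit-n)
      (ring₁ (∑ n₋ h̃) (harmonicSum n) (inv N) (H n) N))
    where
    h̃ : ℕ → ℤ
    h̃ l = sgn (suc l) * bin n (suc l) * inv (+ suc l)
    split : harmonicSum n ≡ ∑ n₋ h̃ + inv N
    split = trans (cong (λ k → ∑ k h̃) (sym suc-n₋)) (cong (λ a → ∑ n₋ h̃ + a) (trans (cong (λ k → sgn k * bin n k * inv (+ k)) suc-n₋)
      (trans (cong₂ (λ a b → a * b * inv N) sgn-n (bin-diag n)) (ring (inv N)))))
      where
      opaque
        unfolding _*_
        ring : ∀ x → + 1 * + 1 * x ≡ x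
        ring = solve-∀
    unit-n : Unit N
    unit-n = unit-small (ℕₚ.<-trans 0<m m<n) (ℕₚ.<-trans n<q (ℕₚ.n<1+n q))
    opaque
      unfolding _*_
      ring₁ : ∀ S h ι H n → S - (- H + + 2) ≡ + 1 * (h - - H) + - + 1 * (h - (S + ι)) + - ι * (+ 1 + (n + n) - + 0) + + 2 * (ι * n - + 1)
      ring₁ = solve-∀

  z≈γ : ∀ i → i ≤ m → z i ≈ γ i [ P ]
  z≈γ i i≤m = ≈-trans (z-mod i i≤m) (≈-sym (γ-mod i (ℕₚ.≤-trans i≤m (ℕₚ.<⇒≤ m<n))))

  G₀ : ℤ
  G₀ = ∑ (ℕ.pred m) summand

  -- `summation` is taken at I = m - 1 because its row 2I + 1 = n - 1 is the one that `Ω-mod` makes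
  -- binomial.
  G₀-value : G₀ ≈ + 4 * F₀ + + 4 * z m - + 2 * H n - + 3 [ P ]
  G₀-value = lincomb₄ (+ 1) (+ 4) (+ 2) (+ 1) (summation (ℕ.pred m) (subst (ℕ.pred m <_) suc-pred-m (ℕₚ.n<1+n (ℕ.pred m)))) ϑ-last reciprocalSum-last
    (+-cong (*-congˡ (+ 4) γSum≈) (*-congˡ (+ 4) (≈-sym (z≈γ m ℕₚ.≤-refl))))
    (ring G₀ (ϑ (ℕ.pred m)) (reciprocalSum n₋) γSum (γ m) (H n) F₀ (z m))
    where
    γSum≈ : γSum ≈ F₀ [ P ]
    γSum≈ = ∑-≈ m λ i i<m → *-congʳ (inv (odd i)) (≈-sym (z≈γ i (ℕₚ.<⇒≤ i<m)))
    opaque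
      unfolding _*_
      ring : ∀ G t r S g H F z → G - (+ 4 * F + + 4 * z - + 2 * H - + 3) ≡
        + 1 * (G - (+ 4 * t + + 2 * r - + 3)) + + 4 * (t - (S - + 1 + g)) + + 2 * (r - (- H + + 2)) + + 1 * (+ 4 * S + + 4 * g - (+ 4 * F + + 4 * z))
      ring = solve-∀

-- The product of consecutive values of T

module ProductXi (m : ℕ) (p-prime : Prime (suc ((m ℕ.+ m) ℕ.+ (m ℕ.+ m)))) (2<p : 2 < suc ((m ℕ.+ m) ℕ.+ (m ℕ.+ m))) where
  open CentralSums m p-prime 2<p public

  -- c₁₆ ^ m = κ².
  c₁₆ : ℤ
  c₁₆ = - + 4 * - + 4

  u-suc : ∀ J → J < m → + 8 * (+ 1 + + J) * u (suc J) ≈ odd J * u J [ P ]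
  u-suc J J<m = ≈-trans (≈-reflexive (cong (+ 8 * (+ 1 + + J) *_) exact)) (lincomb₃ (+ 8 * half₂ * half₂ * half₂ * (ι * (+ 1 + + J)) * odd J * u J) (+ 8 * half₂ * half₂ * half₂ * odd J * u J)
      ((+ 4 * half₂ * half₂ + + 2 * half₂ + + 1) * odd J * u J) (invˡ′ (unit-odd′ J<n)) (invˡ′ (unit-suc (ℕₚ.<-trans J<n n<q))) (P³⇒P half-2)
      (ring (+ J) (odd J) half₂ ι (inv (odd J)) (u J)))
    where
    J<n : J < n
    J<n = ℕₚ.<-trans J<m m<n
    ι : ℤ
    ι = inv (+ suc J)
    exact : u (suc J) ≡ odd J * (half₂ * (half₂ * ι)) * (odd J * (half₂ * inv (odd J)) * u J)
    exact = trans (cong (λ a → Ω (suc a) (suc J)) (ℕₚ.+-suc J J)) (trans (Ω-suc (suc (J ℕ.+ J)) J)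
      (cong₂ (λ a b → odd J * a * b) (trans (inv-even (suc (J ℕ.+ J))) (cong (half₂ *_) (inv-even J)))
        (trans (Ω-same (J ℕ.+ J) J (ℕₚ.m≤m+n J J)) (cong₂ (λ a b → odd a * b * u J) (ℕₚ.m+n∸n≡m J J) (inv-even (J ℕ.+ J))))))
    opaque
      unfolding _*_
      ring : ∀ J o h ι ω u → + 8 * (+ 1 + J) * (o * (h * (h * ι)) * (o * (h * ω) * u)) - o * u ≡
        + 8 * h * h * h * (ι * (+ 1 + J)) * o * u * (ω * o - + 1) + + 8 * h * h * h * o * u * (ι * (+ 1 + J) - + 1)
        + (+ 4 * h * h + + 2 * h + + 1) * o * u * (h * + 2 - + 1)
      ring = solve-∀

  central≈ : ∀ J → J ≤ m → central J ≈ c₁₆ ^ J * u J [ P ]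
  central≈ zero    _   = ≈-trans (≈-sym (P³⇒P inv-one)) (≈-reflexive (ring (inv (+ 1))))
    where
    opaque
      unfolding _*_
      ring : ∀ x → x ≡ + 1 * (+ 1 * + 1 * x)
      ring = solve-∀
  central≈ (suc J) J<m = cancelᴾ (+ 1 + + J) (unit-suc (ℕₚ.<-trans (ℕₚ.<-trans J<m m<n) n<q)) (lincomb₃ (+ 1) (+ 2 * odd J) (- + 2 * c₁₆ ^ J)
      (≈-reflexive (central-rec J)) (central≈ J (ℕₚ.<⇒≤ J<m)) (u-suc J J<m) (ring (+ J) (central (suc J)) (central J) (c₁₆ ^ J) (u (suc J)) (u J)))
    where
    opaque
      unfolding _*_
      ring : ∀ J c c′ t u u′ → let o = + 1 + (J + J) in (+ 1 + J) * c - (+ 1 + J) * (- + 4 * - + 4 * t * u) ≡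
        + 1 * ((+ 1 + J) * c - + 2 * o * c′) + + 2 * o * (c′ - t * u′) + - + 2 * t * (+ 8 * (+ 1 + J) * u - o * u′)
      ring = solve-∀

  -- The analogue of `flux` for ξ. Because of the -4 in the recurrence it is geometric, up to a
  -- source of order D².
  ρ : ℕ → ℤ
  ρ k = (+ 1 + (+ k + D)) * (ξ (suc k) * ξ k)

  ρ-step : ∀ k → suc (suc k) ≤ q →
    (+ 1 + + k) * (+ 2 + + k) * (ρ (suc k) + + 4 * ρ k) ≈ sgn k * (D * D * ((+ 5 * + k + + 7) * ξ (suc k))) [ P³ ]
  ρ-step k k<q = lincomb₁ (ξ (suc k)) (ξ-step k k<q) (ring (+ k) D (ξ (suc (suc k))) (ξ (suc k)) (ξ k) (sgn k))
    where
    opaque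
      unfolding _*_
      ring : ∀ k D x₂ x₁ x₀ s → (+ 1 + k) * (+ 2 + k) * ((+ 1 + (+ 1 + k + D)) * (x₂ * x₁) + + 4 * ((+ 1 + (k + D)) * (x₁ * x₀))) - s * (D * D * ((+ 5 * k + + 7) * x₁)) ≡
        x₁ * ((+ 1 + k) * (+ 2 + k) * ((+ 2 + (k + D)) * x₂ + + 4 * (+ 1 + (k + D)) * x₀) - s * (D * D) * (+ 5 * k + + 7))
      ring = solve-∀

  -- For even k the source contains ξ at an odd index, which is divisible by p and stands next to
  -- D².
  ρ-odd : ∀ j → j < m → ρ (suc (j ℕ.+ j)) ≈ - + 4 * ρ (j ℕ.+ j) [ P³ ]
  ρ-odd j j<m = cancel ((+ 1 + + k′) * (+ 2 + + k′)) (unit-* (unit-suc (ℕₚ.<-trans (ℕₚ.n<1+n k′) k<q)) (unit-suc k<q))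
      (lincomb₂ (+ 1) (sgn k′ * (+ 5 * + k′ + + 7)) (ρ-step k′ k<q) (cube≈0 d≈0 d≈0 (ξ-odd j (ℕₚ.<-trans j<m m<n)))
        (ring (+ k′) (ρ (suc k′)) (ρ k′) (sgn k′) D (ξ (suc k′))))
    where
    k′ : ℕ
    k′ = j ℕ.+ j
    k<q : suc k′ < q
    k<q = ℕₚ.≤-trans (subst (_≤ n) (cong suc (ℕₚ.+-suc j j)) (ℕₚ.+-mono-≤ j<m j<m)) (ℕₚ.<⇒≤ n<q)
    opaque
      unfolding _*_
      ring : ∀ k r r′ s D x → (+ 1 + k) * (+ 2 + k) * r - (+ 1 + k) * (+ 2 + k) * (- + 4 * r′) ≡
        + 1 * ((+ 1 + k) * (+ 2 + k) * (r + + 4 * r′) - s * (D * D * ((+ 5 * k + + 7) * x))) + s * (+ 5 * k + + 7) * (D * D * x - + 0)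
      ring = solve-∀

  ρ-even : ∀ j → suc j < m → ρ (suc j ℕ.+ suc j) ≈ - + 4 * ρ (suc (j ℕ.+ j)) - D * D * (c₁₆ ^ suc j * summand j) [ P³ ]
  ρ-even j J<m = subst (λ a → ρ a ≈ - + 4 * ρ k′ - D * D * (T′ * summand j) [ P³ ]) (sym index)
    (cancel ((+ 1 + + k′) * (+ 2 + + k′)) (unit-* (unit-suc (ℕₚ.<-trans (ℕₚ.n<1+n k′) k<q)) (unit-suc k<q))
      (lincomb₄ (+ 1) (- (+ 5 * + k′ + + 7)) (D * D * (c₅ * (x * T′)) * (+ 2 * inv (odd J) * odd J)) (D * D * (c₅ * (x * T′)) * + 2)
        ρ-step′ (cube≈0 d≈0 d≈0 (difference≈0 ξ≈)) (invˡ (unit-suc (ℕₚ.<-trans (ℕₚ.n<1+n j) (ℕₚ.<-trans (ℕₚ.<-trans J<m m<n) n<q)))) (invˡ (unit-odd′ (ℕₚ.<-trans J<m m<n)))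
        (ring (+ j) (ρ (suc k′)) (ρ k′) D (ξ (suc k′)) T′ x (inv (+ J)) (inv (odd J)))))
    where
    k′ J : ℕ
    k′ = suc (j ℕ.+ j)
    J  = suc j
    T′ x c₅ : ℤ
    T′ = c₁₆ ^ J
    x  = sgn J * u J
    c₅ = + 5 * + J + + 1
    index : suc j ℕ.+ suc j ≡ suc k′
    index = cong suc (ℕₚ.+-suc j j)
    k<q : suc k′ < q
    k<q = ℕₚ.<-trans (subst (_< n) index (ℕₚ.+-mono-< J<m J<m)) n<q
    ρ-step′ : (+ 1 + + k′) * (+ 2 + + k′) * (ρ (suc k′) + + 4 * ρ k′) ≈ - (D * D * ((+ 5 * + k′ + + 7) * ξ (suc k′))) [ P³ ]
    ρ-step′ = ≈-trans (ρ-step k′ k<q) (≈-reflexive (trans (cong (λ a → - a * (D * D * ((+ 5 * + k′ + + 7) * ξ (suc k′)))) (sgn-double j)) (ring₁ (D * D * ((+ 5 * + k′ + + 7) * ξ (suc k′))))))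
      where
      opaque
        unfolding _*_
        ring₁ : ∀ a → - + 1 * a ≡ - a
        ring₁ = solve-∀
    ξ≈ : ξ (suc k′) ≈ T′ * x [ P ]
    ξ≈ = ≈-trans (≈-reflexive (cong ξ (sym index))) (≈-trans (ξ-even J (ℕₚ.<⇒≤ J<m)) (≈-trans (y-mod J (ℕₚ.<⇒≤ J<m)) (≈-trans (*-congˡ (sgn J) (central≈ J (ℕₚ.<⇒≤ J<m)))
      (≈-reflexive (ring₂ (sgn J) T′ (u J))))))
      where
      opaque
        unfolding _*_
        ring₂ : ∀ s t u → s * (t * u) ≡ t * (s * u)
        ring₂ = solve-∀
    opaque
      unfolding _*_
      ring : ∀ j r r′ D X t x ι ω → let k = + 1 + (j + j) ; J = + 1 + j ; o = + 1 + (J + J) ; c = + 5 * J + + 1 in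
        (+ 1 + k) * (+ 2 + k) * r - (+ 1 + k) * (+ 2 + k) * (- + 4 * r′ - D * D * (t * (c * x * ι * ω))) ≡
        + 1 * ((+ 1 + k) * (+ 2 + k) * (r + + 4 * r′) - - (D * D * ((+ 5 * k + + 7) * X))) + - (+ 5 * k + + 7) * (D * D * (X - t * x) - + 0)
        + D * D * (c * (x * t)) * (+ 2 * ω * o) * (ι * J - + 1) + D * D * (c * (x * t)) * + 2 * (ω * o - + 1)
      ring = solve-∀

  ρ-value : ∀ j → j < m → ρ (j ℕ.+ j) ≈ c₁₆ ^ j * (ρ 0 - D * D * ∑ j summand) [ P³ ]
  ρ-value zero    _   = ≈-reflexive (ring (ρ 0) D)
    where
    opaque
      unfolding _*_
      ring : ∀ r D → r ≡ + 1 * (r - D * D * + 0)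
      ring = solve-∀
  ρ-value (suc j) J<m = lincomb₃ (+ 1) (- + 4) c₁₆ (ρ-even j J<m) (ρ-odd j j<m) (ρ-value j j<m)
    (ring (ρ (suc j ℕ.+ suc j)) (ρ (suc (j ℕ.+ j))) (ρ (j ℕ.+ j)) (c₁₆ ^ j) (ρ 0) D (∑ j summand) (summand j))
    where
    j<m : j < m
    j<m = ℕₚ.<-trans (ℕₚ.n<1+n j) J<m
    opaque
      unfolding _*_
      ring : ∀ r″ r′ r t r₀ D S x → let c = - + 4 * - + 4 in r″ - c * t * (r₀ - D * D * (S + x)) ≡
        + 1 * (r″ - (- + 4 * r′ - D * D * (c * t * x))) + - + 4 * (r′ - - + 4 * r) + c * (r - t * (r₀ - D * D * S))
      ring = solve-∀

  ρ-0 : ρ 0 ≡ - (+ 2 * D + + 3 * (D * D) + D * D * D)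
  ρ-0 = trans (cong (λ a → (+ 1 + (+ 0 + D)) * ((+ 0 + + 1 * (+ 1 * + 1) + - + 1 * (a * a)) * (+ 0 + + 1 * (+ 1 * + 1)))) (bin-1 (suc d))) (ring D)
    where
    opaque
      unfolding _*_
      ring : ∀ D → (+ 1 + (+ 0 + D)) * ((+ 0 + + 1 * (+ 1 * + 1) + - + 1 * ((+ 1 + D) * (+ 1 + D))) * (+ 0 + + 1 * (+ 1 * + 1))) ≡ - (+ 2 * D + + 3 * (D * D) + D * D * D)
      ring = solve-∀

  c₁₆^m : c₁₆ * c₁₆ ^ ℕ.pred m ≡ w₂
  c₁₆^m = trans (cong (c₁₆ ^_) suc-pred-m) (trans (sq-pow (- + 4) m) (trans (^-+ (- + 4) m m) κ²))

  -- Since n - 1 = 2(m - 1) + 1, the last step is one of `ρ-odd`. The powers of 16 then complete to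
  -- 16^m = `w₂`, and the factor N + D is -1/2.
  ξ-product : + 2 * (ξ n * ξ n₋) ≈ w₂ * P - D * D * (+ 3 + G₀) [ P³ ]
  ξ-product = ≈-trans (lincomb₄ (+ 2 * (ξ n * ξ n₋)) (- + 4) (+ 16) (ρ 0 - D * D * G₀) 2d≈ last (ρ-value (ℕ.pred m) pred-m<m) (≈-reflexive c₁₆^m)
      (ring N D (ξ n * ξ n₋) (ρ (ℕ.pred m ℕ.+ ℕ.pred m)) (c₁₆ ^ ℕ.pred m) (ρ 0 - D * D * G₀) w₂))
    (≈-trans (≈-reflexive (cong (λ a → w₂ * (a - D * D * G₀)) ρ-0)) (lincomb₃ (- w₂) (- w₂) (- (+ 3 + G₀)) 2d≈ (s³≈0 d≈0) (cube≈0 d≈0 d≈0 (difference≈0 w₂≈1)) (ring′ w₂ D P G₀)))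
    where
    pred-m<m : ℕ.pred m < m
    pred-m<m = subst (ℕ.pred m <_) suc-pred-m (ℕₚ.n<1+n (ℕ.pred m))
    last : (N + D) * (ξ n * ξ n₋) ≈ - + 4 * ρ (ℕ.pred m ℕ.+ ℕ.pred m) [ P³ ]
    last = ≈-trans (≈-reflexive (trans (cong (λ k → (+ k + D) * (ξ k * ξ n₋)) (sym suc-n₋)) (cong (_* (ξ (suc n₋) * ξ n₋)) (ℤₚ.+-assoc (+ 1) (+ n₋) D))))
      (ρ-odd (ℕ.pred m) pred-m<m)
    opaque
      unfolding _*_
      ring : ∀ n D X r t z w → let P = + 1 + (n + n) ; c = - + 4 * - + 4 in + 2 * X - w * z ≡
        + 2 * X * (D + D - - P) + - + 4 * ((n + D) * X - - + 4 * r) + + 16 * (r - t * z) + z * (c * t - w)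
      ring = solve-∀
      ring′ : ∀ w D P G → w * (- (+ 2 * D + + 3 * (D * D) + D * D * D) - D * D * G) - (w * P - D * D * (+ 3 + G)) ≡
        - w * (D + D - - P) + - w * (D * D * D - + 0) + - (+ 3 + G) * (D * D * (w - + 1) - + 0)
      ring′ = solve-∀

  v-pred≈0 : v-pred ≈ + 0 [ P ]
  v-pred≈0 = ≈-trans (≈-reflexive (cong (legendreV q) (trans (cong (ℕ._+ d′) (sym suc-n₋)) (trans (sym (ℕₚ.+-suc n₋ d′)) (cong (n₋ ℕ.+_) suc-d′)))))
    (v-odd (ℕ.pred m) (ℕₚ.<-trans (subst (ℕ.pred m <_) suc-pred-m (ℕₚ.n<1+n (ℕ.pred m))) m<n))

  DD≈0 : D * D ≈ + 0 [ P² ]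
  DD≈0 = *-≈0 d≈0 d≈0

  -- Precision p² is enough here and in `ξ-n-mod²`: these values stand next to `v-pred` and `ξ n₋`,
  -- which are divisible by p.
  v-n-mod² : v n ≈ w₂ * α [ P² ]
  v-n-mod² = cancel² (+ 2) unit-2 (lincomb₂ (+ 1) (- (w₂ * α * c m)) (P³⇒P² (v-n v₀)) DD≈0 (ring (v n) w₂ α D (c m)))
    where
    opaque
      unfolding _*_
      ring : ∀ v w a D C → + 2 * v - + 2 * (w * a) ≡ + 1 * (+ 2 * v - w * (a * (+ 2 - D * D * C))) + - (w * a * C) * (D * D - + 0)
      ring = solve-∀

  ξ-n-mod² : ξ n ≈ α [ P² ]
  ξ-n-mod² = cancel² (+ 2) unit-2 (lincomb₂ (+ 1) (α * c m) (P³⇒P² ξ-n) DD≈0 (ring (ξ n) α D (c m)))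
    where
    opaque
      unfolding _*_
      ring : ∀ v a D C → + 2 * v - + 2 * a ≡ + 1 * (+ 2 * v - a * (+ 2 + D * D * C)) + a * C * (D * D - + 0)
      ring = solve-∀

  ξ-pred≈0 : ξ n₋ ≈ + 0 [ P ]
  ξ-pred≈0 = ξ-odd (ℕ.pred m) (ℕₚ.<-trans (subst (ℕ.pred m <_) suc-pred-m (ℕₚ.n<1+n (ℕ.pred m))) m<n)

  private
    X Y : ℤ
    X = α * v-pred
    Y = α * ξ n₋

    X-value : w₂ * X ≈ P * (w₂ * w₂) + P * P * F₀ [ P³ ]
    X-value = lincomb₂ (- + 1) (+ 1) (*-≈0 v-pred≈0 (difference≈0 v-n-mod²)) v-product (ring w₂ α v-pred (v n) (P * (w₂ * w₂) + P * P * F₀))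
      where
      opaque
        unfolding _*_
        ring : ∀ w a u v t → w * (a * u) - t ≡ - + 1 * (u * (v - w * a) - + 0) + + 1 * (v * u - t)
        ring = solve-∀

    Y-value : + 2 * Y ≈ w₂ * P - D * D * (+ 3 + G₀) [ P³ ]
    Y-value = lincomb₂ (- + 2) (+ 1) (*-≈0 ξ-pred≈0 (difference≈0 ξ-n-mod²)) ξ-product (ring α (ξ n₋) (ξ n) (w₂ * P - D * D * (+ 3 + G₀)))
      where
      opaque
        unfolding _*_
        ring : ∀ a u v t → + 2 * (a * u) - t ≡ - + 2 * (u * (v - a) - + 0) + + 1 * (+ 2 * (v * u) - t)
        ring = solve-∀

    w₂w₂≈1 : w₂ * w₂ ≈ + 1 [ P ]
    w₂w₂≈1 = ≈-trans (*-cong w₂≈1 w₂≈1) (≈-reflexive (*-identityˡ (+ 1)))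

    square-part : + 4 * (w₂ * w₂) * (D * D * (+ 3 + G₀)) ≈ P * (P * (+ 4 * F₀ + + 4 * z m - + 2 * H n)) [ P³ ]
    square-part = lincomb₃ (w₂ * w₂ * (+ 3 + G₀) * (D + D - P)) (+ 1) (+ 1) 2d≈ (scale P (scale P (*-congʳ (+ 3 + G₀) w₂w₂≈1)))
      (scale P (scale P G₀-value)) (ring w₂ D G₀ P F₀ (z m) (H n))
      where
      opaque
        unfolding _*_
        ring : ∀ w D G P F z h → + 4 * (w * w) * (D * D * (+ 3 + G)) - P * (P * (+ 4 * F + + 4 * z - + 2 * h)) ≡
          w * w * (+ 3 + G) * (D + D - P) * (D + D - - P) + + 1 * (P * (P * (w * w * (+ 3 + G))) - P * (P * (+ 1 * (+ 3 + G))))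
          + + 1 * (P * (P * G) - P * (P * (+ 4 * F + + 4 * z - + 2 * h - + 3)))
        ring = solve-∀

    α-part : w₂ * w₂ * (P * (P * α)) ≈ P * (P * z m) [ P³ ]
    α-part = ≈-trans (≈-reflexive (ring w₂ P α)) (scale P (scale P (≈-trans (*-congʳ α w₂w₂≈1) (≈-trans (≈-reflexive (trans (*-identityˡ α) (sym y-m)))
      (≈-trans (*-congʳ (z m) κ≈1) (≈-reflexive (*-identityˡ (z m))))))))
      where
      opaque
        unfolding _*_
        ring : ∀ w P a → w * w * (P * (P * a)) ≡ P * (P * (w * w * a))
        ring = solve-∀

    Fermat-part : + 4 * (w₂ * w₂) * (P * (w₂ - + 1)) ≈ - (P * (P * (+ 2 * H n))) [ P³ ]
    Fermat-part = lincomb₂ (+ 4) (+ 2) (*-≈0 (P≈0) (*-≈0 (difference≈0 w₂w₂≈1) (difference≈0 w₂≈1))) (scale P w₂-mod²) (ring w₂ P (H n))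
      where
      opaque
        unfolding _*_
        ring : ∀ w P h → + 4 * (w * w) * (P * (w - + 1)) - - (P * (P * (+ 2 * h))) ≡
          + 4 * (P * ((w * w - + 1) * (w - + 1)) - + 0) + + 2 * (P * (+ 2 * w) - P * (+ 2 - P * h))
        ring = solve-∀

  -- Everything of order p² cancels. `F₀` comes from `v-product` and, through `G₀-value`, from
  -- `ξ-product` with the opposite sign; the term `z m` is met by p²α; and `H n` is met by the
  -- deviation of `w₂` from 1.
  U-part₁ : α * (v-pred + w₂ * (+ 2 * ξ n₋ + P * P)) ≈ + 2 * (w₂ * P) [ P³ ]
  U-part₁ = cancel (+ 4 * w₂) (unit-* unit-4 unit-w₂) (≈-trans (lincomb₂ (+ 4) (+ 4 * (w₂ * w₂)) X-value Y-value (ring w₂ α v-pred (ξ n₋) P D G₀ F₀))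
    (lincomb₃ (- + 1) (+ 4) (+ 1) square-part α-part Fermat-part (ring′ w₂ P α D G₀ F₀ (z m) (H n))))
    where
    opaque
      unfolding _*_
      ring : ∀ w a v x P D G F → + 4 * w * (a * (v + w * (+ 2 * x + P * P))) -
        (+ 4 * (P * (w * w) + P * P * F) + + 4 * (w * w) * (w * P - D * D * (+ 3 + G)) + + 4 * (w * w * (P * (P * a)))) ≡
        + 4 * (w * (a * v) - (P * (w * w) + P * P * F)) + + 4 * (w * w) * (+ 2 * (a * x) - (w * P - D * D * (+ 3 + G)))
      ring = solve-∀
      ring′ : ∀ w P a D G F z h → + 4 * (P * (w * w) + P * P * F) + + 4 * (w * w) * (w * P - D * D * (+ 3 + G)) + + 4 * (w * w * (P * (P * a))) - + 4 * w * (+ 2 * (w * P)) ≡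
        - + 1 * (+ 4 * (w * w) * (D * D * (+ 3 + G)) - P * (P * (+ 4 * F + + 4 * z - + 2 * h))) + + 4 * (w * w * (P * (P * a)) - P * (P * z))
        + + 1 * (+ 4 * (w * w) * (P * (w - + 1)) - - (P * (P * (+ 2 * h))))
      ring′ = solve-∀

-- Both sums in terms of V and T at X and X - 1

module IntegerCongruence (m : ℕ) (p-prime : Prime (suc ((m ℕ.+ m) ℕ.+ (m ℕ.+ m)))) (2<p : 2 < suc ((m ℕ.+ m) ℕ.+ (m ℕ.+ m))) where
  open ProductXi m p-prime 2<p public

  -- x₊ is −1/2 modulo p³, and x₋ = x₊ − 1.
  x₊ x₋ : ℕ
  x₊ = n ℕ.+ d
  x₋ = n ℕ.+ d′

  suc-x₋ : suc x₋ ≡ x₊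
  suc-x₋ = trans (sym (ℕₚ.+-suc n d′)) (cong (n ℕ.+_) suc-d′)

  half-x₊ : + 2 * + x₊ ≈ - + 1 [ P³ ]
  half-x₊ = lincomb₁ (+ 1) 2d≈ (ring N D)
    where
    opaque
      unfolding _*_
      ring : ∀ n D → + 2 * (n + D) - - + 1 ≡ + 1 * (D + D - - (+ 1 + (n + n)))
      ring = solve-∀

  -- The identity C(2k, k) = (-4)^k C(-1/2, k), proved by comparing ratios so that only 2X ≡ -1 is
  -- used.
  central-x₊ : ∀ k → k ≤ q → central k ≈ (- + 4) ^ k * bin x₊ k [ P³ ]
  central-x₊ zero    _   = ≈-reflexive (sym (*-identityˡ (+ 1)))
  central-x₊ (suc k) k<q = cancel (+ 1 + + k) (unit-suc k<q) (lincomb₄ (+ 1) (+ 2 * (+ 1 + (+ k + + k))) (+ 4 * (- + 4) ^ k) (+ 2 * (- + 4) ^ k * bin x₊ k)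
      (≈-reflexive (central-rec k)) (central-x₊ k (ℕₚ.<⇒≤ k<q)) (≈-reflexive (bin-lower x₊ k)) half-x₊
      (ring (+ k) (+ x₊) (central (suc k)) (central k) ((- + 4) ^ k) (bin x₊ (suc k)) (bin x₊ k)))
    where
    opaque
      unfolding _*_
      ring : ∀ k X c c′ f b b′ → (+ 1 + k) * c - (+ 1 + k) * (- + 4 * f * b) ≡
        + 1 * ((+ 1 + k) * c - + 2 * (+ 1 + (k + k)) * c′) + + 2 * (+ 1 + (k + k)) * (c′ - f * b′)
        + + 4 * f * ((+ 1 + k) * b - (X - k) * b′) + + 2 * f * b′ * (+ 2 * X - - + 1)
      ring = solve-∀

  -- C(x - 1, k) = (1 - k/x) C(x, k), and at x = -1/2 the factor is 2k + 1.
  bin-x₋ : ∀ k → (+ 1 + (+ k + + k)) * bin x₊ k ≈ bin x₋ k [ P³ ]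
  bin-x₋ k = lincomb₃ (- + 2) (bin x₊ k - bin x₋ k) (+ 2 * (bin x₋ k - bin x₊ k))
    (≈-reflexive (subst (λ a → (+ 1 + + x₋ - + k) * bin a k ≡ (+ 1 + + x₋) * bin x₋ k) suc-x₋ (bin-upper x₋ k))) half-x₊ (≈-reflexive (cong +_ (sym suc-x₋)))
    (ring (+ k) (+ x₊) (+ x₋) (bin x₊ k) (bin x₋ k))
    where
    opaque
      unfolding _*_
      ring : ∀ k X x b b′ → (+ 1 + (k + k)) * b - b′ ≡
        - + 2 * ((+ 1 + x - k) * b - (+ 1 + x) * b′) + (b - b′) * (+ 2 * X - - + 1) + + 2 * (b′ - b) * (X - (+ 1 + x))
      ring = solve-∀

  ratio₁ ratio₂ : ℤ
  ratio₁ = half₂ * half₂ * half₂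
  ratio₂ = - (half₂ * half₂ * (half₂ * half₂))

  weighted₁ weighted₂ : ℕ → ℤ
  weighted₁ k = (+ 1 + + k) * (central k * central k)
  weighted₂ k = (+ 1 + (+ k + + k)) * (central k * central k)

  σ₁ σ₂ : ℤ
  σ₁ = ∑ p (λ k → weighted₁ k * ratio₁ ^ k)
  σ₂ = ∑ (suc n) (λ k → weighted₂ k * ratio₂ ^ k)

  scaled-power : ∀ {a b c} k → a * b ≈ c [ P³ ] → a ^ k * b ^ k ≈ c ^ k [ P³ ]
  scaled-power {a} {b} k h′ = ≈-trans (≈-reflexive (sym (^-distrib-* a b k))) (^-cong k h′)

  -- Twice the weight k + 1 is 1 + (2k + 1), and `bin-x₋` lets 2k + 1 lower the argument from X to X
  -- - 1.
  σ₁-value : + 2 * (w₂ * σ₁) ≈ v n + v-pred [ P³ ]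
  σ₁-value = ≈-trans (≈-trans (≈-reflexive (regroup w₂ σ₁)) (*-congˡ w₂ (≈-trans (≈-reflexive (sym (∑-*ˡ p (+ 2) (λ k → weighted₁ k * ratio₁ ^ k))))
      (≈-trans (∑-≈ p λ k k<p → pointwise k (ℕₚ.≤-pred k<p)) (≈-reflexive (∑-+ p (λ k → sgn k * ĉ k * bin x₊ k) (λ k → sgn k * ĉ k * bin x₋ k)))))))
    (≈-trans (≈-reflexive (*-distribˡ-+ w₂ (∑ p (λ k → sgn k * ĉ k * bin x₊ k)) (∑ p (λ k → sgn k * ĉ k * bin x₋ k)))) (+-cong (≈-sym (legendreV-ĉ q x₊)) (≈-sym (legendreV-ĉ q x₋))))
    where
    opaque
      unfolding _*_
      regroup : ∀ w s → + 2 * (w * s) ≡ w * (+ 2 * s)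
      regroup = solve-∀
    powers : ∀ k → ratio₁ ^ k * (- + 4) ^ k ≈ sgn k * half₂ ^ k [ P³ ]
    powers k = ≈-trans (scaled-power k (lincomb₁ (- half₂ * (+ 2 * half₂ + + 1)) half-2 (ring half₂))) (≈-reflexive (neg^ half₂ k))
      where
      opaque
        unfolding _*_
        ring : ∀ h → h * h * h * - + 4 - - h ≡ - h * (+ 2 * h + + 1) * (h * + 2 - + 1)
        ring = solve-∀
    pointwise : ∀ k → k ≤ q → + 2 * (weighted₁ k * ratio₁ ^ k) ≈ sgn k * ĉ k * bin x₊ k + sgn k * ĉ k * bin x₋ k [ P³ ]
    pointwise k k≤q = lincomb₃ (+ 2 * (+ 1 + + k) * central k * ratio₁ ^ k) (+ 2 * (+ 1 + + k) * central k * bin x₊ k) (sgn k * (central k * half₂ ^ k))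
      (central-x₊ k k≤q) (powers k) (bin-x₋ k) (ring (+ k) (central k) (ratio₁ ^ k) ((- + 4) ^ k) (bin x₊ k) (bin x₋ k) (sgn k) (half₂ ^ k))
      where
      opaque
        unfolding _*_
        ring : ∀ k c r f b b′ s h → + 2 * ((+ 1 + k) * (c * c) * r) - (s * (c * h) * b + s * (c * h) * b′) ≡
          + 2 * (+ 1 + k) * c * r * (c - f * b) + + 2 * (+ 1 + k) * c * b * (r * f - s * h) + s * (c * h) * ((+ 1 + (k + k)) * b - b′)
        ring = solve-∀

  x₋-n₋ : x₋ ≡ n₋ ℕ.+ d
  x₋-n₋ = trans (cong (ℕ._+ d′) (sym suc-n₋)) (trans (sym (ℕₚ.+-suc n₋ d′)) (cong (n₋ ℕ.+_) suc-d′))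

  -- The coefficient is that of `bin-next` at N = n - 1, namely D/n ≡ p modulo p²; being divisible
  -- by p, its square is determined modulo p³.
  bin-x₋-n : bin x₋ n * bin x₋ n ≈ P * P [ P³ ]
  bin-x₋-n = lincomb₃ (+ 4) (D + D - P) (- (P - + 2)) squares 2d≈ (*-≈0 P≈0 (*-≈0 b≈0 b≈0)) (ring N D (bin x₋ n))
    where
    n₋<q : suc n₋ ≤ q
    n₋<q = subst (_≤ q) (sym suc-n₋) (ℕₚ.<⇒≤ n<q)
    at : ∀ {f : ℤ → ℤ → ℤ} {r M} → f (+ suc n₋) (bin (n₋ ℕ.+ d) (suc n₋)) ≈ r [ M ] → f N (bin x₋ n) ≈ r [ M ]
    at {f} {r} {M} = subst₂ (λ a k → f (+ k) (bin a k) ≈ r [ M ]) (sym x₋-n₋) suc-n₋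
    squares : N * N * (bin x₋ n * bin x₋ n) ≈ D * D [ P³ ]
    squares = at {λ a b → a * a * (b * b)} (bin-next² n₋ n₋<q)
    b≈0 : bin x₋ n ≈ + 0 [ P ]
    b≈0 = at {λ a b → b} (bin-next≈0 n₋ n₋<q)
    opaque
      unfolding _*_
      ring : ∀ n D b → let P = + 1 + (n + n) in b * b - P * P ≡
        + 4 * (n * n * (b * b) - D * D) + (D + D - P) * (D + D - - P) + - (P - + 2) * (P * (b * b) - + 0)
      ring = solve-∀

  -- At X = -1/2 the weight 2(2k + 1) is 2(2k - X) + 1, and `kummer-weighted` handles 2k - X. It
  -- produces the sum at X - 1 up to n, one term longer than `ξ n₋`; that term and the boundary term
  -- together leave p².
  σ₂-value : + 2 * σ₂ ≈ ξ n + (+ 2 * ξ n₋ + P * P) [ P³ ]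
  σ₂-value = ≈-trans (≈-reflexive (sym (∑-*ˡ (suc n) (+ 2) (λ k → weighted₂ k * ratio₂ ^ k)))) (≈-trans (∑-≈ (suc n) λ k k≤n → pointwise k (ℕₚ.≤-trans (ℕₚ.≤-pred k≤n) (ℕₚ.<⇒≤ n<q)))
      (≈-trans (≈-reflexive (trans (∑-+ (suc n) (λ k → + 2 * shifted k) (λ k → sgn k * (bin x₊ k * bin x₊ k))) (cong (_+ ξ n) (∑-*ˡ (suc n) (+ 2) shifted))))
        (lincomb₄ (+ 2) (b * b - + 2 * T′) (+ 2) (+ 1) (≈-reflexive weighted) half-x₊ (≈-reflexive T-step) bin-x₋-n
          (ring₀ (∑ (suc n) shifted) (ξ n) (ξ n₋) P (+ x₊) T′ b))))
    where
    b T′ : ℤ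
    b = bin x₋ n
    T′ = kummer n x₋
    shifted : ℕ → ℤ
    shifted k = sgn k * (+ 2 * + k - + x₊) * (bin x₊ k * bin x₊ k)
    weighted : ∑ (suc n) shifted ≡ - + 2 * + x₊ * T′ + + x₊ * (b * b)
    weighted = trans (subst (λ a → ∑ (suc n) (λ k → sgn k * (+ 2 * + k - + a) * (bin a k * bin a k)) ≡ - + 2 * + a * T′ + + a * (sgn n * (b * b))) suc-x₋ (kummer-weighted n x₋))
      (cong (λ s → - + 2 * + x₊ * T′ + + x₊ * s) (trans (cong (_* (b * b)) sgn-n) (*-identityˡ (b * b))))
    T-step : T′ ≡ ξ n₋ + b * b
    T-step = trans (cong (λ k → kummer k x₋) (sym suc-n₋)) (cong₂ _+_ (cong (kummer n₋) x₋-n₋)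
      (trans (cong (λ k → sgn k * (bin x₋ k * bin x₋ k)) suc-n₋) (trans (cong (_* (b * b)) sgn-n) (*-identityˡ (b * b)))))
    opaque
      unfolding _*_
      ring₀ : ∀ S x x′ P X T b → + 2 * S + x - (x + (+ 2 * x′ + P * P)) ≡
        + 2 * (S - (- + 2 * X * T + X * (b * b))) + (b * b - + 2 * T) * (+ 2 * X - - + 1) + + 2 * (T - (x′ + b * b)) + + 1 * (b * b - P * P)
      ring₀ = solve-∀
    powers : ∀ k → ratio₂ ^ k * ((- + 4) ^ k * (- + 4) ^ k) ≈ sgn k [ P³ ]
    powers k = ≈-trans (*-congˡ (ratio₂ ^ k) (≈-reflexive (sym (^-distrib-* (- + 4) (- + 4) k)))) (≈-trans (scaled-power k (lincomb₁ (- (+ 2 * half₂ + + 1) * (+ 4 * half₂ * half₂ + + 1)) half-2 (ring half₂)))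
      (≈-reflexive (trans (neg^ (+ 1) k) (trans (cong (sgn k *_) (one^ k)) (*-identityʳ (sgn k))))))
      where
      opaque
        unfolding _*_
        ring : ∀ h → - (h * h * (h * h)) * (- + 4 * - + 4) - - + 1 ≡ - (+ 2 * h + + 1) * (+ 4 * h * h + + 1) * (h * + 2 - + 1)
        ring = solve-∀
    pointwise : ∀ k → k ≤ q → + 2 * (weighted₂ k * ratio₂ ^ k) ≈ + 2 * shifted k + sgn k * (bin x₊ k * bin x₊ k) [ P³ ]
    pointwise k k≤q = lincomb₃ (+ 2 * (+ 1 + (+ k + + k)) * ratio₂ ^ k * (central k + (- + 4) ^ k * bin x₊ k)) (+ 2 * (+ 1 + (+ k + + k)) * (bin x₊ k * bin x₊ k)) (sgn k * (bin x₊ k * bin x₊ k))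
      (central-x₊ k k≤q) (powers k) half-x₊ (ring₁ (+ x₊) (+ k) (central k) (ratio₂ ^ k) ((- + 4) ^ k) (bin x₊ k) (sgn k))
      where
      opaque
        unfolding _*_
        ring₁ : ∀ X k c r f b s → + 2 * ((+ 1 + (k + k)) * (c * c) * r) - (+ 2 * (s * (+ 2 * k - X) * (b * b)) + s * (b * b)) ≡
          + 2 * (+ 1 + (k + k)) * r * (c + f * b) * (c - f * b) + + 2 * (+ 1 + (k + k)) * (b * b) * (r * (f * f) - s) + s * (b * b) * (+ 2 * X - - + 1)
        ring₁ = solve-∀

  -- Multiplied by the unit 2`w₂`α, the left side becomes 2`w₂`(α² + p) by `T-part` and `U-part₁`,
  -- and `α-root` rewrites this as 2`w₂`α times minus the Jacobsthal sum.
  integer-congruence : ∀ x y → P ≡ x * x + y * y → x ≈ + 1 [ + 4 ] → y ≈ + 0 [ + 2 ] → σ₁ + σ₂ ≈ + 2 * χ (+ 2) * x [ P³ ]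
  integer-congruence x y P≡ hx hy = ≈-trans (cancel (α * (+ 2 * w₂)) (unit-* unit-α (unit-* unit-2 unit-w₂))
      (≈-trans (lincomb₂ α (α * w₂) σ₁-value σ₂-value (ring₁ α w₂ σ₁ σ₂ (v n) v-pred (ξ n) (+ 2 * ξ n₋ + P * P)))
        (lincomb₃ α (+ 1) (- + 2 * w₂) (T-part v₀) U-part₁ α-root (ring₂ α w₂ (v n) v-pred (ξ n) (+ 2 * ξ n₋ + P * P) P (- jacobsthal (+ 1))))))
    (≈-reflexive (jacobsthal-value x y P≡ hx hy))
    where
    opaque
      unfolding _*_
      ring₁ : ∀ a w s t v v′ x x′ → a * (+ 2 * w) * (s + t) - (a * v + a * v′ + a * w * x + a * w * x′) ≡
        a * (+ 2 * (w * s) - (v + v′)) + a * w * (+ 2 * t - (x + x′))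
      ring₁ = solve-∀
      ring₂ : ∀ a w v v′ x x′ P j → a * v + a * v′ + a * w * x + a * w * x′ - a * (+ 2 * w) * j ≡
        a * (v + w * x - + 2 * (w * a)) + + 1 * (a * (v′ + w * x′) - + 2 * (w * P)) + - + 2 * w * (a * j - (a * a + P))
      ring₂ = solve-∀

-- Integers and fractions inside ℚ

ℤ→ℚ-/ : ∀ t s → ℤ→ℚ (+ suc s) ℚ.* (t ℚ./ suc s) ≡ ℤ→ℚ t
ℤ→ℚ-/ t s = ℚₚ.toℚᵘ-injective (ℚᵘₚ.≃-trans (ℚₚ.toℚᵘ-homo-* (ℤ→ℚ (+ suc s)) (t ℚ./ suc s))
  (ℚᵘₚ.≃-trans (ℚᵘₚ.*-cong (ℚₚ.toℚᵘ-fromℚᵘ (mkℚᵘ (+ suc s) 0)) (ℚₚ.toℚᵘ-fromℚᵘ (mkℚᵘ t s)))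
    (ℚᵘₚ.≃-trans (*≡* cross) (ℚᵘₚ.≃-sym (ℚₚ.toℚᵘ-fromℚᵘ (mkℚᵘ t 0))))))
  where
  cross : + suc s ℤ.* t ℤ.* + 1 ≡ t ℤ.* + suc (s ℕ.+ 0)
  cross = trans (ℤₚ.*-identityʳ (+ suc s ℤ.* t)) (trans (ℤₚ.*-comm (+ suc s) t) (cong (λ k → t ℤ.* + suc k) (sym (ℕₚ.+-identityʳ s))))

ℤ→ℚ-+ : ∀ a b → ℤ→ℚ (a + b) ≡ ℤ→ℚ a ℚ.+ ℤ→ℚ b
ℤ→ℚ-+ a b = ℚₚ.toℚᵘ-injective (ℚᵘₚ.≃-trans (ℚₚ.toℚᵘ-fromℚᵘ (mkℚᵘ (a + b) 0)) (ℚᵘₚ.≃-sym (ℚᵘₚ.≃-trans (ℚₚ.toℚᵘ-homo-+ (ℤ→ℚ a) (ℤ→ℚ b))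
  (ℚᵘₚ.≃-trans (ℚᵘₚ.+-cong (ℚₚ.toℚᵘ-fromℚᵘ (mkℚᵘ a 0)) (ℚₚ.toℚᵘ-fromℚᵘ (mkℚᵘ b 0)))
    (*≡* (cong (ℤ._* + 1) (cong₂ _+_ (ℤₚ.*-identityʳ a) (ℤₚ.*-identityʳ b))))))))

ℤ→ℚ-* : ∀ a b → ℤ→ℚ (a * b) ≡ ℤ→ℚ a ℚ.* ℤ→ℚ b
ℤ→ℚ-* a b = trans (cong ℤ→ℚ (*≡ℤ* a b)) (ℚₚ.toℚᵘ-injective (ℚᵘₚ.≃-trans (ℚₚ.toℚᵘ-fromℚᵘ (mkℚᵘ (a ℤ.* b) 0)) (ℚᵘₚ.≃-sym (ℚᵘₚ.≃-trans (ℚₚ.toℚᵘ-homo-* (ℤ→ℚ a) (ℤ→ℚ b))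
  (ℚᵘₚ.*-cong (ℚₚ.toℚᵘ-fromℚᵘ (mkℚᵘ a 0)) (ℚₚ.toℚᵘ-fromℚᵘ (mkℚᵘ b 0)))))))

-- Horner's scheme for ∑ N k · aᴷ⁻ᵏ
horner : ℤ → (ℕ → ℤ) → ℕ → ℤ
horner a f zero    = f 0
horner a f (suc K) = a * horner a f K + f (suc K)

-- The bridge between ℚ and residues: the same integer is the rational sum with denominators
-- cleared, by `sumTo-horner`, and the sum with a modular inverse `e` in place of 1/a.
horner-≈ : ∀ {M} a e f K → a * e ≈ + 1 [ M ] → horner a f K ≈ a ^ K * ∑ (suc K) (λ k → f k * e ^ k) [ M ]
horner-≈ a e f zero    h = ≈-reflexive (ring (f 0))
  where
  opaque
    unfolding _*_
    ring : ∀ x → x ≡ + 1 * (+ 0 + x * + 1)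
    ring = solve-∀
horner-≈ a e f (suc K) h = lincomb₂ a (- f (suc K)) (horner-≈ a e f K h)
  (≈-trans (≈-reflexive (sym (^-distrib-* a e (suc K)))) (≈-trans (^-cong (suc K) h) (≈-reflexive (one^ (suc K)))))
  (ring a (a ^ K) (horner a f K) (f (suc K)) (e * e ^ K) (∑ (suc K) (λ k → f k * e ^ k)))
  where
  opaque
    unfolding _*_
    ring : ∀ a t H x y S → a * H + x - a * t * (S + x * y) ≡ a * (H - t * S) + - x * (a * t * y - + 1)
    ring = solve-∀

pow-inverse : ∀ a r K → ℤ→ℚ a ℚ.* r ≡ ℚ.1ℚ → ℤ→ℚ (a ^ K) ℚ.* pow r K ≡ ℚ.1ℚ
pow-inverse a r zero    h = refl
pow-inverse a r (suc K) h = begin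
  ℤ→ℚ (a * a ^ K) ℚ.* (r ℚ.* pow r K)              ≡⟨ cong (ℚ._* (r ℚ.* pow r K)) (ℤ→ℚ-* a (a ^ K)) ⟩
  ℤ→ℚ a ℚ.* ℤ→ℚ (a ^ K) ℚ.* (r ℚ.* pow r K)        ≡⟨ interchange (ℤ→ℚ a) (ℤ→ℚ (a ^ K)) r (pow r K) ⟩
  ℤ→ℚ a ℚ.* r ℚ.* (ℤ→ℚ (a ^ K) ℚ.* pow r K)        ≡⟨ cong₂ ℚ._*_ h (pow-inverse a r K h) ⟩
  ℚ.1ℚ                                             ∎
  where
  open ≡-Reasoning
  open ℚSolver
  interchange : ∀ a b c d → a ℚ.* b ℚ.* (c ℚ.* d) ≡ a ℚ.* c ℚ.* (b ℚ.* d)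
  interchange = solve 4 (λ a b c d → (a :* b :* (c :* d)) := (a :* c :* (b :* d))) refl

sumTo-horner : ∀ a r f K → ℤ→ℚ a ℚ.* r ≡ ℚ.1ℚ → ℤ→ℚ (a ^ K) ℚ.* sumTo K (λ k → ℤ→ℚ (f k) ℚ.* pow r k) ≡ ℤ→ℚ (horner a f K)
sumTo-horner a r f zero    h = trans (ℚₚ.*-identityˡ (ℤ→ℚ (f 0) ℚ.* ℚ.1ℚ)) (ℚₚ.*-identityʳ (ℤ→ℚ (f 0)))
sumTo-horner a r f (suc K) h = begin
  ℤ→ℚ (a ^ suc K) ℚ.* (S ℚ.+ x ℚ.* pow r (suc K))                       ≡⟨ distribute (ℤ→ℚ (a ^ suc K)) S x (pow r (suc K)) ⟩
  ℤ→ℚ (a ^ suc K) ℚ.* S ℚ.+ x ℚ.* (ℤ→ℚ (a ^ suc K) ℚ.* pow r (suc K))   ≡⟨ cong₂ (λ u v → u ℚ.+ x ℚ.* v) head (pow-inverse a r (suc K) h) ⟩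
  ℤ→ℚ (a * horner a f K) ℚ.+ x ℚ.* ℚ.1ℚ                                 ≡⟨ cong (ℤ→ℚ (a * horner a f K) ℚ.+_) (ℚₚ.*-identityʳ x) ⟩
  ℤ→ℚ (a * horner a f K) ℚ.+ x                                          ≡⟨ ℤ→ℚ-+ (a * horner a f K) (f (suc K)) ⟨
  ℤ→ℚ (horner a f (suc K))                                              ∎
  where
  open ≡-Reasoning
  open ℚSolver
  S x : ℚ
  S = sumTo K (λ k → ℤ→ℚ (f k) ℚ.* pow r k)
  x = ℤ→ℚ (f (suc K))
  distribute : ∀ a s x p → a ℚ.* (s ℚ.+ x ℚ.* p) ≡ a ℚ.* s ℚ.+ x ℚ.* (a ℚ.* p)
  distribute = solve 4 (λ a s x p → (a :* (s :+ x :* p)) := (a :* s :+ x :* (a :* p))) refl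
  head : ℤ→ℚ (a ^ suc K) ℚ.* S ≡ ℤ→ℚ (a * horner a f K)
  head = trans (cong (ℚ._* S) (ℤ→ℚ-* a (a ^ K))) (trans (ℚₚ.*-assoc (ℤ→ℚ a) (ℤ→ℚ (a ^ K)) S)
    (trans (cong (ℤ→ℚ a ℚ.*_) (sumTo-horner a r f K h)) (sym (ℤ→ℚ-* a (horner a f K)))))

sumTo-cong : ∀ K {f g : ℕ → ℚ} → (∀ k → f k ≡ g k) → sumTo K f ≡ sumTo K g
sumTo-cong zero    h = h 0
sumTo-cong (suc K) h = cong₂ ℚ._+_ (sumTo-cong K h) (h (suc K))

-- Clearing a denominator prime to p turns the claim into a congruence of integers. The cofactor is
-- its quotient t over that denominator, and reducing a fraction only removes divisors from the
-- denominator.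
congModQ : ∀ {p} s M a (A B : ℤ) → ¬ p ℕD.∣ suc s → ℤ→ℚ (+ suc s) ℚ.* a ≡ ℤ→ℚ A → A ≈ + suc s * B [ + M ] → CongModQ p M a (ℤ→ℚ B)
congModQ {p} s M a A B p∤s hA (by t e) = c , integral , (begin
  a ℚ.- ℤ→ℚ B                                        ≡⟨ cancelled (a ℚ.- ℤ→ℚ B) ⟨
  r ℚ.* (S ℚ.* (a ℚ.- ℤ→ℚ B))                        ≡⟨ cong (r ℚ.*_) scaled ⟩
  r ℚ.* (S ℚ.* (ℕ→ℚ M ℚ.* c))                        ≡⟨ cancelled (ℕ→ℚ M ℚ.* c) ⟩
  ℕ→ℚ M ℚ.* c                                        ∎)
  where
  open ≡-Reasoning
  open ℚSolver
  c r S : ℚ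
  c = t ℚ./ suc s
  r = + 1 ℚ./ suc s
  S = ℤ→ℚ (+ suc s)
  cancelled : ∀ x → r ℚ.* (S ℚ.* x) ≡ x
  cancelled x = trans (sym (ℚₚ.*-assoc r S x)) (trans (cong (ℚ._* x) (trans (ℚₚ.*-comm r S) (ℤ→ℚ-/ (+ 1) s))) (ℚₚ.*-identityˡ x))
  scaled : S ℚ.* (a ℚ.- ℤ→ℚ B) ≡ S ℚ.* (ℕ→ℚ M ℚ.* c)
  scaled = begin
    S ℚ.* (a ℚ.- ℤ→ℚ B)                                ≡⟨ distribute S a (ℤ→ℚ B) ⟩
    S ℚ.* a ℚ.- S ℚ.* ℤ→ℚ B                            ≡⟨ cong₂ ℚ._-_ hA (sym (ℤ→ℚ-* (+ suc s) B)) ⟩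
    ℤ→ℚ A ℚ.- ℤ→ℚ (+ suc s * B)                        ≡⟨ cong (λ z → ℤ→ℚ z ℚ.- ℤ→ℚ (+ suc s * B)) difference ⟩
    ℤ→ℚ (t * + M + + suc s * B) ℚ.- ℤ→ℚ (+ suc s * B)  ≡⟨ cong (ℚ._- ℤ→ℚ (+ suc s * B)) (ℤ→ℚ-+ (t * + M) (+ suc s * B)) ⟩
    ℤ→ℚ (t * + M) ℚ.+ ℤ→ℚ (+ suc s * B) ℚ.- ℤ→ℚ (+ suc s * B)  ≡⟨ add-sub (ℤ→ℚ (t * + M)) (ℤ→ℚ (+ suc s * B)) ⟩
    ℤ→ℚ (t * + M)                                      ≡⟨ ℤ→ℚ-* t (+ M) ⟩
    ℤ→ℚ t ℚ.* ℕ→ℚ M                                    ≡⟨ cong (ℚ._* ℕ→ℚ M) (ℤ→ℚ-/ t s) ⟨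
    S ℚ.* c ℚ.* ℕ→ℚ M                                  ≡⟨ rotate S c (ℕ→ℚ M) ⟩
    S ℚ.* (ℕ→ℚ M ℚ.* c)                                ∎
    where
    distribute : ∀ s a b → s ℚ.* (a ℚ.- b) ≡ s ℚ.* a ℚ.- s ℚ.* b
    distribute = solve 3 (λ s a b → (s :* (a :- b)) := (s :* a :- s :* b)) refl
    add-sub : ∀ a b → a ℚ.+ b ℚ.- b ≡ a
    add-sub = solve 2 (λ a b → (a :+ b :- b) := a) refl
    rotate : ∀ s c m → s ℚ.* c ℚ.* m ≡ s ℚ.* (m ℚ.* c)
    rotate = solve 3 (λ s c m → (s :* c :* m) := (s :* (m :* c))) refl
    difference : A ≡ t * + M + + suc s * B
    difference = linear₁ (+ 1) e (ring A (+ suc s * B) (t * + M))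
      where
      opaque
        unfolding _*_
        ring : ∀ a b c → a - (c + b) ≡ + 1 * (a - b - c)
        ring = solve-∀
  integral : PIntegral p c
  integral h = p∤s (ℕD.∣-trans h (ℕD.divides ∣ gcd t (+ suc s) ∣ (trans (sym (cong ∣_∣ (ℚₚ.↧-/ t (suc s))))
    (trans (ℤₚ.abs-* (ℚ.↧ c) (gcd t (+ suc s))) (ℕₚ.*-comm (ℚ.↧ₙ c) ∣ gcd t (+ suc s) ∣)))))

-- Back to the rational statement

bin-C : ∀ N k → bin N k ≡ + (N ℕC.C k)
bin-C zero    zero    = refl
bin-C zero    (suc k) = refl
bin-C (suc N) zero    = refl
bin-C (suc N) (suc k) = trans (cong₂ _+_ (bin-C N k) (bin-C N (suc k))) (cong +_ (ℕC.nCk+nC[k+1]≡[n+1]C[k+1] N k))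

-- An eliminator for the nested case distinction of `legendre`, so that its branches are opened
-- once, for an arbitrary value c.
legendre-cases : ∀ a q (c : ℤ) → ¬ suc q ℕD.∣ a → ((i : Fin (suc q)) → (toℕ i ℕ.* toℕ i) ℕ.% suc q ≡ a ℕ.% suc q → + 1 ≡ c) →
  ((∀ (i : Fin (suc q)) → (toℕ i ℕ.* toℕ i) ℕ.% suc q ≢ a ℕ.% suc q) → - + 1 ≡ c) → legendre a (suc q) ≡ c
legendre-cases a q c p∤a residue nonresidue with ℕD._∣?_ (suc q) a
... | yes p∣a = contradiction p∣a p∤a
... | no _ with any? (λ (i : Fin (suc q)) → (toℕ i ℕ.* toℕ i) ℕ.% suc q ℕ.≟ a ℕ.% suc q)
...   | yes (i , e) = residue i e
...   | no none     = nonresidue λ i e → none (i , e)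

module RationalCongruence (m : ℕ) (p-prime : Prime (suc ((m ℕ.+ m) ℕ.+ (m ℕ.+ m)))) (2<p : 2 < suc ((m ℕ.+ m) ℕ.+ (m ℕ.+ m))) where
  open IntegerCongruence m p-prime 2<p public

  %-≈ : ∀ a → + a ≈ + (a ℕ.% p) [ P ]
  %-≈ a = by (+ (a ℕ./ p)) (linear₁ (+ 1) (trans (cong +_ (ℕDM.m≡m%n+[m/n]*n a p)) (cong (λ z → + (a ℕ.% p) + z) (pos-* (a ℕ./ p) p)))
    (ring (+ a) (+ (a ℕ.% p)) (+ (a ℕ./ p) * P)))
    where
    opaque
      unfolding _*_
      ring : ∀ a r s → a - r - s ≡ + 1 * (a - (r + s))
      ring = solve-∀

  legendre-χ : legendre 2 p ≡ χ (+ 2)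
  legendre-χ = legendre-cases 2 q (χ (+ 2)) (λ p∣2 → ℕₚ.<⇒≱ 2<p (ℕD.∣⇒≤ p∣2)) residue nonresidue′
    where
    residue : (i : Fin p) → (toℕ i ℕ.* toℕ i) ℕ.% p ≡ 2 ℕ.% p → + 1 ≡ χ (+ 2)
    residue i e = sym (trans (χ-cong (≈-sym square)) (trans (χ-* a a) (χ-unit² unit-a)))
      where
      a : ℤ
      a = + toℕ i
      square : a * a ≈ + 2 [ P ]
      square = ≈-trans (≈-reflexive (sym (pos-* (toℕ i) (toℕ i)))) (≈-trans (%-≈ (toℕ i ℕ.* toℕ i)) (≈-trans (≈-reflexive (cong +_ e)) (≈-sym (%-≈ 2))))
      unit-a : Unit a
      unit-a h′ = unit-2 (≈-trans (≈-sym square) (≈-trans (*-congʳ a h′) (≈-reflexive (*-zeroˡ a))))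
    nonresidue′ : (∀ (i : Fin p) → (toℕ i ℕ.* toℕ i) ℕ.% p ≢ 2 ℕ.% p) → - + 1 ≡ χ (+ 2)
    nonresidue′ none = [ (λ e → ⊥-elim (impossible (sqrt e))) , sym ]′ (χ-unit unit-2)
      where
      i² : ℤ → ℕ
      i² r = toℕ (fromℕ< (res<p r)) ℕ.* toℕ (fromℕ< (res<p r))
      impossible : ¬ (∃ λ r → r * r ≈ + 2 [ P ])
      impossible (r , h′) = none (fromℕ< (res<p r)) (≈⇒≡ (ℕDM.m%n<n (i² r) p) (ℕDM.m%n<n 2 p)
        (≈-trans (≈-sym (%-≈ (i² r))) (≈-trans (≈-reflexive (trans (cong (λ j → + (j ℕ.* j)) (toℕ-fromℕ< (res<p r))) (pos-* (res r) (res r))))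
          (≈-trans (*-cong (≈-sym (≈-res r)) (≈-sym (≈-res r))) (≈-trans h′ (%-≈ 2))))))

  central-C : ∀ k → + ((2 ℕ.* k) ℕC.C k) ≡ central k
  central-C k = trans (cong (λ j → + ((k ℕ.+ j) ℕC.C k)) (ℕₚ.+-identityʳ k)) (sym (bin-C (k ℕ.+ k) k))

  central²-C : ∀ c k → + (c ℕ.* (((2 ℕ.* k) ℕC.C k) ℕ.* ((2 ℕ.* k) ℕC.C k))) ≡ + c * (central k * central k)
  central²-C c k = trans (pos-* c _) (cong (+ c *_) (trans (pos-* _ _) (cong₂ _*_ (central-C k) (central-C k))))

  term1-value : ∀ k → term1 k ≡ ℤ→ℚ (weighted₁ k) ℚ.* pow ((+ 1) ℚ./ 8) k
  term1-value k = cong (λ a → ℤ→ℚ a ℚ.* pow ((+ 1) ℚ./ 8) k) (central²-C (suc k) k)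

  term2-value : ∀ k → term2 k ≡ ℤ→ℚ (weighted₂ k) ℚ.* pow (-[1+ 0 ] ℚ./ 16) k
  term2-value k = cong (λ a → ℤ→ℚ a ℚ.* pow (-[1+ 0 ] ℚ./ 16) k) (trans (central²-C (suc (2 ℕ.* k)) k)
    (cong (λ j → + suc (k ℕ.+ j) * (central k * central k)) (ℕₚ.+-identityʳ k)))

  -- A common denominator of the two sums. Since n is even, (-16)^n is the natural number 16^n.
  S : ℕ
  S = 8 ℕ.^ q ℕ.* 16 ℕ.^ n

  pos-^ : ∀ a k → + (a ℕ.^ k) ≡ (+ a) ^ k
  pos-^ a zero    = refl
  pos-^ a (suc k) = trans (pos-* a (a ℕ.^ k)) (cong (+ a *_) (pos-^ a k))

  S-value : + S ≡ (+ 8) ^ q * (- + 16) ^ n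
  S-value = trans (pos-* (8 ℕ.^ q) (16 ℕ.^ n)) (cong₂ _*_ (pos-^ 8 q) (trans (pos-^ 16 n) (sym (trans (neg^ (+ 16) n) (trans (cong (_* (+ 16) ^ n) sgn-n) (*-identityˡ ((+ 16) ^ n)))))))

  suc-pred-S : suc (ℕ.pred S) ≡ S
  suc-pred-S = ℕₚ.suc-pred S {{ℕₚ.m*n≢0 (8 ℕ.^ q) (16 ℕ.^ n) {{ℕₚ.m^n≢0 8 q}} {{ℕₚ.m^n≢0 16 n}}}}

  unit-S : Unit (+ S)
  unit-S = unit-≈ (≈-reflexive S-value) (unit-* (unit-^ q unit-8) (unit-^ n (unit-neg unit-16)))
    where
    unit-8 : Unit (+ 8)
    unit-8 = unit-≈ (≈-reflexive (sym (*≡ℤ* (+ 2) (+ 4)))) (unit-* unit-2 unit-4)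

  A₁ A₂ : ℤ
  A₁ = horner (+ 8) weighted₁ q
  A₂ = horner (- + 16) weighted₂ n

  p^3 : + (p ℕ.^ 3) ≡ P³
  p^3 = trans (pos-^ p 3) (ring P)
    where
    opaque
      unfolding _*_
      ring : ∀ x → x * (x * (x * + 1)) ≡ x * (x * x)
      ring = solve-∀

  rational-sum : ℤ→ℚ (+ S) ℚ.* (sumTo q term1 ℚ.+ sumTo n term2) ≡ ℤ→ℚ ((- + 16) ^ n * A₁ + (+ 8) ^ q * A₂)
  rational-sum = begin
    ℤ→ℚ (+ S) ℚ.* (T₁ ℚ.+ T₂)                            ≡⟨ cong (ℚ._* (T₁ ℚ.+ T₂)) (trans (cong ℤ→ℚ S-value) (ℤ→ℚ-* s₁ s₂)) ⟩
    ℤ→ℚ s₁ ℚ.* ℤ→ℚ s₂ ℚ.* (T₁ ℚ.+ T₂)                    ≡⟨ distribute (ℤ→ℚ s₁) (ℤ→ℚ s₂) T₁ T₂ ⟩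
    ℤ→ℚ s₂ ℚ.* (ℤ→ℚ s₁ ℚ.* T₁) ℚ.+ ℤ→ℚ s₁ ℚ.* (ℤ→ℚ s₂ ℚ.* T₂)
      ≡⟨ cong₂ (λ a b → ℤ→ℚ s₂ ℚ.* a ℚ.+ ℤ→ℚ s₁ ℚ.* b)
           (trans (cong (ℤ→ℚ s₁ ℚ.*_) (sumTo-cong q term1-value)) (sumTo-horner (+ 8) ((+ 1) ℚ./ 8) weighted₁ q refl))
           (trans (cong (ℤ→ℚ s₂ ℚ.*_) (sumTo-cong n term2-value)) (sumTo-horner (- + 16) (-[1+ 0 ] ℚ./ 16) weighted₂ n refl)) ⟩
    ℤ→ℚ s₂ ℚ.* ℤ→ℚ A₁ ℚ.+ ℤ→ℚ s₁ ℚ.* ℤ→ℚ A₂              ≡⟨ cong₂ ℚ._+_ (ℤ→ℚ-* s₂ A₁) (ℤ→ℚ-* s₁ A₂) ⟨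
    ℤ→ℚ (s₂ * A₁) ℚ.+ ℤ→ℚ (s₁ * A₂)                      ≡⟨ ℤ→ℚ-+ (s₂ * A₁) (s₁ * A₂) ⟨
    ℤ→ℚ (s₂ * A₁ + s₁ * A₂)                              ∎
    where
    open ≡-Reasoning
    open ℚSolver
    T₁ T₂ : ℚ
    T₁ = sumTo q term1
    T₂ = sumTo n term2
    s₁ s₂ : ℤ
    s₁ = (+ 8) ^ q
    s₂ = (- + 16) ^ n
    distribute : ∀ a b t u → a ℚ.* b ℚ.* (t ℚ.+ u) ≡ b ℚ.* (a ℚ.* t) ℚ.+ a ℚ.* (b ℚ.* u)
    distribute = solve 4 (λ a b t u → (a :* b :* (t :+ u)) := (b :* (a :* t) :+ a :* (b :* u))) refl

  congruence : ∀ x y → P ≡ x * x + y * y → x ≈ + 1 [ + 4 ] → y ≈ + 0 [ + 2 ] →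
    CongModQ p (p ℕ.^ 3) (sumTo q term1 ℚ.+ sumTo (q ℕ./ 2) term2) (ℤ→ℚ (+ 2 ℤ.* legendre 2 p ℤ.* x))
  congruence x y P≡ hx hy = subst₂ (λ k b → CongModQ p (p ℕ.^ 3) (sumTo q term1 ℚ.+ sumTo k term2) (ℤ→ℚ b)) (sym q/2) value
    (congModQ (ℕ.pred S) (p ℕ.^ 3) (sumTo q term1 ℚ.+ sumTo n term2) ((- + 16) ^ n * A₁ + (+ 8) ^ q * A₂) (+ 2 * χ (+ 2) * x)
      (subst (λ k → ¬ p ℕD.∣ k) (sym suc-pred-S) (λ p∣S → unit-S (∣⇒≈0 p∣S)))
      (subst (λ k → ℤ→ℚ (+ k) ℚ.* (sumTo q term1 ℚ.+ sumTo n term2) ≡ ℤ→ℚ ((- + 16) ^ n * A₁ + (+ 8) ^ q * A₂)) (sym suc-pred-S) rational-sum)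
      (subst₂ (λ k M → (- + 16) ^ n * A₁ + (+ 8) ^ q * A₂ ≈ + k * (+ 2 * χ (+ 2) * x) [ M ]) (sym suc-pred-S) (sym p^3) numerators))
    where
    q/2 : q ℕ./ 2 ≡ n
    q/2 = trans (cong (ℕ._/ 2) (trans (cong (n ℕ.+_) (sym (ℕₚ.+-identityʳ n))) (ℕₚ.*-comm 2 n))) (ℕDM.m*n/n≡m n 2)
    value : + 2 * χ (+ 2) * x ≡ + 2 ℤ.* legendre 2 p ℤ.* x
    value = trans (*≡ℤ* (+ 2 * χ (+ 2)) x) (cong (ℤ._* x) (trans (*≡ℤ* (+ 2) (χ (+ 2))) (cong (+ 2 ℤ.*_) (sym legendre-χ))))
    numerators : (- + 16) ^ n * A₁ + (+ 8) ^ q * A₂ ≈ + S * (+ 2 * χ (+ 2) * x) [ P³ ]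
    numerators = lincomb₄ ((- + 16) ^ n) ((+ 8) ^ q) ((+ 8) ^ q * (- + 16) ^ n) (- (+ 2 * χ (+ 2) * x))
      (horner-≈ (+ 8) ratio₁ weighted₁ q (lincomb₁ (+ 4 * half₂ * half₂ + + 2 * half₂ + + 1) half-2 (ring₁ half₂)))
      (horner-≈ (- + 16) ratio₂ weighted₂ n (lincomb₁ ((+ 2 * half₂ + + 1) * (+ 4 * half₂ * half₂ + + 1)) half-2 (ring₂ half₂)))
      (integer-congruence x y P≡ hx hy) (≈-reflexive S-value)
      (ring ((+ 8) ^ q) ((- + 16) ^ n) A₁ A₂ σ₁ σ₂ (+ S) (+ 2 * χ (+ 2) * x))
      where
      opaque
        unfolding _*_
        ring₁ : ∀ h → + 8 * (h * h * h) - + 1 ≡ (+ 4 * h * h + + 2 * h + + 1) * (h * + 2 - + 1)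
        ring₁ = solve-∀
        ring₂ : ∀ h → - + 16 * - (h * h * (h * h)) - + 1 ≡ (+ 2 * h + + 1) * (+ 4 * h * h + + 1) * (h * + 2 - + 1)
        ring₂ = solve-∀
        ring : ∀ s t a b σ τ S c → t * a + s * b - S * c ≡ t * (a - s * σ) + s * (b - t * τ) + s * t * (σ + τ - c) + - c * (S - s * t)
        ring = solve-∀

theorem1p2 : (p : ℕ) → Prime p → ¬ (2 ℕD.∣ p) → (x y : ℤ) →
    + p ≡ x ℤ.* x ℤ.+ y ℤ.* y → (+ 4) ℤD.∣ (x ℤ.- + 1) → (+ 2) ℤD.∣ y →
    CongModQ p (p ℕ.^ 3)
      (sumTo (p ∸ 1) term1 ℚ.+ sumTo ((p ∸ 1) / 2) term2)
      (ℤ→ℚ ((+ 2) ℤ.* legendre 2 p ℤ.* x))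
theorem1p2 p p-prime _ x y p≡ 4∣x-1 2∣y = from-quotients (ℤS.∣ᵤ⇒∣ 4∣x-1) (ℤS.∣ᵤ⇒∣ 2∣y)
  where
  P≡ : + p ≡ x * x + y * y
  P≡ = trans p≡ (cong₂ _+_ (sym (*≡ℤ* x x)) (sym (*≡ℤ* y y)))
  Goal : ℕ → Set
  Goal p = CongModQ p (p ℕ.^ 3) (sumTo (p ∸ 1) term1 ℚ.+ sumTo ((p ∸ 1) / 2) term2) (ℤ→ℚ ((+ 2) ℤ.* legendre 2 p ℤ.* x))
  from-quotients : + 4 ℤS.∣ (x - + 1) → + 2 ℤS.∣ y → Goal p
  -- x = 1 + 4k and y = 2l give p = 1 + 4(4k² + 2k + l²), so that p has the form 4m + 1.
  from-quotients (divides k ek) (divides l el) = by-quotient (k * k * + 4 + + 2 * k + l * l)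
    (linear₃ (+ 1) (x + + 1 + k * + 4) (y + l * + 2) P≡ (trans ek (sym (*≡ℤ* k (+ 4)))) (trans el (sym (*≡ℤ* l (+ 2)))) (ring (+ p) x y k l))
    where
    hx : x ≈ + 1 [ + 4 ]
    hx = by k (trans ek (sym (*≡ℤ* k (+ 4))))
    hy : y ≈ + 0 [ + 2 ]
    hy = by l (trans (ℤₚ.+-identityʳ y) (trans el (sym (*≡ℤ* l (+ 2)))))
    opaque
      unfolding _*_
      ring : ∀ p x y k l → p - (+ 1 + + 4 * (k * k * + 4 + + 2 * k + l * l)) ≡
        + 1 * (p - (x * x + y * y)) + (x + + 1 + k * + 4) * (x - + 1 - k * + 4) + (y + l * + 2) * (y - l * + 2)
      ring = solve-∀
    conclude : ∀ m p → Prime p → + p ≡ x * x + y * y → p ≡ suc ((m ℕ.+ m) ℕ.+ (m ℕ.+ m)) → Goal p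
    conclude zero    p p-prime _ refl = ⊥-elim (¬prime[1] p-prime)
    conclude (suc m) p p-prime e refl = RationalCongruence.congruence (suc m) p-prime (s≤s (s≤s (subst (1 ≤_) (sym (ℕₚ.+-suc (m ℕ.+ suc m) (m ℕ.+ suc m))) (s≤s z≤n)))) x y e hx hy
    by-quotient : ∀ t → + p ≡ + 1 + + 4 * t → Goal p
    by-quotient (+ m) e = conclude m p p-prime P≡ (ℤₚ.+-injective (trans e (ring₁ (+ m))))
      where
      opaque
        unfolding _*_
        ring₁ : ∀ m → + 1 + + 4 * m ≡ + 1 + (m + m + (m + m))
        ring₁ = solve-∀
    by-quotient -[1+ j ] e = ⊥-elim (impossible (ℤₚ.+-injective (linear₁ (+ 1) e (ring₂ (+ p) (+ j)))))
      where
      impossible : suc (suc (suc (p ℕ.+ (j ℕ.+ j ℕ.+ (j ℕ.+ j))))) ≡ 0 → ⊥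
      impossible ()
      opaque
        unfolding _*_
        ring₂ : ∀ p j → + 3 + (p + (j + j + (j + j))) - + 0 ≡ + 1 * (p - (+ 1 + + 4 * - (+ 1 + j)))
        ring₂ = solve-∀
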